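{- Let $k\in\mathbb{Z}_{\ge1}$ be odd, $m\in\{1,3\}$, $b\in\{1,4\}$, $p\ge3$ a prime and $r\in\mathbb{Z}_{\ge1}$. Let $\bar p$ denote the multiplicative inverse of $p$ modulo $4$. If $p^r\equiv1\pmod4$, then \begin{multline*} \mathscr{H}_{k,m,4,b}(p^r)=\sum_{\mu=0}^{(k-1)/2}2^{ -2\mu}T(k,\mu)\left(\alpha_{k-2\mu,m,4,b}(p^r)-p^{k-2\mu+1}\alpha_{k-2\mu,m\bar p,4,b}(p^{r-2})\right)p^{r\mu}\\ -b^{ -\frac12}\left(\frac{ -1}{m}\right)\left(\frac{2}{p^r}\right)2^{ -k-1}\sum_{\mu=0}^{(k-1)/2}T(k,\mu)p^{r\mu}-\delta_{2\mid r}\frac1{12}p^{\frac{rk}2}(p-1)\left(\frac{ -1}{m}\right)\varepsilon(p^r), \end{multline*} where $\varepsilon(p^r)=\left(\frac{ -1}{p^{r/2}}\right)$ for $r$ even, and $\alpha_{\ell,m\bar p,4,b}(p^{ -1})$ is taken to be $0$ in the case $r=1$. If $p^r\equiv3\pmod4$, then $\mathscr{H}_{k,m,4,b}(p^r)=0$.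
   Context: $\delta_{\mathcal S}=1$ if the statement $\mathcal S$ is true and $0$ otherwise. $T(k,\mu)=\frac{k-2\mu+1}{k-\mu+1}\binom{k}{\mu}$. $\left(\frac{\cdot}{\cdot}\right)$ is the Jacobi symbol. Hurwitz class numbers: for a negative integer $D\equiv0,1\pmod4$, $H(|D|)=\sum_Q 1/\omega_Q$, the sum over $\mathrm{SL}_2(\mathbb{Z})$-classes of (not necessarily primitive) positive definite integral binary quadratic forms of discriminant $D$, with $\omega_Q=2$ if $Q$ is equivalent to $a(x^2+y^2)$, $\omega_Q=3$ if $Q$ is equivalent to $a(x^2+xy+y^2)$, $\omega_Q=1$ otherwise. $H(0):=-\frac1{12}$, and $H(x):=0$ for every other rational $x$. $\mathscr{H}_{k,m,M,b}(p^r):=\sum_{t\in\mathbb{Z},\,p\nmid t,\,t\equiv m\,(M)}H\left(\frac{p^r-t^2}{b}\right)t^k$. Let $q=e^{2\pi i\tau}$, $\mathcal{H}(\tau)=\sum_{n\ge0}H(n)q^n$, $(\mathcal{H}|V_b)(\tau)=\mathcal{H}(b\tau)$, and $\theta_{j,m,M}(\tau)=\sum_{n\in\mathbb{Z},\,n\equiv m\,(M)}n^jq^{n^2}$ (with $0^0=1$). Rankin–Cohen bracket, for functions $F_1,F_2$ with associated weights $\kappa_1,\kappa_2$: $[F_1,F_2]_k=\frac1{(2\pi i)^k}\sum_{i=0}^k(-1)^i\binom{\kappa_1+k-1}{k-i}\binom{\kappa_2+k-1}{i}\frac{\partial^iF_1}{\partial\tau^i}\frac{\partial^{k-i}F_2}{\partial\tau^{k-i}}$,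 with generalized binomials $\binom{\alpha}{i}=\frac{\Gamma(\alpha+1)}{i!\,\Gamma(\alpha-i+1)}$. In $[\mathcal{H}|V_b,\theta_{j,m,M}]$ the weights are $\kappa_1=\frac32$, $\kappa_2=\frac12+j$. For $\ell\ge0$, $n\ge1$: $\lambda_{\ell,m,M,b}(n)=\sum_{\varepsilon\in\{\pm1\}}\varepsilon^\ell\sum^*(t-\sqrt b\,s)^{\ell+1}$, where $\sum^*$ runs over integers $t\ge1,s\ge0$ with $t^2-bs^2=n$ and $t\equiv\varepsilon m\pmod M$, and terms with $s=0$ have weight $\frac12$. $\Lambda_{\ell,m,M,b}=\sum_{n\ge1}\lambda_{\ell,m,M,b}(n)q^n$. For $\ell\ge0$ and $j\in\{0,1\}$, $j\equiv\ell\pmod2$: $f_{\ell,m,M,b}=[\mathcal{H}|V_b,\theta_{j,m,M}]_{\lfloor\ell/2\rfloor}+b^{ -1/2}2^{ -1-\ell}\binom{\ell}{\lfloor\ell/2\rfloor}\Lambda_{\ell,m,M,b}=\sum_{n\ge0}\gamma_{\ell,m,M,b}(n)q^n$, and $\alpha_{\ell,m,M,b}(n)=\binom{\ell}{\lfloor\ell/2\rfloor}^{ -1}\gamma_{\ell,m,M,b}(n)$. -}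

module Defs where

import Algebra.Properties.CommutativeMonoid.Sum as Sum
open import Data.Bool.Base using (if_then_else_)
import Data.Fin.Base as Fin
import Data.Fin.Properties as Finₚ
open import Data.Integer.Base as ℤ using (ℤ; +_; -[1+_]; 0ℤ; 1ℤ; -1ℤ; ∣_∣; +≤+; +<+; -<+)
open import Data.Integer.Divisibility.Signed using (_∣_; _∣?_)
open import Data.Integer.DivMod using (n%ℕd<d; a≡a%ℕn+[a/ℕn]*n; _/ℕ_; _%ℕ_)
import Data.Integer.Properties as ℤₚ
open import Data.Integer.Tactic.RingSolver using (solve-∀)
open import Data.List.Base using (List; []; _∷_; filter; foldr; cartesianProduct; cartesianProductWith; upTo; map)
open import Data.List.Membership.Propositional using (_∈_; lose)
open import Data.List.Membership.Propositional.Properties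
  using (∈-upTo⁺; ∈-filter⁺; ∈-cartesianProductWith⁺; ∈-cartesianProduct⁺)
open import Data.List.Relation.Unary.All as All using (All; []; _∷_)
import Data.List.Relation.Unary.All.Properties as Allₚ
open import Data.List.Relation.Unary.AllPairs using (AllPairs; []; _∷_)
open import Data.List.Relation.Unary.Any using (Any)
open import Data.List.Relation.Unary.Unique.Propositional using (Unique)
import Data.List.Relation.Unary.Unique.Propositional.Properties as Uniqueₚ
open import Data.Nat.Base as ℕ using (ℕ; zero; suc; NonZero; z≤n; s≤s; ⌊_/2⌋; _!)
open import Data.Nat.Combinatorics using (_C_; nCk≡n!/k![n-k]!; k![n∸k]!∣n!)
import Data.Nat.Divisibility as ℕ∣
import Data.Nat.DivMod as ℕ÷
open import Data.Nat.Induction using (<-wellFounded)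
open import Data.Nat.Primality.Factorisation using (factorise; factors)
import Data.Nat.Properties as ℕₚ
open import Data.Product.Base using (∃-syntax; _×_; _,_; proj₁; proj₂)
open import Data.Rational.Base as ℚ using (ℚ; mkℚ; 0ℚ; 1ℚ; ½; _/_)
import Data.Rational.Properties as ℚₚ
open import Data.Sum.Base using (_⊎_; inj₁; inj₂)
open import Function.Base using (_∘_)
open import Induction.WellFounded using (Acc; acc)
open import Relation.Binary.Definitions using (tri<; tri≈; tri>)
open import Relation.Binary.PropositionalEquality
open import Relation.Nullary using (¬_; Dec; yes; no; does; contradiction)
open import Relation.Nullary.Decidable using (map′; ¬?; _×-dec_; _⊎-dec_)

module BinaryQuadraticForms where

  open import Data.Integer.Base using (_+_; _*_; _-_; -_; _≤_; _<_)

  record Form : Set where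
    constructor ⟨_,_,_⟩
    field
      a b c : ℤ

  _⟦_,_⟧ : Form → ℤ → ℤ → ℤ
  ⟨ a , b , c ⟩ ⟦ x , y ⟧ = a * (x * x) + b * (x * y) + c * (y * y)

  disc : Form → ℤ
  disc ⟨ a , b , c ⟩ = b * b - + 4 * (a * c)

  record PositiveDefinite (Q : Form) : Set where
    constructor mkPD
    field
      positive : ∀ x y → ¬ (x ≡ 0ℤ × y ≡ 0ℤ) → 0ℤ < Q ⟦ x , y ⟧

  infix 4 _~_
  record _~_ (Q R : Form) : Set where
    constructor sl
    field
      α β γ δ    : ℤ
      det≡1      : α * δ - β * γ ≡ 1ℤ
      transforms : ∀ x y → R ⟦ x , y ⟧ ≡ Q ⟦ α * x + β * y , γ * x + δ * y ⟧

  open PositiveDefinite public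

  record ClassRepresentatives (D : ℤ) : Set where
    field
      forms        : List Form
      posDef       : All PositiveDefinite forms
      discriminant : All (λ Q → disc Q ≡ D) forms
      inequivalent : AllPairs (λ Q R → ¬ Q ~ R) forms
      exhaustive   : ∀ Q → PositiveDefinite Q → disc Q ≡ D → Any (Q ~_) forms

  0≤sq : ∀ x → 0ℤ ≤ x * x
  0≤sq (+ n)    = subst (0ℤ ≤_) (ℤₚ.pos-* n n) (+≤+ z≤n)
  0≤sq -[1+ n ] = +≤+ z≤n

  0≤* : ∀ {i j} → 0ℤ ≤ i → 0ℤ ≤ j → 0ℤ ≤ i * j
  0≤* {+ i} {+ j} _ _ = subst (0ℤ ≤_) (ℤₚ.pos-* i j) (+≤+ z≤n)
  0≤* {+ _} { -[1+ _ ] } _ ()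
  0≤* { -[1+ _ ] } ()

  0<* : ∀ {i j} → 0ℤ < i → 0ℤ < j → 0ℤ < i * j
  0<* {+ suc i} {+ suc j} _ _ = +<+ (s≤s z≤n)
  0<* {+ 0} (+<+ ())
  0<* { -[1+ _ ] } ()
  0<* {+ suc _} {+ 0} _ (+<+ ())
  0<* {+ suc _} { -[1+ _ ] } _ ()

  0<sq : ∀ {x} → x ≢ 0ℤ → 0ℤ < x * x
  0<sq {+ 0}     x≢0 = contradiction refl x≢0
  0<sq {+ suc n} _   = +<+ (s≤s z≤n)
  0<sq { -[1+ n ] } _ = +<+ (s≤s z≤n)

  0≤+ : ∀ {i j} → 0ℤ ≤ i → 0ℤ ≤ j → 0ℤ ≤ i + j
  0≤+ = ℤₚ.+-mono-≤

  0<+ : ∀ {i j} → 0ℤ < i → 0ℤ ≤ j → 0ℤ < i + j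
  0<+ = ℤₚ.+-mono-<-≤

  0<⇒1≤ : ∀ {i} → 0ℤ < i → 1ℤ ≤ i
  0<⇒1≤ = ℤₚ.i<j⇒suc[i]≤j

  0≤-⇒≤ : ∀ {i j d} → 0ℤ ≤ d → d ≡ j - i → i ≤ j
  0≤-⇒≤ 0≤d refl = ℤₚ.0≤i-j⇒j≤i 0≤d

  0<-⇒< : ∀ {i j d} → 0ℤ < d → d ≡ j - i → i < j
  0<-⇒< {i} {j} 0<d refl = subst₂ _<_ (ℤₚ.+-identityˡ i) (lem i j) (ℤₚ.+-monoˡ-< i 0<d)
    where
    lem : ∀ i j → (j - i) + i ≡ j
    lem = solve-∀

  ≤⇒0≤ : ∀ {i j} → i ≤ j → 0ℤ ≤ j - i
  ≤⇒0≤ = ℤₚ.i≤j⇒0≤j-i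

  <⇒0< : ∀ {i j} → i < j → 0ℤ < j - i
  <⇒0< {i} {j} i<j = subst (_< j - i) (ℤₚ.+-inverseʳ i) (ℤₚ.+-monoˡ-< (- i) i<j)

  0<*⇒0< : ∀ {i j} → 0ℤ < i → 0ℤ < i * j → 0ℤ < j
  0<*⇒0< {+ suc i} {+ suc j} _ _ = +<+ (s≤s z≤n)
  0<*⇒0< {+ suc i} {+ 0} _ p = contradiction p (ℤₚ.<-irrefl (sym (ℤₚ.*-zeroʳ (+ suc i))))
  0<*⇒0< {+ suc i} { -[1+ j ] } _ ()
  0<*⇒0< {+ 0} (+<+ ())
  0<*⇒0< { -[1+ _ ] } ()

  0≢1 : 0ℤ ≢ 1ℤ
  0≢1 ()

  ~-refl : ∀ {Q} → Q ~ Q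
  ~-refl {Q} = sl 1ℤ 0ℤ 0ℤ 1ℤ refl λ x y → cong₂ (Q ⟦_,_⟧) (l x y) (r x y)
    where
    l : ∀ x y → x ≡ 1ℤ * x + 0ℤ * y
    l = solve-∀
    r : ∀ x y → y ≡ 0ℤ * x + 1ℤ * y
    r = solve-∀

  ~-sym : ∀ {Q R} → Q ~ R → R ~ Q
  ~-sym {Q} {R} (sl α β γ δ det eq) = sl δ (- β) (- γ) α (trans (d α β γ δ) det) λ x y →
    sym (trans (eq _ _) (cong₂ (Q ⟦_,_⟧) (l x y) (r x y)))
    where
    d : ∀ α β γ δ → δ * α - - β * - γ ≡ α * δ - β * γ
    d = solve-∀
    l′ : ∀ α β γ δ x y → α * (δ * x + - β * y) + β * (- γ * x + α * y) ≡ (α * δ - β * γ) * x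
    l′ = solve-∀
    r′ : ∀ α β γ δ x y → γ * (δ * x + - β * y) + δ * (- γ * x + α * y) ≡ (α * δ - β * γ) * y
    r′ = solve-∀
    l : ∀ x y → α * (δ * x + - β * y) + β * (- γ * x + α * y) ≡ x
    l x y = trans (l′ α β γ δ x y) (trans (cong (_* x) det) (ℤₚ.*-identityˡ x))
    r : ∀ x y → γ * (δ * x + - β * y) + δ * (- γ * x + α * y) ≡ y
    r x y = trans (r′ α β γ δ x y) (trans (cong (_* y) det) (ℤₚ.*-identityˡ y))

  ~-trans : ∀ {Q R S} → Q ~ R → R ~ S → Q ~ S
  ~-trans {Q} (sl α β γ δ det eq) (sl α′ β′ γ′ δ′ det′ eq′) =
    sl (α * α′ + β * γ′) (α * β′ + β * δ′) (γ * α′ + δ * γ′) (γ * β′ + δ * δ′)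
       (trans (d α β γ δ α′ β′ γ′ δ′) (cong₂ _*_ det det′))
    λ x y → trans (eq′ x y) (trans (eq _ _) (cong₂ (Q ⟦_,_⟧) (l α β α′ β′ γ′ δ′ x y) (l γ δ α′ β′ γ′ δ′ x y)))
    where
    d : ∀ α β γ δ α′ β′ γ′ δ′ →
        (α * α′ + β * γ′) * (γ * β′ + δ * δ′) - (α * β′ + β * δ′) * (γ * α′ + δ * γ′)
        ≡ (α * δ - β * γ) * (α′ * δ′ - β′ * γ′)
    d = solve-∀
    l : ∀ α β α′ β′ γ′ δ′ x y → α * (α′ * x + β′ * y) + β * (γ′ * x + δ′ * y)
        ≡ (α * α′ + β * γ′) * x + (α * β′ + β * δ′) * y
    l = solve-∀

  module Coefficients {Q R : Form} (Q~R : Q ~ R) where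
    open Form Q
    open Form R renaming (a to a′; b to b′; c to c′)
    open _~_ Q~R

    a-eq : a′ ≡ Q ⟦ α , γ ⟧
    a-eq = trans (e a′ b′ c′) (trans (transforms 1ℤ 0ℤ) (cong₂ (Q ⟦_,_⟧) (l α β) (l γ δ)))
      where
      e : ∀ a b c → a ≡ a * (1ℤ * 1ℤ) + b * (1ℤ * 0ℤ) + c * (0ℤ * 0ℤ)
      e = solve-∀
      l : ∀ x y → x * 1ℤ + y * 0ℤ ≡ x
      l = solve-∀

    c-eq : c′ ≡ Q ⟦ β , δ ⟧
    c-eq = trans (e a′ b′ c′) (trans (transforms 0ℤ 1ℤ) (cong₂ (Q ⟦_,_⟧) (l α β) (l γ δ)))
      where
      e : ∀ a b c → c ≡ a * (0ℤ * 0ℤ) + b * (0ℤ * 1ℤ) + c * (1ℤ * 1ℤ)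
      e = solve-∀
      l : ∀ x y → x * 0ℤ + y * 1ℤ ≡ y
      l = solve-∀

    b-eq : b′ ≡ Q ⟦ α + β , γ + δ ⟧ - Q ⟦ α , γ ⟧ - Q ⟦ β , δ ⟧
    b-eq = trans (e a′ b′ c′)
      (cong₂ _-_ (cong₂ _-_ (trans (transforms 1ℤ 1ℤ) (cong₂ (Q ⟦_,_⟧) (l α β) (l γ δ))) a-eq) c-eq)
      where
      e : ∀ a b c → b ≡ (a * (1ℤ * 1ℤ) + b * (1ℤ * 1ℤ) + c * (1ℤ * 1ℤ)) - a - c
      e = solve-∀
      l : ∀ x y → x * 1ℤ + y * 1ℤ ≡ x + y
      l = solve-∀

    disc-eq : disc R ≡ disc Q
    disc-eq = trans (cong₂ _-_ (cong₂ _*_ b-eq b-eq) (cong (+ 4 *_) (cong₂ _*_ a-eq c-eq)))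
      (trans (e a b c α β γ δ)
      (trans (cong (λ z → (z * z) * disc Q) det≡1) (ℤₚ.*-identityˡ (disc Q))))
      where
      e : ∀ a b c α β γ δ →
        let ev = λ x y → a * (x * x) + b * (x * y) + c * (y * y)
            B  = ev (α + β) (γ + δ) - ev α γ - ev β δ in
        B * B - + 4 * (ev α γ * ev β δ) ≡ ((α * δ - β * γ) * (α * δ - β * γ)) * (b * b - + 4 * (a * c))
      e = solve-∀

  posDef⇒0<a : ∀ {Q} → PositiveDefinite Q → 0ℤ < Form.a Q
  posDef⇒0<a {⟨ a , b , c ⟩} pd = subst (0ℤ <_) (e a b c) (positive pd 1ℤ 0ℤ λ ())
    where
    e : ∀ a b c → a * (1ℤ * 1ℤ) + b * (1ℤ * 0ℤ) + c * (0ℤ * 0ℤ) ≡ a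
    e = solve-∀

  posDef⇒disc<0 : ∀ {Q} → PositiveDefinite Q → disc Q < 0ℤ
  posDef⇒disc<0 {Q@(⟨ a , b , c ⟩)} pd = 0<-⇒< {d = + 4 * (a * c) - b * b}
    (0<*⇒0< 0<a (subst (0ℤ <_) (e a b c)
       (positive pd (- b) (+ 2 * a) λ (_ , 2a≡0) → ℤₚ.<-irrefl (sym 2a≡0) (0<* {+ 2} (+<+ (s≤s z≤n)) 0<a))))
    (f a b c)
    where
    0<a = posDef⇒0<a pd
    e : ∀ a b c → a * (- b * - b) + b * (- b * (+ 2 * a)) + c * ((+ 2 * a) * (+ 2 * a))
        ≡ a * (+ 4 * (a * c) - b * b)
    e = solve-∀
    f : ∀ a b c → + 4 * (a * c) - b * b ≡ 0ℤ - (b * b - + 4 * (a * c))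
    f = solve-∀

  posDef⁺ : ∀ {Q} → 0ℤ < Form.a Q → disc Q < 0ℤ → PositiveDefinite Q
  posDef⁺ {Q@(⟨ a , b , c ⟩)} 0<a d<0 = mkPD λ x y xy≢0 → 0<*⇒0< (0<* {+ 4} (+<+ (s≤s z≤n)) 0<a) (subst (0ℤ <_) (e a b c x y) (pos x y xy≢0))
    where
    e : ∀ a b c x y → (0ℤ - (b * b - + 4 * (a * c))) * (y * y) + (+ 2 * a * x + b * y) * (+ 2 * a * x + b * y)
      ≡ + 4 * a * (a * (x * x) + b * (x * y) + c * (y * y))
    e = solve-∀
    f : ∀ a b c x → + 4 * a * a * (x * x) ≡ (0ℤ - (b * b - + 4 * (a * c))) * (0ℤ * 0ℤ) + (+ 2 * a * x + b * 0ℤ) * (+ 2 * a * x + b * 0ℤ)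
    f = solve-∀
    pos : ∀ x y → ¬ (x ≡ 0ℤ × y ≡ 0ℤ) → 0ℤ < (0ℤ - disc Q) * (y * y) + (+ 2 * a * x + b * y) * (+ 2 * a * x + b * y)
    pos x y xy≢0 with y ℤₚ.≟ 0ℤ
    ... | yes refl = subst (0ℤ <_) (f a b c x)
            (0<* (0<* (0<* {+ 4} (+<+ (s≤s z≤n)) 0<a) 0<a) (0<sq λ x≡0 → xy≢0 (x≡0 , refl)))
    ... | no y≢0 = 0<+ (0<* (<⇒0< d<0) (0<sq y≢0)) (0≤sq (+ 2 * a * x + b * y))

  posDef? : ∀ Q → Dec (PositiveDefinite Q)
  posDef? Q = map′ (λ (p , q) → posDef⁺ p q) (λ pd → posDef⇒0<a pd , posDef⇒disc<0 pd)
    (0ℤ ℤₚ.<? Form.a Q ×-dec disc Q ℤₚ.<? 0ℤ)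

  posDef-~ : ∀ {Q R} → Q ~ R → PositiveDefinite Q → PositiveDefinite R
  posDef-~ {Q} {R} (sl α β γ δ det eq) pd = mkPD λ x y xy≢0 → subst (0ℤ <_) (sym (eq x y)) (positive pd _ _ (nz x y xy≢0))
    where
    l : ∀ α β γ δ x y → (α * δ - β * γ) * x ≡ δ * (α * x + β * y) - β * (γ * x + δ * y)
    l = solve-∀
    r : ∀ α β γ δ x y → (α * δ - β * γ) * y ≡ α * (γ * x + δ * y) - γ * (α * x + β * y)
    r = solve-∀
    z : ∀ u v → u * 0ℤ - v * 0ℤ ≡ 0ℤ
    z = solve-∀
    nz : ∀ x y → ¬ (x ≡ 0ℤ × y ≡ 0ℤ) → ¬ (α * x + β * y ≡ 0ℤ × γ * x + δ * y ≡ 0ℤ)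
    nz x y xy≢0 (p , q) = xy≢0
      ( trans (trans (sym (ℤₚ.*-identityˡ x)) (trans (cong (_* x) (sym det)) (l α β γ δ x y)))
          (trans (cong₂ (λ u v → δ * u - β * v) p q) (z δ β))
      , trans (trans (sym (ℤₚ.*-identityˡ y)) (trans (cong (_* y) (sym det)) (r α β γ δ x y)))
          (trans (cong₂ (λ u v → α * v - γ * u) p q) (z α γ)) )

  -- Gauss reduction: each class of positive definite forms contains exactly one
  -- reduced form, so that the reduced forms are a system of representatives.

  Reduced : Form → Set
  Reduced ⟨ a , b , c ⟩ = (- a < b × b ≤ a) × (a ≤ c × (a < c ⊎ 0ℤ ≤ b))

  reduced? : ∀ Q → Dec (Reduced Q)
  reduced? ⟨ a , b , c ⟩ = (- a ℤₚ.<? b ×-dec b ℤₚ.≤? a) ×-dec (a ℤₚ.≤? c ×-dec (a ℤₚ.<? c ⊎-dec 0ℤ ℤₚ.≤? b))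

  reduced⇒0<a : ∀ {Q} → Reduced Q → 0ℤ < Form.a Q
  reduced⇒0<a {⟨ a , b , c ⟩} ((-a<b , b≤a) , _) = 0<*⇒0< {+ 2} (+<+ (s≤s z≤n)) (subst (0ℤ <_) (e a) (<⇒0< (ℤₚ.<-≤-trans -a<b b≤a)))
    where
    e : ∀ a → a - - a ≡ + 2 * a
    e = solve-∀

  reduced⇒disc<0 : ∀ {Q} → Reduced Q → disc Q < 0ℤ
  reduced⇒disc<0 {Q@(⟨ a , b , c ⟩)} red@((lo , hi) , (a≤c , _)) = 0<-⇒<
    (0<+ (0<* {+ 3} (+<+ (s≤s z≤n)) (0<* 0<a 0<a))
    (0≤+ (0≤* (≤⇒0≤ hi) (ℤₚ.<⇒≤ (<⇒0< lo)))
         (0≤* {+ 4} (+≤+ z≤n) (0≤* (ℤₚ.<⇒≤ 0<a) (≤⇒0≤ a≤c))))) (e a b c)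
    where
    0<a = reduced⇒0<a {Q} red
    e : ∀ a b c → + 3 * (a * a) + ((a - b) * (b - - a) + + 4 * (a * (c - a))) ≡ 0ℤ - (b * b - + 4 * (a * c))
    e = solve-∀

  translate : ∀ a b c k → ⟨ a , b , c ⟩ ~ ⟨ a , b + + 2 * a * k , a * (k * k) + b * k + c ⟩
  translate a b c k = sl 1ℤ k 0ℤ 1ℤ (d k) (e a b c k)
    where
    d : ∀ k → 1ℤ * 1ℤ - k * 0ℤ ≡ 1ℤ
    d = solve-∀
    e : ∀ a b c k x y → a * (x * x) + (b + + 2 * a * k) * (x * y) + (a * (k * k) + b * k + c) * (y * y)
      ≡ a * ((1ℤ * x + k * y) * (1ℤ * x + k * y)) + b * ((1ℤ * x + k * y) * (0ℤ * x + 1ℤ * y)) + c * ((0ℤ * x + 1ℤ * y) * (0ℤ * x + 1ℤ * y))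
    e = solve-∀

  swap~ : ∀ a b c → ⟨ a , b , c ⟩ ~ ⟨ c , - b , a ⟩
  swap~ a b c = sl 0ℤ (- 1ℤ) 1ℤ 0ℤ refl (e a b c)
    where
    e : ∀ a b c x y → c * (x * x) + (- b) * (x * y) + a * (y * y)
      ≡ a * ((0ℤ * x + - 1ℤ * y) * (0ℤ * x + - 1ℤ * y)) + b * ((0ℤ * x + - 1ℤ * y) * (1ℤ * x + 0ℤ * y)) + c * ((1ℤ * x + 0ℤ * y) * (1ℤ * x + 0ℤ * y))
    e = solve-∀

  0<c : ∀ a b c → 0ℤ < a → disc ⟨ a , b , c ⟩ < 0ℤ → 0ℤ < c
  0<c a b c 0<a d<0 = 0<*⇒0< (0<* {+ 4} (+<+ (s≤s z≤n)) 0<a) (subst (0ℤ <_) (e a b c) (0<+ (<⇒0< d<0) (0≤sq b)))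
    where
    e : ∀ a b c → 0ℤ - (b * b - + 4 * (a * c)) + b * b ≡ + 4 * a * c
    e = solve-∀

  centre : ∀ a b → 0ℤ < a → ∃[ k ] (- a < b + + 2 * a * k × b + + 2 * a * k ≤ a)
  centre a@(+ suc n) b _ = k , 0<-⇒< {d = + d - + r} (<⇒0< (+<+ (n%ℕd<d (a - b) d))) (trans (cong (_- + r) d≡2a) (e₁ a b k r≡))
                             , 0≤-⇒≤ {d = + r} (+≤+ z≤n) (e₂ a b k r≡)
    where
    d = 2 ℕ.* suc n
    k = (a - b) /ℕ d
    r = (a - b) %ℕ d
    d≡2a : + d ≡ + 2 * a
    d≡2a = ℤₚ.pos-* 2 (suc n)
    r≡ : + r ≡ (a - b) - k * (+ 2 * a)
    r≡ = trans (s (+ r) (k * + d)) (cong₂ _-_ (sym (a≡a%ℕn+[a/ℕn]*n (a - b) d)) (cong (k *_) d≡2a))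
      where
      s : ∀ r q → r ≡ (r + q) - q
      s = solve-∀
    e₁ : ∀ a b k {r} → r ≡ (a - b) - k * (+ 2 * a) → + 2 * a - r ≡ b + + 2 * a * k - - a
    e₁ a b k refl = f a b k
      where
      f : ∀ a b k → + 2 * a - ((a - b) - k * (+ 2 * a)) ≡ b + + 2 * a * k - - a
      f = solve-∀
    e₂ : ∀ a b k {r} → r ≡ (a - b) - k * (+ 2 * a) → r ≡ a - (b + + 2 * a * k)
    e₂ a b k refl = f a b k
      where
      f : ∀ a b k → (a - b) - k * (+ 2 * a) ≡ a - (b + + 2 * a * k)
      f = solve-∀
  centre (+ 0) b (+<+ ())
  centre -[1+ n ] b ()

  reduce′ : ∀ a b c → Acc ℕ._<_ ∣ a ∣ → 0ℤ < a → disc ⟨ a , b , c ⟩ < 0ℤ → ∃[ R ] (Reduced R × ⟨ a , b , c ⟩ ~ R)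

  reduceCentred : ∀ a b c → Acc ℕ._<_ ∣ a ∣ → 0ℤ < a → disc ⟨ a , b , c ⟩ < 0ℤ → - a < b → b ≤ a →
                  ∃[ R ] (Reduced R × ⟨ a , b , c ⟩ ~ R)

  reduce′ a b c wf 0<a d<0 with centre a b 0<a
  ... | k , lo , hi = let (R , red , v) = reduceCentred a _ _ wf 0<a (subst (_< 0ℤ) (sym (Coefficients.disc-eq t)) d<0) lo hi in
                      R , red , ~-trans t v
    where
    t = translate a b c k

  reduceCentred a b c (acc rec) 0<a d<0 lo hi with ℤₚ.<-cmp a c
  ... | tri< a<c _ _ = _ , ((lo , hi) , (ℤₚ.<⇒≤ a<c , inj₁ a<c)) , ~-refl
  ... | tri≈ _ a≡c _ with 0ℤ ℤₚ.≤? b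
  ...   | yes 0≤b = _ , ((lo , hi) , (ℤₚ.≤-reflexive a≡c , inj₂ 0≤b)) , ~-refl
  ...   | no  0≰b = _ , ((subst (λ z → - z < - b) a≡c (ℤₚ.neg-mono-< (ℤₚ.<-trans b<0 0<a)) ,
                          subst (- b ≤_) a≡c (ℤₚ.<⇒≤ (subst (- b <_) (ℤₚ.neg-involutive a) (ℤₚ.neg-mono-< lo)))) ,
                         (ℤₚ.≤-reflexive (sym a≡c) , inj₂ (ℤₚ.<⇒≤ (ℤₚ.neg-mono-< b<0)))) , swap~ a b c
    where b<0 = ℤₚ.≰⇒> 0≰b
  reduceCentred a b c (acc rec) 0<a d<0 lo hi | tri> _ _ c<a =
    let (R , red , v) = reduce′ c (- b) a (rec (abs< (0<c a b c 0<a d<0) c<a)) (0<c a b c 0<a d<0)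
                          (subst (_< 0ℤ) (sym (Coefficients.disc-eq (swap~ a b c))) d<0) in
    R , red , ~-trans (swap~ a b c) v
    where
    abs< : ∀ {i j} → 0ℤ < i → i < j → ∣ i ∣ ℕ.< ∣ j ∣
    abs< {+ i} {+ j} _ (+<+ p) = p
    abs< { -[1+ _ ] } ()

  -- Opaque so that normalising a term does not unfold the proofs carried along by
  -- the reduction.
  opaque
    reduce : ∀ Q → PositiveDefinite Q → ∃[ R ] (Reduced R × Q ~ R)
    reduce ⟨ a , b , c ⟩ pd = reduce′ a b c (<-wellFounded _) (posDef⇒0<a pd) (posDef⇒disc<0 pd)

  c≤₊ : ∀ a b c x y → 0ℤ < a → 0ℤ ≤ b → b ≤ a → a ≤ c → y ≢ 0ℤ → c ≤ ⟨ a , b , c ⟩ ⟦ x , y ⟧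
  c≤₊ a b c x y 0<a 0≤b b≤a a≤c y≢0 with x ℤₚ.≟ 0ℤ
  ... | yes refl = 0≤-⇒≤ (0≤* 0≤c (≤⇒0≤ (0<⇒1≤ (0<sq y≢0)))) (e a b c y)
    where
    0≤c = ℤₚ.≤-trans (ℤₚ.<⇒≤ 0<a) a≤c
    e : ∀ a b c y → c * (y * y - 1ℤ) ≡ a * (0ℤ * 0ℤ) + b * (0ℤ * y) + c * (y * y) - c
    e = solve-∀
  ... | no x≢0 = ℤₚ.*-cancelˡ-≤-pos _ _ (+ 2) (0≤-⇒≤ nn (e a b c x y))
    where
    e : ∀ a b c x y →
      (a - b) * (x * x + y * y) + (b * ((x + y) * (x + y)) + (a * (x * x - 1ℤ) + ((c - a) + c) * (y * y - 1ℤ)))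
      ≡ + 2 * (a * (x * x) + b * (x * y) + c * (y * y)) - + 2 * c
    e = solve-∀
    0≤c = ℤₚ.≤-trans (ℤₚ.<⇒≤ 0<a) a≤c
    nn = 0≤+ (0≤* (≤⇒0≤ b≤a) (0≤+ (0≤sq x) (0≤sq y)))
         (0≤+ (0≤* 0≤b (0≤sq (x + y)))
         (0≤+ (0≤* (ℤₚ.<⇒≤ 0<a) (≤⇒0≤ (0<⇒1≤ (0<sq x≢0))))
              (0≤* (0≤+ (≤⇒0≤ a≤c) 0≤c) (≤⇒0≤ (0<⇒1≤ (0<sq y≢0))))))

  c≤ : ∀ {Q} x y → Reduced Q → y ≢ 0ℤ → Form.c Q ≤ Q ⟦ x , y ⟧
  c≤ {⟨ a , b , c ⟩} x y red@((lo , hi) , (a≤c , _)) y≢0 with 0ℤ ℤₚ.≤? b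
  ... | yes 0≤b = c≤₊ a b c x y (reduced⇒0<a red) 0≤b hi a≤c y≢0
  ... | no 0≰b = subst (c ≤_) (e a b c x y)
        (c≤₊ a (- b) c (- x) y (reduced⇒0<a red) (ℤₚ.<⇒≤ (ℤₚ.neg-mono-< (ℤₚ.≰⇒> 0≰b)))
          (ℤₚ.<⇒≤ (subst (- b <_) (ℤₚ.neg-involutive a) (ℤₚ.neg-mono-< lo))) a≤c y≢0)
    where
    e : ∀ a b c x y → a * (- x * - x) + - b * (- x * y) + c * (y * y) ≡ a * (x * x) + b * (x * y) + c * (y * y)
    e = solve-∀

  a≤ : ∀ {Q} x y → Reduced Q → ¬ (x ≡ 0ℤ × y ≡ 0ℤ) → Form.a Q ≤ Q ⟦ x , y ⟧
  a≤ {Q@(⟨ a , b , c ⟩)} x y red@(_ , (a≤c , _)) xy≢0 with y ℤₚ.≟ 0ℤ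
  ... | no y≢0 = ℤₚ.≤-trans a≤c (c≤ {Q} x y red y≢0)
  ... | yes refl = 0≤-⇒≤ (0≤* (ℤₚ.<⇒≤ (reduced⇒0<a {Q} red)) (≤⇒0≤ (0<⇒1≤ (0<sq λ x≡0 → xy≢0 (x≡0 , refl))))) (e a b c x)
    where
    e : ∀ a b c x → a * (x * x - 1ℤ) ≡ a * (x * x) + b * (x * 0ℤ) + c * (0ℤ * 0ℤ) - a
    e = solve-∀

  column≢0 : ∀ {Q R} (Q~R : Q ~ R) → ¬ (_~_.α Q~R ≡ 0ℤ × _~_.γ Q~R ≡ 0ℤ)
  column≢0 (sl α β γ δ det _) (refl , refl) = 0≢1 (trans (e β δ) det)
    where
    e : ∀ β δ → 0ℤ ≡ 0ℤ * δ - β * 0ℤ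
    e = solve-∀

  a-min : ∀ {Q R} → Reduced Q → Q ~ R → Form.a Q ≤ Form.a R
  a-min {Q} {R} red Q~R = subst (Form.a Q ≤_) (sym (Coefficients.a-eq {Q} {R} Q~R)) (a≤ {Q} _ _ red (column≢0 Q~R))

  disc-injective : ∀ {a b c c′} → 0ℤ < a → disc ⟨ a , b , c ⟩ ≡ disc ⟨ a , b , c′ ⟩ → c ≡ c′
  disc-injective {a@(+ suc _)} {b} {c} {c′} _ eq = ℤₚ.*-cancelˡ-≡ (+ 4 * a) c c′
    (trans (e a b c) (trans (cong (λ z → b * b - z) eq) (sym (e a b c′))))
    where
    e : ∀ a b c → + 4 * a * c ≡ b * b - (b * b - + 4 * (a * c))
    e = solve-∀
  disc-injective {+ 0} (+<+ ())
  disc-injective { -[1+ _ ] } ()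

  square-injective : ∀ {b b′} → 0ℤ ≤ b → 0ℤ ≤ b′ → b * b ≡ b′ * b′ → b ≡ b′
  square-injective {b} {b′} 0≤b 0≤b′ eq with ℤₚ.i*j≡0⇒i≡0∨j≡0 (b - b′) (trans (e b b′) (ℤₚ.i≡j⇒i-j≡0 eq))
    where
    e : ∀ b b′ → (b - b′) * (b + b′) ≡ b * b - b′ * b′
    e = solve-∀
  ... | inj₁ p = ℤₚ.i-j≡0⇒i≡j b b′ p
  ... | inj₂ p = trans (z 0≤b 0≤b′ p) (sym (z 0≤b′ 0≤b (trans (ℤₚ.+-comm b′ b) p)))
    where
    z : ∀ {i j} → 0ℤ ≤ i → 0ℤ ≤ j → i + j ≡ 0ℤ → i ≡ 0ℤ
    z {i} {j} 0≤i 0≤j eq = ℤₚ.≤-antisym (subst₂ _≤_ (ℤₚ.+-identityʳ i) eq (ℤₚ.+-monoʳ-≤ i 0≤j)) 0≤i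

  small : ∀ {a i} → 0ℤ < a → + 2 * a * i < + 2 * a → i ≤ 0ℤ
  small {a@(+ suc _)} {i} _ lt = ℤₚ.≮⇒≥ λ 0<i → ℤₚ.<⇒≱ lt
    (subst (_≤ + 2 * a * i) (ℤₚ.*-identityʳ (+ 2 * a)) (ℤₚ.*-monoˡ-≤-nonNeg (+ 2 * a) (0<⇒1≤ 0<i)))
  small {+ 0} (+<+ ())
  small { -[1+ _ ] } ()

  b-unique : ∀ {a b b′ i} → 0ℤ < a → - a < b → b ≤ a → - a < b′ → b′ ≤ a → b′ ≡ b + + 2 * a * i → b ≡ b′
  b-unique {a} {b} {i = i} 0<a lo hi lo′ hi′ refl = sym (trans (cong (λ z → b + + 2 * a * z) i≡0) (z a b))
    where
    z : ∀ a b → b + + 2 * a * 0ℤ ≡ b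
    z = solve-∀
    p : ∀ a b i → (a - (b + + 2 * a * i)) + (b - - a) ≡ + 2 * a - + 2 * a * i
    p = solve-∀
    q : ∀ a b i → (a - b) + (b + + 2 * a * i - - a) ≡ + 2 * a - + 2 * a * (- i)
    q = solve-∀
    i≡0 : i ≡ 0ℤ
    i≡0 = ℤₚ.≤-antisym
      (small 0<a (0<-⇒< (ℤₚ.+-mono-≤-< (≤⇒0≤ hi′) (<⇒0< lo)) (p a b i)))
      (ℤₚ.neg-cancel-≤ (small 0<a (0<-⇒< (ℤₚ.+-mono-≤-< (≤⇒0≤ hi) (<⇒0< lo′)) (q a b i))))

  reduced-unique : ∀ {Q R} → Reduced Q → Reduced R → Q ~ R → Q ≡ R
  reduced-unique {Q@(⟨ a , b , c ⟩)} {R@(⟨ a′ , b′ , c′ ⟩)} redQ redR Q~R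
    with ℤₚ.≤-antisym (a-min {Q} {R} redQ Q~R) (a-min {R} {Q} redR (~-sym {Q} {R} Q~R))
  ... | refl = go (_~_.γ Q~R ℤₚ.≟ 0ℤ)
    where
    open _~_ Q~R
    open Coefficients {Q} {R} Q~R
    R~Q = ~-sym {Q} {R} Q~R
    0<a = reduced⇒0<a {Q} redQ
    same-b : b ≡ b′ → Q ≡ R
    same-b refl = cong ⟨ a , b ,_⟩ (disc-injective {a} {b} 0<a (sym disc-eq))
    go : Dec (γ ≡ 0ℤ) → Q ≡ R
    go (yes γ≡0) = same-b (b-unique 0<a (proj₁ (proj₁ redQ)) (proj₂ (proj₁ redQ)) (proj₁ (proj₁ redR)) (proj₂ (proj₁ redR)) b′≡)
      where
      e : ∀ a b c α β γ δ →
        let ev = λ x y → a * (x * x) + b * (x * y) + c * (y * y) in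
        ev (α + β) (γ + δ) - ev α γ - ev β δ ≡ b * (α * δ - β * γ) + + 2 * a * (α * β) + + 2 * (γ * (b * β + c * δ))
      e = solve-∀
      f : ∀ b x y → b * 1ℤ + x + + 2 * (0ℤ * y) ≡ b + x
      f = solve-∀
      b′≡ : b′ ≡ b + + 2 * a * (α * β)
      b′≡ = trans b-eq (trans (e a b c α β γ δ)
        (trans (cong₂ (λ u v → b * u + + 2 * a * (α * β) + + 2 * (v * (b * β + c * δ))) det≡1 γ≡0) (f b (+ 2 * a * (α * β)) (b * β + c * δ))))
    go (no γ≢0) = same-b (square-injective 0≤b 0≤b′ b²≡)
      where
      c≤a : c ≤ a
      c≤a = subst (c ≤_) (sym a-eq) (c≤ {Q} α γ redQ γ≢0)
      c′≤a : c′ ≤ a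
      c′≤a = subst (c′ ≤_) (sym (Coefficients.a-eq {R} {Q} R~Q))
        (c≤ {R} δ (- γ) redR λ p → γ≢0 (trans (sym (ℤₚ.neg-involutive γ)) (cong -_ p)))
      nonneg : ∀ {b c} → c ≤ a → (a < c ⊎ 0ℤ ≤ b) → 0ℤ ≤ b
      nonneg c≤a (inj₁ a<c) = contradiction c≤a (ℤₚ.<⇒≱ a<c)
      nonneg c≤a (inj₂ p) = p
      0≤b = nonneg c≤a (proj₂ (proj₂ redQ))
      0≤b′ = nonneg c′≤a (proj₂ (proj₂ redR))
      c≡c′ : c ≡ c′
      c≡c′ = trans (ℤₚ.≤-antisym c≤a (proj₁ (proj₂ redQ))) (sym (ℤₚ.≤-antisym c′≤a (proj₁ (proj₂ redR))))
      s : ∀ x z → x ≡ (x - z) + z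
      s = solve-∀
      b²≡ : b * b ≡ b′ * b′
      b²≡ = trans (s (b * b) (+ 4 * (a * c))) (trans (cong₂ _+_ (sym disc-eq) (cong (λ z → + 4 * (a * z)) c≡c′)) (sym (s (b′ * b′) (+ 4 * (a * c′)))))

  -- A reduced form of discriminant -n has all its coefficients in [-n, n].
  box : ℕ → List Form
  box n = cartesianProductWith (λ (a , b) c → ⟨ + a , + b - + n , + c ⟩)
    (cartesianProduct (upTo (suc n)) (upTo (suc (n ℕ.+ n)))) (upTo (suc n))

  box-unique : ∀ n → Unique (box n)
  box-unique n = Uniqueₚ.cartesianProductWith⁺ _ inj
    (Uniqueₚ.cartesianProduct⁺ (Uniqueₚ.upTo⁺ (suc n)) (Uniqueₚ.upTo⁺ (suc (n ℕ.+ n)))) (Uniqueₚ.upTo⁺ (suc n))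
    where
    inj : ∀ {p q : ℕ × ℕ} {y z} →
      ⟨ + proj₁ p , + proj₂ p - + n , + y ⟩ ≡ ⟨ + proj₁ q , + proj₂ q - + n , + z ⟩ → p ≡ q × y ≡ z
    inj {p} {q} eq =
      cong₂ _,_ (ℤₚ.+-injective (cong Form.a eq))
                (ℤₚ.+-injective (trans (s (+ proj₂ p) (+ n)) (trans (cong (_+ + n) (cong Form.b eq)) (sym (s (+ proj₂ q) (+ n)))))) ,
      ℤₚ.+-injective (cong Form.c eq)
      where
      s : ∀ x n → x ≡ (x - n) + n
      s = solve-∀

  ∈-box : ∀ n {a b c} → 0ℤ ≤ a → a ≤ + n → - + n ≤ b → b ≤ + n → 0ℤ ≤ c → c ≤ + n → ⟨ a , b , c ⟩ ∈ box n
  ∈-box n {+ a} {b} {+ c} _ (+≤+ a≤n) lo hi _ (+≤+ c≤n) =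
    subst (λ z → ⟨ + a , z , + c ⟩ ∈ box n) (trans (cong (_- + n) B≡) (s b (+ n)))
      (∈-cartesianProductWith⁺ (λ (a , b) c → ⟨ + a , + b - + n , + c ⟩)
        (∈-cartesianProduct⁺ (∈-upTo⁺ (s≤s a≤n)) (∈-upTo⁺ (s≤s B≤))) (∈-upTo⁺ (s≤s c≤n)))
    where
    s : ∀ b n → (b + n) - n ≡ b
    s = solve-∀
    B = ∣ b + + n ∣
    n-n : ∀ n b → b - - n ≡ b + n
    n-n = solve-∀
    B≡ : + B ≡ b + + n
    B≡ = ℤₚ.0≤i⇒+∣i∣≡i (subst (0ℤ ≤_) (n-n (+ n) b) (≤⇒0≤ lo))
    B≤ : B ℕ.≤ n ℕ.+ n
    B≤ = ℤₚ.drop‿+≤+ (subst (_≤ + n + + n) (sym B≡) (ℤₚ.+-monoˡ-≤ (+ n) hi))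
  ∈-box _ { -[1+ _ ] } ()
  ∈-box _ {+ _} {c = -[1+ _ ]} _ _ _ _ ()

  reduced-∈-box : ∀ n {Q} → Reduced Q → disc Q ≡ - + n → Q ∈ box n
  reduced-∈-box n {Q@(⟨ a , b , c ⟩)} redQ@((lo , hi) , (a≤c , _)) d≡ =
    ∈-box n 0≤a (ℤₚ.≤-trans a≤c c≤n) (ℤₚ.≤-trans (ℤₚ.neg-mono-≤ (ℤₚ.≤-trans a≤c c≤n)) (ℤₚ.<⇒≤ lo))
      (ℤₚ.≤-trans hi (ℤₚ.≤-trans a≤c c≤n)) 0≤c c≤n
    where
    0<a = reduced⇒0<a {Q} redQ
    0≤a = ℤₚ.<⇒≤ 0<a
    0≤c = ℤₚ.≤-trans 0≤a a≤c
    n≡ : + n ≡ - (b * b - + 4 * (a * c))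
    n≡ = trans (sym (ℤₚ.neg-involutive (+ n))) (cong -_ (sym d≡))
    e : ∀ a b c → (a - b) * (b - - a) + ((c - a) * a + (+ 2 * (a * c) + c * (a - 1ℤ))) ≡ - (b * b - + 4 * (a * c)) - c
    e = solve-∀
    c≤n : c ≤ + n
    c≤n = 0≤-⇒≤ (0≤+ (0≤* (≤⇒0≤ hi) (ℤₚ.<⇒≤ (<⇒0< lo))) (0≤+ (0≤* (≤⇒0≤ a≤c) 0≤a)
       (0≤+ (0≤* {+ 2} (+≤+ z≤n) (0≤* 0≤a 0≤c)) (0≤* 0≤c (≤⇒0≤ (0<⇒1≤ 0<a))))))
       (trans (e a b c) (cong (_- c) (sym n≡)))

  reducedOfDisc? : ∀ n Q → Dec (Reduced Q × disc Q ≡ - + n)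
  reducedOfDisc? n Q = reduced? Q ×-dec (disc Q ℤₚ.≟ - + n)

  reducedForms : ℕ → List Form
  reducedForms n = filter (reducedOfDisc? n) (box n)

  classRepresentatives : ∀ n .{{_ : NonZero n}} → ClassRepresentatives (- + n)
  classRepresentatives n@(suc _) = record
    { forms        = reducedForms n
    ; posDef       = All.map (λ {Q} (red , d) → posDef⁺ (reduced⇒0<a {Q} red) (subst (_< 0ℤ) (sym d) -<+)) ok
    ; discriminant = All.map proj₂ ok
    ; inequivalent = strict (All.map proj₁ ok) (Uniqueₚ.filter⁺ (reducedOfDisc? n) (box-unique n))
    ; exhaustive   = λ Q pd d → let (R , red , Q~R) = reduce Q pd in
        let d′ = trans (Coefficients.disc-eq {Q} {R} Q~R) d in
        lose (∈-filter⁺ (reducedOfDisc? n) (reduced-∈-box n red d′) (red , d′)) Q~R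
    }
    where
    ok : All (λ Q → Reduced Q × disc Q ≡ - + n) (reducedForms n)
    ok = Allₚ.all-filter (reducedOfDisc? n) (box n)
    strict : ∀ {Qs} → All Reduced Qs → Unique Qs → AllPairs (λ Q R → ¬ Q ~ R) Qs
    strict [] [] = []
    strict {Q ∷ _} (r ∷ rs) (d ∷ ds) =
      All.zipWith (λ {R} (red , Q≢R) Q~R → Q≢R (reduced-unique {Q} {R} r red Q~R)) (rs , d) ∷ strict rs ds

  _≟F_ : ∀ (Q R : Form) → Dec (Q ≡ R)
  ⟨ a , b , c ⟩ ≟F ⟨ a′ , b′ , c′ ⟩ = map′ (λ { (refl , refl , refl) → refl }) (λ { refl → refl , refl , refl })
    (a ℤₚ.≟ a′ ×-dec (b ℤₚ.≟ b′ ×-dec c ℤₚ.≟ c′))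

  module Family (h : ℤ → Form) (lead : ∀ a → Form.a (h a) ≡ a) (red : ∀ a → 0ℤ < a → Reduced (h a)) where

    Member : Form → Set
    Member Q = ∃[ a ] (0ℤ < a × Q ~ h a)

    member⇒posDef : ∀ {Q} → Member Q → PositiveDefinite Q
    member⇒posDef (a , 0<a , Q~) =
      posDef-~ (~-sym Q~) (posDef⁺ (reduced⇒0<a {h a} (red a 0<a)) (reduced⇒disc<0 {h a} (red a 0<a)))

    fromReduced : ∀ {Q} → ∃[ R ] (Reduced R × Q ~ R) → Dec (Member Q)
    fromReduced {Q} (R , redR , Q~R) = map′
      (λ R≡ → Form.a R , reduced⇒0<a {R} redR , subst (Q ~_) R≡ Q~R)
      (λ (a , 0<a , Q~) →
        let R≡ = reduced-unique {R} {h a} redR (red a 0<a) (~-trans (~-sym Q~R) Q~) in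
        trans R≡ (cong h (sym (trans (cong Form.a R≡) (lead a)))))
      (R ≟F h (Form.a R))

    fromPosDef : ∀ {Q} → Dec (PositiveDefinite Q) → Dec (Member Q)
    fromPosDef (no ¬pd)  = no (¬pd ∘ member⇒posDef)
    fromPosDef (yes pd)  = fromReduced (reduce _ pd)

    member? : ∀ Q → Dec (Member Q)
    member? Q = fromPosDef (posDef? Q)

  gaussian eisenstein : ℤ → Form
  gaussian   a = ⟨ a , 0ℤ , a ⟩
  eisenstein a = ⟨ a , a , a ⟩

  gaussianReduced : ∀ a → 0ℤ < a → Reduced (gaussian a)
  gaussianReduced a 0<a = (ℤₚ.neg-mono-< 0<a , ℤₚ.<⇒≤ 0<a) , (ℤₚ.≤-refl , inj₂ ℤₚ.≤-refl)

  eisensteinReduced : ∀ a → 0ℤ < a → Reduced (eisenstein a)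
  eisensteinReduced a 0<a =
    (ℤₚ.<-trans (ℤₚ.neg-mono-< 0<a) 0<a , ℤₚ.≤-refl) , (ℤₚ.≤-refl , inj₂ (ℤₚ.<⇒≤ 0<a))

  -- Every a with Q ~ gaussian a (or eisenstein a) is positive when Q is positive
  -- definite, so requiring 0ℤ < a loses nothing.
  opaque
    gaussian? : ∀ Q → Dec (∃[ a ] (0ℤ < a × Q ~ gaussian a))
    gaussian? = Family.member? gaussian (λ _ → refl) gaussianReduced

    eisenstein? : ∀ Q → Dec (∃[ a ] (0ℤ < a × Q ~ eisenstein a))
    eisenstein? = Family.member? eisenstein (λ _ → refl) eisensteinReduced

open BinaryQuadraticForms public
  using (Form; ⟨_,_,_⟩; _⟦_,_⟧; disc; PositiveDefinite; _~_; ClassRepresentatives; classRepresentatives;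
         gaussian; eisenstein; gaussian?; eisenstein?)

open import Data.Rational.Base using (_+_; _*_; _-_; -_)
open import Algebra.Definitions.RawSemiring ℚ.+-*-rawSemiring public using (_^_)

ι : ℤ → ℚ
ι i = i / 1

δ : ∀ {P : Set} → Dec P → ℚ
δ P? = if does P? then 1ℚ else 0ℚ

Σ[0⋯_] : ℕ → (ℕ → ℚ) → ℚ
Σ[0⋯ n ] f = Sum.sum ℚₚ.+-0-commutativeMonoid {suc n} (f ∘ Fin.toℕ)

-- The sum over the integers t with ∣t∣ ≤ n.
Σ[±_] : ℕ → (ℤ → ℚ) → ℚ
Σ[± n ] f = Σ[0⋯ 2 ℕ.* n ] λ i → f (+ i ℤ.- + n)

infix 4 _≡_[mod_] _≡?_[mod_]

_≡_[mod_] : ℤ → ℤ → ℕ → Set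
x ≡ y [mod M ] = + M ∣ x ℤ.- y

_≡?_[mod_] : ∀ x y M → Dec (x ≡ y [mod M ])
x ≡? y [mod M ] = + M ∣? x ℤ.- y

-- Only meaningful for μ ≤ k.
T : ℕ → ℕ → ℚ
T k μ = ((+ k ℤ.- + (2 ℕ.* μ) ℤ.+ 1ℤ) / suc (k ℕ.∸ μ)) * ι (+ (k C μ))

-- a is a square modulo p iff it is congruent to some x² with 0 ≤ x < p.
legendre : ℤ → ℕ → ℤ
legendre a p =
  if does (+ p ∣? a) then 0ℤ
  else if does (Finₚ.any? λ (x : Fin.Fin p) → a ≡? + (Fin.toℕ x ℕ.^ 2) [mod p ]) then 1ℤ
  else -1ℤ

-- Only meaningful for odd n.
jacobi : ℤ → ℕ → ℤ
jacobi a zero      = 0ℤ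
jacobi a n@(suc _) = foldr ℤ._*_ 1ℤ (map (legendre a) (factors (factorise n)))

1/ω : Form → ℚ
1/ω Q =
  if does (gaussian? Q) then + 1 / 2
  else if does (eisenstein? Q) then + 1 / 3
  else 1ℚ

-- There is no form of discriminant -n unless -n ≡ 0, 1 (mod 4); the sum is then
-- empty, in accordance with H n = 0.
classNumber : ∀ n .{{_ : NonZero n}} → ℚ
classNumber n = foldr _+_ 0ℚ (map 1/ω (ClassRepresentatives.forms (classRepresentatives n)))

H : ℚ → ℚ
H (mkℚ (+ 0)     0 _) = - (+ 1 / 12)
H (mkℚ (+ suc n) 0 _) = classNumber (suc n)
H _                   = 0ℚ

-- The argument of H is negative as soon as ∣t∣ > p ^ r, so this range contains
-- every t which contributes.
𝓗 : (k : ℕ) (m : ℤ) (M b : ℕ) .{{_ : NonZero b}} → (p r : ℕ) → ℚ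
𝓗 k m M b p r = Σ[± p ℕ.^ r ] λ t →
  δ (¬? (+ p ∣? t)) * δ (t ≡? m [mod M ]) * (H ((+ (p ℕ.^ r) ℤ.- t ℤ.* t) / b) * ι (t ℤ.^ k))

-- A q-series Σₙ F(n)qⁿ is represented by its coefficients.
Series : Set
Series = ℕ → ℚ

_⊛_ : Series → Series → Series
(F ⊛ G) n = Σ[0⋯ n ] λ i → F i * G (n ℕ.∸ i)

-- (2πi)⁻¹ ∂/∂τ, which is q d/dq.
∂ : Series → Series
∂ F n = ι (+ n) * F n

∂^ : ℕ → Series → Series
∂^ zero    F = F
∂^ (suc i) F = ∂ (∂^ i F)

-- α(α-1)⋯(α-i+1)/i!, which equals Γ(α+1)/(i! Γ(α-i+1)).
binomial : ℚ → ℕ → ℚ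
binomial α zero    = 1ℚ
binomial α (suc i) = binomial α i * ((α - ι (+ i)) * (+ 1 / suc i))

-- The factor (2πi)⁻ᵏ is absorbed in the k derivatives of each term.
rankinCohen : (κ₁ κ₂ : ℚ) → ℕ → Series → Series → Series
rankinCohen κ₁ κ₂ k F₁ F₂ n = Σ[0⋯ k ] λ i →
  ι (-1ℤ ℤ.^ i) * binomial (κ₁ + ι (+ k) - 1ℚ) (k ℕ.∸ i) * binomial (κ₂ + ι (+ k) - 1ℚ) i
    * (∂^ i F₁ ⊛ ∂^ (k ℕ.∸ i) F₂) n

𝓗-series : Series
𝓗-series n = H (ι (+ n))

V : (b : ℕ) .{{_ : NonZero b}} → Series → Series
V b F n = δ (b ℕ∣.∣? n) * F (n ℕ./ b)

-- t * t = n forces ∣t∣ ≤ n.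
θ : (j : ℕ) (m : ℤ) (M : ℕ) → Series
θ j m M n = Σ[± n ] λ t → δ (t ≡? m [mod M ]) * δ (t ℤ.* t ℤₚ.≟ + n) * ι (t ℤ.^ j)

-- ⌊√n⌋. Below it is only used for perfect squares, where it is the square root.
√_ : ℕ → ℕ
√ zero  = 0
√ suc n = if does (suc (√ n) ℕ.* suc (√ n) ℕₚ.≤? suc n) then suc (√ n) else √ n

√-bounds : ∀ n → (√ n) ℕ.* (√ n) ℕ.≤ n × n ℕ.< suc (√ n) ℕ.* suc (√ n)
√-bounds zero = z≤n , s≤s z≤n
√-bounds (suc n) = step (√ n) (suc (√ n) ℕ.* suc (√ n) ℕₚ.≤? suc n) (√-bounds n)
  where
  step : ∀ s (d : Dec (suc s ℕ.* suc s ℕ.≤ suc n)) → s ℕ.* s ℕ.≤ n × n ℕ.< suc s ℕ.* suc s →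
         let s′ = if does d then suc s else s in s′ ℕ.* s′ ℕ.≤ suc n × suc n ℕ.< suc s′ ℕ.* suc s′
  step s (yes le) (_ , lt) = le , ℕₚ.≤-<-trans lt (ℕₚ.*-mono-< (ℕₚ.n<1+n (suc s)) (ℕₚ.n<1+n (suc s)))
  step s (no nle) (le , _) = ℕₚ.m≤n⇒m≤1+n le , ℕₚ.≰⇒> nle

√-square : ∀ c → √ (c ℕ.* c) ≡ c
√-square c = ℕₚ.≤-antisym
  (ℕₚ.≮⇒≥ λ c<s → ℕₚ.<⇒≱ (ℕₚ.*-mono-< c<s c<s) (proj₁ (√-bounds (c ℕ.* c))))
  (ℕₚ.≮⇒≥ λ s<c → ℕₚ.<⇒≱ (proj₂ (√-bounds (c ℕ.* c))) (ℕₚ.*-mono-≤ s<c s<c))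

√-nonZero : ∀ n .{{_ : NonZero n}} → NonZero (√ n)
√-nonZero n@(suc _) = ℕ.≢-nonZero λ eq →
  ℕₚ.<⇒≱ (subst (λ s → n ℕ.< suc s ℕ.* suc s) eq (proj₂ (√-bounds n))) (s≤s z≤n)

_^-½ : (b : ℕ) .{{_ : NonZero b}} → ℚ
b ^-½ = _/_ (+ 1) (√ b) {{√-nonZero b}}

-- For a square b = c² ≥ 1, (t - cs)(t + cs) = n forces t, s ≤ n.
Λ : (ℓ : ℕ) (m : ℤ) (M b : ℕ) → Series
Λ ℓ m M b zero      = 0ℚ
Λ ℓ m M b n@(suc _) = part 1ℤ + part -1ℤ
  where
  weight : ℕ → ℚ
  weight zero    = ½
  weight (suc _) = 1ℚ

  part : ℤ → ℚ
  part ε = ι (ε ℤ.^ ℓ) * Σ[0⋯ n ] λ t → Σ[0⋯ n ] λ s →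
    δ (1 ℕₚ.≤? t) * δ (+ t ℤ.* + t ℤ.- + b ℤ.* (+ s ℤ.* + s) ℤₚ.≟ + n) * δ (+ t ≡? ε ℤ.* m [mod M ])
      * (weight s * ι ((+ t ℤ.- + (√ b) ℤ.* + s) ℤ.^ suc ℓ))

nCk≢0 : ∀ {n k} → k ℕ.≤ n → NonZero (n C k)
nCk≢0 {n} {k} k≤n = ℕ.>-nonZero (subst (0 ℕ.<_) (sym (nCk≡n!/k![n-k]! k≤n))
  (ℕ÷.m≥n⇒m/n>0 {n !} {k ! ℕ.* (n ℕ.∸ k) !} (ℕ∣.∣⇒≤ (k![n∸k]!∣n! k≤n))))
  where instance
    _ = ℕₚ._!≢0 n
    _ = ℕₚ._!*_!≢0 k (n ℕ.∸ k)

central : ℕ → ℕ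
central ℓ = ℓ C ⌊ ℓ /2⌋

central≢0 : ∀ ℓ → NonZero (central ℓ)
central≢0 ℓ = nCk≢0 (ℕₚ.⌊n/2⌋≤n ℓ)

γ : (ℓ : ℕ) (m : ℤ) (M b : ℕ) .{{_ : NonZero b}} → Series
γ ℓ m M b n =
  rankinCohen (+ 3 / 2) (½ + ι (+ j)) ⌊ ℓ /2⌋ (V b 𝓗-series) (θ j m M) n
    + (b ^-½) * ½ ^ (1 ℕ.+ ℓ) * ι (+ central ℓ) * Λ ℓ m M b n
  where
  j = ℓ ℕ.% 2

α : (ℓ : ℕ) (m : ℤ) (M b : ℕ) .{{_ : NonZero b}} → ℕ → ℚ
α ℓ m M b n = _/_ (+ 1) (central ℓ) {{central≢0 ℓ}} * γ ℓ m M b n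

-- α at p ^ (r - 2), taken to be 0 when the exponent is negative.
α[p^r-2] : (ℓ : ℕ) (m : ℤ) (M b : ℕ) .{{_ : NonZero b}} → (p r : ℕ) → ℚ
α[p^r-2] ℓ m M b p (suc (suc r)) = α ℓ m M b (p ℕ.^ r)
α[p^r-2] ℓ m M b p _             = 0ℚ

-- ε(p ^ r); only meaningful for even r.
ε : (p r : ℕ) → ℤ
ε p r = jacobi -1ℤ (p ℕ.^ (r ℕ./ 2))

{-# OPTIONS --safe #-}

-- Dropping the condition p ∤ t from 𝓗 gives Σ_t H((pʳ - t²)/b) tᵏ over t ≡ m (mod 4). Up to a factor, the n-th
-- coefficient of the bracket [𝓗|V_b , θ]_ν is Σ_t H((n - t²)/b) t W_ν(t², n - t²), where the polynomial W_ν comes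
-- from (t + √(t² - n))^(2ν+2), and 2 (4t²)^κ = Σ_μ T(2κ+1, μ) n^μ W_(κ-μ) turns these coefficients into the moment above.
--
-- The terms with t = pq are reduced to level p^(r-2) by H(p²N) = p H(N) for bN = p^(r-2) - q² > 0, while for N = 0 one
-- has H(0) = -1/12, which gives the term with δ_(2∣r). To prove this relation, count the matrices of determinant p
-- between reduced forms: each form of discriminant -N has p + 1 transforms, one for each line of the plane over 𝔽ₚ, of
-- discriminant -p²N, and the transforms divisible by p correspond to the zeros of the form on the projective line over
-- 𝔽ₚ. If p ∤ q there are two of them, since -N is then a nonzero square modulo p, and induction on r covers p ∣ q.
--
-- In Λ the solutions of t² - bs² = pʳ divisible by p reproduce Λ at p^(r-2), and the only other one is
-- t - √b s = 1, t = (pʳ + 1)/2; its residue modulo 4 is (2/pʳ), by the supplementary laws for (-1/p) and (2/p).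
-- If pʳ ≡ 3 (mod 4), then pʳ - t² ≡ 2 (mod 4) for odd t, and all class numbers vanish.
module Submission where

-- The factor p^(k-2μ+1) is p^ℓ · p with ℓ = k - 2μ: a term of the bracket is homogeneous of degree
-- ℓ in t = pq, and H(p²N) = p H(N). The same power appears in (t - √b s)^(ℓ+1) when t and s are
-- divided by p, so the Λ-parts of the two α cancel up to one solution. Two properties of b = 1, 4
-- enter. Since b = c², t² - bs² splits over ℤ and its values pʳ come from factorisations of pʳ.
-- Since b divides 8, hence p² - 1, multiplication by p² neither creates nor destroys divisibility
-- by b. For odd ℓ both weights are 3/2, so both binomials of the bracket have upper argument ν +
-- 1/2; their products are proportional to the coefficients with odd lower index in row 2ν + 2,
-- which is why W comes from an even power of t + w. The T(k, μ) are ballot numbers: passing from k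
-- to k + 2 convolves them with (1, 2, 1), which matches the three-term recurrence of W. Class
-- numbers are given as weighted lists of reduced forms. As 1/ω is 2 divided by the order of the
-- stabiliser over 2·2, normalised so that weighted stabilisers have size 2, weighted counts of
-- equivalences are 0 or 2.

open import Defs

-- Finite sums over lists and indicator functions

module FiniteSums where

  open import Algebra.Bundles using (CommutativeMonoid)
  import Algebra.Properties.CommutativeMonoid.Sum as Sum
  import Data.Fin.Base as Fin
  open import Data.Integer.Base as ℤ using (ℤ; +_; -[1+_]; ∣_∣)
  import Data.Integer.Properties as ℤₚ
  open import Data.Integer.Tactic.RingSolver using (solve-∀)
  open import Data.List.Base using (List; []; _∷_; foldr; map; upTo; applyUpTo)
  open import Data.List.Membership.Propositional using (_∈_)
  open import Data.List.Membership.Propositional.Properties using (∈-upTo⁺; ∈-upTo⁻; ∈-map⁺; ∈-map⁻)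
  open import Data.List.Relation.Unary.All as All using ([]; _∷_)
  open import Data.List.Relation.Unary.AllPairs using ([]; _∷_)
  open import Data.List.Relation.Unary.Any using (here; there)
  open import Data.List.Relation.Unary.Unique.Propositional using (Unique)
  import Data.List.Relation.Unary.Unique.Propositional.Properties as Uniqueₚ
  open import Data.Nat.Base as ℕ using (ℕ; zero; suc; s≤s)
  import Data.Nat.Properties as ℕₚ
  open import Data.Product.Base using (_×_; _,_)
  open import Data.Rational.Base using (ℚ; 0ℚ; 1ℚ; _+_; _*_; _-_; -_)
  open import Data.Rational.Properties as ℚₚ hiding (_≟_)
  open import Data.Sum.Base using (_⊎_; inj₁; inj₂)
  open import Function.Base using (_∘_)
  open import Relation.Binary.Definitions using (DecidableEquality)
  open import Relation.Binary.PropositionalEquality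
  open import Relation.Nullary using (¬_; Dec; yes; no; contradiction)

  δ-yes : ∀ {P : Set} (P? : Dec P) → P → δ P? ≡ 1ℚ
  δ-yes (yes _) _ = refl
  δ-yes (no ¬p) p = contradiction p ¬p

  δ-no : ∀ {P : Set} (P? : Dec P) → ¬ P → δ P? ≡ 0ℚ
  δ-no (yes p) ¬p = contradiction p ¬p
  δ-no (no _)  _  = refl

  δ-cong : ∀ {P Q : Set} (P? : Dec P) (Q? : Dec Q) → (P → Q) → (Q → P) → δ P? ≡ δ Q?
  δ-cong (yes p) Q? f g = sym (δ-yes Q? (f p))
  δ-cong (no ¬p) Q? f g = sym (δ-no Q? (¬p ∘ g))

  δ*-cong : ∀ {P : Set} (P? : Dec P) {x y} → (P → x ≡ y) → δ P? * x ≡ δ P? * y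
  δ*-cong (yes p) f = cong (1ℚ *_) (f p)
  δ*-cong (no _) {x} {y} f = trans (*-zeroˡ x) (sym (*-zeroˡ y))

  δ*-zero : ∀ {P : Set} (P? : Dec P) {x} → (P → x ≡ 0ℚ) → δ P? * x ≡ 0ℚ
  δ*-zero P? f = trans (δ*-cong P? f) (*-zeroʳ (δ P?))

  δ-no-* : ∀ {P : Set} (P? : Dec P) x → ¬ P → δ P? * x ≡ 0ℚ
  δ-no-* P? x ¬p = δ*-zero P? λ p → contradiction p ¬p

  δ-yes-* : ∀ {P : Set} (P? : Dec P) x → P → δ P? * x ≡ x
  δ-yes-* P? x p = trans (cong (_* x) (δ-yes P? p)) (*-identityˡ x)

  ∑ : ∀ {A : Set} → List A → (A → ℚ) → ℚ
  ∑ xs f = foldr _+_ 0ℚ (map f xs)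

  module _ {A : Set} where

    ∑-cong : ∀ (xs : List A) {f g} → (∀ {x} → x ∈ xs → f x ≡ g x) → ∑ xs f ≡ ∑ xs g
    ∑-cong [] eq = refl
    ∑-cong (x ∷ xs) eq = cong₂ _+_ (eq (here refl)) (∑-cong xs (eq ∘ there))

    ∑-zero : ∀ (xs : List A) {f} → (∀ {x} → x ∈ xs → f x ≡ 0ℚ) → ∑ xs f ≡ 0ℚ
    ∑-zero [] eq = refl
    ∑-zero (x ∷ xs) eq = trans (cong₂ _+_ (eq (here refl)) (∑-zero xs (eq ∘ there))) (+-identityˡ 0ℚ)

    ∑-+ : ∀ (xs : List A) f g → ∑ xs (λ x → f x + g x) ≡ ∑ xs f + ∑ xs g
    ∑-+ [] f g = refl
    ∑-+ (x ∷ xs) f g = trans (cong₂ _+_ {x = f x + g x} refl (∑-+ xs f g)) (interchange (f x) (g x) (∑ xs f) (∑ xs g))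
      where
      open import Algebra.Properties.CommutativeSemigroup
        (CommutativeMonoid.commutativeSemigroup +-0-commutativeMonoid) using (interchange)

    ∑-*ˡ : ∀ c (xs : List A) f → ∑ xs (λ x → c * f x) ≡ c * ∑ xs f
    ∑-*ˡ c [] f = sym (*-zeroʳ c)
    ∑-*ˡ c (x ∷ xs) f = trans (cong₂ _+_ {x = c * f x} refl (∑-*ˡ c xs f)) (sym (*-distribˡ-+ c (f x) (∑ xs f)))

    ∑-*ʳ : ∀ (xs : List A) f c → ∑ xs (λ x → f x * c) ≡ ∑ xs f * c
    ∑-*ʳ xs f c = trans (∑-cong xs λ {x} _ → *-comm (f x) c) (trans (∑-*ˡ c xs f) (*-comm c (∑ xs f)))

    ∑-neg : ∀ (xs : List A) f → ∑ xs (λ x → - f x) ≡ - ∑ xs f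
    ∑-neg [] f = refl
    ∑-neg (x ∷ xs) f = trans (cong₂ _+_ {x = - f x} refl (∑-neg xs f)) (sym (neg-distrib-+ (f x) (∑ xs f)))

    ∑-- : ∀ (xs : List A) f g → ∑ xs (λ x → f x - g x) ≡ ∑ xs f - ∑ xs g
    ∑-- xs f g = trans (∑-+ xs f (λ x → - g x)) (cong₂ _+_ {x = ∑ xs f} refl (∑-neg xs g))

    -- The decision procedures d are arbitrary, so that the indicators met in practice qualify.
    ∑-δ : ∀ {xs : List A} {x : A} (f : A → ℚ) (d : ∀ y → Dec (y ≡ x)) → Unique xs → x ∈ xs →
          ∑ xs (λ y → δ (d y) * f y) ≡ f x
    ∑-δ {y ∷ ys} f d (y∉ ∷ _) (here refl) = trans
      (cong₂ _+_ (δ-yes-* (d y) (f y) refl)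
        (∑-zero ys λ {z} z∈ → δ-no-* (d z) (f z) λ z≡y → All.lookup y∉ z∈ (sym z≡y)))
      (+-identityʳ (f y))
    ∑-δ {y ∷ ys} f d (y∉ ∷ u) (there x∈) = trans
      (cong₂ _+_ (δ-no-* (d y) (f y) λ y≡x → All.lookup y∉ x∈ y≡x) (∑-δ f d u x∈)) (+-identityˡ _)

  ∑-swap : ∀ {A B : Set} (xs : List A) (ys : List B) (f : A → B → ℚ) →
           ∑ xs (λ x → ∑ ys (f x)) ≡ ∑ ys (λ y → ∑ xs (λ x → f x y))
  ∑-swap [] ys f = sym (∑-zero ys λ _ → refl)
  ∑-swap (x ∷ xs) ys f = trans (cong₂ _+_ {x = ∑ ys (f x)} refl (∑-swap xs ys f)) (sym (∑-+ ys (f x) _))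

  ∑-map : ∀ {A B : Set} (g : A → B) (xs : List A) f → ∑ (map g xs) f ≡ ∑ xs (f ∘ g)
  ∑-map g [] f = refl
  ∑-map g (x ∷ xs) f = cong₂ _+_ {x = f (g x)} refl (∑-map g xs f)

  -- Insert the indicators of `y ≡ φ x` and `x ≡ ψ y` and interchange the two sums. The maps have to
  -- be inverse to each other only where the terms are nonzero, so ranges of summation that exceed
  -- the support do no harm.
  ∑-reindex : ∀ {A B : Set} (_≟A_ : DecidableEquality A) (_≟B_ : DecidableEquality B)
    {xs : List A} {ys : List B} {f : A → ℚ} {g : B → ℚ} (φ : A → B) (ψ : B → A) →
    Unique xs → Unique ys →
    (∀ {x} → x ∈ xs → f x ≡ 0ℚ ⊎ (φ x ∈ ys × ψ (φ x) ≡ x × f x ≡ g (φ x))) →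
    (∀ {y} → y ∈ ys → g y ≡ 0ℚ ⊎ (ψ y ∈ xs × φ (ψ y) ≡ y × f (ψ y) ≡ g y)) →
    ∑ xs f ≡ ∑ ys g
  ∑-reindex _≟A_ _≟B_ {xs} {ys} {f} {g} φ ψ uxs uys to from = begin
    ∑ xs f                                                          ≡⟨ ∑-cong xs row ⟩
    ∑ xs (λ x → ∑ ys λ y → δ (y ≟B φ x) * (δ (x ≟A ψ y) * f x))     ≡⟨ ∑-swap xs ys _ ⟩
    ∑ ys (λ y → ∑ xs λ x → δ (y ≟B φ x) * (δ (x ≟A ψ y) * f x))     ≡⟨ ∑-cong ys column ⟩
    ∑ ys g                                                          ∎
    where
    open ≡-Reasoning
    row : ∀ {x} → x ∈ xs → f x ≡ ∑ ys λ y → δ (y ≟B φ x) * (δ (x ≟A ψ y) * f x)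
    row {x} x∈ with to x∈
    ... | inj₁ fx≡0 = trans fx≡0 (sym (∑-zero ys λ {y} _ →
            δ*-zero (y ≟B φ x) λ _ → δ*-zero (x ≟A ψ y) λ _ → fx≡0))
    ... | inj₂ (φx∈ , ψφ , _) = sym (trans (∑-δ (λ y → δ (x ≟A ψ y) * f x) (_≟B φ x) uys φx∈)
            (δ-yes-* (x ≟A ψ (φ x)) (f x) (sym ψφ)))
    column : ∀ {y} → y ∈ ys → (∑ xs λ x → δ (y ≟B φ x) * (δ (x ≟A ψ y) * f x)) ≡ g y
    column {y} y∈ = trans (∑-cong xs entry) (collapse (from y∈))
      where
      entry : ∀ {x} → x ∈ xs → δ (y ≟B φ x) * (δ (x ≟A ψ y) * f x) ≡ δ (x ≟A ψ y) * (δ (y ≟B φ x) * g y)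
      entry {x} x∈ = trans
        (δ*-cong (y ≟B φ x) λ y≡ → δ*-cong (x ≟A ψ y) λ x≡ → value x∈ y≡ x≡)
        (swap (δ (y ≟B φ x)) (δ (x ≟A ψ y)) (g y))
        where
        swap : ∀ a b c → a * (b * c) ≡ b * (a * c)
        swap a b c = trans (sym (*-assoc a b c)) (trans (cong (_* c) (*-comm a b)) (*-assoc b a c))
        -- At a matching pair one hypothesis may report a zero term and the other the equality; in
        -- every combination the two values agree.
        value : ∀ {x} → x ∈ xs → y ≡ φ x → x ≡ ψ y → f x ≡ g y
        value x∈ y≡ x≡ with to x∈ | from y∈
        ... | inj₂ (_ , _ , eq) | _                = trans eq (cong g (sym y≡))
        ... | inj₁ _ | inj₂ (_ , _ , eq)           = trans (cong f x≡) eq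
        ... | inj₁ fx≡0 | inj₁ gy≡0                = trans fx≡0 (sym gy≡0)
      collapse : g y ≡ 0ℚ ⊎ (ψ y ∈ xs × φ (ψ y) ≡ y × f (ψ y) ≡ g y) → (∑ xs λ x → δ (x ≟A ψ y) * (δ (y ≟B φ x) * g y)) ≡ g y
      collapse (inj₁ gy≡0) = trans (∑-zero xs λ {x} _ → δ*-zero (x ≟A ψ y) λ _ → δ*-zero (y ≟B φ x) λ _ → gy≡0) (sym gy≡0)
      collapse (inj₂ (ψy∈ , φψ , _)) = trans (∑-δ (λ x → δ (y ≟B φ x) * g y) (_≟A ψ y) uxs ψy∈) (δ-yes-* (y ≟B φ (ψ y)) (g y) (sym φψ))

  ∑-support : ∀ {A : Set} (_≟A_ : DecidableEquality A) {xs ys : List A} {f g : A → ℚ} →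
    Unique xs → Unique ys →
    (∀ {x} → x ∈ xs → f x ≡ 0ℚ ⊎ (x ∈ ys × f x ≡ g x)) →
    (∀ {x} → x ∈ ys → g x ≡ 0ℚ ⊎ (x ∈ xs × f x ≡ g x)) →
    ∑ xs f ≡ ∑ ys g
  ∑-support _≟A_ uxs uys to from = ∑-reindex _≟A_ _≟A_ (λ x → x) (λ x → x) uxs uys (λ x∈ → insert (to x∈)) (λ x∈ → insert (from x∈))
    where
    insert : ∀ {A B C D : Set} {x : B} → A ⊎ (C × D) → A ⊎ (C × x ≡ x × D)
    insert (inj₁ a) = inj₁ a
    insert (inj₂ (c , a)) = inj₂ (c , refl , a)

  Σ≡∑ : ∀ n f → Σ[0⋯ n ] f ≡ ∑ (upTo (suc n)) f
  Σ≡∑ n f = lemma (suc n) f (λ i → i)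
    where
    -- Generalised over `g` because the tail of `upTo (suc n)` is an `applyUpTo suc`, not an `upTo`.
    lemma : ∀ m (f : ℕ → ℚ) (g : ℕ → ℕ) →
      Sum.sum ℚₚ.+-0-commutativeMonoid {m} (f ∘ g ∘ Fin.toℕ) ≡ ∑ (applyUpTo g m) f
    lemma zero    f g = refl
    lemma (suc m) f g = cong (λ z → f (g 0) + z) (lemma m f (g ∘ suc))

  ∈-upTo⁺′ : ∀ {n i} → i ℕ.≤ n → i ∈ upTo (suc n)
  ∈-upTo⁺′ i≤n = ∈-upTo⁺ (s≤s i≤n)

  ∈-upTo⁻′ : ∀ {n i} → i ∈ upTo (suc n) → i ℕ.≤ n
  ∈-upTo⁻′ i∈ = ℕₚ.≤-pred (∈-upTo⁻ i∈)

  [±_] : ℕ → List ℤ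
  [± n ] = map (λ i → + i ℤ.- + n) (upTo (suc (2 ℕ.* n)))

  Σ±≡∑ : ∀ n f → Σ[± n ] f ≡ ∑ [± n ] f
  Σ±≡∑ n f = trans (Σ≡∑ (2 ℕ.* n) (λ i → f (+ i ℤ.- + n))) (sym (∑-map (λ i → + i ℤ.- + n) (upTo (suc (2 ℕ.* n))) f))

  [±]-unique : ∀ n → Unique [± n ]
  [±]-unique n = Uniqueₚ.map⁺ (λ {i} {j} eq → ℤₚ.+-injective
    (trans (shift (+ i) (+ n)) (trans (cong (ℤ._+ + n) eq) (sym (shift (+ j) (+ n)))))) (Uniqueₚ.upTo⁺ _)
    where
    shift : ∀ i n → i ≡ (i ℤ.- n) ℤ.+ n
    shift = solve-∀

  ∈-[±]⁺ : ∀ n {t} → ∣ t ∣ ℕ.≤ n → t ∈ [± n ]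
  ∈-[±]⁺ n {t} t≤n = subst (_∈ [± n ]) (t≡ t t≤n) (∈-map⁺ _ (∈-upTo⁺′ (bound t t≤n)))
    where
    index : ℤ → ℕ
    index (+ m)    = n ℕ.+ m
    index -[1+ m ] = n ℕ.∸ suc m
    bound : ∀ t → ∣ t ∣ ℕ.≤ n → index t ℕ.≤ 2 ℕ.* n
    bound (+ m) m≤n = ℕₚ.+-monoʳ-≤ n (ℕₚ.≤-trans m≤n (ℕₚ.m≤m+n n 0))
    bound -[1+ m ] _ = ℕₚ.≤-trans (ℕₚ.m∸n≤m n (suc m)) (ℕₚ.m≤m+n n _)
    cancel : ∀ n m → (n ℤ.+ m) ℤ.- n ≡ m
    cancel = solve-∀
    t≡ : ∀ t → ∣ t ∣ ℕ.≤ n → + index t ℤ.- + n ≡ t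
    t≡ (+ m) _ = trans (cong (ℤ._- + n) (ℤₚ.pos-+ n m)) (cancel (+ n) (+ m))
    t≡ -[1+ m ] m<n = trans (cong (ℤ._- + n) (trans (sym (ℤₚ.⊖-≥ m<n)) (sym (ℤₚ.m-n≡m⊖n n (suc m))))) (cancel (+ n) -[1+ m ])

  ∈-[±]⁻ : ∀ n {t} → t ∈ [± n ] → ∣ t ∣ ℕ.≤ n
  ∈-[±]⁻ n t∈ with ∈-map⁻ (λ i → + i ℤ.- + n) t∈
  ... | i , i∈ , refl = subst (ℕ._≤ n) (sym (cong ∣_∣ (ℤₚ.m-n≡m⊖n i n))) (bound (ℕₚ.≤-total n i))
    where
    i≤2n : i ℕ.≤ n ℕ.+ n
    i≤2n = subst (λ z → i ℕ.≤ n ℕ.+ z) (ℕₚ.+-identityʳ n) (∈-upTo⁻′ i∈)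
    bound : n ℕ.≤ i ⊎ i ℕ.≤ n → ∣ i ℤ.⊖ n ∣ ℕ.≤ n
    bound (inj₁ n≤i) = subst (ℕ._≤ n) (sym (cong ∣_∣ (ℤₚ.⊖-≥ n≤i))) (ℕₚ.m≤n+o⇒m∸n≤o i n i≤2n)
    bound (inj₂ i≤n) = subst (ℕ._≤ n) (sym (trans (ℤₚ.∣m⊖n∣≡∣n⊖m∣ i n) (cong ∣_∣ (ℤₚ.⊖-≥ i≤n)))) (ℕₚ.m∸n≤m n i)

  Σ-cong : ∀ n {f g} → (∀ {i} → i ℕ.≤ n → f i ≡ g i) → Σ[0⋯ n ] f ≡ Σ[0⋯ n ] g
  Σ-cong n {f} {g} eq = trans (Σ≡∑ n f) (trans (∑-cong (upTo (suc n)) λ i∈ → eq (∈-upTo⁻′ i∈)) (sym (Σ≡∑ n g)))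

  Σ-*ˡ : ∀ c n f → Σ[0⋯ n ] (λ i → c * f i) ≡ c * Σ[0⋯ n ] f
  Σ-*ˡ c n f = trans (Σ≡∑ n (λ i → c * f i)) (trans (∑-*ˡ c (upTo (suc n)) f) (cong (c *_) (sym (Σ≡∑ n f))))

  Σ-+ : ∀ n f g → Σ[0⋯ n ] (λ i → f i + g i) ≡ Σ[0⋯ n ] f + Σ[0⋯ n ] g
  Σ-+ n f g = trans (Σ≡∑ n (λ i → f i + g i)) (trans (∑-+ (upTo (suc n)) f g) (sym (cong₂ _+_ (Σ≡∑ n f) (Σ≡∑ n g))))

-- The embedding of the integers in the rationals, and values of H

module Rationals where

  open import Data.Integer.Base as ℤ using (ℤ; +_; 0ℤ; 1ℤ)
  import Data.Integer.Properties as ℤₚ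
  open import Data.Integer.Tactic.RingSolver using (solve-∀)
  open import Data.Maybe.Base using (Maybe; just; nothing)
  open import Data.Nat.Base as ℕ using (ℕ; zero; suc; NonZero)
  open import Data.Rational.Base as ℚ using (ℚ; mkℚ; 0ℚ; _+_; _*_; _-_; -_; _/_; toℚᵘ; fromℚᵘ)
  open import Data.Rational.Properties
  open import Data.Rational.Unnormalised.Base as ℚᵘ using (mkℚᵘ; *≡*)
  import Data.Rational.Unnormalised.Properties as ℚᵘₚ
  open import Level using (0ℓ)
  open import Relation.Binary.PropositionalEquality
  open import Relation.Nullary using (yes; no; contradiction)
  import Tactic.RingSolver.Core.AlmostCommutativeRing as ACR

  ringℚ : ACR.AlmostCommutativeRing 0ℓ 0ℓ
  ringℚ = ACR.fromCommutativeRing +-*-commutativeRing zero?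
    where
    zero? : ∀ q → Maybe (0ℚ ≡ q)
    zero? q with 0ℚ ≟ q
    ... | yes p = just p
    ... | no  _ = nothing

  /≡fromℚᵘ : ∀ i d → i / suc d ≡ fromℚᵘ (mkℚᵘ i d)
  /≡fromℚᵘ (+ n)        d = refl
  /≡fromℚᵘ ℤ.-[1+ n ]   d = refl

  -- `_/_` divides by a gcd that does not compute on variables. Equations between such fractions are
  -- therefore checked on unnormalised ones, where they are polynomial identities over ℤ.
  toℚᵘ-/ : ∀ i d → toℚᵘ (i / suc d) ℚᵘ.≃ mkℚᵘ i d
  toℚᵘ-/ i d = ℚᵘₚ.≃-trans (ℚᵘₚ.≃-reflexive (cong toℚᵘ (/≡fromℚᵘ i d))) (toℚᵘ-fromℚᵘ (mkℚᵘ i d))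

  ι-+ : ∀ i j → ι (i ℤ.+ j) ≡ ι i + ι j
  ι-+ i j = toℚᵘ-injective (begin
    toℚᵘ (ι (i ℤ.+ j))            ≈⟨ toℚᵘ-/ (i ℤ.+ j) 0 ⟩
    mkℚᵘ (i ℤ.+ j) 0              ≈⟨ *≡* (e i j) ⟩
    mkℚᵘ i 0 ℚᵘ.+ mkℚᵘ j 0        ≈⟨ ℚᵘₚ.+-cong (toℚᵘ-/ i 0) (toℚᵘ-/ j 0) ⟨
    toℚᵘ (ι i) ℚᵘ.+ toℚᵘ (ι j)    ≈⟨ toℚᵘ-homo-+ (ι i) (ι j) ⟨
    toℚᵘ (ι i + ι j)              ∎)
    where
    open ℚᵘₚ.≃-Reasoning
    e : ∀ i j → (i ℤ.+ j) ℤ.* 1ℤ ≡ (i ℤ.* 1ℤ ℤ.+ j ℤ.* 1ℤ) ℤ.* 1ℤ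
    e = solve-∀

  ι-* : ∀ i j → ι (i ℤ.* j) ≡ ι i * ι j
  ι-* i j = toℚᵘ-injective (begin
    toℚᵘ (ι (i ℤ.* j))            ≈⟨ toℚᵘ-/ (i ℤ.* j) 0 ⟩
    mkℚᵘ i 0 ℚᵘ.* mkℚᵘ j 0        ≈⟨ ℚᵘₚ.*-cong (toℚᵘ-/ i 0) (toℚᵘ-/ j 0) ⟨
    toℚᵘ (ι i) ℚᵘ.* toℚᵘ (ι j)    ≈⟨ toℚᵘ-homo-* (ι i) (ι j) ⟨
    toℚᵘ (ι i * ι j)              ∎)
    where
    open ℚᵘₚ.≃-Reasoning

  ι-neg : ∀ i → ι (ℤ.- i) ≡ - ι i
  ι-neg i = begin
    ι (ℤ.- i)                    ≡⟨ e (ι i) (ι (ℤ.- i)) ⟩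
    (ι i + ι (ℤ.- i)) - ι i      ≡⟨ cong (_- ι i) (ι-+ i (ℤ.- i)) ⟨
    ι (i ℤ.- i) - ι i            ≡⟨ cong (λ z → ι z - ι i) (ℤₚ.+-inverseʳ i) ⟩
    0ℚ - ι i                     ≡⟨ +-identityˡ (- ι i) ⟩
    - ι i                        ∎
    where
    open ≡-Reasoning
    import Tactic.RingSolver as RS
    e : ∀ x y → y ≡ (x + y) - x
    e = RS.solve-∀ ringℚ

  ι-- : ∀ i j → ι (i ℤ.- j) ≡ ι i - ι j
  ι-- i j = trans (ι-+ i (ℤ.- j)) (cong (λ z → ι i + z) (ι-neg j))

  ι-injective : ∀ {i j} → ι i ≡ ι j → i ≡ j
  ι-injective {i} {j} eq with ℚᵘₚ.≃-trans (ℚᵘₚ.≃-sym (toℚᵘ-/ i 0)) (ℚᵘₚ.≃-trans (ℚᵘₚ.≃-reflexive (cong toℚᵘ eq)) (toℚᵘ-/ j 0))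
  ... | *≡* e = ℤₚ.*-cancelʳ-≡ i j 1ℤ e

  ι-^ : ∀ i n → ι (i ℤ.^ n) ≡ ι i ^ n
  ι-^ i zero    = refl
  ι-^ i (suc n) = trans (ι-* i (i ℤ.^ n)) (cong (ι i *_) (ι-^ i n))

  ι*/ : ∀ i d .{{_ : NonZero d}} → ι (+ d) * (i / d) ≡ ι i
  ι*/ i d@(suc d-1) = toℚᵘ-injective (begin
    toℚᵘ (ι (+ d) * (i / d))            ≈⟨ toℚᵘ-homo-* (ι (+ d)) (i / d) ⟩
    toℚᵘ (ι (+ d)) ℚᵘ.* toℚᵘ (i / d)    ≈⟨ ℚᵘₚ.*-cong (toℚᵘ-/ (+ d) 0) (toℚᵘ-/ i d-1) ⟩
    mkℚᵘ (+ d) 0 ℚᵘ.* mkℚᵘ i d-1        ≈⟨ *≡* (e (+ d) i) ⟩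
    mkℚᵘ i 0                            ≈⟨ toℚᵘ-/ i 0 ⟨
    toℚᵘ (ι i)                          ∎)
    where
    open ℚᵘₚ.≃-Reasoning
    e : ∀ d i → (d ℤ.* i) ℤ.* 1ℤ ≡ i ℤ.* (1ℤ ℤ.* d)
    e = solve-∀

  ι≢0 : ∀ {i} → i ≢ 0ℤ → ι i ≢ 0ℚ
  ι≢0 i≢0 eq = i≢0 (ι-injective {j = 0ℤ} eq)

  *-cancelˡ : ∀ {x y z} → x ≢ 0ℚ → x * y ≡ x * z → y ≡ z
  *-cancelˡ {x} {y} {z} x≢0 eq = begin
    y                   ≡⟨ e y ⟨
    ℚ.1/ x * x * y      ≡⟨ *-assoc (ℚ.1/ x) x y ⟩
    ℚ.1/ x * (x * y)    ≡⟨ cong (ℚ.1/ x *_) eq ⟩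
    ℚ.1/ x * (x * z)    ≡⟨ *-assoc (ℚ.1/ x) x z ⟨
    ℚ.1/ x * x * z      ≡⟨ e z ⟩
    z                   ∎
    where
    open ≡-Reasoning
    instance
      _ = ℚ.≢-nonZero x≢0
    e : ∀ y → ℚ.1/ x * x * y ≡ y
    e y = trans (cong (_* y) (*-inverseˡ x)) (*-identityˡ y)

  ι-suc≢0 : ∀ n → ι (+ suc n) ≢ 0ℚ
  ι-suc≢0 n = ι≢0 {+ suc n} λ ()

  ι+≢0 : ∀ n .{{_ : NonZero n}} → ι (+ n) ≢ 0ℚ
  ι+≢0 (suc n) = ι-suc≢0 n

  -- `H` matches on the normalised fraction and is 0 except at natural numbers; a natural value `n`
  -- of `i / d` would give `i ≡ + (d * n)`.
  H-cases : ∀ i d .{{_ : NonZero d}} → (∀ n → i ≢ + (d ℕ.* n)) → H (i / d) ≡ 0ℚ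
  H-cases i d ndiv = go (i / d) refl
    where
    go : ∀ q → q ≡ i / d → H q ≡ 0ℚ
    go q@(mkℚ (+ n) 0 c) eq = contradiction
      (ι-injective (trans (sym (ι*/ i d)) (trans (cong (λ z → ι (+ d) * z) (trans (sym eq) (sym (↥p/↧p≡p q))))
        (trans (sym (ι-* (+ d) (+ n))) (cong ι (sym (ℤₚ.pos-* d n)))))))
      (ndiv n)
    go (mkℚ ℤ.-[1+ n ] zero c)      eq = refl
    go (mkℚ ℤ.-[1+ n ] (suc _) c)   eq = refl
    go (mkℚ (+ zero) (suc _) c)     eq = refl
    go (mkℚ (+ suc _) (suc _) c)    eq = refl

  *d/d : ∀ d .{{_ : NonZero d}} n → + (d ℕ.* n) / d ≡ ι (+ n)
  *d/d d n = *-cancelˡ (ι+≢0 d) (trans (ι*/ (+ (d ℕ.* n)) d) (trans (cong ι (ℤₚ.pos-* d n)) (ι-* (+ d) (+ n))))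

  -- `ι (+ n)` does not reduce to a constructor for variable `n`; `H` computes once it is rewritten
  -- as the explicit normal form `mkℚ (+ n) 0`.
  H-ι : ∀ n .{{_ : NonZero n}} → H (ι (+ n)) ≡ classNumber n
  H-ι n@(suc m) = lemma (ι (+ n)) refl
    where
    lemma : ∀ q → q ≡ ι (+ n) → H q ≡ classNumber n
    lemma q eq = trans (cong H (trans eq (↥p/↧p≡p (mkℚ (+ n) 0 (c n))))) refl
      where
      import Data.Nat.Coprimality as C
      c : ∀ n → C.Coprime n 1
      c n = C.sym (C.1-coprimeTo n)

-- Counting by complete lists without repetition

module Enumerations where

  open import Data.Integer.Base using (+_)
  import Data.Integer.Properties as ℤₚ
  open import Data.List.Base using (List; []; _∷_; _++_; map; length)
  import Data.List.Properties as Listₚ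
  open import Data.List.Membership.Propositional using (_∈_)
  open import Data.List.Membership.Propositional.Properties using (∈-∃++; ∈-++⁺ˡ; ∈-++⁺ʳ; ∈-++⁻; ∈-map⁺; ∈-map⁻)
  open import Data.List.Relation.Unary.All as All using ([]; _∷_)
  open import Data.List.Relation.Unary.AllPairs using ([]; _∷_)
  open import Data.List.Relation.Unary.Any using (here; there)
  open import Data.List.Relation.Unary.Unique.Propositional using (Unique)
  import Data.List.Relation.Unary.Unique.Propositional.Properties as Uniqueₚ
  open import Data.Nat.Base as ℕ using (ℕ; suc; z≤n; s≤s)
  import Data.Nat.Properties as ℕₚ
  open import Data.Product.Base using (∃-syntax; _×_; _,_; proj₁; proj₂)
  open import Data.Rational.Base using (ℚ; _+_)
  open import Data.Sum.Base using (inj₁; inj₂)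
  open import Relation.Binary.PropositionalEquality
  open import Relation.Nullary using (¬_; contradiction)
  open FiniteSums
  open Rationals

  -- The sets to be counted consist of integer matrices and have no finite ambient type, so
  -- finiteness is carried by an explicit list. The size is rational because it is multiplied by the
  -- weights `1/ω`.
  record Enumeration {A : Set} (P : A → Set) : Set where
    field
      list     : List A
      unique   : Unique list
      sound    : ∀ {x} → x ∈ list → P x
      complete : ∀ {x} → P x → x ∈ list

    size : ℚ
    size = ι (+ length list)

  open Enumeration public

  empty : ∀ {A : Set} {P : A → Set} → (∀ {x} → ¬ P x) → Enumeration P
  empty ¬p = record { list = [] ; unique = [] ; sound = λ () ; complete = λ p → contradiction p ¬p }

  -- Pigeonhole: the partner of the head is removed from `ys`, and injectivity keeps the partners of
  -- the other elements in what is left. `R` is a relation and not a function, so that it can carry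
  -- the conditions under which it is injective.
  length-≤ : ∀ {A B : Set} (R : A → B → Set) → (∀ {x x′ y} → R x y → R x′ y → x ≡ x′) →
    ∀ {xs : List A} (ys : List B) → Unique xs → (∀ {x} → x ∈ xs → ∃[ y ] (y ∈ ys × R x y)) →
    length xs ℕ.≤ length ys
  length-≤ R inj {[]}     ys u f = z≤n
  length-≤ R inj {x ∷ xs} ys (x∉ ∷ u) f with f (here refl)
  ... | y , y∈ , r with ∈-∃++ y∈
  ...   | as , bs , refl = subst (suc (length xs) ℕ.≤_) (sym len) (s≤s (length-≤ R inj (as ++ bs) u rest))
    where
    len : length (as ++ y ∷ bs) ≡ suc (length (as ++ bs))
    len = trans (Listₚ.length-++ as) (trans (ℕₚ.+-suc (length as) (length bs)) (cong suc (sym (Listₚ.length-++ as))))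
    rest : ∀ {x′} → x′ ∈ xs → ∃[ y ] (y ∈ as ++ bs × R x′ y)
    rest {x′} x′∈ with f (there x′∈)
    ... | y′ , y′∈ , r′ with ∈-++⁻ as y′∈
    ...   | inj₁ y′∈as           = y′ , ∈-++⁺ˡ y′∈as , r′
    ...   | inj₂ (there y′∈bs)   = y′ , ∈-++⁺ʳ as y′∈bs , r′
    ...   | inj₂ (here refl)     = contradiction (inj r r′) (All.lookup x∉ x′∈)

  module _ {A B : Set} {P : A → Set} {P′ : B → Set} (E : Enumeration P) (E′ : Enumeration P′) where

    size-≡ : (R : A → B → Set) →
      (∀ {x x′ y} → R x y → R x′ y → x ≡ x′) → (∀ {x y y′} → R x y → R x y′ → y ≡ y′) →
      (∀ {x} → P x → ∃[ y ] (P′ y × R x y)) → (∀ {y} → P′ y → ∃[ x ] (P x × R x y)) →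
      size E ≡ size E′
    size-≡ R inj inj′ to from = cong (λ n → ι (+ n)) (ℕₚ.≤-antisym
      (length-≤ R inj (list E′) (unique E) λ x∈ → let (y , p , r) = to (sound E x∈) in y , complete E′ p , r)
      (length-≤ (λ y x → R x y) inj′ (list E) (unique E′) λ y∈ → let (x , p , r) = from (sound E′ y∈) in x , complete E p , r))

  image : ∀ {A B : Set} {P : A → Set} {P′ : B → Set} (f : A → B) →
    (∀ {x x′} → f x ≡ f x′ → x ≡ x′) → (∀ {x} → P x → P′ (f x)) → (∀ {y} → P′ y → ∃[ x ] (P x × y ≡ f x)) →
    Enumeration P → Enumeration P′
  image {P′ = P′} f inj to from E = record
    { list = map f (list E)
    ; unique = Uniqueₚ.map⁺ inj (unique E)
    ; sound = λ y∈ → let (x , x∈ , eq) = ∈-map⁻ f y∈ in subst P′ (sym eq) (to (sound E x∈))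
    ; complete = λ {y} p → let (x , q , eq) = from p in subst (_∈ map f (list E)) (sym eq) (∈-map⁺ f (complete E q))
    }

  size-image : ∀ {A B : Set} {P : A → Set} {P′ : B → Set} (f : A → B) (inj : ∀ {x x′} → f x ≡ f x′ → x ≡ x′)
    (to : ∀ {x} → P x → P′ (f x)) (from : ∀ {y} → P′ y → ∃[ x ] (P x × y ≡ f x)) (E : Enumeration P) →
    size (image {P′ = P′} f inj to from E) ≡ size E
  size-image f inj to from E = cong (λ n → ι (+ n)) (Listₚ.length-map f (list E))

  module _ {I A : Set} {P : I → A → Set} (E : ∀ i → Enumeration (P i)) where

    pairs : List I → List (I × A)
    pairs [] = []
    pairs (i ∷ is) = map (i ,_) (list (E i)) ++ pairs is

    ∈-pairs⁻ : ∀ is {i x} → (i , x) ∈ pairs is → i ∈ is × P i x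
    ∈-pairs⁻ (j ∷ is) ix∈ with ∈-++⁻ (map (j ,_) (list (E j))) ix∈
    ... | inj₂ ix∈′ = let (i∈ , p) = ∈-pairs⁻ is ix∈′ in there i∈ , p
    ... | inj₁ ix∈′ with ∈-map⁻ (j ,_) ix∈′
    ...   | x , x∈ , refl = here refl , sound (E j) x∈

    ∈-pairs⁺ : ∀ is {i x} → i ∈ is → P i x → (i , x) ∈ pairs is
    ∈-pairs⁺ (j ∷ is) (here refl) p = ∈-++⁺ˡ (∈-map⁺ (j ,_) (complete (E j) p))
    ∈-pairs⁺ (j ∷ is) (there i∈)  p = ∈-++⁺ʳ (map (j ,_) (list (E j))) (∈-pairs⁺ is i∈ p)

    pairs-unique : ∀ {is} → Unique is → Unique (pairs is)
    pairs-unique {[]} [] = []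
    pairs-unique {i ∷ is} (i∉ ∷ u) = Uniqueₚ.++⁺ (Uniqueₚ.map⁺ (cong proj₂) (unique (E i))) (pairs-unique u)
      λ (∈₁ , ∈₂) → let (x , _ , eq) = ∈-map⁻ (i ,_) ∈₁ in
        All.lookup i∉ (proj₁ (∈-pairs⁻ is (subst (_∈ pairs is) eq ∈₂))) refl

    sigma : ∀ {is} → Unique is → Enumeration (λ ((i , x) : I × A) → i ∈ is × P i x)
    sigma {is} u = record
      { list = pairs is ; unique = pairs-unique u ; sound = ∈-pairs⁻ is ; complete = λ (i∈ , p) → ∈-pairs⁺ is i∈ p }

    size-sigma : ∀ {is} (u : Unique is) → size (sigma u) ≡ ∑ is (λ i → size (E i))
    size-sigma {is} _ = lemma is
      where
      lemma : ∀ is → ι (+ length (pairs is)) ≡ ∑ is (λ i → size (E i))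
      lemma [] = refl
      lemma (i ∷ is) = trans (cong (λ n → ι (+ n)) (trans (Listₚ.length-++ (map (i ,_) (list (E i))))
          (cong (ℕ._+ length (pairs is)) (Listₚ.length-map (i ,_) (list (E i))))))
        (trans (cong ι (ℤₚ.pos-+ (length (list (E i))) (length (pairs is))))
        (trans (ι-+ (+ length (list (E i))) (+ length (pairs is))) (cong (λ z → size (E i) + z) (lemma is))))

-- Integer matrices acting on binary quadratic forms

module Substitutions where

  open import Data.Integer.Base using (ℤ; +_; 0ℤ; 1ℤ; _+_; _*_; _-_; -_; _<_; NonZero)
  import Data.Integer.Properties as ℤₚ
  open import Data.Integer.Tactic.RingSolver using (solve-∀)
  open import Data.Product.Base using (∃-syntax; _×_; _,_)
  open import Relation.Binary.PropositionalEquality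
  open BinaryQuadraticForms using (module Coefficients; sl; posDef⁺; posDef⇒disc<0; positive; 0<*; 0<-⇒<; <⇒0<)

  record Matrix : Set where
    constructor mat
    field
      m₁₁ m₁₂ m₂₁ m₂₂ : ℤ

  mat-cong : ∀ {α α′ β β′ γ γ′ δ δ′} → α ≡ α′ → β ≡ β′ → γ ≡ γ′ → δ ≡ δ′ → mat α β γ δ ≡ mat α′ β′ γ′ δ′
  mat-cong refl refl refl refl = refl

  form-cong : ∀ {a a′ b b′ c c′} → a ≡ a′ → b ≡ b′ → c ≡ c′ → ⟨ a , b , c ⟩ ≡ ⟨ a′ , b′ , c′ ⟩
  form-cong refl refl refl = refl

  infixl 7 _·_ _∘_

  -- Opaque so that comparing forms does not unfold them into polynomials.
  opaque
    det : Matrix → ℤ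
    det (mat α β γ δ) = α * δ - β * γ

    adj : Matrix → Matrix
    adj (mat α β γ δ) = mat δ (- β) (- γ) α

    _·_ : Matrix → Matrix → Matrix
    mat α β γ δ · mat α′ β′ γ′ δ′ = mat (α * α′ + β * γ′) (α * β′ + β * δ′) (γ * α′ + δ * γ′) (γ * β′ + δ * δ′)

    -- The form Q(αx + βy, γx + δy).
    _∘_ : Form → Matrix → Form
    Q@(⟨ a , b , c ⟩) ∘ mat α β γ δ =
      ⟨ Q ⟦ α , γ ⟧ , + 2 * (a * (α * β)) + b * (α * δ + β * γ) + + 2 * (c * (γ * δ)) , Q ⟦ β , δ ⟧ ⟩

    scale : ℤ → Form → Form
    scale k ⟨ a , b , c ⟩ = ⟨ k * a , k * b , k * c ⟩

    det-adj : ∀ g → det (adj g) ≡ det g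
    det-adj (mat α β γ δ) = e α β γ δ
      where
      e : ∀ α β γ δ → δ * α - - β * - γ ≡ α * δ - β * γ
      e = solve-∀

    det-· : ∀ g h → det (g · h) ≡ det g * det h
    det-· (mat α β γ δ) (mat α′ β′ γ′ δ′) = e α β γ δ α′ β′ γ′ δ′
      where
      e : ∀ α β γ δ α′ β′ γ′ δ′ →
          (α * α′ + β * γ′) * (γ * β′ + δ * δ′) - (α * β′ + β * δ′) * (γ * α′ + δ * γ′)
          ≡ (α * δ - β * γ) * (α′ * δ′ - β′ * γ′)
      e = solve-∀

    adj-adj : ∀ g → adj (adj g) ≡ g
    adj-adj (mat α β γ δ) = mat-cong refl (ℤₚ.neg-involutive β) (ℤₚ.neg-involutive γ) refl

    smul : ℤ → Matrix → Matrix
    smul k (mat α β γ δ) = mat (k * α) (k * β) (k * γ) (k * δ)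

    smul-1 : ∀ g → smul 1ℤ g ≡ g
    smul-1 (mat α β γ δ) = mat-cong (ℤₚ.*-identityˡ α) (ℤₚ.*-identityˡ β) (ℤₚ.*-identityˡ γ) (ℤₚ.*-identityˡ δ)

    scale-1 : ∀ Q → scale 1ℤ Q ≡ Q
    scale-1 ⟨ a , b , c ⟩ = form-cong (ℤₚ.*-identityˡ a) (ℤₚ.*-identityˡ b) (ℤₚ.*-identityˡ c)

    g·adj·h : ∀ g h → g · (adj g · h) ≡ smul (det g) h
    g·adj·h (mat α β γ δ) (mat α′ β′ γ′ δ′) = mat-cong (e α β γ δ α′ γ′) (e α β γ δ β′ δ′) (f α β γ δ α′ γ′) (f α β γ δ β′ δ′)
      where
      e : ∀ α β γ δ x y → α * (δ * x + - β * y) + β * (- γ * x + α * y) ≡ (α * δ - β * γ) * x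
      e = solve-∀
      f : ∀ α β γ δ x y → γ * (δ * x + - β * y) + δ * (- γ * x + α * y) ≡ (α * δ - β * γ) * y
      f = solve-∀

    adj·g·h : ∀ g h → adj g · (g · h) ≡ smul (det g) h
    adj·g·h (mat α β γ δ) (mat α′ β′ γ′ δ′) = mat-cong (e α β γ δ α′ γ′) (e α β γ δ β′ δ′) (f α β γ δ α′ γ′) (f α β γ δ β′ δ′)
      where
      e : ∀ α β γ δ x y → δ * (α * x + β * y) + - β * (γ * x + δ * y) ≡ (α * δ - β * γ) * x
      e = solve-∀
      f : ∀ α β γ δ x y → - γ * (α * x + β * y) + α * (γ * x + δ * y) ≡ (α * δ - β * γ) * y
      f = solve-∀

    ∘-· : ∀ Q g h → Q ∘ (g · h) ≡ Q ∘ g ∘ h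
    ∘-· ⟨ a , b , c ⟩ (mat α β γ δ) (mat α′ β′ γ′ δ′) = form-cong (e a b c α β γ δ α′ γ′) (f a b c α β γ δ α′ β′ γ′ δ′) (e a b c α β γ δ β′ δ′)
      where
      e : ∀ a b c α β γ δ x y → let ev = λ x y → a * (x * x) + b * (x * y) + c * (y * y) in
        ev (α * x + β * y) (γ * x + δ * y) ≡
        ev α γ * (x * x) + (+ 2 * (a * (α * β)) + b * (α * δ + β * γ) + + 2 * (c * (γ * δ))) * (x * y) + ev β δ * (y * y)
      e = solve-∀
      f : ∀ a b c α β γ δ α′ β′ γ′ δ′ → let ev = λ x y → a * (x * x) + b * (x * y) + c * (y * y) in
        + 2 * (a * ((α * α′ + β * γ′) * (α * β′ + β * δ′)))
          + b * ((α * α′ + β * γ′) * (γ * β′ + δ * δ′) + (α * β′ + β * δ′) * (γ * α′ + δ * γ′))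
          + + 2 * (c * ((γ * α′ + δ * γ′) * (γ * β′ + δ * δ′)))
        ≡ + 2 * (ev α γ * (α′ * β′))
          + (+ 2 * (a * (α * β)) + b * (α * δ + β * γ) + + 2 * (c * (γ * δ))) * (α′ * δ′ + β′ * γ′)
          + + 2 * (ev β δ * (γ′ * δ′))
      f = solve-∀

    -- `g · adj g` is `det g` times the identity and a form is homogeneous of degree 2. For
    -- determinant `p` this sends a matrix from `Q` to `Q′` to one from `Q′` to `p² Q`.
    ∘-adj : ∀ Q g → Q ∘ g ∘ adj g ≡ scale (det g * det g) Q
    ∘-adj Q@(⟨ a , b , c ⟩) g@(mat α β γ δ) = trans (sym (∘-· Q g (adj g)))
      (form-cong (e₁ a b c α β γ δ) (e₂ a b c α β γ δ) (e₃ a b c α β γ δ))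
      where
      e₁ : ∀ a b c α β γ δ → let ev = λ x y → a * (x * x) + b * (x * y) + c * (y * y) in
        ev (α * δ + β * - γ) (γ * δ + δ * - γ) ≡ (α * δ - β * γ) * (α * δ - β * γ) * a
      e₁ = solve-∀
      e₃ : ∀ a b c α β γ δ → let ev = λ x y → a * (x * x) + b * (x * y) + c * (y * y) in
        ev (α * - β + β * α) (γ * - β + δ * α) ≡ (α * δ - β * γ) * (α * δ - β * γ) * c
      e₃ = solve-∀
      e₂ : ∀ a b c α β γ δ →
        + 2 * (a * ((α * δ + β * - γ) * (α * - β + β * α))) + b * ((α * δ + β * - γ) * (γ * - β + δ * α) + (α * - β + β * α) * (γ * δ + δ * - γ))
          + + 2 * (c * ((γ * δ + δ * - γ) * (γ * - β + δ * α))) ≡ (α * δ - β * γ) * (α * δ - β * γ) * b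
      e₂ = solve-∀

    scale-∘ : ∀ k Q g → scale k Q ∘ g ≡ scale k (Q ∘ g)
    scale-∘ k ⟨ a , b , c ⟩ (mat α β γ δ) = form-cong (e k a b c α γ) (f k a b c α β γ δ) (e k a b c β δ)
      where
      e : ∀ k a b c x y → k * a * (x * x) + k * b * (x * y) + k * c * (y * y) ≡ k * (a * (x * x) + b * (x * y) + c * (y * y))
      e = solve-∀
      f : ∀ k a b c α β γ δ → + 2 * (k * a * (α * β)) + k * b * (α * δ + β * γ) + + 2 * (k * c * (γ * δ))
        ≡ k * (+ 2 * (a * (α * β)) + b * (α * δ + β * γ) + + 2 * (c * (γ * δ)))
      f = solve-∀

    scale-scale : ∀ k l Q → scale k (scale l Q) ≡ scale (k * l) Q
    scale-scale k l ⟨ a , b , c ⟩ = form-cong (sym (ℤₚ.*-assoc k l a)) (sym (ℤₚ.*-assoc k l b)) (sym (ℤₚ.*-assoc k l c))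

    scale-injective : ∀ k .{{_ : NonZero k}} {Q R} → scale k Q ≡ scale k R → Q ≡ R
    scale-injective k {⟨ a , b , c ⟩} {⟨ a′ , b′ , c′ ⟩} eq = form-cong
      (ℤₚ.*-cancelˡ-≡ k a a′ (cong Form.a eq)) (ℤₚ.*-cancelˡ-≡ k b b′ (cong Form.b eq)) (ℤₚ.*-cancelˡ-≡ k c c′ (cong Form.c eq))

    disc-∘ : ∀ Q g → disc (Q ∘ g) ≡ det g * det g * disc Q
    disc-∘ ⟨ a , b , c ⟩ (mat α β γ δ) = e a b c α β γ δ
      where
      e : ∀ a b c α β γ δ →
        let ev = λ x y → a * (x * x) + b * (x * y) + c * (y * y)
            B  = + 2 * (a * (α * β)) + b * (α * δ + β * γ) + + 2 * (c * (γ * δ)) in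
        B * B - + 4 * (ev α γ * ev β δ) ≡ (α * δ - β * γ) * (α * δ - β * γ) * (b * b - + 4 * (a * c))
      e = solve-∀

    disc-scale : ∀ k Q → disc (scale k Q) ≡ k * k * disc Q
    disc-scale k ⟨ a , b , c ⟩ = e k a b c
      where
      e : ∀ k a b c → k * b * (k * b) - + 4 * (k * a * (k * c)) ≡ k * k * (b * b - + 4 * (a * c))
      e = solve-∀

  record Iso (Q R : Form) (g : Matrix) : Set where
    constructor iso
    field
      det≡1 : det g ≡ 1ℤ
      ∘≡    : Q ∘ g ≡ R

  open Iso public

  opaque
    unfolding det adj _·_ _∘_ scale

    -- `_~_` compares values and `Iso` compares coefficients; the values at (1, 0), (0, 1) and (1,
    -- 1) determine the coefficients.
    ~⇒iso : ∀ {Q R} → Q ~ R → ∃[ g ] Iso Q R g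
    ~⇒iso {Q@(⟨ a , b , c ⟩)} {R} Q~R@(sl α β γ δ d _) =
      mat α β γ δ , iso d (sym (form-cong a-eq (trans b-eq (e a b c α β γ δ)) c-eq))
      where
      open Coefficients {Q} {R} Q~R
      e : ∀ a b c α β γ δ → let ev = λ x y → a * (x * x) + b * (x * y) + c * (y * y) in
        ev (α + β) (γ + δ) - ev α γ - ev β δ ≡ + 2 * (a * (α * β)) + b * (α * δ + β * γ) + + 2 * (c * (γ * δ))
      e = solve-∀

    iso⇒~ : ∀ {Q R g} → Iso Q R g → Q ~ R
    iso⇒~ {Q@(⟨ a , b , c ⟩)} {g = mat α β γ δ} (iso d refl) = sl α β γ δ d (e a b c α β γ δ)
      where
      e : ∀ a b c α β γ δ x y → let ev = λ x y → a * (x * x) + b * (x * y) + c * (y * y) in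
        ev α γ * (x * x) + (+ 2 * (a * (α * β)) + b * (α * δ + β * γ) + + 2 * (c * (γ * δ))) * (x * y) + ev β δ * (y * y)
        ≡ ev (α * x + β * y) (γ * x + δ * y)
      e = solve-∀

  iso-· : ∀ {Q R S g h} → Iso Q R g → Iso R S h → Iso Q S (g · h)
  iso-· {Q} {g = g} {h = h} (iso d refl) (iso d′ refl) = iso (trans (det-· g h) (cong₂ _*_ d d′)) (∘-· Q g h)

  iso-adj : ∀ {Q R g} → Iso Q R g → Iso R Q (adj g)
  iso-adj {Q} {g = g} (iso d refl) = iso (trans (det-adj g) d)
    (trans (∘-adj Q g) (trans (cong (λ z → scale (z * z) Q) d) (scale-1 Q)))

  opaque
    unfolding det adj _·_ _∘_ scale

    posDef-∘ : ∀ {Q g} → PositiveDefinite Q → 0ℤ < det g → PositiveDefinite (Q ∘ g)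
    posDef-∘ {Q} {g@(mat α β γ δ)} pd 0<d = posDef⁺
      (positive pd α γ λ { (refl , refl) → ℤₚ.<-irrefl (sym (e β δ)) 0<d })
      (0<-⇒< (0<* (0<* 0<d 0<d) (<⇒0< (posDef⇒disc<0 pd))) (trans (f (det g) (disc Q)) (cong (λ z → 0ℤ - z) (sym (disc-∘ Q g)))))
      where
      e : ∀ β δ → 0ℤ * δ - β * 0ℤ ≡ 0ℤ
      e = solve-∀
      f : ∀ d D → d * d * (0ℤ - D) ≡ 0ℤ - d * d * D
      f = solve-∀

    posDef-unscale : ∀ k {Q} → 0ℤ < k → PositiveDefinite (scale k Q) → PositiveDefinite Q
    posDef-unscale k {Q@(⟨ a , b , c ⟩)} 0<k pd = BinaryQuadraticForms.mkPD λ x y xy≢0 →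
      BinaryQuadraticForms.0<*⇒0< 0<k (subst (0ℤ <_) (e k a b c x y) (positive pd x y xy≢0))
      where
      e : ∀ k a b c x y → k * a * (x * x) + k * b * (x * y) + k * c * (y * y) ≡ k * (a * (x * x) + b * (x * y) + c * (y * y))
      e = solve-∀

  -- The middle coefficient of `⟨ a , b , c ⟩ ∘ mat α β γ δ`, as a plain function that unfolds
  -- although `_∘_` is opaque.
  middle : ℤ → ℤ → ℤ → ℤ → ℤ → ℤ → ℤ → ℤ
  middle a b c α β γ δ = + 2 * (a * (α * β)) + b * (α * δ + β * γ) + + 2 * (c * (γ * δ))

  opaque
    unfolding det _∘_

    iso-mat⁻ : ∀ {a b c a′ b′ c′ α β γ δ} → Iso ⟨ a , b , c ⟩ ⟨ a′ , b′ , c′ ⟩ (mat α β γ δ) →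
      α * δ - β * γ ≡ 1ℤ × ⟨ a , b , c ⟩ ⟦ α , γ ⟧ ≡ a′ × middle a b c α β γ δ ≡ b′ × ⟨ a , b , c ⟩ ⟦ β , δ ⟧ ≡ c′
    iso-mat⁻ (iso d eq) = d , cong Form.a eq , cong Form.b eq , cong Form.c eq

    iso-mat⁺ : ∀ {a b c a′ b′ c′ α β γ δ} →
      α * δ - β * γ ≡ 1ℤ → ⟨ a , b , c ⟩ ⟦ α , γ ⟧ ≡ a′ → middle a b c α β γ δ ≡ b′ → ⟨ a , b , c ⟩ ⟦ β , δ ⟧ ≡ c′ →
      Iso ⟨ a , b , c ⟩ ⟨ a′ , b′ , c′ ⟩ (mat α β γ δ)
    iso-mat⁺ d E₁ E₂ E₃ = iso d (form-cong E₁ E₂ E₃)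

-- Stabilisers of reduced forms

module Automorphisms where

  open import Data.Integer.Base using (ℤ; +_; -[1+_]; 0ℤ; 1ℤ; -1ℤ; ∣_∣; _+_; _*_; _-_; -_; _<_; _≤_; +<+; +≤+)
  import Data.Integer.Properties as ℤₚ
  open import Data.Integer.Tactic.RingSolver using (solve-∀)
  open import Data.List.Base using (List; []; _∷_)
  open import Data.List.Membership.Propositional using (_∈_)
  open import Data.List.Relation.Unary.All using ([]; _∷_)
  open import Data.List.Relation.Unary.AllPairs using ([]; _∷_)
  open import Data.List.Relation.Unary.Any using (here; there)
  open import Data.List.Relation.Unary.Unique.Propositional using (Unique)
  open import Data.Nat.Base as ℕ using (s≤s; z≤n)
  import Data.Nat.Properties as ℕₚ
  open import Data.Product.Base using (Σ; ∃-syntax; _×_; _,_)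
  open import Data.Rational.Base as ℚ using (ℚ; 1ℚ; _/_)
  open import Data.Sum.Base using (_⊎_; inj₁; inj₂)
  open import Relation.Binary.PropositionalEquality
  open import Relation.Nullary using (Dec; yes; no; does; contradiction)
  open import Data.Bool.Base using (if_then_else_)
  open BinaryQuadraticForms
    using (Reduced; reduced⇒0<a; reduced-unique; c≤; 0≤sq; 0≤*; 0<*; 0<+; 0≤+; ≤⇒0≤; gaussianReduced; eisensteinReduced)
  open Enumerations
  open Rationals
  open Substitutions

  data Small : ℤ → Set where
    zero : Small 0ℤ
    one  : Small 1ℤ
    -one : Small -1ℤ

  small? : ∀ y → Small y ⊎ + 4 ≤ y * y
  small? (+ 0)                 = inj₁ zero
  small? (+ 1)                 = inj₁ one
  small? -[1+ 0 ]              = inj₁ -one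
  small? (+ ℕ.suc (ℕ.suc n))   = inj₂ (+≤+ (ℕₚ.*-mono-≤ {2} {ℕ.suc (ℕ.suc n)} {2} (s≤s (s≤s z≤n)) (s≤s (s≤s z≤n))))
  small? -[1+ ℕ.suc n ]        = inj₂ (+≤+ (ℕₚ.*-mono-≤ {2} {ℕ.suc (ℕ.suc n)} {2} (s≤s (s≤s z≤n)) (s≤s (s≤s z≤n))))

  module _ {a b : ℤ} (0<a : 0ℤ < a) (0≤b : 0ℤ ≤ b) (b≤a : b ≤ a) where

    -- With Q = `⟨ a , b , a ⟩`, 4a Q(x, y) = (2ax + by)² + (4a² - b²) y², where 4a² - b² ≥ 3a². If
    -- y² ≥ 4, this is at least 12a², whereas Q(x, y) = a makes it 4a². The positive `sum` is the
    -- difference of the two sides, split into nonnegative pieces.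
    minimal⇒small : ∀ x y → a ≡ ⟨ a , b , a ⟩ ⟦ x , y ⟧ → Small y
    minimal⇒small x y eq with small? y
    ... | inj₁ s   = s
    ... | inj₂ 4≤y² = contradiction positive (ℤₚ.<-irrefl (sym zeroSum))
      where
      sum = + 8 * (a * a) + ((+ 2 * a * x + b * y) * (+ 2 * a * x + b * y)
              + ((a - b) * (a + b) * (y * y) + + 3 * (a * a) * (y * y - + 4)))
      e : ∀ a b x y → + 8 * (a * a) + ((+ 2 * a * x + b * y) * (+ 2 * a * x + b * y)
              + ((a - b) * (a + b) * (y * y) + + 3 * (a * a) * (y * y - + 4)))
            ≡ + 4 * a * ((a * (x * x) + b * (x * y) + a * (y * y)) - a)
      e = solve-∀
      zeroSum : sum ≡ 0ℤ
      zeroSum = trans (e a b x y) (trans (cong (λ z → + 4 * a * (z - a)) (sym eq))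
        (trans (cong (+ 4 * a *_) (ℤₚ.+-inverseʳ a)) (ℤₚ.*-zeroʳ (+ 4 * a))))
      positive : 0ℤ < sum
      positive = 0<+ (0<* {+ 8} (+<+ (s≤s z≤n)) (0<* 0<a 0<a)) (0≤+ (0≤sq (+ 2 * a * x + b * y))
        (0≤+ (0≤* (0≤* (≤⇒0≤ b≤a) (0≤+ (ℤₚ.<⇒≤ 0<a) 0≤b)) (0≤sq y))
             (0≤* (0≤* {+ 3} (+≤+ z≤n) (ℤₚ.<⇒≤ (0<* 0<a 0<a))) (≤⇒0≤ 4≤y²))))

    minimal⇒smallˡ : ∀ x y → a ≡ ⟨ a , b , a ⟩ ⟦ x , y ⟧ → Small x
    minimal⇒smallˡ x y eq = minimal⇒small y x (trans eq (e a b x y))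
      where
      e : ∀ a b x y → a * (x * x) + b * (x * y) + a * (y * y) ≡ a * (y * y) + b * (y * x) + a * (x * x)
      e = solve-∀

  minimal-1-−1 : ∀ {a b} → a ≡ a * 1ℤ + b * -1ℤ + a * 1ℤ → b ≡ a
  minimal-1-−1 {a} {b} eq = sym (trans (e a b) (trans (cong (λ z → z - a + b) (sym eq)) (f a b)))
    where
    e : ∀ a b → a ≡ (a * 1ℤ + b * -1ℤ + a * 1ℤ) - a + b
    e = solve-∀
    f : ∀ a b → a - a + b ≡ b
    f = solve-∀

  negated⇒0 : ∀ {b} → b ≡ - b → b ≡ 0ℤ
  negated⇒0 {+ 0} _ = refl

  doubled⇒0 : ∀ {i} → 0ℤ ≡ + 2 * i → i ≡ 0ℤ
  doubled⇒0 {i} eq = ℤₚ.*-cancelˡ-≡ (+ 2) i 0ℤ (sym eq)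

  -- The stabilisers in SL₂(ℤ) of a general form, of x² + y² and of x² + xy + y². They have order 2,
  -- 4 and 6.
  ±I ±S ±U : List Matrix
  ±I = mat 1ℤ 0ℤ 0ℤ 1ℤ ∷ mat -1ℤ 0ℤ 0ℤ -1ℤ ∷ []
  ±S = mat 0ℤ -1ℤ 1ℤ 0ℤ ∷ mat 0ℤ 1ℤ -1ℤ 0ℤ ∷ ±I
  ±U = mat 0ℤ -1ℤ 1ℤ 1ℤ ∷ mat 0ℤ 1ℤ -1ℤ -1ℤ ∷ mat -1ℤ -1ℤ 1ℤ 0ℤ ∷ mat 1ℤ 1ℤ -1ℤ 0ℤ ∷ ±I

  Classified : Form → Matrix → Set
  Classified Q g = g ∈ ±I ⊎ ((∃[ a ] (Q ≡ gaussian a)) × g ∈ ±S) ⊎ ((∃[ a ] (Q ≡ eisenstein a)) × g ∈ ±U)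

  units : ∀ i j → i * j ≡ 1ℤ → (i ≡ 1ℤ × j ≡ 1ℤ) ⊎ (i ≡ -1ℤ × j ≡ -1ℤ)
  units i j eq = combine i j eq (ℕₚ.m*n≡1⇒m≡1 ∣ i ∣ ∣ j ∣ abs≡) (ℕₚ.m*n≡1⇒n≡1 ∣ i ∣ ∣ j ∣ abs≡)
    where
    abs≡ : ∣ i ∣ ℕ.* ∣ j ∣ ≡ 1
    abs≡ = trans (sym (ℤₚ.abs-* i j)) (cong ∣_∣ eq)
    combine : ∀ i j → i * j ≡ 1ℤ → ∣ i ∣ ≡ 1 → ∣ j ∣ ≡ 1 → (i ≡ 1ℤ × j ≡ 1ℤ) ⊎ (i ≡ -1ℤ × j ≡ -1ℤ)
    combine (+ _) (+ _) _ refl refl       = inj₁ (refl , refl)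
    combine -[1+ _ ] -[1+ _ ] _ refl refl = inj₂ (refl , refl)
    combine (+ _) -[1+ _ ] () refl refl
    combine -[1+ _ ] (+ _) () refl refl

  -- The determinant forces α = δ = ±1, and then the middle coefficient changes by ±2aβ, so β = 0.
  triangular : ∀ {a b c α β δ} → 0ℤ < a → α * δ - β * 0ℤ ≡ 1ℤ →
    b ≡ middle a b c α β 0ℤ δ → mat α β 0ℤ δ ∈ ±I
  triangular {a} {b} {c} {α} {β} {δ} 0<a d eq = conclude (units α δ αδ≡1)
    where
    s : ∀ x β → x - β * 0ℤ ≡ x
    s = solve-∀
    αδ≡1 : α * δ ≡ 1ℤ
    αδ≡1 = trans (sym (s (α * δ) β)) d
    e₊ : ∀ a b c β → + 2 * (a * β) ≡ + 2 * (a * (1ℤ * β)) + b * (1ℤ * 1ℤ + β * 0ℤ) + + 2 * (c * (0ℤ * 1ℤ)) - b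
    e₊ = solve-∀
    e₋ : ∀ a b c β → + 2 * (a * - β) ≡ + 2 * (a * (-1ℤ * β)) + b * (-1ℤ * -1ℤ + β * 0ℤ) + + 2 * (c * (0ℤ * -1ℤ)) - b
    e₋ = solve-∀
    β≡0 : ∀ {β} → + 2 * (a * β) ≡ b - b → β ≡ 0ℤ
    β≡0 {β} p with ℤₚ.i*j≡0⇒i≡0∨j≡0 a (doubled⇒0 (sym (trans p (ℤₚ.+-inverseʳ b))))
    ... | inj₁ a≡0 = contradiction 0<a (ℤₚ.<-irrefl (sym a≡0))
    ... | inj₂ q   = q
    conclude : (α ≡ 1ℤ × δ ≡ 1ℤ) ⊎ (α ≡ -1ℤ × δ ≡ -1ℤ) → mat α β 0ℤ δ ∈ ±I
    conclude (inj₁ (refl , refl)) = here (mat-cong refl (β≡0 (trans (e₊ a b c β) (cong (_- b) (sym eq)))) refl refl)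
    conclude (inj₂ (refl , refl)) = there (here (mat-cong refl
      (trans (sym (ℤₚ.neg-involutive β)) (cong -_ (β≡0 (trans (e₋ a b c β) (cong (_- b) (sym eq)))))) refl refl))

  module _ {a b : ℤ} (0<a : 0ℤ < a) (0≤b : 0ℤ ≤ b) where

    ¬11 : a ≢ a * 1ℤ + b * 1ℤ + a * 1ℤ
    ¬11 eq = ℤₚ.<-irrefl (sym (trans (e a b) (trans (cong (_- a) (sym eq)) (ℤₚ.+-inverseʳ a)))) (0<+ 0<a 0≤b)
      where
      e : ∀ a b → a + b ≡ a * 1ℤ + b * 1ℤ + a * 1ℤ - a
      e = solve-∀

    gaussian-middle : b ≡ + 2 * (a * 0ℤ) + b * -1ℤ + + 2 * (a * 0ℤ) → b ≡ 0ℤ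
    gaussian-middle eq = negated⇒0 (trans eq (e a b))
      where
      e : ∀ a b → + 2 * (a * 0ℤ) + b * -1ℤ + + 2 * (a * 0ℤ) ≡ - b
      e = solve-∀

    ¬eisenstein : b ≡ a → b ≢ + 2 * (a * 0ℤ) + b * 1ℤ + + 2 * (a * -1ℤ)
    ¬eisenstein refl eq = ℤₚ.<-irrefl (sym (trans (e a) (trans (cong (λ z → a - z) (sym eq)) (ℤₚ.+-inverseʳ a)))) (0<+ 0<a (ℤₚ.<⇒≤ 0<a))
      where
      e : ∀ a → a + a ≡ a - (+ 2 * (a * 0ℤ) + a * 1ℤ + + 2 * (a * -1ℤ))
      e = solve-∀

    -- With γ = ±1 there are 54 choices of the entries, of which the determinant leaves fourteen. A
    -- column ±(1, 1) would give the value 2a + b > a, a column ±(1, -1) gives b = a, and the middle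
    -- coefficient settles the rest.
    small-entries : ∀ {α β γ δ} → Small α → Small β → Small γ → γ ≢ 0ℤ → Small δ → α * δ - β * γ ≡ 1ℤ →
      a ≡ ⟨ a , b , a ⟩ ⟦ α , γ ⟧ → b ≡ middle a b a α β γ δ → a ≡ ⟨ a , b , a ⟩ ⟦ β , δ ⟧ →
      (b ≡ 0ℤ × mat α β γ δ ∈ ±S) ⊎ (b ≡ a × mat α β γ δ ∈ ±U)
    small-entries _ _ zero γ≢0 _ _ _ _ _ = contradiction refl γ≢0
    small-entries zero zero one _ zero ()
    small-entries zero zero one _ one ()
    small-entries zero zero one _ -one ()
    small-entries zero one one _ zero ()
    small-entries zero one one _ one ()
    small-entries zero one one _ -one ()
    small-entries zero -one one _ zero _ E₁ E₂ E₃ = inj₁ (gaussian-middle E₂ , here refl)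
    small-entries zero -one one _ one _ E₁ E₂ E₃ = inj₂ (minimal-1-−1 E₃ , here refl)
    small-entries zero -one one _ -one _ E₁ E₂ E₃ = contradiction E₃ ¬11
    small-entries one zero one _ zero ()
    small-entries one zero one _ one _ E₁ E₂ E₃ = contradiction E₁ (¬11)
    small-entries one zero one _ -one ()
    small-entries one one one _ zero ()
    small-entries one one one _ one ()
    small-entries one one one _ -one ()
    small-entries one -one one _ zero _ E₁ E₂ E₃ = contradiction E₁ (¬11)
    small-entries one -one one _ one ()
    small-entries one -one one _ -one ()
    small-entries -one zero one _ zero ()
    small-entries -one zero one _ one ()
    small-entries -one zero one _ -one _ E₁ E₂ E₃ = contradiction (¬eisenstein (minimal-1-−1 E₁) E₂) λ ()
    small-entries -one one one _ zero ()
    small-entries -one one one _ one ()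
    small-entries -one one one _ -one ()
    small-entries -one -one one _ zero _ E₁ E₂ E₃ = inj₂ (minimal-1-−1 E₁ , there (there (here refl)))
    small-entries -one -one one _ one ()
    small-entries -one -one one _ -one ()
    small-entries zero zero -one _ zero ()
    small-entries zero zero -one _ one ()
    small-entries zero zero -one _ -one ()
    small-entries zero one -one _ zero _ E₁ E₂ E₃ = inj₁ (gaussian-middle E₂ , there (here refl))
    small-entries zero one -one _ one _ E₁ E₂ E₃ = contradiction E₃ ¬11
    small-entries zero one -one _ -one _ E₁ E₂ E₃ = inj₂ (minimal-1-−1 E₃ , there (here refl))
    small-entries zero -one -one _ zero ()
    small-entries zero -one -one _ one ()
    small-entries zero -one -one _ -one ()
    small-entries one zero -one _ zero ()
    small-entries one zero -one _ one _ E₁ E₂ E₃ = contradiction (¬eisenstein (minimal-1-−1 E₁) E₂) λ ()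
    small-entries one zero -one _ -one ()
    small-entries one one -one _ zero _ E₁ E₂ E₃ = inj₂ (minimal-1-−1 E₁ , there (there (there (here refl))))
    small-entries one one -one _ one ()
    small-entries one one -one _ -one ()
    small-entries one -one -one _ zero ()
    small-entries one -one -one _ one ()
    small-entries one -one -one _ -one ()
    small-entries -one zero -one _ zero ()
    small-entries -one zero -one _ one ()
    small-entries -one zero -one _ -one _ E₁ E₂ E₃ = contradiction E₁ (¬11)
    small-entries -one one -one _ zero _ E₁ E₂ E₃ = contradiction E₁ (¬11)
    small-entries -one one -one _ one ()
    small-entries -one one -one _ -one ()
    small-entries -one -one -one _ zero ()
    small-entries -one -one -one _ one ()
    small-entries -one -one -one _ -one ()

  -- If γ = 0, the matrix is triangular. If γ ≠ 0, the form takes the value a at a vector with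
  -- nonzero second entry, where a reduced form is at least c; hence a = c, both columns represent
  -- the minimum a, and all entries are 0 or ±1.
  classify : ∀ {Q g} → Reduced Q → Iso Q Q g → Classified Q g
  classify {Q@(⟨ a , b , c ⟩)} {mat α β γ δ} red i = go red (γ ℤₚ.≟ 0ℤ) (iso-mat⁻ {a} {b} {c} {α = α} {β} {γ} {δ} i)
    where
    balanced : ∀ {a b c γ} → c ≡ a → Reduced ⟨ a , b , c ⟩ → γ ≢ 0ℤ →
      α * δ - β * γ ≡ 1ℤ × ⟨ a , b , c ⟩ ⟦ α , γ ⟧ ≡ a × middle a b c α β γ δ ≡ b × ⟨ a , b , c ⟩ ⟦ β , δ ⟧ ≡ c →
      Classified ⟨ a , b , c ⟩ (mat α β γ δ)
    balanced {a} {b} {γ = γ} refl red@((_ , b≤a) , (_ , tie)) γ≢0 (d , E₁ , E₂ , E₃) =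
      inj₂ (conclude (small-entries 0<a 0≤b
            (minimal⇒smallˡ 0<a 0≤b b≤a α γ (sym E₁)) (minimal⇒smallˡ 0<a 0≤b b≤a β δ (sym E₃))
            (minimal⇒small 0<a 0≤b b≤a α γ (sym E₁)) γ≢0 (minimal⇒small 0<a 0≤b b≤a β δ (sym E₃))
            d (sym E₁) (sym E₂) (sym E₃)))
      where
      0<a = reduced⇒0<a {⟨ a , b , a ⟩} red
      nonneg : ∀ {a b} → a < a ⊎ 0ℤ ≤ b → 0ℤ ≤ b
      nonneg (inj₁ a<a) = contradiction a<a (ℤₚ.<-irrefl refl)
      nonneg (inj₂ p)   = p
      0≤b = nonneg tie
      conclude : ∀ {g} → (b ≡ 0ℤ × g ∈ ±S) ⊎ (b ≡ a × g ∈ ±U) →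
        ((∃[ a′ ] (⟨ a , b , a ⟩ ≡ gaussian a′)) × g ∈ ±S) ⊎ ((∃[ a′ ] (⟨ a , b , a ⟩ ≡ eisenstein a′)) × g ∈ ±U)
      conclude (inj₁ (refl , g∈)) = inj₁ ((a , refl) , g∈)
      conclude (inj₂ (refl , g∈)) = inj₂ ((a , refl) , g∈)
    go : ∀ {a b c γ} → Reduced ⟨ a , b , c ⟩ → Dec (γ ≡ 0ℤ) →
      α * δ - β * γ ≡ 1ℤ × ⟨ a , b , c ⟩ ⟦ α , γ ⟧ ≡ a × middle a b c α β γ δ ≡ b × ⟨ a , b , c ⟩ ⟦ β , δ ⟧ ≡ c →
      Classified ⟨ a , b , c ⟩ (mat α β γ δ)
    go {a} {b} {c} red (yes refl) (d , _ , E₂ , _) =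
      inj₁ (triangular {a} {b} {c} {α} {β} {δ} (reduced⇒0<a {⟨ a , b , c ⟩} red) d (sym E₂))
    go {a} {b} {c} {γ} red@(_ , (a≤c , _)) (no γ≢0) eqs@(_ , E₁ , _) =
      balanced (ℤₚ.≤-antisym (subst (c ≤_) E₁ (c≤ {⟨ a , b , c ⟩} α γ red γ≢0)) a≤c) red γ≢0 eqs

  ±I-iso : ∀ Q {g} → g ∈ ±I → Iso Q Q g
  ±I-iso ⟨ a , b , c ⟩ (here refl) = iso-mat⁺ refl (e₁ a b c) (e₂ a b c) (e₃ a b c)
    where
    e₁ : ∀ a b c → a * 1ℤ + b * 0ℤ + c * 0ℤ ≡ a
    e₁ = solve-∀
    e₂ : ∀ a b c → + 2 * (a * 0ℤ) + b * 1ℤ + + 2 * (c * 0ℤ) ≡ b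
    e₂ = solve-∀
    e₃ : ∀ a b c → a * 0ℤ + b * 0ℤ + c * 1ℤ ≡ c
    e₃ = solve-∀
  ±I-iso ⟨ a , b , c ⟩ (there (here refl)) = iso-mat⁺ refl (e₁ a b c) (e₂ a b c) (e₃ a b c)
    where
    e₁ : ∀ a b c → a * 1ℤ + b * 0ℤ + c * 0ℤ ≡ a
    e₁ = solve-∀
    e₂ : ∀ a b c → + 2 * (a * 0ℤ) + b * 1ℤ + + 2 * (c * 0ℤ) ≡ b
    e₂ = solve-∀
    e₃ : ∀ a b c → a * 0ℤ + b * 0ℤ + c * 1ℤ ≡ c
    e₃ = solve-∀

  ±S-iso : ∀ a {g} → g ∈ ±S → Iso (gaussian a) (gaussian a) g
  ±S-iso a = λ
    { (here refl)           → iso-mat⁺ refl (e a) (f a) (e′ a)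
    ; (there (here refl))   → iso-mat⁺ refl (e a) (f a) (e′ a)
    ; (there (there g∈))    → ±I-iso (gaussian a) g∈
    }
    where
    e : ∀ a → a * 0ℤ + 0ℤ + a * 1ℤ ≡ a
    e = solve-∀
    e′ : ∀ a → a * 1ℤ + 0ℤ + a * 0ℤ ≡ a
    e′ = solve-∀
    f : ∀ a → + 2 * (a * 0ℤ) + 0ℤ + + 2 * (a * 0ℤ) ≡ 0ℤ
    f = solve-∀

  ±U-iso : ∀ a {g} → g ∈ ±U → Iso (eisenstein a) (eisenstein a) g
  ±U-iso a = λ
    { (here refl)                           → iso-mat⁺ refl (e₁ a) (e₂ a) (e₃ a)
    ; (there (here refl))                   → iso-mat⁺ refl (e₁ a) (e₂ a) (e₃ a)
    ; (there (there (here refl)))           → iso-mat⁺ refl (e₃ a) (e₄ a) (e₅ a)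
    ; (there (there (there (here refl))))   → iso-mat⁺ refl (e₃ a) (e₄ a) (e₅ a)
    ; (there (there (there (there g∈))))    → ±I-iso (eisenstein a) g∈
    }
    where
    e₁ : ∀ a → a * 0ℤ + a * 0ℤ + a * 1ℤ ≡ a
    e₁ = solve-∀
    e₂ : ∀ a → + 2 * (a * 0ℤ) + a * -1ℤ + + 2 * (a * 1ℤ) ≡ a
    e₂ = solve-∀
    e₃ : ∀ a → a * 1ℤ + a * -1ℤ + a * 1ℤ ≡ a
    e₃ = solve-∀
    e₄ : ∀ a → + 2 * (a * 1ℤ) + a * -1ℤ + + 2 * (a * 0ℤ) ≡ a
    e₄ = solve-∀
    e₅ : ∀ a → a * 1ℤ + a * 0ℤ + a * 0ℤ ≡ a
    e₅ = solve-∀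

  ±I-unique : Unique ±I
  ±I-unique = ((λ ()) ∷ []) ∷ [] ∷ []

  ±S-unique : Unique ±S
  ±S-unique = ((λ ()) ∷ (λ ()) ∷ (λ ()) ∷ []) ∷ ((λ ()) ∷ (λ ()) ∷ []) ∷ ±I-unique

  ±U-unique : Unique ±U
  ±U-unique = ((λ ()) ∷ (λ ()) ∷ (λ ()) ∷ (λ ()) ∷ (λ ()) ∷ []) ∷ ((λ ()) ∷ (λ ()) ∷ (λ ()) ∷ (λ ()) ∷ [])
    ∷ ((λ ()) ∷ (λ ()) ∷ (λ ()) ∷ []) ∷ ((λ ()) ∷ (λ ()) ∷ []) ∷ ±I-unique

  IsGaussian IsEisenstein : Form → Set
  IsGaussian   Q = ∃[ a ] (0ℤ < a × Q ~ gaussian a)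
  IsEisenstein Q = ∃[ a ] (0ℤ < a × Q ~ eisenstein a)

  weight : ∀ {P R : Set} → Dec P → Dec R → ℚ
  weight P? R? = if does P? then + 1 / 2 else if does R? then + 1 / 3 else 1ℚ

  gaussian-automorphs : ∀ {Q a} → Reduced Q → 0ℤ < a → Q ≡ gaussian a → Σ (Enumeration (Iso Q Q)) λ E → (+ 1 / 2) ℚ.* size E ≡ ι (+ 2)
  gaussian-automorphs {a = a} red 0<a refl =
    record { list = ±S ; unique = ±S-unique ; sound = ±S-iso a ; complete = λ i → complete′ (classify red i) } , refl
    where
    complete′ : ∀ {g} → Classified (gaussian a) g → g ∈ ±S
    complete′ (inj₁ g∈)                        = there (there g∈)
    complete′ (inj₂ (inj₁ (_ , g∈)))           = g∈
    complete′ (inj₂ (inj₂ ((_ , refl) , _)))   = contradiction 0<a (ℤₚ.<-irrefl refl)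

  eisenstein-automorphs : ∀ {Q a} → Reduced Q → 0ℤ < a → Q ≡ eisenstein a → Σ (Enumeration (Iso Q Q)) λ E → (+ 1 / 3) ℚ.* size E ≡ ι (+ 2)
  eisenstein-automorphs {a = a} red 0<a refl =
    record { list = ±U ; unique = ±U-unique ; sound = ±U-iso a ; complete = λ i → complete′ (classify red i) } , refl
    where
    complete′ : ∀ {g} → Classified (eisenstein a) g → g ∈ ±U
    complete′ (inj₁ g∈)                        = there (there (there (there g∈)))
    complete′ (inj₂ (inj₁ ((_ , refl) , _)))   = contradiction 0<a (ℤₚ.<-irrefl refl)
    complete′ (inj₂ (inj₂ (_ , g∈)))           = g∈

  -- The weights 1/2, 1/3, 1 belong to stabilisers of order 4, 6, 2, so the product is always 2.
  -- This constant is what makes weighted counts of equivalences independent of the form.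
  automorphs : ∀ {Q} → Reduced Q → Σ (Enumeration (Iso Q Q)) λ E → 1/ω Q ℚ.* size E ≡ ι (+ 2)
  automorphs {Q} red = go (gaussian? Q) (eisenstein? Q)
    where
    go : (G? : Dec (IsGaussian Q)) (E? : Dec (IsEisenstein Q)) →
         Σ (Enumeration (Iso Q Q)) λ E → weight G? E? ℚ.* size E ≡ ι (+ 2)
    go (yes (a , 0<a , Q~)) _ = gaussian-automorphs red 0<a (reduced-unique {Q} {gaussian a} red (gaussianReduced a 0<a) Q~)
    go (no _) (yes (a , 0<a , Q~)) = eisenstein-automorphs red 0<a (reduced-unique {Q} {eisenstein a} red (eisensteinReduced a 0<a) Q~)
    go (no ¬G) (no ¬E) = record { list = ±I ; unique = ±I-unique ; sound = ±I-iso Q ; complete = λ i → complete′ (classify red i) } , refl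
      where
      complete′ : ∀ {g} → Classified Q g → g ∈ ±I
      complete′ (inj₁ g∈)                        = g∈
      complete′ (inj₂ (inj₁ ((a , refl) , _)))   = contradiction (a , reduced⇒0<a {Q} red , BinaryQuadraticForms.~-refl) ¬G
      complete′ (inj₂ (inj₂ ((a , refl) , _)))   = contradiction (a , reduced⇒0<a {Q} red , BinaryQuadraticForms.~-refl) ¬E

-- Congruences modulo a prime

module PrimeModulus where

  open import Data.Integer.Base as ℤ using (ℤ; +_; -[1+_]; 0ℤ; 1ℤ; _+_; _*_; _-_; -_)
  import Data.Integer.Properties as ℤₚ
  open import Data.Integer.Divisibility.Signed
  open import Data.Integer.DivMod using (_%ℕ_; _/ℕ_; n%ℕd<d; a≡a%ℕn+[a/ℕn]*n)
  open import Data.Integer.Tactic.RingSolver using (solve-∀)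
  open import Data.Nat.Base as ℕ using (ℕ; NonZero)
  import Data.Nat.Coprimality as Coprimality
  import Data.Nat.Divisibility as ℕ∣
  open import Data.Nat.GCD using (module Bézout)
  import Data.Nat.Properties as ℕₚ
  open import Data.Nat.Primality using (Prime; prime⇒irreducible; euclidsLemma; prime⇒nonZero; ¬prime[1])
  open import Data.Product.Base using (∃-syntax; _×_; _,_)
  open import Data.Sum.Base as Sum using (_⊎_; inj₁; inj₂)
  open import Relation.Binary.PropositionalEquality
  open import Relation.Nullary using (¬_; contradiction)

  ∣-≡ : ∀ {k x y} → x ≡ y → k ∣ x → k ∣ y
  ∣-≡ refl k∣x = k∣x

  ∣-combine : ∀ {k x y} u v → k ∣ x → k ∣ y → k ∣ u * x + v * y
  ∣-combine u v k∣x k∣y = ∣m∣n⇒∣m+n (∣n⇒∣m*n u k∣x) (∣n⇒∣m*n v k∣y)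

  ∣-lin : ∀ {k x y z} u v → k ∣ x → k ∣ y → u * x + v * y ≡ z → k ∣ z
  ∣-lin u v k∣x k∣y eq = ∣-≡ eq (∣-combine u v k∣x k∣y)

  ∣-lin₁ : ∀ {k x z} u → k ∣ x → u * x ≡ z → k ∣ z
  ∣-lin₁ u k∣x eq = ∣-≡ eq (∣n⇒∣m*n u k∣x)

  ∣-0 : ∀ {k} → k ∣ 0ℤ
  ∣-0 {k} = divides 0ℤ refl

  residue : ∀ (p : ℕ) .{{_ : NonZero p}} (x : ℤ) → ∃[ j ] (j ℕ.< p × + p ∣ x - + j)
  residue p x = x %ℕ p , n%ℕd<d x p , divides (x /ℕ p)
    (trans (cong (_- + (x %ℕ p)) (a≡a%ℕn+[a/ℕn]*n x p)) (e (+ (x %ℕ p)) (x /ℕ p * + p)))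
    where
    e : ∀ r q → r + q - r ≡ q
    e = solve-∀

  ∣-small : ∀ {p z} → ℤ.∣ z ∣ ℕ.< p → + p ∣ z → z ≡ 0ℤ
  ∣-small {p} {z} z<p p∣z = ℤₚ.∣i∣≡0⇒i≡0 (zero (∣⇒∣ᵤ p∣z) z<p)
    where
    zero : ∀ {m} → p ℕ∣.∣ m → m ℕ.< p → m ≡ 0
    zero {ℕ.zero}  _   _   = refl
    zero {ℕ.suc m} p∣m m<p = contradiction (ℕ∣.∣⇒≤ p∣m) (ℕₚ.<⇒≱ m<p)

  4∤2 : ¬ + 4 ∣ + 2
  4∤2 d with ∣-small {4} (ℕ.s≤s (ℕ.s≤s (ℕ.s≤s ℕ.z≤n))) d
  ... | ()

  residues-equal : ∀ {p i j} → i ℕ.< p → j ℕ.< p → + p ∣ + i - + j → i ≡ j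
  residues-equal {p} {i} {j} i<p j<p p∣ = ℤₚ.+-injective (ℤₚ.i-j≡0⇒i≡j (+ i) (+ j) (∣-small
    (subst (λ z → ℤ.∣ z ∣ ℕ.< p) (sym (ℤₚ.m-n≡m⊖n i j)) (ℕₚ.≤-<-trans (ℤₚ.∣m⊝n∣≤m⊔n i j) (ℕₚ.⊔-pres-<m i<p j<p))) p∣))

  prime-nonZero : ∀ {p} → Prime p → ℤ.NonZero (+ p)
  prime-nonZero {p} pp = ℤ.≢-nonZero λ p≡0 → ℕ.≢-nonZero⁻¹ p {{prime⇒nonZero pp}} (ℤₚ.+-injective p≡0)

  module _ {p : ℕ} (pp : Prime p) where

    private instance
      _ = prime⇒nonZero pp

    opaque
      euclid : ∀ x y → + p ∣ x * y → + p ∣ x ⊎ + p ∣ y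
      euclid x y p∣xy = Sum.map ∣ᵤ⇒∣ ∣ᵤ⇒∣ (euclidsLemma ℤ.∣ x ∣ ℤ.∣ y ∣ pp (subst (p ℕ∣.∣_) (ℤₚ.abs-* x y) (∣⇒∣ᵤ p∣xy)))

    cancel-∣ : ∀ {x} y → ¬ + p ∣ x → + p ∣ x * y → + p ∣ y
    cancel-∣ {x} y p∤x d = Sum.[ (λ p∣x → contradiction p∣x p∤x) , (λ p∣y → p∣y) ] (euclid x y d)

    coprime : ∀ x → ¬ + p ∣ x → Coprimality.Coprime p ℤ.∣ x ∣
    coprime x p∤x (d∣p , d∣x) with prime⇒irreducible pp d∣p
    ... | inj₁ d≡1 = d≡1
    ... | inj₂ refl = contradiction (∣ᵤ⇒∣ d∣x) p∤x

    -- Bézout's identity for `p` and the absolute value of `x` comes in two shapes over ℕ, according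
    -- to which product exceeds the other by 1; the sign of `x` is put back at the end.
    inverse : ∀ x → ¬ + p ∣ x → ∃[ y ] (+ p ∣ x * y - 1ℤ)
    inverse x p∤x = signed x (natural (Coprimality.coprime-Bézout (coprime x p∤x)))
      where
      natural : Bézout.Identity 1 p ℤ.∣ x ∣ → ∃[ y ] (+ p ∣ + ℤ.∣ x ∣ * y - 1ℤ)
      natural (Bézout.+- u v eq) = - + v , divides (- + u) (trans (e (+ ℤ.∣ x ∣) (+ v))
          (trans (cong (λ z → - z) (trans (sym (trans (ℤₚ.pos-+ 1 (v ℕ.* ℤ.∣ x ∣)) (cong (λ z → 1ℤ + z) (ℤₚ.pos-* v ℤ.∣ x ∣)))) (trans (cong (λ n → + n) eq) (ℤₚ.pos-* u p))))
          (ℤₚ.neg-distribˡ-* (+ u) (+ p))))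
        where
        e : ∀ n v → n * - v - 1ℤ ≡ - (1ℤ + v * n)
        e = solve-∀
      natural (Bézout.-+ u v eq) = + v , divides (+ u) (trans (cong (_- 1ℤ) (trans (ℤₚ.*-comm (+ ℤ.∣ x ∣) (+ v))
          (trans (sym (ℤₚ.pos-* v ℤ.∣ x ∣)) (trans (cong (λ n → + n) (sym eq)) (trans (ℤₚ.pos-+ 1 (u ℕ.* p)) (cong (λ z → 1ℤ + z) (ℤₚ.pos-* u p)))))))
          (e (+ u * + p)))
        where
        e : ∀ z → 1ℤ + z - 1ℤ ≡ z
        e = solve-∀
      signed : ∀ x → ∃[ y ] (+ p ∣ + ℤ.∣ x ∣ * y - 1ℤ) → ∃[ y ] (+ p ∣ x * y - 1ℤ)
      signed (+ n)          yd      = yd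
      signed -[1+ n ] (y , d)       = - y , ∣-≡ (cong (_- 1ℤ) (e (+ ℕ.suc n) y)) d
        where
        e : ∀ x y → x * y ≡ - x * - y
        e = solve-∀

    euclid-contra : ∀ {x y} → ¬ + p ∣ x → ¬ + p ∣ y → ¬ + p ∣ x * y
    euclid-contra p∤x p∤y p∣xy = Sum.[ p∤x , p∤y ] (euclid _ _ p∣xy)

    euclid-sq : ∀ x → + p ∣ x * x → + p ∣ x
    euclid-sq x p∣xx = Sum.[ (λ d → d) , (λ d → d) ] (euclid x x p∣xx)

    p∤1 : ¬ + p ∣ 1ℤ
    p∤1 p∣1 = ¬prime[1] (subst Prime (ℕ∣.∣1⇒≡1 (∣⇒∣ᵤ p∣1)) pp)

    solution : ∀ u v → ¬ + p ∣ u → ∃[ j ] (j ℕ.< p × + p ∣ u * + j + v)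
    solution u v p∤u =
      let (y , d) = inverse u p∤u ; (j , j<p , d′) = residue p (- (y * v)) in
      j , j<p , ∣-lin (- v) (- u) d d′ (e u v y (+ j))
      where
      e : ∀ u v y j → - v * (u * y - 1ℤ) + - u * (- (y * v) - j) ≡ u * j + v
      e = solve-∀

    solution-unique : ∀ {u v i j} → ¬ + p ∣ u → i ℕ.< p → j ℕ.< p → + p ∣ u * + i + v → + p ∣ u * + j + v → i ≡ j
    solution-unique {u} {v} {i} {j} p∤u i<p j<p d d′ =
      residues-equal i<p j<p (Sum.[ (λ p∣u → contradiction p∣u p∤u) , (λ q → q) ] (euclid u (+ i - + j)
        (∣-≡ (e u v (+ i) (+ j)) (∣m∣n⇒∣m-n d d′))))
      where
      e : ∀ u v i j → (u * i + v) - (u * j + v) ≡ u * (i - j)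
      e = solve-∀

-- Matrices of determinant p and the projective line over 𝔽ₚ

module Lines where

  open import Data.Integer.Base as ℤ using (ℤ; +_; 0ℤ; 1ℤ; -1ℤ; _+_; _*_; _-_; -_)
  import Data.Integer.Properties as ℤₚ
  open import Data.Integer.Divisibility.Signed
  open import Data.Integer.Tactic.RingSolver using (solve-∀)
  open import Data.List.Base using (List; _∷_; map; upTo)
  open import Data.List.Membership.Propositional using (_∈_)
  open import Data.List.Membership.Propositional.Properties using (∈-upTo⁺; ∈-upTo⁻; ∈-map⁺; ∈-map⁻)
  open import Data.List.Relation.Unary.All as All using ([]; _∷_)
  import Data.List.Relation.Unary.All.Properties as Allₚ
  open import Data.List.Relation.Unary.AllPairs using ([]; _∷_)
  open import Data.List.Relation.Unary.Any using (here; there)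
  open import Data.List.Relation.Unary.Unique.Propositional using (Unique)
  import Data.List.Relation.Unary.Unique.Propositional.Properties as Uniqueₚ
  open import Data.Maybe.Base using (Maybe; just; nothing)
  open import Data.Maybe.Properties using (just-injective)
  open import Data.Nat.Base as ℕ using (ℕ; NonZero)
  open import Data.Nat.Primality using (Prime)
  open import Data.Product.Base using (∃-syntax; _×_; _,_)
  import Data.Sum.Base as Sum
  open import Relation.Binary.PropositionalEquality
  open import Relation.Nullary using (yes; no; contradiction)
  open PrimeModulus
  open Substitutions

  -- The point at infinity and the p finite points of the projective line over 𝔽ₚ.
  lines : ℕ → List (Maybe ℕ)
  lines p = nothing ∷ map just (upTo p)

  lines-unique : ∀ p → Unique (lines p)
  lines-unique p = Allₚ.map⁺ (All.tabulate λ _ ()) ∷ Uniqueₚ.map⁺ just-injective (Uniqueₚ.upTo⁺ p)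

  ∈-lines⁺ : ∀ {p j} → j ℕ.< p → just j ∈ lines p
  ∈-lines⁺ j<p = there (∈-map⁺ just (∈-upTo⁺ j<p))

  ∈-lines⁻ : ∀ {p j} → just j ∈ lines p → j ℕ.< p
  ∈-lines⁻ (there j∈) with ∈-map⁻ just j∈
  ... | _ , i∈ , refl = ∈-upTo⁻ i∈

  -- Representatives of the matrices of determinant p modulo SL₂(ℤ) on the right.
  rep : ℕ → Maybe ℕ → Matrix
  rep p nothing  = mat 1ℤ 0ℤ 0ℤ (+ p)
  rep p (just j) = mat (+ p) (+ j) 0ℤ 1ℤ

  opaque
    unfolding det adj _·_ _∘_ smul

    det-rep : ∀ p i → det (rep p i) ≡ + p
    det-rep p nothing  = e (+ p)
      where
      e : ∀ p → 1ℤ * p - 0ℤ * 0ℤ ≡ p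
      e = solve-∀
    det-rep p (just j) = e (+ p) (+ j)
      where
      e : ∀ p j → p * 1ℤ - j * 0ℤ ≡ p
      e = solve-∀

    det-column : ∀ {k α β γ δ} → k ∣ γ → k ∣ δ → det (mat α β γ δ) ≡ 1ℤ → k ∣ 1ℤ
    det-column {α = α} {β} {γ} {δ} k∣γ k∣δ d = ∣-lin (- β) α k∣γ k∣δ (trans (e α β γ δ) d)
      where
      e : ∀ α β γ δ → - β * γ + α * δ ≡ α * δ - β * γ
      e = solve-∀

    -- For two different lines, equality of the products makes `p` divide both entries of the lower
    -- row of a matrix of determinant 1. For the same line, `rep p i` is cancelled by multiplying
    -- with its adjugate.
    rep·-injective : ∀ {p} → Prime p → ∀ {i i′ h h′} → i ∈ lines p → i′ ∈ lines p → det h ≡ 1ℤ → det h′ ≡ 1ℤ →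
      rep p i · h ≡ rep p i′ · h′ → (i , h) ≡ (i′ , h′)
    rep·-injective {p} pp {i} {i′} {h} {h′} i∈ i′∈ d d′ eq = pair (same i i′ h h′ i∈ i′∈ d d′ eq)
      where
      mod : ∀ {i} → rep p i · h ≡ rep p i · h′ → h ≡ h′
      mod {i} eq′ = smul-injective (trans (sym (smul-det h)) (trans (cong (adj (rep p i) ·_) eq′) (smul-det h′)))
        where
        instance
          p≢0 : ℤ.NonZero (+ p)
          p≢0 = prime-nonZero pp
        smul-det : ∀ h → adj (rep p i) · (rep p i · h) ≡ smul (+ p) h
        smul-det h = trans (adj·g·h (rep p i) h) (cong (λ z → smul z h) (det-rep p i))
        smul-injective : ∀ {g g′} → smul (+ p) g ≡ smul (+ p) g′ → g ≡ g′
        smul-injective {mat α β γ δ} {mat α′ β′ γ′ δ′} eq = mat-cong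
          (c α α′ (cong Matrix.m₁₁ eq)) (c β β′ (cong Matrix.m₁₂ eq)) (c γ γ′ (cong Matrix.m₂₁ eq)) (c δ δ′ (cong Matrix.m₂₂ eq))
          where
          c : ∀ x y → + p * x ≡ + p * y → x ≡ y
          c x y = ℤₚ.*-cancelˡ-≡ (+ p) x y
      pair : i ≡ i′ → (i , h) ≡ (i′ , h′)
      pair refl = cong (i ,_) (mod {i} eq)
      r₀ : ∀ p γ δ → p * γ ≡ 0ℤ * δ + p * γ
      r₀ = solve-∀
      r₁ : ∀ x y → 0ℤ * x + 1ℤ * y ≡ y
      r₁ = solve-∀
      mixed : ∀ {j h h′} → det h′ ≡ 1ℤ → rep p nothing · h ≢ rep p (just j) · h′
      mixed {j} {mat α β γ δ} {mat α′ β′ γ′ δ′} d′ eq = p∤1 pp (det-column {α = α′} {β = β′}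
        (divides γ (sym (trans (ℤₚ.*-comm γ (+ p)) (trans (r₀ (+ p) γ α) (trans (cong Matrix.m₂₁ eq) (r₁ α′ γ′))))))
        (divides δ (sym (trans (ℤₚ.*-comm δ (+ p)) (trans (r₀ (+ p) δ β) (trans (cong Matrix.m₂₂ eq) (r₁ β′ δ′)))))) d′)
      same : ∀ i i′ h h′ → i ∈ lines p → i′ ∈ lines p → det h ≡ 1ℤ → det h′ ≡ 1ℤ → rep p i · h ≡ rep p i′ · h′ → i ≡ i′
      same nothing nothing _ _ _ _ _ _ _ = refl
      same nothing (just j) h h′ _ _ _ d′ eq = contradiction eq (mixed {j} {h} {h′} d′)
      same (just j) nothing h h′ _ _ d _ eq = contradiction (sym eq) (mixed {j} {h′} {h} d)
      same (just i) (just j) (mat α β γ δ) (mat α′ β′ γ′ δ′) i∈ j∈ d d′ eq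
        with trans (sym (r₁ α γ)) (trans (cong Matrix.m₂₁ eq) (r₁ α′ γ′)) | trans (sym (r₁ β δ)) (trans (cong Matrix.m₂₂ eq) (r₁ β′ δ′))
      ... | refl | refl with + p ∣? + i - + j
      ...   | yes p∣ = cong just (residues-equal (∈-lines⁻ i∈) (∈-lines⁻ j∈) p∣)
      ...   | no p∤ = contradiction (det-column {α = α} {β = β}
                  (column α α′ γ (cong Matrix.m₁₁ eq)) (column β β′ δ (cong Matrix.m₁₂ eq)) d) (p∤1 pp)
        where
        column : ∀ α α′ γ → + p * α + + i * γ ≡ + p * α′ + + j * γ → + p ∣ γ
        column α α′ γ eq = Sum.[ (λ p∣ → contradiction p∣ p∤) , (λ q → q) ] (euclid pp (+ i - + j) γ
          (divides (α′ - α) (trans (e₁ (+ i) (+ j) γ (+ p * α)) (trans (cong (λ z → z - (+ p * α + + j * γ)) eq) (e₂ (+ p) α α′ (+ j * γ))))))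
          where
          e₁ : ∀ i j γ x → (i - j) * γ ≡ (x + i * γ) - (x + j * γ)
          e₁ = solve-∀
          e₂ : ∀ p α α′ y → (p * α′ + y) - (p * α + y) ≡ (α′ - α) * p
          e₂ = solve-∀

    finite : ∀ {p α β γ δ j} → Prime p → j ℕ.< p → det (mat α β γ δ) ≡ + p → + p ∣ γ * + j + - α → + p ∣ δ * + j + - β →
      ∃[ i ] ∃[ h ] (i ∈ lines p × det h ≡ 1ℤ × mat α β γ δ ≡ rep p i · h)
    finite {p} {α} {β} {γ} {δ} {j} pp j<p d (divides q eq) (divides s eq′) = just j , mat (- q) (- s) γ δ , ∈-lines⁺ j<p ,
      ℤₚ.*-cancelˡ-≡ (+ p) (- q * δ - - s * γ) 1ℤ (trans (e₁ (+ p) q s γ δ) (trans (cong₂ (λ x y → - x * δ + y * γ) (sym eq) (sym eq′))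
        (trans (e₂ α β γ δ (+ j)) (trans d (sym (ℤₚ.*-identityʳ (+ p))))))) ,
      mat-cong (column α γ q eq) (column β δ s eq′) (e₃ (- q) γ) (e₃ (- s) δ)
      where
      instance
        p≢0 : ℤ.NonZero (+ p)
        p≢0 = prime-nonZero pp
      e₁ : ∀ p q s γ δ → p * (- q * δ - - s * γ) ≡ - (q * p) * δ + (s * p) * γ
      e₁ = solve-∀
      e₂ : ∀ α β γ δ j → - (γ * j + - α) * δ + (δ * j + - β) * γ ≡ α * δ - β * γ
      e₂ = solve-∀
      e₃ : ∀ q γ → γ ≡ 0ℤ * q + 1ℤ * γ
      e₃ = solve-∀
      column : ∀ α γ q → γ * + j + - α ≡ q * + p → α ≡ + p * - q + + j * γ
      column α γ q eq = trans (e α γ (+ j)) (trans (cong (λ z → - z + + j * γ) eq) (f (+ p) q (+ j * γ)))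
        where
        e : ∀ α γ j → α ≡ - (γ * j + - α) + j * γ
        e = solve-∀
        f : ∀ p q x → - (q * p) + x ≡ p * - q + x
        f = solve-∀

    -- The rows of `g` are linearly dependent modulo `p`. If the lower row vanishes modulo `p`, the
    -- line is the point at infinity. Otherwise the upper row is `j` times the lower one: `j` is
    -- found from a lower entry prime to `p`, and the determinant gives the congruence for the other
    -- column.
    decompose : ∀ {p} → Prime p → ∀ g → det g ≡ + p → ∃[ i ] ∃[ h ] (i ∈ lines p × det h ≡ 1ℤ × g ≡ rep p i · h)
    decompose {p} pp (mat α β γ δ) d with + p ∣? γ | + p ∣? δ
    ... | yes (divides γ′ refl) | yes (divides δ′ refl) = nothing , mat α β γ′ δ′ , here refl ,
      ℤₚ.*-cancelˡ-≡ (+ p) (α * δ′ - β * γ′) 1ℤ (trans (e₁ (+ p) α β γ′ δ′) (trans d (sym (ℤₚ.*-identityʳ (+ p))))) ,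
      mat-cong (e₂ α γ′) (e₂ β δ′) (e₃ (+ p) α γ′) (e₃ (+ p) β δ′)
      where
      instance
        p≢0 : ℤ.NonZero (+ p)
        p≢0 = prime-nonZero pp
      e₁ : ∀ p α β γ δ → p * (α * δ - β * γ) ≡ α * (δ * p) - β * (γ * p)
      e₁ = solve-∀
      e₂ : ∀ α γ → α ≡ 1ℤ * α + 0ℤ * γ
      e₂ = solve-∀
      e₃ : ∀ p α γ → γ * p ≡ 0ℤ * α + p * γ
      e₃ = solve-∀
    ... | no p∤γ | _ = let (j , j<p , p∣) = solution pp γ (- α) p∤γ in
      finite {α = α} {β} {γ} {δ} {j} pp j<p d p∣ (Sum.[ (λ p∣γ → contradiction p∣γ p∤γ) , (λ q → q) ] (euclid pp γ (δ * + j + - β)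
        (∣-lin δ 1ℤ p∣ ∣-refl (trans (cong (λ z → δ * (γ * + j + - α) + 1ℤ * z) (sym d)) (e α β γ δ (+ j))))))
      where
      e : ∀ α β γ δ j → δ * (γ * j + - α) + 1ℤ * (α * δ - β * γ) ≡ γ * (δ * j + - β)
      e = solve-∀
    ... | yes _ | no p∤δ = let (j , j<p , p∣) = solution pp δ (- β) p∤δ in
      finite {α = α} {β} {γ} {δ} {j} pp j<p d (Sum.[ (λ p∣δ → contradiction p∣δ p∤δ) , (λ q → q) ] (euclid pp δ (γ * + j + - α)
        (∣-lin γ -1ℤ p∣ ∣-refl (trans (cong (λ z → γ * (δ * + j + - β) + -1ℤ * z) (sym d)) (e α β γ δ (+ j)))))) p∣
      where
      e : ∀ α β γ δ j → γ * (δ * j + - β) + -1ℤ * (α * δ - β * γ) ≡ δ * (γ * j + - α)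
      e = solve-∀

-- Double counting of matrices of determinant p between reduced forms

module MassRelation where

  open import Data.Integer.Base as ℤ using (ℤ; +_; 0ℤ; 1ℤ)
  import Data.Integer.Properties as ℤₚ
  open import Data.Integer.Divisibility.Signed
  open import Data.Integer.Tactic.RingSolver using (solve-∀)
  open import Data.List.Base using (List)
  open import Data.List.Membership.Propositional using (_∈_)
  open import Data.List.Membership.Propositional.Properties using (∈-filter⁺; ∈-filter⁻)
  open import Data.List.Relation.Unary.Unique.Propositional using (Unique)
  import Data.List.Relation.Unary.Unique.Propositional.Properties as Uniqueₚ
  open import Data.Maybe.Base using (Maybe)
  open import Data.Nat.Base as ℕ using (ℕ; NonZero)
  import Data.Nat.Properties as ℕₚ
  open import Data.Nat.Primality using (Prime; prime⇒nonZero)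
  open import Data.Product.Base using (Σ; ∃-syntax; _×_; _,_; proj₁; proj₂)
  open import Data.Rational.Base using (ℚ; 1ℚ; _+_; _*_)
  open import Data.Rational.Properties as ℚₚ using (*-zeroʳ; *-identityʳ; *-identityˡ)
  open import Relation.Binary.PropositionalEquality
  open import Relation.Nullary using (Dec; yes; no; contradiction)
  open import Relation.Nullary.Decidable using (map′; _×-dec_)
  import Tactic.RingSolver as RS
  open BinaryQuadraticForms
    using (Reduced; reduced⇒0<a; reduced⇒disc<0; reduced-unique; posDef⁺; posDef?; reduce; reducedForms; reducedOfDisc?;
           box; box-unique; reduced-∈-box; _≟F_; ~-sym; ~-trans)
  open Automorphisms
  open Enumerations
  open FiniteSums
  open Lines
  open PrimeModulus using (prime-nonZero)
  open Rationals
  open Substitutions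

  reduced⇒posDef : ∀ {Q} → Reduced Q → PositiveDefinite Q
  reduced⇒posDef {Q} red = posDef⁺ (reduced⇒0<a {Q} red) (reduced⇒disc<0 {Q} red)

  canonical′ : ∀ X → Dec (PositiveDefinite X) → Form
  canonical′ X (yes pd) = proj₁ (reduce X pd)
  canonical′ X (no _)   = X

  opaque
    -- The reduced form equivalent to X when X is positive definite, and X otherwise.
    canonical : Form → Form
    canonical X = canonical′ X (posDef? X)

    canonical-spec : ∀ {X} → PositiveDefinite X → Reduced (canonical X) × X ~ canonical X
    canonical-spec {X} pd = go (posDef? X)
      where
      go : (pd? : Dec (PositiveDefinite X)) → Reduced (canonical′ X pd?) × X ~ canonical′ X pd?
      go (yes pd′) = proj₂ (reduce X pd′)
      go (no ¬pd)  = contradiction pd ¬pd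

  ·-cancel-adj : ∀ {u} g → det u ≡ 1ℤ → g ≡ u · (adj u · g)
  ·-cancel-adj {u} g d = sym (trans (g·adj·h u g) (trans (cong (λ z → smul z g) d) (smul-1 g)))

  ·-injective : ∀ {u g h} → det u ≡ 1ℤ → u · g ≡ u · h → g ≡ h
  ·-injective {u} {g} {h} d eq = trans (sym (undo g)) (trans (cong (adj u ·_) eq) (undo h))
    where
    undo : ∀ g → adj u · (u · g) ≡ g
    undo g = trans (adj·g·h u g) (trans (cong (λ z → smul z g) d) (smul-1 g))

  -- The equivalences from `X` to `Y` are none or a coset of the stabiliser of `Y`, so with the
  -- weight of `Y` they count 0 or 2. As `Y` is reduced, comparison with `canonical X` decides
  -- which.
  isos : ∀ {X Y} → PositiveDefinite X → Reduced Y →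
         Σ (Enumeration (Iso X Y)) λ E → 1/ω Y * size E ≡ δ (Y ≟F canonical X) * ι (+ 2)
  isos {X} {Y} pd red = go (Y ≟F canonical X)
    where
    red′ = proj₁ (canonical-spec pd)
    X~ = proj₂ (canonical-spec pd)
    pull : ∀ {u} → Iso X Y u → Σ (Enumeration (Iso Y Y)) (λ E → 1/ω Y * size E ≡ ι (+ 2)) →
           Σ (Enumeration (Iso X Y)) λ E → 1/ω Y * size E ≡ ι (+ 2)
    pull {u} X→Y (E , weighted) = image (u ·_) inj to from E , trans (cong (1/ω Y *_) (size-image (u ·_) inj to from E)) weighted
      where
      inj : ∀ {g h} → u · g ≡ u · h → g ≡ h
      inj {g} {h} = ·-injective {u} {g} {h} (det≡1 X→Y)
      to : ∀ {h} → Iso Y Y h → Iso X Y (u · h)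
      to {h} Y→Y = iso-· {g = u} {h} X→Y Y→Y
      from : ∀ {g} → Iso X Y g → ∃[ h ] (Iso Y Y h × g ≡ u · h)
      from {g} i = adj u · g , iso-· {g = adj u} {g} (iso-adj {g = u} X→Y) i , ·-cancel-adj {u} g (det≡1 X→Y)
    go : (Y? : Dec (Y ≡ canonical X)) → Σ (Enumeration (Iso X Y)) λ E → 1/ω Y * size E ≡ δ Y? * ι (+ 2)
    go (no Y≢) = empty (λ i → Y≢ (reduced-unique {Y} {canonical X} red red′ (~-trans (~-sym (iso⇒~ i)) X~))) ,
                 trans (*-zeroʳ (1/ω Y)) (sym (ℚₚ.*-zeroˡ (ι (+ 2))))
    go (yes Y≡) = let (E , weighted) = pull (proj₂ (~⇒iso (subst (X ~_) (sym Y≡) X~))) (automorphs {Y} red) in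
                  E , trans weighted (sym (*-identityˡ (ι (+ 2))))

  infix 4 _∣F_ _∣F?_
  _∣F_ : ℤ → Form → Set
  k ∣F Q = ∃[ R ] (Q ≡ scale k R)

  opaque
    unfolding scale

    ∣F⁺ : ∀ {k Q} → k ∣ Form.a Q → k ∣ Form.b Q → k ∣ Form.c Q → k ∣F Q
    ∣F⁺ {k} (divides a refl) (divides b refl) (divides c refl) =
      ⟨ a , b , c ⟩ , form-cong (ℤₚ.*-comm a k) (ℤₚ.*-comm b k) (ℤₚ.*-comm c k)

    ∣F⁻ : ∀ {k Q} → k ∣F Q → k ∣ Form.a Q × k ∣ Form.b Q × k ∣ Form.c Q
    ∣F⁻ {k} (⟨ a , b , c ⟩ , refl) = divides a (ℤₚ.*-comm k a) , divides b (ℤₚ.*-comm k b) , divides c (ℤₚ.*-comm k c)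

  opaque
    _∣F?_ : ∀ k Q → Dec (k ∣F Q)
    k ∣F? Q = map′ (λ (p , q , r) → ∣F⁺ p q r) ∣F⁻ (k ∣? Form.a Q ×-dec (k ∣? Form.b Q ×-dec k ∣? Form.c Q))

  quotient′ : ∀ {k Q} → Dec (k ∣F Q) → Form
  quotient′ (yes (R , _))   = R
  quotient′ {Q = Q} (no _)  = Q

  -- Q / k when k divides all coefficients of Q, and Q otherwise.
  quotientF : ℤ → Form → Form
  quotientF k Q = quotient′ (k ∣F? Q)

  quotientF-spec : ∀ {k Q} → k ∣F Q → Q ≡ scale k (quotientF k Q)
  quotientF-spec {k} {Q} k∣Q = go (k ∣F? Q)
    where
    go : (d : Dec (k ∣F Q)) → Q ≡ scale k (quotient′ d)
    go (yes (R , eq)) = eq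
    go (no ¬d)        = contradiction k∣Q ¬d

  ∈-reducedForms⁺ : ∀ {n Q} → Reduced Q → disc Q ≡ ℤ.- + n → Q ∈ reducedForms n
  ∈-reducedForms⁺ {n} {Q} red d = ∈-filter⁺ (reducedOfDisc? n) (reduced-∈-box n red d) (red , d)

  ∈-reducedForms⁻ : ∀ {n Q} → Q ∈ reducedForms n → Reduced Q × disc Q ≡ ℤ.- + n
  ∈-reducedForms⁻ {n} Q∈ = proj₂ (∈-filter⁻ (reducedOfDisc? n) {xs = box n} Q∈)

  reducedForms-unique : ∀ n → Unique (reducedForms n)
  reducedForms-unique n = Uniqueₚ.filter⁺ (reducedOfDisc? n) (box-unique n)

  -- For `k` = p this counts the zeros of `Q` on the projective line over 𝔽ₚ; for `k` = p² it counts
  -- the transforms that, divided by p², have discriminant `disc Q` / p².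
  lineCount : (p : ℕ) → ℤ → Form → ℚ
  lineCount p k Q = ∑ (lines p) λ i → δ (k ∣F? Q ∘ rep p i)

  module _ {p : ℕ} (pp : Prime p) where

    private
      p² = + p ℤ.* + p
      instance
        p≢0 : ℤ.NonZero (+ p)
        p≢0 = prime-nonZero pp
        p²≢0 : ℤ.NonZero p²
        p²≢0 = ℤₚ.i*j≢0 (+ p) (+ p)

      0<p : 0ℤ ℤ.< + p
      0<p = ℤ.+<+ (ℕₚ.n≢0⇒n>0 (ℕ.≢-nonZero⁻¹ p {{prime⇒nonZero pp}}))

      det-rep· : ∀ i {h} → det h ≡ 1ℤ → det (rep p i · h) ≡ + p
      det-rep· i {h} d = trans (det-· (rep p i) h) (trans (cong₂ ℤ._*_ (det-rep p i) d) (ℤₚ.*-identityʳ (+ p)))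

      posDef-rep : ∀ {Q} i → PositiveDefinite Q → PositiveDefinite (Q ∘ rep p i)
      posDef-rep {Q} i pd = posDef-∘ {Q} {rep p i} pd (subst (0ℤ ℤ.<_) (sym (det-rep p i)) 0<p)

    -- Applying the adjugate to `X ∘ h ≡ scale p² Y` shows that p² divides `X`. After division by p²
    -- the equivalences are those counted by `isos`.
    isos-p² : ∀ {X Y} → PositiveDefinite X → Reduced Y →
      Σ (Enumeration (Iso X (scale p² Y))) λ E → 1/ω Y * size E ≡ δ (p² ∣F? X) * (δ (Y ≟F canonical (quotientF p² X)) * ι (+ 2))
    isos-p² {X} {Y} pd red = go (p² ∣F? X)
      where
      go : (d : Dec (p² ∣F X)) → Σ (Enumeration (Iso X (scale p² Y))) λ E → 1/ω Y * size E ≡ δ d * (δ (Y ≟F canonical (quotientF p² X)) * ι (+ 2))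
      go (no ¬d) = empty (λ {h} (iso d eq) → ¬d (Y ∘ adj h , trans (unadj h d) (trans (cong (_∘ adj h) eq) (scale-∘ p² Y (adj h))))) ,
                   trans (*-zeroʳ (1/ω Y)) (sym (ℚₚ.*-zeroˡ (δ (Y ≟F canonical (quotientF p² X)) * ι (+ 2))))
        where
        unadj : ∀ h → det h ≡ 1ℤ → X ≡ X ∘ h ∘ adj h
        unadj h d = sym (trans (∘-adj X h) (trans (cong (λ z → scale (z ℤ.* z) X) d) (scale-1 X)))
      go (yes p²∣X) = image (λ h → h) (λ eq → eq) to from E ,
                      trans (cong (1/ω Y *_) (size-image (λ h → h) (λ eq → eq) to from E)) (trans weighted (sym (*-identityˡ (δ (Y ≟F canonical R) * ι (+ 2)))))
        where
        R = quotientF p² X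
        X≡ : X ≡ scale p² R
        X≡ = quotientF-spec p²∣X
        pdR : PositiveDefinite R
        pdR = posDef-unscale p² (BinaryQuadraticForms.0<* 0<p 0<p) (subst PositiveDefinite X≡ pd)
        E = proj₁ (isos {R} {Y} pdR red)
        weighted = proj₂ (isos {R} {Y} pdR red)
        to : ∀ {h} → Iso R Y h → Iso X (scale p² Y) h
        to {h} (iso d eq) = iso d (trans (cong (_∘ h) X≡) (trans (scale-∘ p² R h) (cong (scale p²) eq)))
        from : ∀ {h} → Iso X (scale p² Y) h → ∃[ h′ ] (Iso R Y h′ × h ≡ h′)
        from {h} (iso d eq) = h , iso d (scale-injective p² (trans (sym (scale-∘ p² R h)) (trans (cong (_∘ h) (sym X≡)) eq))) , refl

    -- Both sides enumerate the matrices g of determinant p with Q ∘ g = Q′; the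
    -- adjugate of such a g carries Q′ to p² Q.
    correspondence : ∀ {Q Q′} →
      (E : ∀ i → Enumeration (Iso (Q ∘ rep p i) Q′)) (E′ : ∀ i → Enumeration (Iso (Q′ ∘ rep p i) (scale p² Q))) →
      ∑ (lines p) (λ i → size (E i)) ≡ ∑ (lines p) (λ i → size (E′ i))
    correspondence {Q} {Q′} E E′ = trans (sym (size-sigma E (lines-unique p)))
      (trans (size-≡ (sigma E (lines-unique p)) (sigma E′ (lines-unique p)) Related inj inj′ to from)
        (size-sigma E′ (lines-unique p)))
      where
      P P′ : Maybe ℕ × Matrix → Set
      P  (i , h) = i ∈ lines p × Iso (Q ∘ rep p i) Q′ h
      P′ (i , h) = i ∈ lines p × Iso (Q′ ∘ rep p i) (scale p² Q) h
      Related : Maybe ℕ × Matrix → Maybe ℕ × Matrix → Set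
      Related x@(i , h) y@(i′ , h′) = P x × P′ y × rep p i′ · h′ ≡ adj (rep p i · h)
      inj : ∀ {x x′ y} → Related x y → Related x′ y → x ≡ x′
      inj {i , h} {j , k} ((i∈ , iso d _) , _ , eq) ((j∈ , iso d′ _) , _ , eq′) = rep·-injective pp {i} {j} {h} {k} i∈ j∈ d d′
        (trans (sym (adj-adj (rep p i · h))) (trans (cong adj (trans (sym eq) eq′)) (adj-adj (rep p j · k))))
      inj′ : ∀ {x y y′} → Related x y → Related x y′ → y ≡ y′
      inj′ {y = i , h} {j , k} (_ , (i∈ , iso d _) , eq) (_ , (j∈ , iso d′ _) , eq′) =
        rep·-injective pp {i} {j} {h} {k} i∈ j∈ d d′ (trans eq (sym eq′))
      to : ∀ {x} → P x → ∃[ y ] (P′ y × Related x y)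
      to {i , h} Px@(i∈ , iso d eq) = let (i′ , h′ , i′∈ , d′ , adj≡) = decompose pp (adj g) (trans (det-adj g) det-g)
                                          P′y = i′∈ , iso d′ (moved {i′} {h′} adj≡) in
        (i′ , h′) , P′y , (Px , P′y , sym adj≡)
        where
        g = rep p i · h
        det-g = det-rep· i {h} d
        moved : ∀ {i′ h′} → adj g ≡ rep p i′ · h′ → Q′ ∘ rep p i′ ∘ h′ ≡ scale p² Q
        moved {i′} {h′} adj≡ = begin
          Q′ ∘ rep p i′ ∘ h′           ≡⟨ ∘-· Q′ (rep p i′) h′ ⟨
          Q′ ∘ (rep p i′ · h′)         ≡⟨ cong₂ _∘_ (sym (trans (∘-· Q (rep p i) h) eq)) (sym adj≡) ⟩
          Q ∘ g ∘ adj g                ≡⟨ ∘-adj Q g ⟩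
          scale (det g ℤ.* det g) Q    ≡⟨ cong (λ z → scale (z ℤ.* z) Q) det-g ⟩
          scale p² Q                   ∎
          where open ≡-Reasoning
      from : ∀ {y} → P′ y → ∃[ x ] (P x × Related x y)
      from {i′ , h′} P′y@(i′∈ , iso d′ eq) = let (i , h , i∈ , d , adj≡) = decompose pp (adj g) (trans (det-adj g) det-g)
                                                 Px = i∈ , iso d (moved {i} {h} adj≡) in
        (i , h) , Px , (Px , P′y , trans (sym (adj-adj g)) (cong adj adj≡))
        where
        g = rep p i′ · h′
        det-g = det-rep· i′ {h′} d′
        moved : ∀ {i h} → adj g ≡ rep p i · h → Q ∘ rep p i ∘ h ≡ Q′
        moved {i} {h} adj≡ = scale-injective p² (begin
          scale p² (Q ∘ rep p i ∘ h)      ≡⟨ cong (scale p²) (trans (sym (∘-· Q (rep p i) h)) (cong (Q ∘_) (sym adj≡))) ⟩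
          scale p² (Q ∘ adj g)            ≡⟨ scale-∘ p² Q (adj g) ⟨
          scale p² Q ∘ adj g              ≡⟨ cong (_∘ adj g) (sym (trans (∘-· Q′ (rep p i′) h′) eq)) ⟩
          Q′ ∘ g ∘ adj g                  ≡⟨ ∘-adj Q′ g ⟩
          scale (det g ℤ.* det g) Q′      ≡⟨ cong (λ z → scale (z ℤ.* z) Q′) det-g ⟩
          scale p² Q′                     ∎)
          where open ≡-Reasoning

    -- Multiplied by 2, both sides are `1/ω Q * 1/ω Q′` times the number of matrices of determinant
    -- `p` from `Q` to `Q′`. The weight of `Q′` absorbs the equivalences on the left, and that of
    -- `Q` those on the right. This is the self-adjointness of the Hecke correspondence.
    symmetric : ∀ {Q Q′} → Reduced Q → Reduced Q′ →
      1/ω Q * ∑ (lines p) (λ i → δ (Q′ ≟F canonical (Q ∘ rep p i))) ≡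
      1/ω Q′ * ∑ (lines p) (λ i → δ (p² ∣F? Q′ ∘ rep p i) * δ (Q ≟F canonical (quotientF p² (Q′ ∘ rep p i))))
    symmetric {Q} {Q′} red red′ = *-cancelˡ {ι (+ 2)} (λ ()) (begin
      ι (+ 2) * (w * ∑L f)                    ≡⟨ e (ι (+ 2)) w (∑L f) ⟩
      w * (∑L f * ι (+ 2))                    ≡⟨ cong (w *_) (∑-*ʳ (lines p) f (ι (+ 2))) ⟨
      w * ∑L (λ i → f i * ι (+ 2))            ≡⟨ cong (w *_) (∑-cong (lines p) λ {i} _ → sym (proj₂ (A i))) ⟩
      w * ∑L (λ i → w′ * size (E i))          ≡⟨ cong (w *_) (∑-*ˡ w′ (lines p) (λ i → size (E i))) ⟩
      w * (w′ * ∑L (λ i → size (E i)))        ≡⟨ cong (λ z → w * (w′ * z)) (correspondence {Q} {Q′} E E′) ⟩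
      w * (w′ * ∑L (λ i → size (E′ i)))       ≡⟨ e₂ w w′ (∑L (λ i → size (E′ i))) ⟩
      w′ * (w * ∑L (λ i → size (E′ i)))       ≡⟨ cong (w′ *_) (∑-*ˡ w (lines p) (λ i → size (E′ i))) ⟨
      w′ * ∑L (λ i → w * size (E′ i))         ≡⟨ cong (w′ *_) (∑-cong (lines p) λ {i} _ → trans (proj₂ (A′ i)) (e₃ (δ (p² ∣F? Q′ ∘ rep p i)) _ (ι (+ 2)))) ⟩
      w′ * ∑L (λ i → f′ i * ι (+ 2))          ≡⟨ cong (w′ *_) (∑-*ʳ (lines p) f′ (ι (+ 2))) ⟩
      w′ * (∑L f′ * ι (+ 2))                  ≡⟨ e (ι (+ 2)) w′ (∑L f′) ⟨
      ι (+ 2) * (w′ * ∑L f′)                  ∎)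
      where
      open ≡-Reasoning
      ∑L : (Maybe ℕ → ℚ) → ℚ
      ∑L = ∑ (lines p)
      w = 1/ω Q
      w′ = 1/ω Q′
      f f′ : Maybe ℕ → ℚ
      f i = δ (Q′ ≟F canonical (Q ∘ rep p i))
      f′ i = δ (p² ∣F? Q′ ∘ rep p i) * δ (Q ≟F canonical (quotientF p² (Q′ ∘ rep p i)))
      A = λ i → isos {Q ∘ rep p i} {Q′} (posDef-rep {Q} i (reduced⇒posDef {Q} red)) red′
      A′ = λ i → isos-p² {Q′ ∘ rep p i} {Q} (posDef-rep {Q′} i (reduced⇒posDef {Q′} red′)) red
      E = λ i → proj₁ (A i)
      E′ = λ i → proj₁ (A′ i)
      e : ∀ t w x → t * (w * x) ≡ w * (x * t)
      e = RS.solve-∀ ringℚ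
      e₂ : ∀ x y z → x * (y * z) ≡ y * (x * z)
      e₂ = RS.solve-∀ ringℚ
      e₃ : ∀ x y z → x * (y * z) ≡ x * y * z
      e₃ = RS.solve-∀ ringℚ

    canonical-disc : ∀ {X D} → PositiveDefinite X → disc X ≡ D → disc (canonical X) ≡ D
    canonical-disc {X} pd d = trans (BinaryQuadraticForms.Coefficients.disc-eq {X} (proj₂ (canonical-spec pd))) d

    ∑-canonical : ∀ {n X} → PositiveDefinite X → disc X ≡ ℤ.- + n → ∑ (reducedForms n) (λ Y → δ (Y ≟F canonical X)) ≡ 1ℚ
    ∑-canonical {n} {X} pd d = trans (∑-cong (reducedForms n) λ {Y} _ → sym (*-identityʳ (δ (Y ≟F canonical X))))
      (∑-δ (λ _ → 1ℚ) (_≟F canonical X) (reducedForms-unique n)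
        (∈-reducedForms⁺ (proj₁ (canonical-spec pd)) (canonical-disc pd d)))

    -- Each transform of `Q` is equivalent to exactly one reduced `Q′` of discriminant -p²n, so 1
    -- may be replaced by a sum over `Q′`. After `symmetric` the sum over `Q` is taken for fixed
    -- `Q′`, and a line contributes precisely when p² divides the transform of `Q′`.
    mass-relation : ∀ n →
      ∑ (reducedForms n) (λ Q → 1/ω Q * ∑ (lines p) λ _ → 1ℚ) ≡ ∑ (reducedForms (p ℕ.* p ℕ.* n)) (λ Q → 1/ω Q * lineCount p p² Q)
    mass-relation n = begin
      ∑ A (λ Q → 1/ω Q * ∑ L λ _ → 1ℚ)
        ≡⟨ ∑-cong A (λ {Q} Q∈ → cong (1/ω Q *_) (∑-cong L λ {i} _ → sym (∑-canonical {p ℕ.* p ℕ.* n} {Q ∘ rep p i} (pdA Q∈ i) (discA {Q} Q∈ i)))) ⟩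
      ∑ A (λ Q → 1/ω Q * ∑ L λ i → ∑ B λ Q′ → F Q Q′ i)
        ≡⟨ ∑-cong A (λ {Q} _ → trans (cong (1/ω Q *_) (∑-swap L B (λ i Q′ → F Q Q′ i))) (sym (∑-*ˡ (1/ω Q) B (λ Q′ → ∑ L (F Q Q′))))) ⟩
      ∑ A (λ Q → ∑ B λ Q′ → 1/ω Q * ∑ L (F Q Q′))
        ≡⟨ ∑-cong A (λ {Q} Q∈ → ∑-cong B λ {Q′} Q′∈ →
             symmetric {Q} {Q′} (proj₁ (∈-reducedForms⁻ {n} Q∈)) (proj₁ (∈-reducedForms⁻ {p ℕ.* p ℕ.* n} Q′∈))) ⟩
      ∑ A (λ Q → ∑ B λ Q′ → 1/ω Q′ * ∑ L (λ i → G Q′ i * K Q Q′ i))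
        ≡⟨ ∑-swap A B (λ Q Q′ → 1/ω Q′ * ∑ L (λ i → G Q′ i * K Q Q′ i)) ⟩
      ∑ B (λ Q′ → ∑ A λ Q → 1/ω Q′ * ∑ L (λ i → G Q′ i * K Q Q′ i))
        ≡⟨ ∑-cong B (λ {Q′} Q′∈ → trans (∑-*ˡ (1/ω Q′) A (λ Q → ∑ L (λ i → G Q′ i * K Q Q′ i)))
             (cong (1/ω Q′ *_) (trans (∑-swap A L (λ Q i → G Q′ i * K Q Q′ i)) (∑-cong L λ {i} _ → collapse Q′∈ i)))) ⟩
      ∑ B (λ Q′ → 1/ω Q′ * lineCount p p² Q′)
        ∎
      where
      F K : Form → Form → Maybe ℕ → ℚ
      F Q Q′ i = δ (Q′ ≟F canonical (Q ∘ rep p i))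
      K Q Q′ i = δ (Q ≟F canonical (quotientF p² (Q′ ∘ rep p i)))
      G : Form → Maybe ℕ → ℚ
      G Q′ i = δ (p² ∣F? Q′ ∘ rep p i)
      open ≡-Reasoning
      A = reducedForms n
      B = reducedForms (p ℕ.* p ℕ.* n)
      L = lines p
      p²n : p² ℤ.* (ℤ.- + n) ≡ ℤ.- + (p ℕ.* p ℕ.* n)
      p²n = trans (sym (ℤₚ.neg-distribʳ-* p² (+ n))) (cong ℤ.-_ (trans (cong (ℤ._* + n) (sym (ℤₚ.pos-* p p))) (sym (ℤₚ.pos-* (p ℕ.* p) n))))
      disc-rep : ∀ Q i → disc (Q ∘ rep p i) ≡ p² ℤ.* disc Q
      disc-rep Q i = trans (disc-∘ Q (rep p i)) (cong (λ z → z ℤ.* z ℤ.* disc Q) (det-rep p i))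
      pdA : ∀ {Q} → Q ∈ A → ∀ i → PositiveDefinite (Q ∘ rep p i)
      pdA {Q} Q∈ i = posDef-rep {Q} i (reduced⇒posDef {Q} (proj₁ (∈-reducedForms⁻ {n} Q∈)))
      discA : ∀ {Q} → Q ∈ A → ∀ i → disc (Q ∘ rep p i) ≡ ℤ.- + (p ℕ.* p ℕ.* n)
      discA {Q} Q∈ i = trans (disc-rep Q i) (trans (cong (p² ℤ.*_) (proj₂ (∈-reducedForms⁻ {n} Q∈))) p²n)
      collapse : ∀ {Q′} → Q′ ∈ B → ∀ i →
        ∑ A (λ Q → G Q′ i * K Q Q′ i) ≡ G Q′ i
      collapse {Q′} Q′∈ i = trans (∑-*ˡ (δ (p² ∣F? X)) A (λ Q → δ (Q ≟F canonical (quotientF p² X)))) (trans (δ*-cong (p² ∣F? X) total) (*-identityʳ (δ (p² ∣F? X))))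
        where
        X = Q′ ∘ rep p i
        total : p² ∣F X → ∑ A (λ Q → δ (Q ≟F canonical (quotientF p² X))) ≡ 1ℚ
        total p²∣X = ∑-canonical {n} {quotientF p² X} pdR discR
          where
          R = quotientF p² X
          X≡ : X ≡ scale p² R
          X≡ = quotientF-spec p²∣X
          redQ′ = proj₁ (∈-reducedForms⁻ {p ℕ.* p ℕ.* n} Q′∈)
          discQ′ = proj₂ (∈-reducedForms⁻ {p ℕ.* p ℕ.* n} Q′∈)
          pdR = posDef-unscale p² (BinaryQuadraticForms.0<* 0<p 0<p) (subst PositiveDefinite X≡ (posDef-rep {Q′} i (reduced⇒posDef {Q′} redQ′)))
          -- The transform of `Q′` has discriminant p² · (-p²n), and equals p² R, of discriminant p⁴
          -- `disc R`; so p² is cancelled twice.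
          discR : disc R ≡ ℤ.- + n
          discR = ℤₚ.*-cancelˡ-≡ p² (disc R) (ℤ.- + n) (ℤₚ.*-cancelˡ-≡ p² (p² ℤ.* disc R) (p² ℤ.* (ℤ.- + n))
            (trans (sym (ℤₚ.*-assoc p² p² (disc R))) (trans (sym (disc-scale p² R)) (trans (cong disc (sym X≡))
              (trans (disc-rep Q′ i) (cong (p² ℤ.*_) (trans discQ′ (sym p²n))))))))

-- Zeros of a form on the projective line over 𝔽ₚ

module LineCounts where

  open import Data.Integer.Base using (ℤ; +_; 0ℤ; 1ℤ; -1ℤ; _+_; _*_; _-_; -_)
  import Data.Integer.Properties as ℤₚ
  open import Data.Integer.Divisibility.Signed
  open import Data.Integer.Tactic.RingSolver using (solve-∀)
  open import Data.List.Base using (upTo)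
  open import Data.List.Membership.Propositional.Properties using (∈-upTo⁺; ∈-upTo⁻)
  import Data.List.Relation.Unary.Unique.Propositional.Properties as Uniqueₚ
  open import Data.Maybe.Base using (just; nothing)
  open import Data.Nat.Base using (ℕ)
  import Data.Nat.Properties as ℕₚ
  open import Data.Nat.Primality using (Prime)
  open import Data.Product.Base using (_,_; proj₁; proj₂)
  open import Data.Rational.Base as ℚ using (ℚ; 1ℚ)
  import Data.Rational.Properties as ℚₚ
  open import Data.Sum.Base as Sum using (_⊎_)
  open import Relation.Binary.PropositionalEquality
  open import Relation.Nullary using (¬_; Dec; yes; no; contradiction)
  open FiniteSums
  open Lines
  open MassRelation
  open PrimeModulus
  open Rationals
  open Substitutions

  value : Form → ℤ → ℤ
  value ⟨ a , b , c ⟩ j = a * (j * j) + b * j + c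

  slope : Form → ℤ → ℤ
  slope ⟨ a , b , c ⟩ j = + 2 * a * j + b

  complete-square : ∀ Q j → + 4 * Form.a Q * value Q j ≡ slope Q j * slope Q j - disc Q
  complete-square ⟨ a , b , c ⟩ j = e a b c j
    where
    e : ∀ a b c j → + 4 * a * (a * (j * j) + b * j + c) ≡ (+ 2 * a * j + b) * (+ 2 * a * j + b) - (b * b - + 4 * (a * c))
    e = solve-∀

  opaque
    unfolding _∘_

    ∘-rep-∞ : ∀ Q p → Q ∘ rep p nothing ≡ ⟨ Form.a Q , + p * Form.b Q , + p * + p * Form.c Q ⟩
    ∘-rep-∞ ⟨ a , b , c ⟩ p = form-cong (e₁ a b c) (e₂ a b c (+ p)) (e₃ a b c (+ p))
      where
      e₁ : ∀ a b c → a * (1ℤ * 1ℤ) + b * (1ℤ * 0ℤ) + c * (0ℤ * 0ℤ) ≡ a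
      e₁ = solve-∀
      e₂ : ∀ a b c p → + 2 * (a * (1ℤ * 0ℤ)) + b * (1ℤ * p + 0ℤ * 0ℤ) + + 2 * (c * (0ℤ * p)) ≡ p * b
      e₂ = solve-∀
      e₃ : ∀ a b c p → a * (0ℤ * 0ℤ) + b * (0ℤ * p) + c * (p * p) ≡ p * p * c
      e₃ = solve-∀

    ∘-rep-just : ∀ Q p j → Q ∘ rep p (just j) ≡ ⟨ + p * + p * Form.a Q , + p * slope Q (+ j) , value Q (+ j) ⟩
    ∘-rep-just ⟨ a , b , c ⟩ p j = form-cong (e₁ a b c (+ p)) (e₂ a b c (+ p) (+ j)) (e₃ a b c (+ j))
      where
      e₁ : ∀ a b c p → a * (p * p) + b * (p * 0ℤ) + c * (0ℤ * 0ℤ) ≡ p * p * a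
      e₁ = solve-∀
      e₂ : ∀ a b c p j → + 2 * (a * (p * j)) + b * (p * 1ℤ + j * 0ℤ) + + 2 * (c * (0ℤ * 1ℤ)) ≡ p * (+ 2 * a * j + b)
      e₂ = solve-∀
      e₃ : ∀ a b c j → a * (j * j) + b * (j * 1ℤ) + c * (1ℤ * 1ℤ) ≡ a * (j * j) + b * j + c
      e₃ = solve-∀

  module _ {p : ℕ} {Q : Form} where

    private
      k∣k* : ∀ {k} x → k ∣ k * x
      k∣k* {k} x = ∣m⇒∣m*n x (∣-refl {k})

      open Form Q

    p∣∞⁺ : + p ∣ a → + p ∣F Q ∘ rep p nothing
    p∣∞⁺ p∣a = subst (+ p ∣F_) (sym (∘-rep-∞ Q p)) (∣F⁺ p∣a (k∣k* b) (∣-≡ (sym (ℤₚ.*-assoc (+ p) (+ p) c)) (k∣k* (+ p * c))))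

    ∣∞⁻ : ∀ {k} → k ∣F Q ∘ rep p nothing → k ∣ a
    ∣∞⁻ {k} d = proj₁ (∣F⁻ (subst (k ∣F_) (∘-rep-∞ Q p) d))

    p²∣∞⁺ : + p * + p ∣ a → + p ∣ b → + p * + p ∣F Q ∘ rep p nothing
    p²∣∞⁺ p²∣a p∣b = subst (+ p * + p ∣F_) (sym (∘-rep-∞ Q p)) (∣F⁺ p²∣a (*-monoʳ-∣ (+ p) p∣b) (k∣k* c))

    p∣just⁺ : ∀ {j} → + p ∣ value Q (+ j) → + p ∣F Q ∘ rep p (just j)
    p∣just⁺ {j} d = subst (+ p ∣F_) (sym (∘-rep-just Q p j))
      (∣F⁺ (∣-≡ (sym (ℤₚ.*-assoc (+ p) (+ p) a)) (k∣k* (+ p * a))) (k∣k* (slope Q (+ j))) d)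

    ∣just⁻ : ∀ {k j} → k ∣F Q ∘ rep p (just j) → k ∣ value Q (+ j)
    ∣just⁻ {k} {j} d = proj₂ (proj₂ (∣F⁻ (subst (k ∣F_) (∘-rep-just Q p j) d)))

    p²∣just⁺ : ∀ {j} → + p ∣ slope Q (+ j) → + p * + p ∣ value Q (+ j) → + p * + p ∣F Q ∘ rep p (just j)
    p²∣just⁺ {j} d d′ = subst (+ p * + p ∣F_) (sym (∘-rep-just Q p j)) (∣F⁺ (k∣k* a) (*-monoʳ-∣ (+ p) d) d′)

  ∑-lines : ∀ p f → ∑ (lines p) f ≡ f nothing ℚ.+ ∑ (upTo p) (λ j → f (just j))
  ∑-lines p f = cong (λ z → f nothing ℚ.+ z) (∑-map just (upTo p) f)

  module _ {p : ℕ} (pp : Prime p) where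

    private
      p² = + p * + p

    ∑-root : ∀ {u v} {P : ℕ → Set} (P? : ∀ j → Dec (P j)) → ¬ + p ∣ u →
      (∀ {j} → P j → + p ∣ u * + j + v) → (∀ {j} → + p ∣ u * + j + v → P j) → ∑ (upTo p) (λ j → δ (P? j)) ≡ 1ℚ
    ∑-root {u} {v} P? p∤u to from =
      let (j₀ , j₀<p , root) = solution pp u v p∤u in
      trans (∑-cong (upTo p) λ {j} j∈ → trans
          (δ-cong (P? j) (j ℕₚ.≟ j₀) (λ Pj → solution-unique pp {u} {v} p∤u (∈-upTo⁻ j∈) j₀<p (to Pj) root) λ { refl → from root })
          (sym (ℚₚ.*-identityʳ (δ (j ℕₚ.≟ j₀)))))
        (∑-δ (λ _ → 1ℚ) (ℕₚ._≟ j₀) (Uniqueₚ.upTo⁺ p) (∈-upTo⁺ j₀<p))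

    p²⇒p : ∀ {x} → p² ∣ x → + p ∣ x
    p²⇒p (divides q refl) = divides (q * + p) (sym (ℤₚ.*-assoc q (+ p) (+ p)))

    p²-cancel : ∀ {u x} → ¬ + p ∣ u → p² ∣ u * x → p² ∣ x
    p²-cancel {u} {x} p∤u d with cancel-∣ pp {u} x p∤u (p²⇒p d)
    ... | divides q refl = *-monoˡ-∣ (+ p) (cancel-∣ pp {u} q p∤u
            (*-cancelʳ-∣ (+ p) {{prime-nonZero pp}} (∣-≡ (sym (ℤₚ.*-assoc u q (+ p))) d)))

    module _ (odd : ¬ + p ∣ + 2) where

      p∤4 : ¬ + p ∣ + 4
      p∤4 = euclid-contra pp {+ 2} {+ 2} odd odd

      module _ {Q : Form} where

        open Form Q

        root⇒slope : ∀ {j} → + p ∣ disc Q → + p ∣ value Q j → + p ∣ slope Q j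
        root⇒slope {j} p∣D p∣v = euclid-sq pp (slope Q j) (∣-lin (+ 4 * a) 1ℤ p∣v p∣D
          (trans (cong (_+ 1ℤ * disc Q) (complete-square Q j)) (e (slope Q j) (disc Q))))
          where
          e : ∀ s D → s * s - D + 1ℤ * D ≡ s * s
          e = solve-∀

        square-disc : ∀ {k x} → k ∣ slope Q x * slope Q x → k ∣ disc Q → k ∣ + 4 * a * value Q x
        square-disc {k} {x} d d′ = ∣-≡ (sym (complete-square Q x)) (∣m∣n⇒∣m-n d d′)

        p∤4a : ¬ + p ∣ a → ¬ + p ∣ + 4 * a
        p∤4a p∤a = euclid-contra pp {+ 4} {a} p∤4 p∤a

        p∤2a : ¬ + p ∣ a → ¬ + p ∣ + 2 * a
        p∤2a p∤a = euclid-contra pp {+ 2} {a} odd p∤a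

        b² : b * b ≡ disc Q + + 4 * c * a
        b² = e a b c
          where
          e : ∀ a b c → b * b ≡ b * b - + 4 * (a * c) + + 4 * c * a
          e = solve-∀

        p∣a⇒p∣b : + p ∣ disc Q → + p ∣ a → + p ∣ b
        p∣a⇒p∣b p∣D p∣a = euclid-sq pp b (∣-≡ (sym b²) (∣m∣n⇒∣m+n p∣D (∣n⇒∣m*n (+ 4 * c) p∣a)))

        value-∣a : ∀ j → + p ∣ a → + p ∣ value Q j → + p ∣ b * j + c
        value-∣a j p∣a d = ∣-lin 1ℤ (- (j * j)) d p∣a (e a b c j)
          where
          e : ∀ a b c j → 1ℤ * (a * (j * j) + b * j + c) + - (j * j) * a ≡ b * j + c
          e = solve-∀

        value-∣a⁻ : ∀ j → + p ∣ a → + p ∣ b * j + c → + p ∣ value Q j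
        value-∣a⁻ j p∣a d = ∣-lin 1ℤ (j * j) d p∣a (e a b c j)
          where
          e : ∀ a b c j → 1ℤ * (b * j + c) + j * j * a ≡ a * (j * j) + b * j + c
          e = solve-∀

        p∣c : ∀ {j} → + p ∣ b → + p ∣ b * j + c → + p ∣ c
        p∣c {j} p∣b d = ∣-lin 1ℤ (- j) d p∣b (e b c j)
          where
          e : ∀ b c j → 1ℤ * (b * j + c) + - j * b ≡ c
          e = solve-∀

        -- Modulo p such a form is a nonzero multiple of the square of a linear form, which has one
        -- zero: the point at infinity if p ∣ a, and otherwise the root of 2aj + b.
        lineCount-ramified : + p ∣ disc Q → ¬ + p ∣F Q → lineCount p (+ p) Q ≡ 1ℚ
        lineCount-ramified p∣D p∤Q = trans (∑-lines p (λ i → δ (+ p ∣F? Q ∘ rep p i))) (go (+ p ∣? a))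
          where
          go : Dec (+ p ∣ a) → δ (+ p ∣F? Q ∘ rep p nothing) ℚ.+ ∑ (upTo p) (λ j → δ (+ p ∣F? Q ∘ rep p (just j))) ≡ 1ℚ
          go (yes p∣a) = cong₂ ℚ._+_ (δ-yes (+ p ∣F? Q ∘ rep p nothing) (p∣∞⁺ {p} {Q} p∣a))
            (∑-zero (upTo p) λ {j} _ → δ-no (+ p ∣F? Q ∘ rep p (just j)) λ d →
              p∤Q (∣F⁺ p∣a p∣b (p∣c {+ j} p∣b (value-∣a (+ j) p∣a (∣just⁻ {p} {Q} d)))))
            where
            p∣b = p∣a⇒p∣b p∣D p∣a
          go (no p∤a) = cong₂ ℚ._+_ (δ-no (+ p ∣F? Q ∘ rep p nothing) λ d → p∤a (∣∞⁻ {p} {Q} d))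
            (∑-root {+ 2 * a} {b} (λ j → + p ∣F? Q ∘ rep p (just j)) (p∤2a p∤a)
              (λ {j} d → root⇒slope {+ j} p∣D (∣just⁻ {p} {Q} d))
              (λ {j} d → p∣just⁺ {p} {Q} (cancel-∣ pp {+ 4 * a} (value Q (+ j)) (p∤4a p∤a)
                (square-disc {+ p} {+ j} (∣n⇒∣m*n (slope Q (+ j)) d) p∣D))))

        -- A zero modulo p is a double one, so p divides the slope there. As 4a times the value is
        -- slope² - disc, the value is then divisible by p²; at infinity the same argument is b² -
        -- disc = 4ac.
        lineCount-p² : p² ∣ disc Q → ¬ + p ∣F Q → lineCount p p² Q ≡ lineCount p (+ p) Q
        lineCount-p² p²∣D p∤Q = ∑-cong (lines p) λ {i} _ → δ-cong (p² ∣F? Q ∘ rep p i) (+ p ∣F? Q ∘ rep p i) weaken (strengthen i)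
          where
          p∣D = p²⇒p p²∣D
          weaken : ∀ {X} → p² ∣F X → + p ∣F X
          weaken d = let (x , y , z) = ∣F⁻ d in ∣F⁺ (p²⇒p x) (p²⇒p y) (p²⇒p z)
          strengthen : ∀ i → + p ∣F Q ∘ rep p i → p² ∣F Q ∘ rep p i
          strengthen nothing d = p²∣∞⁺ {p} {Q} (p²-cancel {+ 4 * c} (euclid-contra pp {+ 4} {c} p∤4 λ p∣c → p∤Q (∣F⁺ p∣a p∣b p∣c)) p²∣4ca) p∣b
            where
            p∣a = ∣∞⁻ {p} {Q} d
            p∣b = p∣a⇒p∣b p∣D p∣a
            e : ∀ D x → D + x - D ≡ x
            e = solve-∀
            p²∣4ca : p² ∣ + 4 * c * a
            p²∣4ca = ∣-≡ (trans (cong (_- disc Q) b²) (e (disc Q) (+ 4 * c * a)))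
              (∣m∣n⇒∣m-n (∣-trans (*-monoˡ-∣ (+ p) p∣b) (*-monoʳ-∣ b p∣b)) p²∣D)
          strengthen (just j) d = p²∣just⁺ {p} {Q} p∣s (p²-cancel {+ 4 * a} (p∤4a p∤a)
              (square-disc {p²} {+ j} (∣-trans (*-monoˡ-∣ (+ p) p∣s) (*-monoʳ-∣ (slope Q (+ j)) p∣s)) p²∣D))
            where
            p∣s = root⇒slope {+ j} p∣D (∣just⁻ {p} {Q} d)
            p∤a : ¬ + p ∣ a
            p∤a p∣a = let p∣b = p∣a⇒p∣b p∣D p∣a in p∤Q (∣F⁺ p∣a p∣b (p∣c {+ j} p∣b (value-∣a (+ j) p∣a (∣just⁻ {p} {Q} d))))

        -- The discriminant is the nonzero square (t / c₀)² modulo p; `c₀` stays as a multiplier to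
        -- avoid inverses. If p ∤ a, the zeros are the roots of the two linear factors 2ac₀j + c₀b ±
        -- t. If p ∣ a, one zero is at infinity and the other is the root of bj + c.
        lineCount-split : ∀ c₀ t → ¬ + p ∣ c₀ → ¬ + p ∣ t → + p ∣ c₀ * c₀ * disc Q - t * t → lineCount p (+ p) Q ≡ ι (+ 2)
        lineCount-split c₀ t p∤c₀ p∤t split = trans (∑-lines p (λ i → δ (+ p ∣F? Q ∘ rep p i))) (go (+ p ∣? a))
          where
          go : Dec (+ p ∣ a) → δ (+ p ∣F? Q ∘ rep p nothing) ℚ.+ ∑ (upTo p) (λ j → δ (+ p ∣F? Q ∘ rep p (just j))) ≡ ι (+ 2)
          go (yes p∣a) = cong₂ ℚ._+_ (δ-yes (+ p ∣F? Q ∘ rep p nothing) (p∣∞⁺ {p} {Q} p∣a))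
            (∑-root {b} {c} (λ j → + p ∣F? Q ∘ rep p (just j)) p∤b
              (λ {j} d → value-∣a (+ j) p∣a (∣just⁻ {p} {Q} d))
              (λ {j} d → p∣just⁺ {p} {Q} (value-∣a⁻ (+ j) p∣a d)))
            where
            e : ∀ a b c c₀ t → (c₀ * c₀ * b) * b + (- (+ 4 * (c₀ * c₀ * c)) * a + -1ℤ * (c₀ * c₀ * (b * b - + 4 * (a * c)) - t * t)) ≡ t * t
            e = solve-∀
            p∤b : ¬ + p ∣ b
            p∤b p∣b = p∤t (euclid-sq pp t (∣-≡ (e a b c c₀ t)
              (∣m∣n⇒∣m+n (∣n⇒∣m*n (c₀ * c₀ * b) p∣b) (∣-combine (- (+ 4 * (c₀ * c₀ * c))) -1ℤ p∣a split))))
          go (no p∤a) = trans (cong₂ ℚ._+_ (δ-no (+ p ∣F? Q ∘ rep p nothing) λ d → p∤a (∣∞⁻ {p} {Q} d))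
              (trans (∑-cong (upTo p) λ {j} _ → two j) (trans (∑-+ (upTo p) (λ j → δ (r₊? j)) (λ j → δ (r₋? j)))
              (cong₂ ℚ._+_ (∑-root r₊? p∤2ac₀ (λ d → d) (λ d → d)) (∑-root r₋? p∤2ac₀ (λ d → d) (λ d → d)))))) refl
            where
            u = + 2 * a * c₀
            p∤2ac₀ : ¬ + p ∣ u
            p∤2ac₀ = euclid-contra pp {+ 2 * a} {c₀} (p∤2a p∤a) p∤c₀
            r₊? : ∀ j → Dec (+ p ∣ u * + j + (c₀ * b + t))
            r₊? j = + p ∣? u * + j + (c₀ * b + t)
            r₋? : ∀ j → Dec (+ p ∣ u * + j + (c₀ * b - t))
            r₋? j = + p ∣? u * + j + (c₀ * b - t)
            e₁ : ∀ a b c c₀ t j → (+ 2 * a * c₀ * j + (c₀ * b + t)) * (+ 2 * a * c₀ * j + (c₀ * b - t))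
              ≡ (+ 4 * a * (c₀ * c₀)) * (a * (j * j) + b * j + c) + 1ℤ * (c₀ * c₀ * (b * b - + 4 * (a * c)) - t * t)
            e₁ = solve-∀
            e₂ : ∀ a b c c₀ t j → 1ℤ * ((+ 2 * a * c₀ * j + (c₀ * b + t)) * (+ 2 * a * c₀ * j + (c₀ * b - t)))
              + -1ℤ * (c₀ * c₀ * (b * b - + 4 * (a * c)) - t * t) ≡ + 4 * a * (c₀ * c₀) * (a * (j * j) + b * j + c)
            e₂ = solve-∀
            e₃ : ∀ x y t → (x + (y + t)) - (x + (y - t)) ≡ + 2 * t
            e₃ = solve-∀
            forth : ∀ {j} → + p ∣F Q ∘ rep p (just j) → + p ∣ u * + j + (c₀ * b + t) ⊎ + p ∣ u * + j + (c₀ * b - t)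
            forth {j} d = euclid pp (u * + j + (c₀ * b + t)) (u * + j + (c₀ * b - t)) (∣-≡ (sym (e₁ a b c c₀ t (+ j)))
              (∣-combine (+ 4 * a * (c₀ * c₀)) 1ℤ (∣just⁻ {p} {Q} d) split))
            back : ∀ {j} → + p ∣ (u * + j + (c₀ * b + t)) * (u * + j + (c₀ * b - t)) → + p ∣F Q ∘ rep p (just j)
            back {j} d = p∣just⁺ {p} {Q} (cancel-∣ pp {+ 4 * a * (c₀ * c₀)} (value Q (+ j)) p∤4ac₀² (∣-lin 1ℤ -1ℤ d split (e₂ a b c c₀ t (+ j))))
              where
              p∤4ac₀² = euclid-contra pp {+ 4 * a} {c₀ * c₀} (p∤4a p∤a) (euclid-contra pp {c₀} {c₀} p∤c₀ p∤c₀)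
            two : ∀ j → δ (+ p ∣F? Q ∘ rep p (just j)) ≡ δ (r₊? j) ℚ.+ δ (r₋? j)
            two j = sum (r₊? j) (r₋? j)
              where
              X? = + p ∣F? Q ∘ rep p (just j)
              sum : (R₊ : Dec (+ p ∣ u * + j + (c₀ * b + t))) (R₋ : Dec (+ p ∣ u * + j + (c₀ * b - t))) → δ X? ≡ δ R₊ ℚ.+ δ R₋
              -- The two linear factors differ by 2t, so they have no common root modulo p.
              sum (yes d) (yes d′) = contradiction (∣-≡ (e₃ (u * + j) (c₀ * b) t) (∣m∣n⇒∣m-n d d′)) (euclid-contra pp {+ 2} {t} odd p∤t)
              sum (yes d) (no _)   = δ-yes X? (back (∣m⇒∣m*n (u * + j + (c₀ * b - t)) d))
              sum (no _)  (yes d)  = δ-yes X? (back (∣n⇒∣m*n (u * + j + (c₀ * b + t)) d))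
              sum (no ¬d) (no ¬d′) = δ-no X? λ d → Sum.[ ¬d , ¬d′ ] (forth d)

-- The relation between the class numbers of discriminants -n and -p²n

module ClassNumberRelation where

  open import Data.Integer.Base as ℤ using (ℤ; +_; 0ℤ; 1ℤ)
  import Data.Integer.Properties as ℤₚ
  open import Data.Integer.Divisibility.Signed using (_∣_; divides)
  open import Data.Integer.Tactic.RingSolver using (solve-∀)
  open import Data.List.Base using (upTo; List; []; _∷_)
  import Data.List.Properties as Listₚ
  open import Data.List.Membership.Propositional using (_∈_)
  open import Data.Nat.Base as ℕ using (ℕ; suc; NonZero)
  import Data.Nat.Properties as ℕₚ
  open import Data.Nat.Primality using (Prime; prime⇒nonZero)
  open import Data.Product.Base using (∃-syntax; _×_; _,_; proj₁; proj₂)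
  open import Data.Rational.Base using (ℚ; 0ℚ; 1ℚ; _+_; _*_; _-_; -_)
  import Data.Rational.Properties as ℚₚ
  open import Data.Sum.Base as Sum using (_⊎_; inj₁; inj₂)
  open import Relation.Binary.PropositionalEquality
  open import Relation.Nullary using (¬_; Dec; yes; no; contradiction)
  import Tactic.RingSolver as RS
  open BinaryQuadraticForms using (Reduced; reduced⇒0<a; reduced-unique; reducedForms; _≟F_; ~-refl; gaussianReduced; eisensteinReduced; 0<*)
  open Automorphisms
  open FiniteSums
  open Lines
  open LineCounts
  open MassRelation
  open PrimeModulus
  open Rationals
  open Substitutions

  module _ (k : ℤ) {{k>0 : ℤ.Positive k}} where

    private
      0<k : 0ℤ ℤ.< k
      0<k = ℤₚ.positive⁻¹ k
      instance
        k≢0 : ℤ.NonZero k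
        k≢0 = ℤ.≢-nonZero λ k≡0 → ℤₚ.<-irrefl (sym k≡0) 0<k
        k≥0 : ℤ.NonNegative k
        k≥0 = ℤ.nonNegative (ℤₚ.<⇒≤ 0<k)

    opaque
      unfolding scale

      reduced-scale⁺ : ∀ {Q} → Reduced Q → Reduced (scale k Q)
      reduced-scale⁺ {⟨ a , b , c ⟩} ((lo , hi) , (a≤c , tie)) =
        (subst (ℤ._< k ℤ.* b) (sym (ℤₚ.neg-distribʳ-* k a)) (ℤₚ.*-monoˡ-<-pos k lo) , ℤₚ.*-monoˡ-≤-nonNeg k hi) ,
        (ℤₚ.*-monoˡ-≤-nonNeg k a≤c ,
         Sum.map (ℤₚ.*-monoˡ-<-pos k) (λ 0≤b → subst (ℤ._≤ k ℤ.* b) (ℤₚ.*-zeroʳ k) (ℤₚ.*-monoˡ-≤-nonNeg k 0≤b)) tie)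

      reduced-scale⁻ : ∀ {Q} → Reduced (scale k Q) → Reduced Q
      reduced-scale⁻ {⟨ a , b , c ⟩} ((lo , hi) , (a≤c , tie)) =
        (ℤₚ.*-cancelˡ-<-nonNeg k (subst (ℤ._< k ℤ.* b) (ℤₚ.neg-distribʳ-* k a) lo) , ℤₚ.*-cancelˡ-≤-pos b a k hi) ,
        (ℤₚ.*-cancelˡ-≤-pos a c k a≤c ,
         Sum.map (ℤₚ.*-cancelˡ-<-nonNeg k) (λ 0≤kb → ℤₚ.*-cancelˡ-≤-pos 0ℤ b k (subst (ℤ._≤ k ℤ.* b) (sym (ℤₚ.*-zeroʳ k)) 0≤kb)) tie)

      gaussian-scale : ∀ a → scale k (gaussian a) ≡ gaussian (k ℤ.* a)
      gaussian-scale a = form-cong refl (ℤₚ.*-zeroʳ k) refl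

      gaussian-unscale : ∀ {Q a} → scale k Q ≡ gaussian a → Q ≡ gaussian (Form.a Q)
      gaussian-unscale {⟨ a , b , c ⟩} eq = form-cong refl
        (ℤₚ.*-cancelˡ-≡ k b 0ℤ (trans (cong Form.b eq) (sym (ℤₚ.*-zeroʳ k))))
        (ℤₚ.*-cancelˡ-≡ k c a (trans (cong Form.c eq) (sym (cong Form.a eq))))

      eisenstein-scale : ∀ a → scale k (eisenstein a) ≡ eisenstein (k ℤ.* a)
      eisenstein-scale a = refl

      eisenstein-unscale : ∀ {Q a} → scale k Q ≡ eisenstein a → Q ≡ eisenstein (Form.a Q)
      eisenstein-unscale {⟨ a , b , c ⟩} eq = form-cong refl
        (ℤₚ.*-cancelˡ-≡ k b a (trans (cong Form.b eq) (sym (cong Form.a eq))))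
        (ℤₚ.*-cancelˡ-≡ k c a (trans (cong Form.c eq) (sym (cong Form.a eq))))

    module _ (h : ℤ → Form) (red-h : ∀ a → 0ℤ ℤ.< a → Reduced (h a))
             (h-scale : ∀ a → scale k (h a) ≡ h (k ℤ.* a)) (h-unscale : ∀ {Q a} → scale k Q ≡ h a → Q ≡ h (Form.a Q)) where

      -- Between reduced forms equivalence is equality, so membership in the class of a multiple of
      -- x² + y² or x² + xy + y² can be read off the coefficients, where scaling is harmless.
      family-scale⁺ : ∀ {Q} → Reduced Q → ∃[ a ] (0ℤ ℤ.< a × Q ~ h a) → ∃[ a ] (0ℤ ℤ.< a × scale k Q ~ h a)
      family-scale⁺ {Q} red (a , 0<a , Q~) = k ℤ.* a , 0<* 0<k 0<a ,
        subst (_~ h (k ℤ.* a)) (sym (trans (cong (scale k) (reduced-unique {Q} {h a} red (red-h a 0<a) Q~)) (h-scale a))) ~-refl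

      family-scale⁻ : ∀ {Q} → Reduced Q → ∃[ a ] (0ℤ ℤ.< a × scale k Q ~ h a) → ∃[ a ] (0ℤ ℤ.< a × Q ~ h a)
      family-scale⁻ {Q} red (a , 0<a , kQ~) = Form.a Q , reduced⇒0<a {Q} red ,
        subst (Q ~_) (h-unscale (reduced-unique {scale k Q} {h a} (reduced-scale⁺ {Q} red) (red-h a 0<a) kQ~)) ~-refl

    weight-cong : ∀ {P P′ R R′ : Set} (P? : Dec P) (P′? : Dec P′) (R? : Dec R) (R′? : Dec R′) →
      (P → P′) → (P′ → P) → (R → R′) → (R′ → R) → weight P? R? ≡ weight P′? R′?
    weight-cong (yes p) (yes p′) _ _ _ _ _ _          = refl
    weight-cong (yes p) (no ¬p′) _ _ f _ _ _          = contradiction (f p) ¬p′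
    weight-cong (no ¬p) (yes p′) _ _ _ g _ _          = contradiction (g p′) ¬p
    weight-cong (no _) (no _) (yes r) (yes r′) _ _ _ _ = refl
    weight-cong (no _) (no _) (yes r) (no ¬r′) _ _ f _ = contradiction (f r) ¬r′
    weight-cong (no _) (no _) (no ¬r) (yes r′) _ _ _ g = contradiction (g r′) ¬r
    weight-cong (no _) (no _) (no _) (no _) _ _ _ _    = refl

    1/ω-scale : ∀ {Q} → Reduced Q → 1/ω (scale k Q) ≡ 1/ω Q
    1/ω-scale {Q} red = weight-cong (gaussian? (scale k Q)) (gaussian? Q) (eisenstein? (scale k Q)) (eisenstein? Q)
      (family-scale⁻ gaussian gaussianReduced gaussian-scale (λ {Q} {a} → gaussian-unscale {Q} {a}) {Q} red)
      (family-scale⁺ gaussian gaussianReduced gaussian-scale (λ {Q} {a} → gaussian-unscale {Q} {a}) {Q} red)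
      (family-scale⁻ eisenstein eisensteinReduced eisenstein-scale (λ {Q} {a} → eisenstein-unscale {Q} {a}) {Q} red)
      (family-scale⁺ eisenstein eisensteinReduced eisenstein-scale (λ {Q} {a} → eisenstein-unscale {Q} {a}) {Q} red)

  mass : ℕ → ℚ
  mass n = ∑ (reducedForms n) 1/ω

  mass≡classNumber : ∀ n .{{_ : NonZero n}} → mass n ≡ classNumber n
  mass≡classNumber (suc n) = refl

  module _ {p : ℕ} (pp : Prime p) where

    private
      p² = + p ℤ.* + p
      instance
        p≢0 : ℤ.NonZero (+ p)
        p≢0 = prime-nonZero pp
        p>0 : ℤ.Positive (+ p)
        p>0 = ℤ.positive (ℤ.+<+ (ℕₚ.n≢0⇒n>0 (ℕ.≢-nonZero⁻¹ p {{prime⇒nonZero pp}})))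
        p²≢0 : ℤ.NonZero p²
        p²≢0 = ℤₚ.i*j≢0 (+ p) (+ p)

      p²n : ∀ n → ℤ.- + (p ℕ.* p ℕ.* n) ≡ p² ℤ.* (ℤ.- + n)
      p²n n = sym (trans (sym (ℤₚ.neg-distribʳ-* p² (+ n))) (cong (λ z → ℤ.- z)
        (trans (cong (λ z → z ℤ.* + n) (sym (ℤₚ.pos-* p p))) (sym (ℤₚ.pos-* (p ℕ.* p) n)))))

    -- Multiplication by p keeps forms reduced and preserves `1/ω`; hence it is a weighted bijection
    -- from the reduced forms of discriminant -n to those of discriminant -p²n that p divides.
    divisible-sum : ∀ n (G : Form → ℚ) →
      ∑ (reducedForms (p ℕ.* p ℕ.* n)) (λ Q → 1/ω Q * (δ (+ p ∣F? Q) * G (quotientF (+ p) Q))) ≡ ∑ (reducedForms n) (λ Q → 1/ω Q * G Q)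
    divisible-sum n G = ∑-reindex _≟F_ _≟F_ (quotientF (+ p)) (scale (+ p)) (reducedForms-unique (p ℕ.* p ℕ.* n)) (reducedForms-unique n) to from
      where
      quotient-scale : ∀ Q → quotientF (+ p) (scale (+ p) Q) ≡ Q
      quotient-scale Q = scale-injective (+ p) (sym (quotientF-spec {+ p} {scale (+ p) Q} (Q , refl)))
      f : Form → ℚ
      f Q = 1/ω Q * (δ (+ p ∣F? Q) * G (quotientF (+ p) Q))
      f-scale : ∀ {Q} → Reduced Q → f (scale (+ p) Q) ≡ 1/ω Q * G Q
      f-scale {Q} red = cong₂ _*_ (1/ω-scale (+ p) {Q} red)
        (trans (δ-yes-* (+ p ∣F? scale (+ p) Q) (G (quotientF (+ p) (scale (+ p) Q))) (Q , refl)) (cong G (quotient-scale Q)))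
      from : ∀ {Q} → Q ∈ reducedForms n → 1/ω Q * G Q ≡ 0ℚ ⊎
        (scale (+ p) Q ∈ reducedForms (p ℕ.* p ℕ.* n) × quotientF (+ p) (scale (+ p) Q) ≡ Q × f (scale (+ p) Q) ≡ 1/ω Q * G Q)
      from {Q} Q∈ = let (red , d) = ∈-reducedForms⁻ {n} Q∈ in
        inj₂ (∈-reducedForms⁺ {p ℕ.* p ℕ.* n} {scale (+ p) Q} (reduced-scale⁺ (+ p) {Q} red)
                (trans (disc-scale (+ p) Q) (trans (cong (p² ℤ.*_) d) (sym (p²n n)))) ,
              quotient-scale Q , f-scale red)
      to : ∀ {Q} → Q ∈ reducedForms (p ℕ.* p ℕ.* n) → f Q ≡ 0ℚ ⊎
        (quotientF (+ p) Q ∈ reducedForms n × scale (+ p) (quotientF (+ p) Q) ≡ Q × f Q ≡ 1/ω (quotientF (+ p) Q) * G (quotientF (+ p) Q))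
      to {Q} Q∈ = go (+ p ∣F? Q) refl
        where
        red = proj₁ (∈-reducedForms⁻ {p ℕ.* p ℕ.* n} Q∈)
        d = proj₂ (∈-reducedForms⁻ {p ℕ.* p ℕ.* n} Q∈)
        R = quotientF (+ p) Q
        go : (p∣Q? : Dec (+ p ∣F Q)) → δ p∣Q? ≡ δ (+ p ∣F? Q) → f Q ≡ 0ℚ ⊎ (R ∈ reducedForms n × scale (+ p) R ≡ Q × f Q ≡ 1/ω R * G R)
        go (no _) eq = inj₁ (trans (cong (λ z → 1/ω Q * (z * G R)) (sym eq)) (trans (cong (1/ω Q *_) (ℚₚ.*-zeroˡ (G R))) (ℚₚ.*-zeroʳ (1/ω Q))))
        go (yes p∣Q) _ = inj₂ (∈-reducedForms⁺ {n} {R} redR discR , sym Q≡ , trans (cong f Q≡) (f-scale redR))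
          where
          Q≡ : Q ≡ scale (+ p) R
          Q≡ = quotientF-spec p∣Q
          redR : Reduced R
          redR = reduced-scale⁻ (+ p) {R} (subst Reduced Q≡ red)
          discR : disc R ≡ ℤ.- + n
          discR = ℤₚ.*-cancelˡ-≡ p² (disc R) (ℤ.- + n) (trans (sym (disc-scale (+ p) R)) (trans (cong disc (sym Q≡)) (trans d (p²n n))))

    ∑-lines-1 : ∑ (lines p) (λ _ → 1ℚ) ≡ 1ℚ + ι (+ p)
    ∑-lines-1 = trans (∑-lines p (λ _ → 1ℚ)) (cong (λ z → 1ℚ + z) (trans (∑-1 (upTo p)) (cong (λ n → ι (+ n)) (Listₚ.length-upTo p))))
      where
      open import Data.List.Base using (length)
      ∑-1 : ∀ {A : Set} (xs : List A) → ∑ xs (λ _ → 1ℚ) ≡ ι (+ length xs)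
      ∑-1 [] = refl
      ∑-1 (x ∷ xs) = trans (cong (λ z → 1ℚ + z) (∑-1 xs)) (sym (ι-+ 1ℤ (+ length xs)))

    lineCount-scaled : ∀ Q → lineCount p p² (scale (+ p) Q) ≡ lineCount p (+ p) Q
    lineCount-scaled Q = ∑-cong (lines p) λ {i} _ → δ-cong (p² ∣F? scale (+ p) Q ∘ rep p i) (+ p ∣F? Q ∘ rep p i)
      (λ (R , eq) → R , scale-injective (+ p) (trans (sym (scale-∘ (+ p) Q (rep p i))) (trans eq (sym (scale-scale (+ p) (+ p) R)))))
      (λ (R , eq) → R , trans (scale-∘ (+ p) Q (rep p i)) (trans (cong (scale (+ p)) eq) (scale-scale (+ p) (+ p) R)))

    lineCount-all : ∀ {Q} → + p ∣F Q → lineCount p (+ p) Q ≡ 1ℚ + ι (+ p)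
    lineCount-all {Q} (R , refl) = trans (∑-cong (lines p) λ {i} _ → δ-yes (+ p ∣F? scale (+ p) R ∘ rep p i) (R ∘ rep p i , scale-∘ (+ p) R (rep p i))) ∑-lines-1

    module _ (odd : ¬ + p ∣ + 2) where

      -- There are 1 + p lines. On the other side of `mass-relation`, a form not divisible by p has
      -- exactly one zero, since p² divides its discriminant, and this zero counts for p². For pR
      -- the count is that of the zeros of `R`. Writing it as 1 plus an excess leaves a sum over the
      -- forms `R` of discriminant -n.
      class-relation : ∀ n → (1ℚ + ι (+ p)) * mass n ≡ mass (p ℕ.* p ℕ.* n) + ∑ (reducedForms n) (λ Q → 1/ω Q * (lineCount p (+ p) Q - 1ℚ))
      class-relation n = begin
        (1ℚ + ι (+ p)) * mass n                                          ≡⟨ ∑-*ˡ (1ℚ + ι (+ p)) A 1/ω ⟨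
        ∑ A (λ Q → (1ℚ + ι (+ p)) * 1/ω Q)                               ≡⟨ ∑-cong A (λ {Q} _ → trans (ℚₚ.*-comm (1ℚ + ι (+ p)) (1/ω Q)) (cong (1/ω Q *_) (sym ∑-lines-1))) ⟩
        ∑ A (λ Q → 1/ω Q * ∑ (lines p) λ _ → 1ℚ)                         ≡⟨ mass-relation pp n ⟩
        ∑ B (λ Q → 1/ω Q * lineCount p p² Q)                             ≡⟨ ∑-cong B (λ {Q} Q∈ → trans (cong (1/ω Q *_) (split-count Q∈)) (e (1/ω Q) (δ (+ p ∣F? Q) * G (quotientF (+ p) Q)))) ⟩
        ∑ B (λ Q → 1/ω Q + 1/ω Q * (δ (+ p ∣F? Q) * G (quotientF (+ p) Q))) ≡⟨ ∑-+ B 1/ω (λ Q → 1/ω Q * (δ (+ p ∣F? Q) * G (quotientF (+ p) Q))) ⟩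
        mass (p ℕ.* p ℕ.* n) + ∑ B (λ Q → 1/ω Q * (δ (+ p ∣F? Q) * G (quotientF (+ p) Q)))
                                                                         ≡⟨ cong (λ z → mass (p ℕ.* p ℕ.* n) + z) (divisible-sum n G) ⟩
        mass (p ℕ.* p ℕ.* n) + ∑ A (λ Q → 1/ω Q * G Q)                   ∎
        where
        open ≡-Reasoning
        A = reducedForms n
        B = reducedForms (p ℕ.* p ℕ.* n)
        G : Form → ℚ
        G Q = lineCount p (+ p) Q - 1ℚ
        e : ∀ w x → w * (1ℚ + x) ≡ w + w * x
        e = RS.solve-∀ ringℚ
        e₁ : ∀ x → x ≡ 1ℚ + 1ℚ * (x - 1ℚ)
        e₁ = RS.solve-∀ ringℚ
        e₀ : ∀ x → 1ℚ ≡ 1ℚ + 0ℚ * x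
        e₀ = RS.solve-∀ ringℚ
        split-count : ∀ {Q} → Q ∈ B → lineCount p p² Q ≡ 1ℚ + δ (+ p ∣F? Q) * G (quotientF (+ p) Q)
        split-count {Q} Q∈ = go (+ p ∣F? Q)
          where
          R = quotientF (+ p) Q
          p²∣disc : p² ∣ disc Q
          p²∣disc = divides (ℤ.- + n) (trans (proj₂ (∈-reducedForms⁻ {p ℕ.* p ℕ.* n} Q∈)) (trans (p²n n) (ℤₚ.*-comm p² (ℤ.- + n))))
          go : (p∣Q? : Dec (+ p ∣F Q)) → lineCount p p² Q ≡ 1ℚ + δ p∣Q? * G R
          go (yes p∣Q) = trans (trans (cong (lineCount p p²) (quotientF-spec p∣Q)) (lineCount-scaled R)) (e₁ (lineCount p (+ p) R))
          go (no p∤Q)  = trans (trans (lineCount-p² pp odd p²∣disc p∤Q) (lineCount-ramified pp odd (p²⇒p pp p²∣disc) p∤Q)) (e₀ (G R))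

      -- Every form of discriminant -n has two zeros, so its excess is 1 and the sum in
      -- `class-relation` is `mass n`; the factor 1 + p drops to p.
      mass-split : ∀ n c t → ¬ + p ∣ c → ¬ + p ∣ t → + p ∣ c ℤ.* c ℤ.* (ℤ.- + n) ℤ.- t ℤ.* t →
        mass (p ℕ.* p ℕ.* n) ≡ ι (+ p) * mass n
      mass-split n c t p∤c p∤t split = conclude (trans (class-relation n) (cong (λ z → mass (p ℕ.* p ℕ.* n) + z)
        (trans (∑-cong (reducedForms n) λ {Q} Q∈ → cong (λ z → 1/ω Q * (z - 1ℚ))
            (lineCount-split pp odd {Q} c t p∤c p∤t (subst (λ D → + p ∣ c ℤ.* c ℤ.* D ℤ.- t ℤ.* t) (sym (proj₂ (∈-reducedForms⁻ {n} Q∈))) split)))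
          (∑-cong (reducedForms n) λ {Q} _ → ℚₚ.*-identityʳ (1/ω Q)))))
        where
        e : ∀ y z → y ≡ (y + z) - z
        e = RS.solve-∀ ringℚ
        f : ∀ x z → (1ℚ + x) * z - z ≡ x * z
        f = RS.solve-∀ ringℚ
        conclude : (1ℚ + ι (+ p)) * mass n ≡ mass (p ℕ.* p ℕ.* n) + mass n → mass (p ℕ.* p ℕ.* n) ≡ ι (+ p) * mass n
        conclude eq = trans (e (mass (p ℕ.* p ℕ.* n)) (mass n)) (trans (cong (_- mass n) (sym eq)) (f (ι (+ p)) (mass n)))

      -- Put N = p²n. A form of discriminant -N has one zero and excess 0 if p does not divide it,
      -- and all p + 1 lines as zeros and excess p if it does. The sum in `class-relation` is
      -- therefore p · `mass n`, which is `mass N` by hypothesis, and 1 + p again drops to p.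
      mass-ramified : ∀ n → mass (p ℕ.* p ℕ.* n) ≡ ι (+ p) * mass n →
        mass (p ℕ.* p ℕ.* (p ℕ.* p ℕ.* n)) ≡ ι (+ p) * mass (p ℕ.* p ℕ.* n)
      mass-ramified n hyp = conclude (trans (class-relation N) (cong (λ z → mass (p ℕ.* p ℕ.* N) + z)
        (trans (∑-cong (reducedForms N) λ {Q} Q∈ → cong (1/ω Q *_) (count Q∈)) (divisible-sum n (λ _ → ι (+ p))))))
        where
        N = p ℕ.* p ℕ.* n
        e : ∀ x → (1ℚ + x) - 1ℚ ≡ 1ℚ * x
        e = RS.solve-∀ ringℚ
        e₀ : ∀ x → 1ℚ - 1ℚ ≡ 0ℚ * x
        e₀ = RS.solve-∀ ringℚ
        count : ∀ {Q} → Q ∈ reducedForms N → lineCount p (+ p) Q - 1ℚ ≡ δ (+ p ∣F? Q) * ι (+ p)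
        count {Q} Q∈ = go (+ p ∣F? Q)
          where
          p²∣disc : p² ∣ disc Q
          p²∣disc = divides (ℤ.- + n) (trans (proj₂ (∈-reducedForms⁻ {N} Q∈)) (trans (p²n n) (ℤₚ.*-comm p² (ℤ.- + n))))
          go : (p∣Q? : Dec (+ p ∣F Q)) → lineCount p (+ p) Q - 1ℚ ≡ δ p∣Q? * ι (+ p)
          go (yes p∣Q) = trans (cong (_- 1ℚ) (lineCount-all {Q} p∣Q)) (e (ι (+ p)))
          go (no p∤Q)  = trans (cong (_- 1ℚ) (lineCount-ramified pp odd (p²⇒p pp p²∣disc) p∤Q)) (e₀ (ι (+ p)))
        f : ∀ y z → y ≡ (y + z) - z
        f = RS.solve-∀ ringℚ
        g : ∀ x z → (1ℚ + x) * z - z ≡ x * z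
        g = RS.solve-∀ ringℚ
        conclude : (1ℚ + ι (+ p)) * mass N ≡ mass (p ℕ.* p ℕ.* N) + ∑ (reducedForms n) (λ Q → 1/ω Q * ι (+ p)) →
          mass (p ℕ.* p ℕ.* N) ≡ ι (+ p) * mass N
        conclude eq = trans (f (mass (p ℕ.* p ℕ.* N)) (mass N)) (trans (cong (_- mass N)
            (trans (cong (λ z → mass (p ℕ.* p ℕ.* N) + z) (trans hyp (trans (ℚₚ.*-comm (ι (+ p)) (mass n)) (sym (∑-*ʳ (reducedForms n) 1/ω (ι (+ p))))))) (sym eq)))
          (g (ι (+ p)) (mass N)))

-- Values of H at p²z / b

module HurwitzValues where

  open import Data.Integer.Base as ℤ using (ℤ; +_; -[1+_]; 0ℤ; 1ℤ; _+_; _*_; _-_; -_; _≤_; _<_)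
  import Data.Integer.Properties as ℤₚ
  open import Data.Integer.Divisibility.Signed
  open import Data.Integer.Tactic.RingSolver using (solve-∀)
  open import Data.Nat.Base as ℕ using (ℕ; zero; suc; NonZero; z≤n; s≤s)
  import Data.Nat.Divisibility as ℕ∣
  import Data.Nat.Properties as ℕₚ
  open import Data.Nat.Primality using (Prime; prime⇒nonZero)
  open import Data.Product.Base using (∃-syntax; _,_; proj₁; proj₂)
  open import Data.Rational.Base as ℚ using (ℚ; 0ℚ; 1ℚ; _/_)
  open import Data.Sum.Base as Sum using (_⊎_; inj₁; inj₂)
  open import Relation.Binary.PropositionalEquality
  open import Relation.Nullary using (¬_; Dec; yes; no; contradiction)
  import Tactic.RingSolver as RS
  open BinaryQuadraticForms using (0<sq; 0<*; 0<⇒1≤; reducedForms)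
  open ClassNumberRelation
  open FiniteSums
  open MassRelation
  open LineCounts
  open PrimeModulus
  open Rationals

  H-mass : ∀ b .{{_ : NonZero b}} n .{{_ : NonZero n}} → H (+ (b ℕ.* n) / b) ≡ mass n
  H-mass b n = trans (cong H (*d/d b n)) (trans (H-ι n) (sym (mass≡classNumber n)))

  H-zero : ∀ b .{{_ : NonZero b}} → H (0ℤ / b) ≡ ℚ.- (+ 1 / 12)
  H-zero b = trans (cong H (trans (cong (λ n → + n / b) (sym (ℕₚ.*-zeroʳ b))) (*d/d b 0))) refl

  square-mod-4 : ∀ x → + 4 ∣ x * x ⊎ + 4 ∣ x * x - 1ℤ
  square-mod-4 x with residue 2 x
  ... | 0 , _ , divides q eq = inj₁ (divides (q * q) (trans (e₀ x) (trans (cong (λ z → z * z) eq) (e q))))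
    where
    e₀ : ∀ x → x * x ≡ (x - 0ℤ) * (x - 0ℤ)
    e₀ = solve-∀
    e : ∀ q → q * + 2 * (q * + 2) ≡ q * q * + 4
    e = solve-∀
  ... | 1 , _ , divides q eq = inj₂ (divides (q * q + q) (trans (e₀ x) (trans (cong (λ z → z * z + + 2 * z) eq) (e q))))
    where
    e₀ : ∀ x → x * x - 1ℤ ≡ (x - 1ℤ) * (x - 1ℤ) + + 2 * (x - 1ℤ)
    e₀ = solve-∀
    e : ∀ q → q * + 2 * (q * + 2) + + 2 * (q * + 2) ≡ (q * q + q) * + 4
    e = solve-∀
  ... | suc (suc j) , s≤s (s≤s ()) , _

  4∤3 : ¬ + 4 ∣ + 3
  4∤3 d with ∣-small {4} (s≤s (s≤s (s≤s (s≤s z≤n)))) d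
  ... | ()

  -- The discriminant of a form is a square modulo 4.
  mass-vanishes : ∀ n → + 4 ∣ + n - + 2 → mass n ≡ 0ℚ
  mass-vanishes n d = ∑-zero (reducedForms n) λ {Q} Q∈ → contradiction (proj₂ (∈-reducedForms⁻ {n} Q∈)) (impossible Q)
    where
    impossible : ∀ Q → disc Q ≢ - + n
    impossible ⟨ a , b , c ⟩ eq = Sum.[ (λ 4∣b² → 4∤2 (∣-≡ (e₁ (b * b)) (∣m∣n⇒∣m-n 4∣b²+2 4∣b²))) ,
                                        (λ 4∣b²-1 → 4∤3 (∣-≡ (e₂ (b * b)) (∣m∣n⇒∣m-n 4∣b²+2 4∣b²-1))) ] (square-mod-4 b)
      where
      e₁ : ∀ x → x + + 2 - x ≡ + 2
      e₁ = solve-∀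
      e₂ : ∀ x → x + + 2 - (x - 1ℤ) ≡ + 3
      e₂ = solve-∀
      e₃ : ∀ n ac → + 4 * ac - (n - + 2) ≡ - n + + 4 * ac + + 2
      e₃ = solve-∀
      e₄ : ∀ x ac → x - + 4 * ac + + 4 * ac + + 2 ≡ x + + 2
      e₄ = solve-∀
      4∣b²+2 : + 4 ∣ b * b + + 2
      4∣b²+2 = ∣-≡ (trans (e₃ (+ n) (a * c)) (trans (cong (λ z → z + + 4 * (a * c) + + 2) (sym eq)) (e₄ (b * b) (a * c))))
        (∣m∣n⇒∣m-n (∣m⇒∣m*n (a * c) ∣-refl) d)

  -- For b = 4 the argument is not an integer. For b = 1 it is negative, or else the negative of an
  -- integer that is not a discriminant.
  H-vanishes : ∀ b .{{_ : NonZero b}} → b ≡ 1 ⊎ b ≡ 4 → ∀ z → + 4 ∣ z - + 2 → H (z / b) ≡ 0ℚ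
  H-vanishes _ (inj₁ refl) (+ zero) d = contradiction (∣-≡ refl (∣m⇒∣-m d)) 4∤2
  H-vanishes _ (inj₁ refl) z@(+ suc n) d = trans (cong (λ m → H (+ m / 1)) (sym (ℕₚ.*-identityˡ (suc n))))
    (trans (H-mass 1 (suc n)) (mass-vanishes (suc n) d))
  H-vanishes _ (inj₁ refl) -[1+ n ] d = H-cases -[1+ n ] 1 λ _ ()
  H-vanishes _ (inj₂ refl) z d = H-cases z 4 λ n z≡ → 4∤2 (∣-≡ (e z) (∣m∣n⇒∣m-n (divides (+ n) (trans z≡ (trans (ℤₚ.pos-* 4 n) (ℤₚ.*-comm (+ 4) (+ n))))) d))
    where
    e : ∀ z → z - (z - + 2) ≡ + 2
    e = solve-∀

  natural-quotient : ∀ {k n} → + k ∣ + n → ∃[ m ] (n ≡ k ℕ.* m)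
  natural-quotient {k} d with ∣⇒∣ᵤ d
  ... | ℕ∣.divides m eq = m , trans eq (ℕₚ.*-comm m k)

  module _ {p : ℕ} (pp : Prime p) (odd : ¬ + p ∣ + 2) (c : ℕ) .{{_ : NonZero (c ℕ.* c)}} (b∣p²-1 : + (c ℕ.* c) ∣ + p * + p - 1ℤ) where

    private
      b : ℕ
      b = c ℕ.* c
      instance
        p≢0 : ℤ.NonZero (+ p)
        p≢0 = prime-nonZero pp
      0<p : 0ℤ < + p
      0<p = ℤ.+<+ (ℕₚ.n≢0⇒n>0 (ℕ.≢-nonZero⁻¹ p {{prime⇒nonZero pp}}))

    p∤b : ¬ + p ∣ + b
    p∤b p∣b = p∤1 pp (∣-≡ (e (+ p)) (∣m∣n⇒∣m-n (∣m⇒∣m*n (+ p) ∣-refl) (∣-trans p∣b b∣p²-1)))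
      where
      e : ∀ p → p * p - (p * p - 1ℤ) ≡ 1ℤ
      e = solve-∀

    p∤c : ¬ + p ∣ + c
    p∤c p∣c = p∤b (∣-≡ (sym (ℤₚ.pos-* c c)) (∣m⇒∣m*n (+ c) p∣c))

    0<b* : ∀ n → 0ℤ < + (b ℕ.* suc n)
    0<b* n = ℤ.+<+ (ℕₚ.n≢0⇒n>0 (ℕ.≢-nonZero⁻¹ (b ℕ.* suc n) {{ℕₚ.m*n≢0 b (suc n)}}))

    pos-sub : ∀ {x y z} → x ≡ y - z → 0ℤ < x → z < y
    pos-sub {x} {y} {z} eq 0<x = BinaryQuadraticForms.0<-⇒< {z} {y} {x} 0<x eq

    -- If p ∤ t, then -c²n ≡ t² modulo p and `mass-split` applies. If p ∣ t, the exponents 0 and 1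
    -- are excluded by size, because t ≠ 0 and bn > 0. From exponent 2 on, t = pu gives n = p²m with
    -- bm = p^(s-2) - u², and `mass-ramified` lifts the relation from m to n.
    mass-p² : ∀ s t n → t ≢ 0ℤ → + (b ℕ.* suc n) ≡ + (p ℕ.^ s) - t * t → mass (p ℕ.* p ℕ.* suc n) ≡ ι (+ p) ℚ.* mass (suc n)
    mass-p² s t n t≢0 eq with + p ∣? t
    mass-p² zero t n t≢0 eq | _ = contradiction (0<⇒1≤ (0<sq t≢0)) (ℤₚ.<⇒≱ (pos-sub eq (0<b* n)))
    mass-p² (suc s) t n t≢0 eq | no p∤t = mass-split pp odd (suc n) (+ c) t p∤c p∤t (divides (- + (p ℕ.^ s)) (begin
      + c * + c * (- + suc n) - t * t          ≡⟨ e₁ (+ c) (+ suc n) (t * t) ⟩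
      - (+ c * + c * + suc n) - t * t          ≡⟨ cong (λ z → - z - t * t) (trans (cong (_* + suc n) (sym (ℤₚ.pos-* c c))) (trans (sym (ℤₚ.pos-* b (suc n))) eq)) ⟩
      - (+ (p ℕ.^ suc s) - t * t) - t * t      ≡⟨ cong (λ z → - (z - t * t) - t * t) (ℤₚ.pos-* p (p ℕ.^ s)) ⟩
      - (+ p * + (p ℕ.^ s) - t * t) - t * t    ≡⟨ e₂ (+ p) (+ (p ℕ.^ s)) (t * t) ⟩
      - + (p ℕ.^ s) * + p                      ∎))
      where
      open ≡-Reasoning
      e₁ : ∀ c n x → c * c * (- n) - x ≡ - (c * c * n) - x
      e₁ = solve-∀
      e₂ : ∀ p q x → - (p * q - x) - x ≡ - q * p
      e₂ = solve-∀
    mass-p² (suc zero) t n t≢0 eq | yes (divides u refl) = contradiction (ℤₚ.≤-trans (1≤ {u * u} (0<⇒1≤ (0<sq u≢0))) (ℤₚ.≤-reflexive (e (+ p) u)))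
      (ℤₚ.<⇒≱ (subst (u * + p * (u * + p) <_) (cong +_ (ℕₚ.*-identityʳ p)) (pos-sub eq (0<b* n))))
      where
      u≢0 : u ≢ 0ℤ
      u≢0 refl = t≢0 refl
      e : ∀ p u → p * (p * (u * u)) ≡ u * p * (u * p)
      e = solve-∀
      1≤ : ∀ {x} → 1ℤ ≤ x → + p ≤ + p * (+ p * x)
      1≤ {x} 1≤x = subst (_≤ + p * (+ p * x)) (ℤₚ.*-identityʳ (+ p)) (ℤₚ.*-monoˡ-≤-nonNeg (+ p)
        (ℤₚ.≤-trans (0<⇒1≤ 0<p) (subst (_≤ + p * x) (ℤₚ.*-identityʳ (+ p)) (ℤₚ.*-monoˡ-≤-nonNeg (+ p) 1≤x))))
    mass-p² (suc (suc s)) t n t≢0 eq | yes (divides u refl) = descend (p²-cancel pp {+ b} {+ suc n} p∤b p²∣bn)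
      where
      x = + (p ℕ.^ s) - u * u
      u≢0 : u ≢ 0ℤ
      u≢0 refl = t≢0 refl
      e : ∀ p q u → p * (p * q) - u * p * (u * p) ≡ (q - u * u) * (p * p)
      e = solve-∀
      bn≡ : + b * + suc n ≡ x * (+ p * + p)
      bn≡ = trans (sym (ℤₚ.pos-* b (suc n))) (trans eq (trans (cong (λ z → z - u * + p * (u * + p))
        (trans (ℤₚ.pos-* p (p ℕ.* p ℕ.^ s)) (cong (+ p *_) (ℤₚ.pos-* p (p ℕ.^ s))))) (e (+ p) (+ (p ℕ.^ s)) u)))
      p²∣bn : + p * + p ∣ + b * + suc n
      p²∣bn = divides x bn≡
      descend : + p * + p ∣ + suc n → mass (p ℕ.* p ℕ.* suc n) ≡ ι (+ p) ℚ.* mass (suc n)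
      descend d = go (natural-quotient (subst (_∣ + suc n) (sym (ℤₚ.pos-* p p)) d))
        where
        go : ∃[ m ] (suc n ≡ p ℕ.* p ℕ.* m) → mass (p ℕ.* p ℕ.* suc n) ≡ ι (+ p) ℚ.* mass (suc n)
        go (zero , n≡) = contradiction (trans n≡ (ℕₚ.*-zeroʳ (p ℕ.* p))) λ ()
        go (suc m , n≡) = subst (λ N → mass (p ℕ.* p ℕ.* N) ≡ ι (+ p) ℚ.* mass N) (sym n≡)
          (mass-ramified pp odd (suc m) (mass-p² s u m u≢0 bm≡))
          where
          e₁ : ∀ b m p → b * m * p ≡ b * (p * m)
          e₁ = solve-∀
          n≡ℤ : + suc n ≡ + p * + p * + suc m
          n≡ℤ = trans (cong +_ n≡) (trans (ℤₚ.pos-* (p ℕ.* p) (suc m)) (cong (_* + suc m) (ℤₚ.pos-* p p)))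
          bm≡ : + (b ℕ.* suc m) ≡ x
          bm≡ = trans (ℤₚ.pos-* b (suc m)) (ℤₚ.*-cancelʳ-≡ (+ b * + suc m) x (+ p * + p) {{ℤₚ.i*j≢0 (+ p) (+ p)}}
            (trans (e₁ (+ b) (+ suc m) (+ p * + p)) (trans (cong (+ b *_) (sym n≡ℤ)) bn≡)))

    -- The integers z for which z / b is a natural number; at all others H(z / b) is 0.
    Rep : ℤ → Set
    Rep z = ∃[ n ] (z ≡ + (b ℕ.* n))

    rep? : ∀ z → Dec (Rep z)
    rep? -[1+ _ ] = no λ ()
    rep? (+ z) with + b ∣? + z
    ... | yes b∣z = let (n , eq) = natural-quotient b∣z in yes (n , cong +_ eq)
    ... | no b∤z  = no λ (n , eq) → b∤z (divides (+ n) (trans eq (trans (ℤₚ.pos-* b n) (ℤₚ.*-comm (+ b) (+ n)))))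

    rep-p²⁺ : ∀ {z} → Rep z → Rep (+ p * + p * z)
    rep-p²⁺ (n , refl) = p ℕ.* p ℕ.* n , p²bn n
      where
      e : ∀ p b n → p * p * (b * n) ≡ b * (p * p * n)
      e = solve-∀
      p²bn : ∀ n → + p * + p * + (b ℕ.* n) ≡ + (b ℕ.* (p ℕ.* p ℕ.* n))
      p²bn n = begin
        + p * + p * + (b ℕ.* n)               ≡⟨ cong (+ p * + p *_) (ℤₚ.pos-* b n) ⟩
        + p * + p * (+ b * + n)               ≡⟨ e (+ p) (+ b) (+ n) ⟩
        + b * (+ p * + p * + n)               ≡⟨ cong (λ z → + b * (z * + n)) (ℤₚ.pos-* p p) ⟨
        + b * (+ (p ℕ.* p) * + n)             ≡⟨ cong (+ b *_) (ℤₚ.pos-* (p ℕ.* p) n) ⟨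
        + b * + (p ℕ.* p ℕ.* n)               ≡⟨ ℤₚ.pos-* b (p ℕ.* p ℕ.* n) ⟨
        + (b ℕ.* (p ℕ.* p ℕ.* n))             ∎
        where open ≡-Reasoning

    -- z = p²z - (p² - 1)z, and `b` divides p² - 1.
    rep-p²⁻ : ∀ {z} → Rep (+ p * + p * z) → Rep z
    rep-p²⁻ {z} (n , eq) = go z b∣z 0≤z
      where
      e : ∀ p z → p * p * z - (p * p - 1ℤ) * z ≡ z
      e = solve-∀
      b∣z : + b ∣ z
      b∣z = ∣-≡ (e (+ p) z) (∣m∣n⇒∣m-n (divides (+ n) (trans eq (trans (ℤₚ.pos-* b n) (ℤₚ.*-comm (+ b) (+ n))))) (∣m⇒∣m*n z b∣p²-1))
      0≤z : 0ℤ ≤ z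
      0≤z = ℤₚ.≮⇒≥ λ z<0 → ℤₚ.<⇒≱ (subst (_< 0ℤ) eq (subst (+ p * + p * z <_) (ℤₚ.*-zeroʳ (+ p * + p))
        (ℤₚ.*-monoˡ-<-pos (+ p * + p) {{ℤ.positive (0<* 0<p 0<p)}} z<0))) (ℤ.+≤+ z≤n)
      go : ∀ z → + b ∣ z → 0ℤ ≤ z → Rep z
      go (+ z) b∣z _ = let (n , eq) = natural-quotient b∣z in n , cong +_ eq
      go -[1+ _ ] _ ()

    -- Where z / b is not a natural number, both sides vanish; for z > 0 this is `mass-p²`. At z = 0
    -- the value does not scale, and -1/12 = p · (-1/12) + (p - 1)/12 leaves the second summand.
    H-p² : ∀ s t → t ≢ 0ℤ → H ((+ (p ℕ.^ suc (suc s)) - t * + p * (t * + p)) / b) ≡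
      ι (+ p) ℚ.* H ((+ (p ℕ.^ s) - t * t) / b) ℚ.+ δ (t * t ℤₚ.≟ + (p ℕ.^ s)) ℚ.* (+ 1 / 12 ℚ.* ι (+ p - 1ℤ))
    H-p² s t t≢0 = trans (cong (λ z → H (z / b)) p²x) (go x refl (rep? x))
      where
      x = + (p ℕ.^ s) - t * t
      e : ∀ p q t → p * (p * q) - t * p * (t * p) ≡ p * p * (q - t * t)
      e = solve-∀
      p²x : + (p ℕ.^ suc (suc s)) - t * + p * (t * + p) ≡ + p * + p * x
      p²x = trans (cong (λ z → z - t * + p * (t * + p)) (trans (ℤₚ.pos-* p (p ℕ.* p ℕ.^ s)) (cong (+ p *_) (ℤₚ.pos-* p (p ℕ.^ s)))))
        (e (+ p) (+ (p ℕ.^ s)) t)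
      x≢0⇒ : x ≢ 0ℤ → t * t ≢ + (p ℕ.^ s)
      x≢0⇒ x≢0 eq = x≢0 (trans (cong (λ z → + (p ℕ.^ s) - z) eq) (ℤₚ.+-inverseʳ (+ (p ℕ.^ s))))
      R : ℤ → ℚ
      R z = ι (+ p) ℚ.* H (z / b) ℚ.+ δ (t * t ℤₚ.≟ + (p ℕ.^ s)) ℚ.* (+ 1 / 12 ℚ.* ι (+ p - 1ℤ))
      off : ∀ h k → h ≡ 0ℚ → k ≡ 0ℚ → 0ℚ ≡ ι (+ p) ℚ.* h ℚ.+ k ℚ.* (+ 1 / 12 ℚ.* ι (+ p - 1ℤ))
      off _ _ refl refl = f (ι (+ p)) (+ 1 / 12 ℚ.* ι (+ p - 1ℤ))
        where
        f : ∀ x y → 0ℚ ≡ x ℚ.* 0ℚ ℚ.+ 0ℚ ℚ.* y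
        f = RS.solve-∀ ringℚ
      go : ∀ z → z ≡ x → Dec (Rep z) → H (+ p * + p * z / b) ≡ R z
      go z z≡x (no ¬r) = trans (H-cases (+ p * + p * z) b λ n eq → ¬r (rep-p²⁻ (n , eq)))
        (off (H (z / b)) (δ (t * t ℤₚ.≟ + (p ℕ.^ s))) (H-cases z b λ n eq → ¬r (n , eq))
          (δ-no (t * t ℤₚ.≟ + (p ℕ.^ s)) (x≢0⇒ λ x≡0 → ¬r (0 , trans z≡x (trans x≡0 (cong +_ (sym (ℕₚ.*-zeroʳ b))))))))
      go z z≡x (yes (zero , eq)) = zeroCase z (trans eq (cong +_ (ℕₚ.*-zeroʳ b))) z≡x
        where
        f : ∀ P → ℚ.- (+ 1 / 12) ≡ P ℚ.* ℚ.- (+ 1 / 12) ℚ.+ 1ℚ ℚ.* (+ 1 / 12 ℚ.* (P ℚ.- 1ℚ))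
        f = RS.solve-∀ ringℚ
        zeroCase : ∀ z → z ≡ 0ℤ → z ≡ x → H (+ p * + p * z / b) ≡ R z
        zeroCase _ refl 0≡x = begin
          H (+ p * + p * 0ℤ / b)    ≡⟨ cong (λ z → H (z / b)) (ℤₚ.*-zeroʳ (+ p * + p)) ⟩
          H (0ℤ / b)                ≡⟨ H-zero b ⟩
          ℚ.- (+ 1 / 12)            ≡⟨ f (ι (+ p)) ⟩
          ι (+ p) ℚ.* ℚ.- (+ 1 / 12) ℚ.+ 1ℚ ℚ.* (+ 1 / 12 ℚ.* (ι (+ p) ℚ.- 1ℚ))
            ≡⟨ cong₂ ℚ._+_ (cong (ι (+ p) ℚ.*_) (sym (H-zero b))) (cong₂ ℚ._*_
                 (sym (δ-yes (t * t ℤₚ.≟ + (p ℕ.^ s)) (sym (ℤₚ.i-j≡0⇒i≡j (+ (p ℕ.^ s)) (t * t) (sym 0≡x)))))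
                 (cong (+ 1 / 12 ℚ.*_) (sym (ι-- (+ p) 1ℤ)))) ⟩
          R 0ℤ                      ∎
          where open ≡-Reasoning
      go z z≡x (yes (suc n , eq)) = begin
        H (+ p * + p * z / b)                       ≡⟨ cong (λ z → H (z / b)) (proj₂ (rep-p²⁺ (suc n , eq))) ⟩
        H (+ (b ℕ.* proj₁ (rep-p²⁺ (suc n , eq))) / b) ≡⟨ cong (λ m → H (+ (b ℕ.* m) / b)) (rep-value eq) ⟩
        H (+ (b ℕ.* (p ℕ.* p ℕ.* suc n)) / b)       ≡⟨ H-mass b (p ℕ.* p ℕ.* suc n) {{p²n≢0}} ⟩
        mass (p ℕ.* p ℕ.* suc n)                    ≡⟨ mass-p² s t n t≢0 (trans (sym eq) z≡x) ⟩
        ι (+ p) ℚ.* mass (suc n)                    ≡⟨ cong (ι (+ p) ℚ.*_) (trans (sym (H-mass b (suc n))) (cong (λ z → H (z / b)) (sym eq))) ⟩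
        ι (+ p) ℚ.* H (z / b)                       ≡⟨ f (ι (+ p) ℚ.* H (z / b)) (+ 1 / 12 ℚ.* ι (+ p - 1ℤ)) ⟩
        ι (+ p) ℚ.* H (z / b) ℚ.+ 0ℚ ℚ.* (+ 1 / 12 ℚ.* ι (+ p - 1ℤ))
          ≡⟨ cong (λ k → ι (+ p) ℚ.* H (z / b) ℚ.+ k ℚ.* (+ 1 / 12 ℚ.* ι (+ p - 1ℤ)))
               (sym (δ-no (t * t ℤₚ.≟ + (p ℕ.^ s)) (x≢0⇒ λ x≡0 → ℤₚ.<-irrefl (sym (trans (sym eq) (trans z≡x x≡0))) (0<b* n)))) ⟩
        R z                                         ∎
        where
        open ≡-Reasoning
        rep-value : ∀ {z} (eq : z ≡ + (b ℕ.* suc n)) → proj₁ (rep-p²⁺ (suc n , eq)) ≡ p ℕ.* p ℕ.* suc n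
        rep-value refl = refl
        p²n≢0 : NonZero (p ℕ.* p ℕ.* suc n)
        p²n≢0 = ℕₚ.m*n≢0 (p ℕ.* p) (suc n) {{ℕₚ.m*n≢0 p p {{prime⇒nonZero pp}} {{prime⇒nonZero pp}}}}
        f : ∀ x y → x ≡ x ℚ.+ 0ℚ ℚ.* y
        f = RS.solve-∀ ringℚ

-- Recurrences for binomial coefficients

module BinomialCoefficients where

  open import Data.Integer.Base using (+_; 0ℤ; 1ℤ; _+_; _*_; _-_)
  import Data.Integer.Properties as ℤₚ
  open import Data.Integer.Tactic.RingSolver using (solve-∀)
  open import Data.Nat.Base using (zero; suc)
  open import Data.Nat.Combinatorics using (_C_; nCk+nC[k+1]≡[n+1]C[k+1])
  open import Relation.Binary.PropositionalEquality

  pascal : ∀ n k → + (suc n C suc k) ≡ + (n C k) + + (n C suc k)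
  pascal n k = trans (cong +_ (sym (nCk+nC[k+1]≡[n+1]C[k+1] n k))) (ℤₚ.pos-+ (n C k) (n C suc k))

  mutual

    -- The two identities feed each other through Pascal's rule: absorption at n follows from the
    -- step at n, and the step at n + 1 from absorption and the step at n. Over ℤ the difference n -
    -- k is not truncated.
    nCk-step : ∀ n k → + suc k * + (n C suc k) ≡ (+ n - + k) * + (n C k)
    nCk-step zero zero       = refl
    nCk-step zero (suc k)    = trans (ℤₚ.*-zeroʳ (+ suc (suc k))) (sym (ℤₚ.*-zeroʳ (+ 0 - + suc k)))
    nCk-step (suc n) zero    = trans (absorption n zero) (e (+ suc n))
      where
      e : ∀ n → n * 1ℤ ≡ (n - 0ℤ) * 1ℤ
      e = solve-∀
    nCk-step (suc n) (suc k) = trans (absorption n (suc k)) (sym (begin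
      (+ suc n - + suc k) * + (suc n C suc k)                        ≡⟨ cong₂ (λ x y → (x - y) * + (suc n C suc k)) (ℤₚ.pos-+ 1 n) (ℤₚ.pos-+ 1 k) ⟩
      (1ℤ + + n - (1ℤ + + k)) * + (suc n C suc k)                    ≡⟨ cong ((1ℤ + + n - (1ℤ + + k)) *_) (pascal n k) ⟩
      (1ℤ + + n - (1ℤ + + k)) * (+ (n C k) + + (n C suc k))          ≡⟨ e₁ (+ n) (+ k) (+ (n C k)) (+ (n C suc k)) ⟩
      (+ n - + k) * + (n C k) + (+ n - + k) * + (n C suc k)          ≡⟨ cong (_+ (+ n - + k) * + (n C suc k)) (nCk-step n k) ⟨
      + suc k * + (n C suc k) + (+ n - + k) * + (n C suc k)          ≡⟨ cong (λ z → z * + (n C suc k) + (+ n - + k) * + (n C suc k)) (ℤₚ.pos-+ 1 k) ⟩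
      (1ℤ + + k) * + (n C suc k) + (+ n - + k) * + (n C suc k)       ≡⟨ e₂ (+ n) (+ k) (+ (n C suc k)) ⟩
      (1ℤ + + n) * + (n C suc k)                                     ≡⟨ cong (_* + (n C suc k)) (ℤₚ.pos-+ 1 n) ⟨
      + suc n * + (n C suc k)                                        ∎))
      where
      open ≡-Reasoning
      e₁ : ∀ n k x y → (1ℤ + n - (1ℤ + k)) * (x + y) ≡ (n - k) * x + (n - k) * y
      e₁ = solve-∀
      e₂ : ∀ n k y → (1ℤ + k) * y + (n - k) * y ≡ (1ℤ + n) * y
      e₂ = solve-∀

    absorption : ∀ n k → + suc k * + (suc n C suc k) ≡ + suc n * + (n C k)
    absorption n k = begin
      + suc k * + (suc n C suc k)                                 ≡⟨ cong (+ suc k *_) (pascal n k) ⟩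
      + suc k * (+ (n C k) + + (n C suc k))                       ≡⟨ ℤₚ.*-distribˡ-+ (+ suc k) (+ (n C k)) (+ (n C suc k)) ⟩
      + suc k * + (n C k) + + suc k * + (n C suc k)               ≡⟨ cong₂ _+_ (cong (_* + (n C k)) (ℤₚ.pos-+ 1 k)) (nCk-step n k) ⟩
      (1ℤ + + k) * + (n C k) + (+ n - + k) * + (n C k)            ≡⟨ e (+ n) (+ k) (+ (n C k)) ⟩
      (1ℤ + + n) * + (n C k)                                      ≡⟨ cong (_* + (n C k)) (ℤₚ.pos-+ 1 n) ⟨
      + suc n * + (n C k)                                         ∎
      where
      open ≡-Reasoning
      e : ∀ n k x → (1ℤ + k) * x + (n - k) * x ≡ (1ℤ + n) * x
      e = solve-∀

-- Fermat's theorem and the existence of nonresidues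

module QuadraticResidues where

  open import Data.Fin.Base as Fin using (Fin)
  import Data.Fin.Properties as Finₚ
  open import Data.Integer.Base as ℤ using (ℤ; +_; 0ℤ; 1ℤ; _+_; _*_; _-_; -_)
  import Data.Integer.Properties as ℤₚ
  open import Data.Integer.Divisibility.Signed
  open import Data.Integer.Tactic.RingSolver using (solve-∀)
  open import Data.Nat.Base as ℕ using (ℕ; zero; suc; NonZero; z≤n; s≤s)
  open import Data.Nat.Combinatorics using (_C_; nCn≡1)
  import Data.Nat.Properties as ℕₚ
  open import Data.Nat.Primality using (Prime; prime⇒nonZero)
  open import Data.Product.Base using (∃-syntax; _×_; _,_; proj₁; proj₂)
  open import Data.Vec.Functional using (Vector)
  open import Relation.Binary.PropositionalEquality
  open import Relation.Nullary using (¬_; contradiction)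
  import Algebra.Properties.Monoid.Sum as Sum
  import Algebra.Definitions.RawMonoid as RawMonoid
  import Algebra.Properties.CommutativeSemiring.Binomial as Binomial
  open BinomialCoefficients
  open PrimeModulus

  private
    module B = Binomial ℤₚ.+-*-commutativeSemiring
    open Sum ℤₚ.+-0-monoid using (sum; sum-init-last)
    open RawMonoid ℤ.+-0-rawMonoid using () renaming (_×_ to _×ˢ_)

  ×≡* : ∀ n x → n ×ˢ x ≡ + n * x
  ×≡* zero x = sym (ℤₚ.*-zeroˡ x)
  ×≡* (suc n) x = trans (cong (λ z → x + z) (×≡* n x)) (sym (trans (cong (_* x) (ℤₚ.pos-+ 1 n)) (e (+ n) x)))
    where
    e : ∀ n x → (1ℤ + n) * x ≡ x + n * x
    e = solve-∀

  sum-∣ : ∀ {k n} (t : Vector ℤ n) → (∀ i → k ∣ t i) → k ∣ sum t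
  sum-∣ {n = zero}  t d = ∣-0
  sum-∣ {n = suc n} t d = ∣m∣n⇒∣m+n (d Fin.zero) (sum-∣ (λ i → t (Fin.suc i)) (λ i → d (Fin.suc i)))

  pow-cong : ∀ {k x y} n → k ∣ x - y → k ∣ x ℤ.^ n - y ℤ.^ n
  pow-cong zero d = ∣-0
  pow-cong {k} {x} {y} (suc n) d = ∣-≡ (e x y (x ℤ.^ n) (y ℤ.^ n)) (∣m∣n⇒∣m+n (∣n⇒∣m*n x (pow-cong n d)) (∣n⇒∣m*n (y ℤ.^ n) d))
    where
    e : ∀ x y a b → x * (a - b) + b * (x - y) ≡ x * a - y * b
    e = solve-∀

  1^n : ∀ n → 1ℤ ℤ.^ n ≡ 1ℤ
  1^n = ℤₚ.^-zeroˡ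

  module _ {p : ℕ} (pp : Prime p) where

    private instance
      p≢0 : NonZero p
      p≢0 = prime⇒nonZero pp

    p∤small : ∀ {n} .{{_ : NonZero n}} → n ℕ.< p → ¬ + p ∣ + n
    p∤small {n} n<p d = ℕ.≢-nonZero⁻¹ n (ℤₚ.+-injective (∣-small n<p d))

    -- For 0 < k < p absorption reads k C(p, k) = p C(p - 1, k - 1), and p ∤ k, so p divides every
    -- inner term of the binomial expansion.
    freshman : ∀ x → + p ∣ (x + 1ℤ) ℤ.^ p - (x ℤ.^ p + 1ℤ)
    freshman x = go p refl
      where
      go : ∀ n → n ≡ p → + p ∣ (x + 1ℤ) ℤ.^ n - (x ℤ.^ n + 1ℤ)
      go zero 0≡p = contradiction (sym 0≡p) (ℕ.≢-nonZero⁻¹ p)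
      go n@(suc q) refl = ∣-≡ (trans (e (x ℤ.^ n) 1ℤ (sum middle)) (cong (λ z → z - (x ℤ.^ n + 1ℤ)) (sym expand))) (sum-∣ middle middle-∣)
        where
        open import Algebra.Definitions.RawSemiring ℤ.+-*-rawSemiring using () renaming (_^_ to _^ˢ_)
        open ≡-Reasoning
        ^ˢ≡^ : ∀ x n → x ^ˢ n ≡ x ℤ.^ n
        ^ˢ≡^ x zero    = refl
        ^ˢ≡^ x (suc n) = cong (x *_) (^ˢ≡^ x n)
        t : Vector ℤ (suc n)
        t = B.binomialTerm x 1ℤ n
        middle : Vector ℤ q
        middle i = t (Fin.suc (Fin.inject₁ i))
        e : ∀ a b m → m ≡ (b + (m + a)) - (a + b)
        e = solve-∀
        t≡ : ∀ k → t k ≡ + (n C Fin.toℕ k) * x ℤ.^ Fin.toℕ k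
        t≡ k = trans (×≡* (n C Fin.toℕ k) _) (cong (+ (n C Fin.toℕ k) *_) (trans
          (cong₂ _*_ (^ˢ≡^ x (Fin.toℕ k)) (trans (^ˢ≡^ 1ℤ (n ℕ.∸ Fin.toℕ k)) (1^n (n ℕ.∸ Fin.toℕ k)))) (ℤₚ.*-identityʳ (x ℤ.^ Fin.toℕ k))))
        last≡ : t (Fin.fromℕ n) ≡ x ℤ.^ n
        last≡ = trans (t≡ (Fin.fromℕ n)) (trans (cong (λ k → + (n C k) * x ℤ.^ k) (Finₚ.toℕ-fromℕ n))
          (trans (cong (λ c → + c * x ℤ.^ n) (nCn≡1 n)) (ℤₚ.*-identityˡ (x ℤ.^ n))))
        expand : (x + 1ℤ) ℤ.^ n ≡ 1ℤ + (sum middle + x ℤ.^ n)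
        expand = begin
          (x + 1ℤ) ℤ.^ n                                  ≡⟨ ^ˢ≡^ (x + 1ℤ) n ⟨
          (x + 1ℤ) ^ˢ n                                 ≡⟨ B.theorem n x 1ℤ ⟩
          t Fin.zero + sum (λ i → t (Fin.suc i))        ≡⟨ cong₂ _+_ (t≡ Fin.zero) (sum-init-last (λ i → t (Fin.suc i))) ⟩
          1ℤ + (sum middle + t (Fin.fromℕ n))           ≡⟨ cong (λ z → 1ℤ + (sum middle + z)) last≡ ⟩
          1ℤ + (sum middle + x ℤ.^ n)                     ∎
        middle-∣ : ∀ i → + n ∣ middle i
        middle-∣ i = ∣-≡ (sym (trans (t≡ (Fin.suc (Fin.inject₁ i))) (cong (λ k → + (n C suc k) * x ℤ.^ suc k) (Finₚ.toℕ-inject₁ i))))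
          (∣m⇒∣m*n (x ℤ.^ suc (Fin.toℕ i)) (cancel-∣ pp {+ suc (Fin.toℕ i)} (+ (n C suc (Fin.toℕ i))) (p∤small (s≤s (Finₚ.toℕ<n i)))
            (∣-≡ (sym (absorption q (Fin.toℕ i))) (∣m⇒∣m*n (+ (q C Fin.toℕ i)) ∣-refl))))

    fermat′ : ∀ n → + p ∣ (+ n) ℤ.^ p - + n
    fermat′ zero = ∣-≡ (cong (λ z → z - 0ℤ) (sym (zero-pow p))) ∣-0
      where
      zero-pow : ∀ n .{{_ : NonZero n}} → 0ℤ ℤ.^ n ≡ 0ℤ
      zero-pow (suc n) = refl
    fermat′ (suc n) = ∣-≡ (trans (e ((+ n + 1ℤ) ℤ.^ p) ((+ n) ℤ.^ p) (+ n)) (cong (λ z → z ℤ.^ p - z) n+1)) (∣m∣n⇒∣m+n (freshman (+ n)) (fermat′ n))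
      where
      n+1 : + n + 1ℤ ≡ + suc n
      n+1 = trans (sym (ℤₚ.pos-+ n 1)) (cong +_ (ℕₚ.+-comm n 1))
      e : ∀ a b n → (a - (b + 1ℤ)) + (b - n) ≡ a - (n + 1ℤ)
      e = solve-∀

    fermat : ∀ {x n} → p ≡ suc n → ¬ + p ∣ x → + p ∣ x ℤ.^ n - 1ℤ
    fermat {x} {n} p≡ p∤x = let (j , _ , d) = residue p x in
      cancel-∣ pp {x} (x ℤ.^ n - 1ℤ) p∤x (∣-≡ (trans (e (x ℤ.^ p) ((+ j) ℤ.^ p) x (+ j)) (trans (cong (λ m → x ℤ.^ m - x) p≡) (f x (x ℤ.^ n))))
        (∣m∣n⇒∣m-n (∣m∣n⇒∣m+n (pow-cong p d) (fermat′ j)) d))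
      where
      e : ∀ a b x j → (a - b) + (b - j) - (x - j) ≡ a - x
      e = solve-∀
      f : ∀ x a → x * a - x ≡ x * (a - 1ℤ)
      f = solve-∀

    -- f is given by a polynomial of degree at most d: dividing f - f(a) by y - a lowers the degree.
    Degree≤ : ℕ → (ℤ → ℤ) → Set
    Degree≤ zero    f = ∀ x y → f x ≡ f y
    Degree≤ (suc d) f = ∀ a → ∃[ g ] (Degree≤ d g × ∀ y → f y ≡ f a + (y - a) * g y)

    degree-+ : ∀ d {f} c → Degree≤ d f → Degree≤ d (λ x → f x + c)
    degree-+ zero    c D x y = cong (_+ c) (D x y)
    degree-+ (suc d) {f} c D a = let (g , Dg , eq) = D a in g , Dg , λ y → trans (cong (_+ c) (eq y)) (e (f a) c ((y - a) * g y))
      where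
      e : ∀ x c z → x + z + c ≡ x + c + z
      e = solve-∀

    degree-* : ∀ d {f} → Degree≤ d f → Degree≤ (suc d) (λ x → x * f x)
    degree-* zero {f} D a = (λ _ → f a) , (λ _ _ → refl) , λ y → trans (cong (y *_) (D y a)) (e a y (f a))
      where
      e : ∀ a y c → y * c ≡ a * c + (y - a) * c
      e = solve-∀
    degree-* (suc d) {f} D a = let (g , Dg , eq) = D a in
      (λ y → y * g y + f a) , degree-+ (suc d) (f a) (degree-* d Dg) , λ y → trans (cong (y *_) (eq y)) (e a y (f a) (g y))
      where
      e : ∀ a y c g → y * (c + (y - a) * g) ≡ a * c + (y - a) * (y * g + c)
      e = solve-∀

    degree-^ : ∀ d → Degree≤ d (λ x → x ℤ.^ d)
    degree-^ zero    x y = refl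
    degree-^ (suc d) = degree-* d (degree-^ d)

    -- Lagrange's bound on roots: dividing off the root d + 1 leaves a quotient of lower degree with
    -- the roots 1, ..., d, since these differ from d + 1 modulo p.
    vanish : ∀ d {f} → Degree≤ d f → suc d ℕ.< p → (∀ {i} → i ℕ.≤ d → + p ∣ f (+ suc i)) → ∀ y → + p ∣ f y
    vanish zero {f} D _ roots y = ∣-≡ (D 1ℤ y) (roots z≤n)
    vanish (suc d) {f} D d+2<p roots y = let (g , Dg , eq) = D a in
      ∣-≡ (sym (eq y)) (∣m∣n⇒∣m+n (roots ℕₚ.≤-refl) (∣n⇒∣m*n (y - a) (vanish d Dg (ℕₚ.<-trans (ℕₚ.n<1+n (suc d)) d+2<p) (λ {i} i≤d → root g eq i≤d) y)))
      where
      a = + suc (suc d)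
      e : ∀ x z → (x + z) - x ≡ z
      e = solve-∀
      root : ∀ g → (∀ y → f y ≡ f a + (y - a) * g y) → ∀ {i} → i ℕ.≤ d → + p ∣ g (+ suc i)
      root g eq {i} i≤d = cancel-∣ pp {+ suc i - a} (g (+ suc i))
        (λ p∣ → ℕₚ.<⇒≢ i+1<d+2 (residues-equal (ℕₚ.<-trans i+1<d+2 d+2<p) d+2<p p∣))
        (∣-≡ (trans (cong (λ z → z - f a) (eq (+ suc i))) (e (f a) _)) (∣m∣n⇒∣m-n (roots (ℕₚ.m≤n⇒m≤1+n i≤d)) (roots ℕₚ.≤-refl)))
        where
        i+1<d+2 : suc i ℕ.< suc (suc d)
        i+1<d+2 = s≤s (s≤s i≤d)

    -- If x^h ≡ 1 held for x = 1, ..., h + 1, then x^h - 1, of degree h, would vanish identically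
    -- modulo p, but its value at 0 is -1. For an x with x^h ≢ 1, Fermat's theorem (x^h - 1)(x^h +
    -- 1) ≡ 0 leaves x^h ≡ -1.
    nonresidue : ∀ {h} .{{_ : NonZero h}} → p ≡ suc (h ℕ.+ h) → ∃[ x ] (+ p ∣ x ℤ.^ h + 1ℤ)
    nonresidue {h@(suc h′)} p≡ = x , cancel-∣ pp {x ℤ.^ h - 1ℤ} (x ℤ.^ h + 1ℤ) (proj₂ found)
        (∣-≡ (trans (cong (_- 1ℤ) (ℤₚ.^-distribˡ-+-* x h h)) (e (x ℤ.^ h))) (fermat p≡ p∤x))
      where
      bound : suc h ℕ.< p
      bound = subst (suc h ℕ.<_) (sym p≡) (s≤s (subst (ℕ._≤ h ℕ.+ h) (ℕₚ.+-comm h 1) (ℕₚ.+-monoʳ-≤ h (s≤s z≤n))))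
      e : ∀ a → a * a - 1ℤ ≡ (a - 1ℤ) * (a + 1ℤ)
      e = solve-∀
      P : Fin (suc h) → Set
      P i = + p ∣ (+ suc (Fin.toℕ i)) ℤ.^ h - 1ℤ
      found : ∃[ i ] (¬ P i)
      found = Finₚ.¬∀⟶∃¬ (suc h) P (λ i → + p ∣? (+ suc (Fin.toℕ i)) ℤ.^ h - 1ℤ) λ all →
        p∤1 pp (∣-≡ refl (∣m⇒∣-m (vanish h {λ x → x ℤ.^ h - 1ℤ} (degree-+ h (- 1ℤ) (degree-^ h)) bound
          (λ {i} i≤h → ∣-≡ (cong (λ j → (+ suc j) ℤ.^ h - 1ℤ) (Finₚ.toℕ-fromℕ< (s≤s i≤h))) (all (Fin.fromℕ< (s≤s i≤h)))) 0ℤ)))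
      x = + suc (Fin.toℕ (proj₁ found))
      p∤x : ¬ + p ∣ x
      p∤x = p∤small (ℕₚ.≤-<-trans (Finₚ.toℕ<n (proj₁ found)) bound)

-- The supplementary laws for -1 and 2, and Jacobi symbols of prime powers

module JacobiSymbols where

  open import Data.Bool.Base using (if_then_else_)
  open import Data.Fin.Base as Fin using (Fin)
  import Data.Fin.Properties as Finₚ
  open import Data.Integer.Base as ℤ using (ℤ; +_; 0ℤ; 1ℤ; -1ℤ; _+_; _*_; _-_; -_)
  import Data.Integer.Properties as ℤₚ
  open import Data.Integer.Divisibility.Signed
  open import Data.Integer.Tactic.RingSolver using (solve-∀)
  open import Data.List.Base using (List; []; _∷_; foldr; map; replicate; length)
  import Data.List.Properties as Listₚ
  open import Data.List.Relation.Binary.Permutation.Propositional using (_↭_; ↭-sym)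
  open import Data.List.Relation.Binary.Permutation.Propositional.Properties using (All-resp-↭; ↭-length)
  open import Data.List.Relation.Unary.All using (All; []; _∷_)
  import Data.List.Relation.Unary.All.Properties as Allₚ
  open import Data.Nat.Base as ℕ using (ℕ; zero; suc; NonZero; z≤n; s≤s)
  import Data.Nat.Divisibility as ℕ∣
  import Data.Nat.DivMod as ℕ÷
  import Data.Nat.Properties as ℕₚ
  open import Data.Nat.ListAction using (product)
  open import Data.Nat.Primality using (Prime; prime⇒nonZero; prime⇒irreducible)
  open import Data.Nat.Primality.Factorisation using (factorise; factors; factorisationUnique)
  import Data.Nat.Tactic.RingSolver as ℕRing
  open import Data.Product.Base using (∃-syntax; _,_)
  open import Data.Sum.Base using (_⊎_; inj₁; inj₂)
  open import Relation.Binary.PropositionalEquality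
  open import Relation.Nullary using (¬_; Dec; yes; no; does; contradiction)
  open PrimeModulus
  open QuadraticResidues

  symbol : ∀ {P R : Set} → Dec P → Dec R → ℤ
  symbol P? R? = if does P? then 0ℤ else if does R? then 1ℤ else -1ℤ

  symbol-square : ∀ {P R : Set} (P? : Dec P) (R? : Dec R) → ¬ P → R → symbol P? R? ≡ 1ℤ
  symbol-square (yes p) _ ¬p _      = contradiction p ¬p
  symbol-square (no _) (yes _) _ _  = refl
  symbol-square (no _) (no ¬r) _ r  = contradiction r ¬r

  symbol-nonsquare : ∀ {P R : Set} (P? : Dec P) (R? : Dec R) → ¬ P → ¬ R → symbol P? R? ≡ -1ℤ
  symbol-nonsquare (yes p) _ ¬p _      = contradiction p ¬p
  symbol-nonsquare (no _) (yes r) _ ¬r = contradiction r ¬r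
  symbol-nonsquare (no _) (no _) _ _   = refl

  IsSquare : ℤ → ℕ → Set
  IsSquare a p = ∃[ x ] (+ p ∣ a - x * x)

  toℕ-square : ∀ j → + (j ℕ.^ 2) ≡ + j * + j
  toℕ-square j = trans (cong (λ z → + (j ℕ.* z)) (ℕₚ.*-identityʳ j)) (ℤₚ.pos-* j j)

  legendre-square : ∀ {a p} .{{_ : NonZero p}} → ¬ + p ∣ a → IsSquare a p → legendre a p ≡ 1ℤ
  legendre-square {a} {p} p∤a (x , d) = symbol-square (+ p ∣? a) (Finₚ.any? λ (y : Fin p) → a ≡? + (Fin.toℕ y ℕ.^ 2) [mod p ]) p∤a
    (let (j , j<p , d′) = residue p x in Fin.fromℕ< j<p , subst (λ i → + p ∣ a - + (i ℕ.^ 2)) (sym (Finₚ.toℕ-fromℕ< j<p))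
      (∣-≡ (cong (λ z → a - z) (sym (toℕ-square j))) (∣-lin 1ℤ (x + + j) d d′ (e a x (+ j)))))
    where
    e : ∀ a x j → 1ℤ * (a - x * x) + (x + j) * (x - j) ≡ a - j * j
    e = solve-∀

  legendre-nonsquare : ∀ {a p} → ¬ + p ∣ a → ¬ IsSquare a p → legendre a p ≡ -1ℤ
  legendre-nonsquare {a} {p} p∤a ¬sq = symbol-nonsquare (+ p ∣? a) (Finₚ.any? λ (y : Fin p) → a ≡? + (Fin.toℕ y ℕ.^ 2) [mod p ]) p∤a
    λ (y , d) → ¬sq (+ Fin.toℕ y , ∣-≡ (cong (λ z → a - z) (toℕ-square (Fin.toℕ y))) d)

  legendre-±1 : ∀ {a p} .{{_ : NonZero p}} → ¬ + p ∣ a → legendre a p ≡ 1ℤ ⊎ legendre a p ≡ -1ℤ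
  legendre-±1 {a} {p} p∤a = go (Finₚ.any? λ (y : Fin p) → a ≡? + (Fin.toℕ y ℕ.^ 2) [mod p ])
    where
    go : Dec (∃[ y ] (a ≡ + (Fin.toℕ {p} y ℕ.^ 2) [mod p ])) → legendre a p ≡ 1ℤ ⊎ legendre a p ≡ -1ℤ
    go (yes r) = inj₁ (symbol-square (+ p ∣? a) (Finₚ.any? λ (y : Fin p) → a ≡? + (Fin.toℕ y ℕ.^ 2) [mod p ]) p∤a r)
    go (no ¬r) = inj₂ (symbol-nonsquare (+ p ∣? a) (Finₚ.any? λ (y : Fin p) → a ≡? + (Fin.toℕ y ℕ.^ 2) [mod p ]) p∤a ¬r)

  data OddMod8 (p : ℕ) : Set where
    1mod8 : ∀ q → p ≡ 1 ℕ.+ q ℕ.* 8 → OddMod8 p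
    3mod8 : ∀ q → p ≡ 3 ℕ.+ q ℕ.* 8 → OddMod8 p
    5mod8 : ∀ q → p ≡ 5 ℕ.+ q ℕ.* 8 → OddMod8 p
    7mod8 : ∀ q → p ≡ 7 ℕ.+ q ℕ.* 8 → OddMod8 p

  oddMod8 : ∀ {p} → Prime p → 3 ℕ.≤ p → OddMod8 p
  oddMod8 {p} pp 3≤p = go (p ℕ.% 8) (ℕ÷.m%n<n p 8) (ℕ÷.m≡m%n+[m/n]*n p 8)
    where
    q = p ℕ./ 8
    even : ∀ {m} → p ≡ 2 ℕ.* m → OddMod8 p
    even {m} eq with prime⇒irreducible pp (ℕ∣.divides m (trans eq (ℕₚ.*-comm 2 m)))
    ... | inj₁ ()
    ... | inj₂ refl = contradiction 3≤p (ℕₚ.<⇒≱ ℕₚ.≤-refl)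
    e₀ : ∀ q → 0 ℕ.+ q ℕ.* 8 ≡ 2 ℕ.* (q ℕ.* 4)
    e₀ = ℕRing.solve-∀
    e₂ : ∀ q → 2 ℕ.+ q ℕ.* 8 ≡ 2 ℕ.* (1 ℕ.+ q ℕ.* 4)
    e₂ = ℕRing.solve-∀
    e₄ : ∀ q → 4 ℕ.+ q ℕ.* 8 ≡ 2 ℕ.* (2 ℕ.+ q ℕ.* 4)
    e₄ = ℕRing.solve-∀
    e₆ : ∀ q → 6 ℕ.+ q ℕ.* 8 ≡ 2 ℕ.* (3 ℕ.+ q ℕ.* 4)
    e₆ = ℕRing.solve-∀
    go : ∀ j → j ℕ.< 8 → p ≡ j ℕ.+ q ℕ.* 8 → OddMod8 p
    go 0 _ eq = even {q ℕ.* 4} (trans eq (e₀ q))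
    go 1 _ eq = 1mod8 q eq
    go 2 _ eq = even {1 ℕ.+ q ℕ.* 4} (trans eq (e₂ q))
    go 3 _ eq = 3mod8 q eq
    go 4 _ eq = even {2 ℕ.+ q ℕ.* 4} (trans eq (e₄ q))
    go 5 _ eq = 5mod8 q eq
    go 6 _ eq = even {3 ℕ.+ q ℕ.* 4} (trans eq (e₆ q))
    go 7 _ eq = 7mod8 q eq
    go (suc (suc (suc (suc (suc (suc (suc (suc j)))))))) (s≤s (s≤s (s≤s (s≤s (s≤s (s≤s (s≤s (s≤s ())))))))) _

  -1^odd : ∀ q → -1ℤ ℤ.^ suc (q ℕ.+ q) ≡ -1ℤ
  -1^odd q = trans (cong (λ z → -1ℤ * z) (trans (ℤₚ.^-distribˡ-+-* -1ℤ q q) (square q))) refl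
    where
    e : ∀ x → -1ℤ * x * (-1ℤ * x) ≡ x * x
    e = solve-∀
    square : ∀ q → -1ℤ ℤ.^ q * -1ℤ ℤ.^ q ≡ 1ℤ
    square zero    = refl
    square (suc q) = trans (e (-1ℤ ℤ.^ q)) (square q)

  ∣+1⇒∣pow : ∀ {k x} n → k ∣ x + 1ℤ → k ∣ x ℤ.^ n - -1ℤ ℤ.^ n
  ∣+1⇒∣pow n d = pow-cong n d

  square-pow : ∀ x q → x ℤ.^ (q ℕ.+ q) ≡ x ℤ.^ q * x ℤ.^ q
  square-pow x q = ℤₚ.^-distribˡ-+-* x q q

  module _ {p : ℕ} (pp : Prime p) (odd : ¬ + p ∣ + 2) where

    private instance
      p≢0 : NonZero p
      p≢0 = prime⇒nonZero pp

    p∤-1 : ¬ + p ∣ -1ℤ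
    p∤-1 d = p∤1 pp (∣m⇒∣-m d)

    -- Raising x² ≡ -1 to an odd power contradicts Fermat's theorem.
    ¬square≡-1 : ∀ {x q} → p ≡ suc (suc (q ℕ.+ q) ℕ.+ suc (q ℕ.+ q)) → ¬ + p ∣ x * x + 1ℤ
    ¬square≡-1 {x} {q} p≡ d = odd (∣-≡ (trans (cong (λ z → (x ℤ.^ m² - z) - (x ℤ.^ m² - 1ℤ)) (-1^odd q)) (e (x ℤ.^ m²)))
      (∣m∣n⇒∣m-n (∣-≡ (cong (_- -1ℤ ℤ.^ m) (trans (pow-* x m) (sym (square-pow x m)))) (∣+1⇒∣pow {x = x * x} m d)) (fermat pp p≡ p∤x)))
      where
      m = suc (q ℕ.+ q)
      m² = m ℕ.+ m
      pow-* : ∀ x n → (x * x) ℤ.^ n ≡ x ℤ.^ n * x ℤ.^ n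
      pow-* x zero    = refl
      pow-* x (suc n) = trans (cong (x * x *_) (pow-* x n)) (f x (x ℤ.^ n))
        where
        f : ∀ x a → x * x * (a * a) ≡ x * a * (x * a)
        f = solve-∀
      e : ∀ a → (a - -1ℤ) - (a - 1ℤ) ≡ + 2
      e = solve-∀
      f₁ : ∀ x → x * x + 1ℤ - x * x ≡ 1ℤ
      f₁ = solve-∀
      p∤x : ¬ + p ∣ x
      p∤x p∣x = p∤1 pp (∣-≡ (f₁ x) (∣m∣n⇒∣m-n d (∣n⇒∣m*n x p∣x)))

    -- The power (p - 1)/4 of a nonresidue.
    √-1 : ∀ {q} .{{_ : NonZero q}} → p ≡ suc ((q ℕ.+ q) ℕ.+ (q ℕ.+ q)) → ∃[ i ] (+ p ∣ i * i + 1ℤ)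
    √-1 {q@(suc _)} p≡ = let (x , d) = nonresidue pp {q ℕ.+ q} p≡ in x ℤ.^ q , ∣-≡ (cong (_+ 1ℤ) (square-pow x q)) d

    legendre[-1]-1mod4 : ∀ q .{{_ : NonZero q}} → p ≡ suc ((q ℕ.+ q) ℕ.+ (q ℕ.+ q)) → legendre -1ℤ p ≡ 1ℤ
    legendre[-1]-1mod4 q p≡ = let (i , d) = √-1 {q} p≡ in legendre-square p∤-1 (i , ∣-≡ (e (i * i)) (∣m⇒∣-m d))
      where
      e : ∀ x → - (x + 1ℤ) ≡ -1ℤ - x
      e = solve-∀

    legendre[-1]-3mod4 : ∀ q → p ≡ suc (suc (q ℕ.+ q) ℕ.+ suc (q ℕ.+ q)) → legendre -1ℤ p ≡ -1ℤ
    legendre[-1]-3mod4 q p≡ = legendre-nonsquare p∤-1 λ (x , d) → ¬square≡-1 {x} {q} p≡ (∣-≡ (e (x * x)) (∣m⇒∣-m d))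
      where
      e : ∀ x → - (-1ℤ - x) ≡ x + 1ℤ
      e = solve-∀

    -- An eighth root of unity z gives (z - z³)² = 2.
    legendre[2]-1mod8 : ∀ q .{{_ : NonZero q}} → p ≡ 1 ℕ.+ q ℕ.* 8 → legendre (+ 2) p ≡ 1ℤ
    legendre[2]-1mod8 q@(suc _) p≡ = let (i , d) = √-1 {q ℕ.+ q} (trans p≡ (e₁ q)) ; (x , d′) = nonresidue pp {(q ℕ.+ q) ℕ.+ (q ℕ.+ q)} (trans p≡ (e₁ q)) in
      legendre-square odd (x ℤ.^ q - x ℤ.^ q * (x ℤ.^ q * x ℤ.^ q) ,
        ∣-lin₁ (- (x ℤ.^ q * x ℤ.^ q - + 2)) (∣-≡ (cong (_+ 1ℤ) (trans (square-pow x (q ℕ.+ q)) (cong₂ _*_ (square-pow x q) (square-pow x q)))) d′) (e₂ (x ℤ.^ q)))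
      where
      e₁ : ∀ q → 1 ℕ.+ q ℕ.* 8 ≡ suc (((q ℕ.+ q) ℕ.+ (q ℕ.+ q)) ℕ.+ ((q ℕ.+ q) ℕ.+ (q ℕ.+ q)))
      e₁ = ℕRing.solve-∀
      e₂ : ∀ z → - (z * z - + 2) * (z * z * (z * z) + 1ℤ) ≡ + 2 - (z - z * (z * z)) * (z - z * (z * z))
      e₂ = solve-∀

    -- If y² ≡ 2 and i² ≡ -1, then (1 + i)² ≡ y² i, and the power (p - 1) / 2 of both sides contradicts Fermat's theorem.
    legendre[2]-5mod8 : ∀ q → p ≡ 5 ℕ.+ q ℕ.* 8 → legendre (+ 2) p ≡ -1ℤ
    legendre[2]-5mod8 q p≡ = legendre-nonsquare odd λ (y , d) → impossible y d (√-1 {suc (q ℕ.+ q)} (trans p≡ (e₁ q)))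
      where
      e₁ : ∀ q → 5 ℕ.+ q ℕ.* 8 ≡ suc ((suc (q ℕ.+ q) ℕ.+ suc (q ℕ.+ q)) ℕ.+ (suc (q ℕ.+ q) ℕ.+ suc (q ℕ.+ q)))
      e₁ = ℕRing.solve-∀
      m = suc (q ℕ.+ q)
      n = m ℕ.+ m
      p≡n : p ≡ suc (n ℕ.+ n)
      p≡n = trans p≡ (e₁ q)
      pow-* : ∀ x y n → (x * y) ℤ.^ n ≡ x ℤ.^ n * y ℤ.^ n
      pow-* x y zero    = refl
      pow-* x y (suc n) = trans (cong (x * y *_) (pow-* x y n)) (f x y (x ℤ.^ n) (y ℤ.^ n))
        where
        f : ∀ x y a b → x * y * (a * b) ≡ x * a * (y * b)
        f = solve-∀
      impossible : ∀ y → + p ∣ + 2 - y * y → ¬ (∃[ i ] (+ p ∣ i * i + 1ℤ))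
      impossible y d (i , d′) = odd (∣-≡ (trans (cong (λ z → - (((A - 1ℤ) - (A - B * C)) - ((B - 1ℤ) * C + (C - z)))) (-1^odd q)) (e₄ A B C))
        (∣m⇒∣-m (∣m∣n⇒∣m-n (∣m∣n⇒∣m-n F-A A-BC) (∣m∣n⇒∣m+n (∣m⇒∣m*n C F-B) C+1))))
        where
        A = (1ℤ + i) ℤ.^ (n ℕ.+ n)
        B = y ℤ.^ (n ℕ.+ n)
        C = i ℤ.^ n
        e₄ : ∀ A B C → - (((A - 1ℤ) - (A - B * C)) - ((B - 1ℤ) * C + (C - -1ℤ))) ≡ + 2
        e₄ = solve-∀
        f₁ : ∀ y → + 2 - y * y + y * y ≡ + 2
        f₁ = solve-∀
        p∤y : ¬ + p ∣ y
        p∤y p∣y = odd (∣-≡ (f₁ y) (∣m∣n⇒∣m+n d (∣n⇒∣m*n y p∣y)))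
        f₂ : ∀ i → (1ℤ - i) * (1ℤ + i) + (i * i + 1ℤ) ≡ + 2
        f₂ = solve-∀
        p∤1+i : ¬ + p ∣ 1ℤ + i
        p∤1+i p∣ = odd (∣-≡ (f₂ i) (∣m∣n⇒∣m+n (∣n⇒∣m*n (1ℤ - i) p∣) d′))
        F-A : + p ∣ A - 1ℤ
        F-A = fermat pp p≡n p∤1+i
        F-B : + p ∣ B - 1ℤ
        F-B = fermat pp p≡n p∤y
        f₃ : ∀ y i → 1ℤ * (i * i + 1ℤ) + i * (+ 2 - y * y) ≡ (1ℤ + i) * (1ℤ + i) - y * y * i
        f₃ = solve-∀
        A-BC : + p ∣ A - B * C
        A-BC = ∣-≡ (cong₂ _-_ (trans (pow-* (1ℤ + i) (1ℤ + i) n) (sym (square-pow (1ℤ + i) n)))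
            (trans (pow-* (y * y) i n) (cong (_* C) (trans (pow-* y y n) (sym (square-pow y n))))))
          (pow-cong {x = (1ℤ + i) * (1ℤ + i)} {y * y * i} n (∣-lin 1ℤ i d′ d (f₃ y i)))
        C+1 : + p ∣ C - -1ℤ ℤ.^ m
        C+1 = ∣-≡ (cong (_- -1ℤ ℤ.^ m) (trans (pow-* i i m) (sym (square-pow i m)))) (∣+1⇒∣pow {x = i * i} m d′)

    private
      4∣8q : ∀ q j → + 4 ∣ + (j ℕ.+ q ℕ.* 8) - + j
      4∣8q q j = divides (+ q * + 2) (trans (cong (_- + j) (trans (ℤₚ.pos-+ j (q ℕ.* 8)) (cong (λ z → + j + z) (ℤₚ.pos-* q 8)))) (e (+ j) (+ q)))
        where
        e : ∀ j q → j + q * + 8 - j ≡ q * + 2 * + 4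
        e = solve-∀

      8∣8q : ∀ q j → + 8 ∣ + (j ℕ.+ q ℕ.* 8) - + j
      8∣8q q j = divides (+ q) (trans (cong (_- + j) (trans (ℤₚ.pos-+ j (q ℕ.* 8)) (cong (λ z → + j + z) (ℤₚ.pos-* q 8)))) (e (+ j) (+ q)))
        where
        e : ∀ j q → j + q * + 8 - j ≡ q * + 8
        e = solve-∀

      1≢p : 1 ≢ p
      1≢p 1≡p = p∤1 pp (subst (λ z → + z ∣ 1ℤ) 1≡p ∣-refl)

    -- The first supplementary law as a congruence, the form in which it passes to powers of p.
    legendre[-1]-mod4 : OddMod8 p → + 4 ∣ + p - legendre -1ℤ p
    legendre[-1]-mod4 (1mod8 zero p≡) = contradiction (sym p≡) 1≢p
    legendre[-1]-mod4 (1mod8 q@(suc _) p≡) = subst₂ (λ x l → + 4 ∣ + x - l) (sym p≡) (sym (legendre[-1]-1mod4 (q ℕ.+ q) {{_}} (trans p≡ (e q)))) (4∣8q q 1)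
      where
      e : ∀ q → 1 ℕ.+ q ℕ.* 8 ≡ suc (((q ℕ.+ q) ℕ.+ (q ℕ.+ q)) ℕ.+ ((q ℕ.+ q) ℕ.+ (q ℕ.+ q)))
      e = ℕRing.solve-∀
    legendre[-1]-mod4 (3mod8 q p≡) = subst₂ (λ x l → + 4 ∣ + x - l) (sym p≡) (sym (legendre[-1]-3mod4 (q ℕ.+ q) (trans p≡ (e q))))
      (∣-≡ (f (+ (3 ℕ.+ q ℕ.* 8))) (∣m∣n⇒∣m+n (4∣8q q 3) (∣-refl {+ 4})))
      where
      e : ∀ q → 3 ℕ.+ q ℕ.* 8 ≡ suc (suc ((q ℕ.+ q) ℕ.+ (q ℕ.+ q)) ℕ.+ suc ((q ℕ.+ q) ℕ.+ (q ℕ.+ q)))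
      e = ℕRing.solve-∀
      f : ∀ x → x - + 3 + + 4 ≡ x - -1ℤ
      f = solve-∀
    legendre[-1]-mod4 (5mod8 q p≡) = subst₂ (λ x l → + 4 ∣ + x - l) (sym p≡) (sym (legendre[-1]-1mod4 (suc (q ℕ.+ q)) (trans p≡ (e q))))
      (∣-≡ (f (+ (5 ℕ.+ q ℕ.* 8))) (∣m∣n⇒∣m+n (4∣8q q 5) (∣-refl {+ 4})))
      where
      e : ∀ q → 5 ℕ.+ q ℕ.* 8 ≡ suc ((suc (q ℕ.+ q) ℕ.+ suc (q ℕ.+ q)) ℕ.+ (suc (q ℕ.+ q) ℕ.+ suc (q ℕ.+ q)))
      e = ℕRing.solve-∀
      f : ∀ x → x - + 5 + + 4 ≡ x - 1ℤ
      f = solve-∀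
    legendre[-1]-mod4 (7mod8 q p≡) = subst₂ (λ x l → + 4 ∣ + x - l) (sym p≡) (sym (legendre[-1]-3mod4 (suc (q ℕ.+ q)) (trans p≡ (e q))))
      (∣-≡ (f (+ (7 ℕ.+ q ℕ.* 8))) (∣m∣n⇒∣m+n (4∣8q q 7) (divides (+ 2) refl)))
      where
      e : ∀ q → 7 ℕ.+ q ℕ.* 8 ≡ suc (suc (suc (q ℕ.+ q) ℕ.+ suc (q ℕ.+ q)) ℕ.+ suc (suc (q ℕ.+ q) ℕ.+ suc (q ℕ.+ q)))
      e = ℕRing.solve-∀
      f : ∀ x → x - + 7 + + 8 ≡ x - -1ℤ
      f = solve-∀

    private
      4∤ : ∀ {j} → ¬ + 4 ∣ j - 1ℤ → ∀ {x} → + 4 ∣ x - j → ¬ + 4 ∣ x - 1ℤ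
      4∤ {j} ¬d {x} d d′ = ¬d (∣-≡ (e x j) (∣m∣n⇒∣m-n d′ d))
        where
        e : ∀ x j → x - 1ℤ - (x - j) ≡ j - 1ℤ
        e = solve-∀

    -- For p ≡ 1 modulo 4 the second supplementary law says that (p + 1)/2 is congruent to (2/p)
    -- modulo 4. Here the denominator is cleared.
    legendre[2]-mod8 : OddMod8 p → + 4 ∣ + p - 1ℤ → + 8 ∣ + p + 1ℤ - + 2 * legendre (+ 2) p
    legendre[2]-mod8 (1mod8 zero p≡) _ = contradiction (sym p≡) 1≢p
    legendre[2]-mod8 (1mod8 q@(suc _) p≡) _ = subst₂ (λ x l → + 8 ∣ + x + 1ℤ - + 2 * l) (sym p≡) (sym (legendre[2]-1mod8 q p≡))
      (∣-≡ (f (+ (1 ℕ.+ q ℕ.* 8))) (8∣8q q 1))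
      where
      f : ∀ x → x - 1ℤ ≡ x + 1ℤ - + 2 * 1ℤ
      f = solve-∀
    legendre[2]-mod8 (5mod8 q p≡) _ = subst₂ (λ x l → + 8 ∣ + x + 1ℤ - + 2 * l) (sym p≡) (sym (legendre[2]-5mod8 q p≡))
      (∣-≡ (f (+ (5 ℕ.+ q ℕ.* 8))) (∣m∣n⇒∣m+n (8∣8q q 5) (∣-refl {+ 8})))
      where
      f : ∀ x → x - + 5 + + 8 ≡ x + 1ℤ - + 2 * -1ℤ
      f = solve-∀
    legendre[2]-mod8 (3mod8 q p≡) d = contradiction (subst (λ x → + 4 ∣ + x - 1ℤ) p≡ d) (4∤ {+ 3} 4∤2 {+ (3 ℕ.+ q ℕ.* 8)} (4∣8q q 3))
    legendre[2]-mod8 (7mod8 q p≡) d = contradiction (subst (λ x → + 4 ∣ + x - 1ℤ) p≡ d)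
      (4∤ {+ 7} (λ d → 4∤2 (∣m∣n⇒∣m-n d (∣-refl {+ 4}))) {+ (7 ℕ.+ q ℕ.* 8)} (4∣8q q 7))

    square≡1-mod8 : OddMod8 p → + 8 ∣ + p * + p - 1ℤ
    square≡1-mod8 o = lemma o
      where
      e : ∀ x j → (x - j) * (x + j) + (j * j - 1ℤ) ≡ x * x - 1ℤ
      e = solve-∀
      case : ∀ {q j} → p ≡ j ℕ.+ q ℕ.* 8 → + 8 ∣ + j * + j - 1ℤ → + 8 ∣ + p * + p - 1ℤ
      case {q} {j} p≡ d = subst (λ x → + 8 ∣ + x * + x - 1ℤ) (sym p≡)
        (∣-≡ (e (+ (j ℕ.+ q ℕ.* 8)) (+ j)) (∣m∣n⇒∣m+n (∣m⇒∣m*n (+ (j ℕ.+ q ℕ.* 8) + + j) (8∣8q q j)) d))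
      lemma : OddMod8 p → + 8 ∣ + p * + p - 1ℤ
      lemma (1mod8 q p≡) = case {q} p≡ (divides (+ 0) refl)
      lemma (3mod8 q p≡) = case {q} p≡ (divides (+ 1) refl)
      lemma (5mod8 q p≡) = case {q} p≡ (divides (+ 3) refl)
      lemma (7mod8 q p≡) = case {q} p≡ (divides (+ 6) refl)

  -- The prime factors of p^r computed by `factorise` are, by uniqueness, a permutation of r copies
  -- of p.
  jacobi-pow : ∀ {p} → Prime p → ∀ a r → jacobi a (p ℕ.^ r) ≡ legendre a p ℤ.^ r
  jacobi-pow {p} pp a r = go (p ℕ.^ r) refl
    where
    instance
      p≢0 : NonZero p
      p≢0 = prime⇒nonZero pp
      p^r≢0 : NonZero (p ℕ.^ r)
      p^r≢0 = ℕₚ.m^n≢0 p r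
    fold : ∀ xs → All (_≡ p) xs → foldr _*_ 1ℤ (map (legendre a) xs) ≡ legendre a p ℤ.^ length xs
    fold [] [] = refl
    fold (_ ∷ xs) (refl ∷ all) = cong (legendre a p *_) (fold xs all)
    product-replicate : ∀ r → p ℕ.^ r ≡ product (replicate r p)
    product-replicate zero    = refl
    product-replicate (suc r) = cong (p ℕ.*_) (product-replicate r)
    go : ∀ n → n ≡ p ℕ.^ r → jacobi a n ≡ legendre a p ℤ.^ r
    go zero 0≡ = contradiction (sym 0≡) (ℕ.≢-nonZero⁻¹ (p ℕ.^ r))
    go n@(suc _) n≡ = trans (fold (factors (factorise n)) (All-resp-↭ (↭-sym perm) (Allₚ.replicate⁺ r refl)))
      (cong (legendre a p ℤ.^_) (trans (↭-length perm) (Listₚ.length-replicate r)))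
      where
      perm : factors (factorise n) ↭ replicate r p
      perm = factorisationUnique (factorise n) (record
        { factors = replicate r p ; isFactorisation = trans n≡ (product-replicate r) ; factorsPrime = Allₚ.replicate⁺ r pp })

-- The polynomials W and ballot numbers

module BracketPolynomials where

  open import Data.Integer.Base using (+_)
  open import Data.Nat.Base as ℕ using (ℕ; zero; suc; z≤n; s≤s)
  open import Data.Nat.Combinatorics using (_C_; nCk≡nC[n∸k]; k>n⇒nCk≡0)
  import Data.Nat.Properties as ℕₚ
  open import Data.Rational.Base using (ℚ; 0ℚ; 1ℚ; _+_; _*_; _-_; -_)
  import Data.Rational.Properties as ℚₚ
  open import Relation.Binary.PropositionalEquality
  import Tactic.RingSolver as RS
  open BinomialCoefficients
  open Rationals
  open ≡-Reasoning

  -- Σᵢ c(i) yⁱ v(N - i)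
  G : (ℕ → ℚ) → ℚ → ℕ → (ℕ → ℚ) → ℚ
  G v y zero    c = c 0 * v 0
  G v y (suc N) c = c 0 * v (suc N) + y * G v y N (λ i → c (suc i))

  shift : (ℕ → ℚ) → ℕ → ℚ
  shift c zero    = 0ℚ
  shift c (suc i) = c i

  -- By recursion, so that `double (suc n)` computes to two successors and Pascal's rule applies
  -- without rewriting.
  double : ℕ → ℕ
  double zero    = zero
  double (suc n) = suc (suc (double n))

  module _ (v : ℕ → ℚ) (y : ℚ) where

    G-cong : ∀ N {c d} → (∀ i → i ℕ.≤ N → c i ≡ d i) → G v y N c ≡ G v y N d
    G-cong zero eq = cong (_* v 0) (eq 0 z≤n)
    G-cong (suc N) eq = cong₂ (λ a b → a * v (suc N) + y * b) (eq 0 z≤n) (G-cong N λ i i≤N → eq (suc i) (s≤s i≤N))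

    G-+ : ∀ N c d → G v y N (λ i → c i + d i) ≡ G v y N c + G v y N d
    G-+ zero c d = ℚₚ.*-distribʳ-+ (v 0) (c 0) (d 0)
    G-+ (suc N) c d = trans (cong (λ z → (c 0 + d 0) * v (suc N) + y * z) (G-+ N (λ i → c (suc i)) (λ i → d (suc i))))
      (e (c 0) (d 0) (v (suc N)) y (G v y N (λ i → c (suc i))) (G v y N (λ i → d (suc i))))
      where
      e : ∀ c d v y s t → (c + d) * v + y * (s + t) ≡ (c * v + y * s) + (d * v + y * t)
      e = RS.solve-∀ ringℚ

    G-0 : ∀ N → G v y N (λ _ → 0ℚ) ≡ 0ℚ
    G-0 zero = ℚₚ.*-zeroˡ (v 0)
    G-0 (suc N) = trans (cong (λ z → 0ℚ * v (suc N) + y * z) (G-0 N)) (e (v (suc N)) y)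
      where
      e : ∀ v y → 0ℚ * v + y * 0ℚ ≡ 0ℚ
      e = RS.solve-∀ ringℚ

    G-shift : ∀ N c → G v y (suc N) (shift c) ≡ y * G v y N c
    G-shift N c = e (v (suc N)) (y * G v y N c)
      where
      e : ∀ v s → 0ℚ * v + s ≡ s
      e = RS.solve-∀ ringℚ

  -- Multiplication by x raises every exponent of x by one. The enlarged sum has one more term, with
  -- coefficient `c (suc N)`, which must be 0.
  G-* : ∀ x y N c → c (suc N) ≡ 0ℚ → x * G (x ^_) y N c ≡ G (x ^_) y (suc N) c
  G-* x y zero c c≡0 = trans (e x y (c 0)) (cong (λ z → c 0 * (x * 1ℚ) + y * (z * 1ℚ)) (sym c≡0))
    where
    e : ∀ x y c → x * (c * 1ℚ) ≡ c * (x * 1ℚ) + y * (0ℚ * 1ℚ)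
    e = RS.solve-∀ ringℚ
  G-* x y (suc N) c c≡0 = trans (e x y (c 0) (x ^ suc N) (G (x ^_) y N (λ i → c (suc i))))
      (cong (λ z → c 0 * (x * x ^ suc N) + y * z) (G-* x y N (λ i → c (suc i)) c≡0))
    where
    e : ∀ x y c v s → x * (c * v + y * s) ≡ c * (x * v) + y * (x * s)
    e = RS.solve-∀ ringℚ

  C′ : ℕ → ℕ → ℚ
  C′ n k = ι (+ (n C k))

  C′-pascal : ∀ n k → C′ (suc n) (suc k) ≡ C′ n k + C′ n (suc k)
  C′-pascal n k = trans (cong ι (pascal n k)) (ι-+ (+ (n C k)) (+ (n C suc k)))

  C′-large : ∀ {n k} → n ℕ.< k → C′ n k ≡ 0ℚ
  C′-large n<k = cong (λ m → ι (+ m)) (k>n⇒nCk≡0 n<k)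

  -- The coefficients after multiplication of the generating series of `c` by (1 + X)².
  spread : (ℕ → ℚ) → ℕ → ℚ
  spread c i = c i + ι (+ 2) * shift c i + shift (shift c) i

  -- Ballot numbers, shown in `T≡ballot` to be the `T k μ` for μ ≤ k. As differences of binomial
  -- coefficients they inherit Pascal's rule.
  ballot : ℕ → ℕ → ℚ
  ballot k zero    = 1ℚ
  ballot k (suc μ) = C′ k (suc μ) - C′ k μ

  ballot-suc : ∀ k μ → ballot (suc k) μ ≡ ballot k μ + shift (ballot k) μ
  ballot-suc k zero = refl
  ballot-suc k (suc zero) = trans (cong (_- 1ℚ) (C′-pascal k 0)) (e (C′ k 1))
    where
    e : ∀ a → 1ℚ + a - 1ℚ ≡ a - 1ℚ + 1ℚ
    e = RS.solve-∀ ringℚ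
  ballot-suc k (suc (suc μ)) = trans (cong₂ _-_ (C′-pascal k (suc μ)) (C′-pascal k μ)) (e (C′ k (suc μ)) (C′ k (suc (suc μ))) (C′ k μ))
    where
    e : ∀ a b c → (a + b) - (c + a) ≡ (b - a) + (a - c)
    e = RS.solve-∀ ringℚ

  ballot-suc-suc : ∀ k μ → ballot (suc (suc k)) μ ≡ spread (ballot k) μ
  ballot-suc-suc k μ = trans (ballot-suc (suc k) μ) (trans (cong₂ _+_ (ballot-suc k μ) (shifted μ)) (e (ballot k μ) (shift (ballot k) μ) (shift (shift (ballot k)) μ)))
    where
    shifted : ∀ μ → shift (ballot (suc k)) μ ≡ shift (ballot k) μ + shift (shift (ballot k)) μ
    shifted zero    = refl
    shifted (suc μ) = ballot-suc k μ
    e : ∀ a b c → (a + b) + (b + c) ≡ a + ι (+ 2) * b + c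
    e = RS.solve-∀ ringℚ

  -- The two middle entries of row 2κ + 1 are equal. This is the boundary condition that allows sums
  -- over μ to stop at κ.
  ballot-middle : ∀ κ → ballot (suc (double κ)) (suc κ) ≡ 0ℚ
  ballot-middle κ = trans (cong (λ m → ι (+ m) - C′ k κ) C≡) (ℚₚ.+-inverseʳ (C′ k κ))
    where
    k = suc (double κ)
    k≡ : ∀ κ → double κ ≡ κ ℕ.+ κ
    k≡ zero    = refl
    k≡ (suc κ) = cong suc (trans (cong suc (k≡ κ)) (sym (ℕₚ.+-suc κ κ)))
    C≡ : k C suc κ ≡ k C κ
    C≡ = trans (nCk≡nC[n∸k] {suc κ} {k} (s≤s (subst (κ ℕ.≤_) (sym (k≡ κ)) (ℕₚ.m≤m+n κ κ))))
      (cong (k C_) (trans (cong (ℕ._∸ κ) (k≡ κ)) (ℕₚ.m+n∸n≡m κ κ)))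

  module _ (x z : ℚ) where

    private
      E : ℕ → (ℕ → ℚ) → ℚ
      E = G (x ^_) z

    -- In terms of w with w² = z and t with t² = x, (t + w)^(2ν + 1) = t A′(ν) + w B′(ν) and
    -- (t + w)^(2ν + 2) = A(ν) + t w W(ν).
    A′ B′ A W : ℕ → ℚ
    A′ ν = E ν (λ i → C′ (suc (double ν)) (double i))
    B′ ν = E ν (λ i → C′ (suc (double ν)) (suc (double i)))
    A ν  = E (suc ν) (λ i → C′ (suc (suc (double ν))) (double i))
    W ν  = E ν (λ i → C′ (suc (suc (double ν))) (suc (double i)))

    -- This and the next relations compare coefficients when (t + w)^n is multiplied by t + w: the
    -- parts with t and with w are combined for the even exponent, and the rational part and the
    -- part with tw for the following odd one.
    W≡ : ∀ ν → W ν ≡ A′ ν + B′ ν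
    W≡ ν = trans (G-cong (x ^_) z ν λ i _ → C′-pascal (suc (double ν)) (double i))
      (G-+ (x ^_) z ν (λ i → C′ (suc (double ν)) (double i)) (λ i → C′ (suc (double ν)) (suc (double i))))

    A≡ : ∀ ν → A ν ≡ x * A′ ν + z * B′ ν
    A≡ ν = begin
      E (suc ν) (λ i → C′ (suc n) (double i))
        ≡⟨ G-cong (x ^_) z (suc ν) (λ i _ → split i) ⟩
      E (suc ν) (λ i → C′ n (double i) + shift (λ j → C′ n (suc (double j))) i)
        ≡⟨ G-+ (x ^_) z (suc ν) (λ i → C′ n (double i)) (shift (λ j → C′ n (suc (double j)))) ⟩
      E (suc ν) (λ i → C′ n (double i)) + E (suc ν) (shift (λ j → C′ n (suc (double j))))
        ≡⟨ cong₂ _+_ (sym (G-* x z ν (λ i → C′ n (double i)) (C′-large {n} (ℕₚ.n<1+n n)))) (G-shift (x ^_) z ν (λ j → C′ n (suc (double j)))) ⟩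
      x * A′ ν + z * B′ ν
        ∎
      where
      n = suc (double ν)
      split : ∀ i → C′ (suc n) (double i) ≡ C′ n (double i) + shift (λ j → C′ n (suc (double j))) i
      split zero    = refl
      split (suc i) = trans (C′-pascal n (suc (double i))) (ℚₚ.+-comm (C′ n (suc (double i))) (C′ n (suc (suc (double i)))))

    A′-suc : ∀ ν → A′ (suc ν) ≡ A ν + z * W ν
    A′-suc ν = begin
      E (suc ν) (λ i → C′ (suc n) (double i))
        ≡⟨ G-cong (x ^_) z (suc ν) (λ i _ → split i) ⟩
      E (suc ν) (λ i → C′ n (double i) + shift (λ j → C′ n (suc (double j))) i)
        ≡⟨ G-+ (x ^_) z (suc ν) (λ i → C′ n (double i)) (shift (λ j → C′ n (suc (double j)))) ⟩
      A ν + E (suc ν) (shift (λ j → C′ n (suc (double j))))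
        ≡⟨ cong (λ s → A ν + s) (G-shift (x ^_) z ν (λ j → C′ n (suc (double j)))) ⟩
      A ν + z * W ν
        ∎
      where
      n = suc (suc (double ν))
      split : ∀ i → C′ (suc n) (double i) ≡ C′ n (double i) + shift (λ j → C′ n (suc (double j))) i
      split zero    = refl
      split (suc i) = trans (C′-pascal n (suc (double i))) (ℚₚ.+-comm (C′ n (suc (double i))) (C′ n (suc (suc (double i)))))

    B′-suc : ∀ ν → B′ (suc ν) ≡ A ν + x * W ν
    B′-suc ν = begin
      E (suc ν) (λ i → C′ (suc n) (suc (double i)))
        ≡⟨ G-cong (x ^_) z (suc ν) (λ i _ → C′-pascal n (double i)) ⟩
      E (suc ν) (λ i → C′ n (double i) + C′ n (suc (double i)))
        ≡⟨ G-+ (x ^_) z (suc ν) (λ i → C′ n (double i)) (λ i → C′ n (suc (double i))) ⟩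
      A ν + E (suc ν) (λ i → C′ n (suc (double i)))
        ≡⟨ cong (λ s → A ν + s) (sym (G-* x z ν (λ i → C′ n (suc (double i))) (C′-large {n} (ℕₚ.n<1+n n)))) ⟩
      A ν + x * W ν
        ∎
      where
      n = suc (suc (double ν))

    W-suc : ∀ ν → W (suc ν) ≡ ι (+ 2) * A ν + (x + z) * W ν
    W-suc ν = trans (W≡ (suc ν)) (trans (cong₂ _+_ (A′-suc ν) (B′-suc ν)) (e (A ν) (W ν) x z))
      where
      e : ∀ a w x z → (a + z * w) + (a + x * w) ≡ ι (+ 2) * a + (x + z) * w
      e = RS.solve-∀ ringℚ

    A-suc : ∀ ν → A (suc ν) ≡ (x + z) * A ν + ι (+ 2) * (x * z) * W ν
    A-suc ν = trans (A≡ (suc ν)) (trans (cong₂ (λ a b → x * a + z * b) (A′-suc ν) (B′-suc ν)) (e (A ν) (W ν) x z))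
      where
      e : ∀ a w x z → x * (a + z * w) + z * (a + x * w) ≡ (x + z) * a + ι (+ 2) * (x * z) * w
      e = RS.solve-∀ ringℚ

    W-0 : ι (+ 4) * x * W 0 ≡ W 1 + ι (+ 2) * (x - z) * W 0
    W-0 = e x z
      where
      e : ∀ x z → ι (+ 4) * x * (ι (+ 2) * 1ℚ) ≡ (ι (+ 4) * (x * 1ℚ) + z * (ι (+ 4) * 1ℚ)) + ι (+ 2) * (x - z) * (ι (+ 2) * 1ℚ)
      e = RS.solve-∀ ringℚ

    -- The numbers (t + w)² and (t - w)² have sum 2(x + z) and product (x - z)², so W(ν + 2) = 2(x +
    -- z) W(ν + 1) - (x - z)² W(ν). In the form given, with 4x isolated, the other coefficients 1,
    -- 2n, n² depend only on n = x - z. `W-0` is the initial case with W(-1) = 0.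
    W-recurrence : ∀ ν → ι (+ 4) * x * W (suc ν) ≡ W (suc (suc ν)) + ι (+ 2) * (x - z) * W (suc ν) + (x - z) * (x - z) * W ν
    W-recurrence ν = sym (begin
      W (suc (suc ν)) + ι (+ 2) * (x - z) * W (suc ν) + (x - z) * (x - z) * W ν
        ≡⟨ cong (λ w → w + ι (+ 2) * (x - z) * W (suc ν) + (x - z) * (x - z) * W ν)
             (trans (W-suc (suc ν)) (cong (λ a → ι (+ 2) * a + (x + z) * W (suc ν)) (A-suc ν))) ⟩
      ι (+ 2) * ((x + z) * A ν + ι (+ 2) * (x * z) * W ν) + (x + z) * W (suc ν) + ι (+ 2) * (x - z) * W (suc ν) + (x - z) * (x - z) * W ν
        ≡⟨ e (A ν) (W ν) (W (suc ν)) x z ⟩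
      (x + z) * (ι (+ 2) * A ν + (x + z) * W ν) + (x + z) * W (suc ν) + ι (+ 2) * (x - z) * W (suc ν)
        ≡⟨ cong (λ w → (x + z) * w + (x + z) * W (suc ν) + ι (+ 2) * (x - z) * W (suc ν)) (sym (W-suc ν)) ⟩
      (x + z) * W (suc ν) + (x + z) * W (suc ν) + ι (+ 2) * (x - z) * W (suc ν)
        ≡⟨ f (W (suc ν)) x z ⟩
      ι (+ 4) * x * W (suc ν)
        ∎)
      where
      e : ∀ a w w′ x z → ι (+ 2) * ((x + z) * a + ι (+ 2) * (x * z) * w) + (x + z) * w′ + ι (+ 2) * (x - z) * w′ + (x - z) * (x - z) * w
        ≡ (x + z) * (ι (+ 2) * a + (x + z) * w) + (x + z) * w′ + ι (+ 2) * (x - z) * w′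
      e = RS.solve-∀ ringℚ
      f : ∀ w x z → (x + z) * w + (x + z) * w + ι (+ 2) * (x - z) * w ≡ ι (+ 4) * x * w
      f = RS.solve-∀ ringℚ

    private
      n = x - z

    -- By `W-recurrence`, 4x sends n^i W(N - i) to the three neighbouring terms with coefficients 1,
    -- 2, 1, which is `spread` on the coefficients. The last of them may fall outside the range,
    -- where W(-1) = 0 stands, and the condition on `c (suc N)` closes the other end.
    G-W : ∀ N c → c (suc N) ≡ 0ℚ → ι (+ 4) * x * G W n N c ≡ G W n (suc N) (spread c)
    G-W zero c c≡0 = begin
      ι (+ 4) * x * (c 0 * W 0)                                   ≡⟨ e₁ (ι (+ 4) * x) (c 0) (W 0) ⟩
      c 0 * (ι (+ 4) * x * W 0)                                   ≡⟨ cong (c 0 *_) W-0 ⟩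
      c 0 * (W 1 + ι (+ 2) * n * W 0)                             ≡⟨ e₂ (c 0) (W 1) (W 0) n ⟩
      spread c 0 * W 1 + n * ((0ℚ + ι (+ 2) * c 0 + 0ℚ) * W 0)    ≡⟨ cong (λ d → spread c 0 * W 1 + n * ((d + ι (+ 2) * c 0 + 0ℚ) * W 0)) (sym c≡0) ⟩
      spread c 0 * W 1 + n * (spread c 1 * W 0)                   ∎
      where
      e₁ : ∀ x c w → x * (c * w) ≡ c * (x * w)
      e₁ = RS.solve-∀ ringℚ
      e₂ : ∀ c w₁ w₀ n → c * (w₁ + ι (+ 2) * n * w₀) ≡ (c + ι (+ 2) * 0ℚ + 0ℚ) * w₁ + n * ((0ℚ + ι (+ 2) * c + 0ℚ) * w₀)
      e₂ = RS.solve-∀ ringℚ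
    G-W (suc N) c c≡0 = begin
      ι (+ 4) * x * (c 0 * W (suc N) + n * G W n N c′)
        ≡⟨ e₁ (ι (+ 4) * x) (c 0) (W (suc N)) n (G W n N c′) ⟩
      c 0 * (ι (+ 4) * x * W (suc N)) + n * (ι (+ 4) * x * G W n N c′)
        ≡⟨ cong₂ (λ a b → c 0 * a + n * b) (W-recurrence N) (G-W N c′ c≡0) ⟩
      c 0 * (W (suc (suc N)) + ι (+ 2) * n * W (suc N) + n * n * W N) + n * G W n (suc N) (spread c′)
        ≡⟨ e₂ (c 0) (W (suc (suc N))) (W (suc N)) (W N) n (G W n (suc N) (spread c′)) ⟩
      spread c 0 * W (suc (suc N)) + n * (G W n (suc N) (spread c′) + (ι (+ 2) * c 0 * W (suc N) + n * (c 0 * W N)))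
        ≡⟨ cong (λ s → spread c 0 * W (suc (suc N)) + n * (G W n (suc N) (spread c′) + (ι (+ 2) * c 0 * W (suc N) + n * s))) (sym (first N)) ⟩
      spread c 0 * W (suc (suc N)) + n * (G W n (suc N) (spread c′) + G W n (suc N) head)
        ≡⟨ cong (λ s → spread c 0 * W (suc (suc N)) + n * s) (sym (G-+ W n (suc N) (spread c′) head)) ⟩
      spread c 0 * W (suc (suc N)) + n * G W n (suc N) (λ i → spread c′ i + head i)
        ≡⟨ cong (λ s → spread c 0 * W (suc (suc N)) + n * s) (G-cong W n (suc N) λ i _ → compare i) ⟩
      spread c 0 * W (suc (suc N)) + n * G W n (suc N) (λ i → spread c (suc i))
        ∎
      where
      -- `head` holds what `c 0` adds to the two following coefficients, 2 `c 0` and `c 0`. It is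
      -- missing from `spread c′`, which only knows the shifted sequence.
      c′ head tail : ℕ → ℚ
      c′ i = c (suc i)
      head zero    = ι (+ 2) * c 0
      head (suc i) = tail i
      tail zero    = c 0
      tail (suc i) = 0ℚ
      first : ∀ N → G W n N tail ≡ c 0 * W N
      first zero    = refl
      first (suc N) = trans (cong (λ s → c 0 * W (suc N) + n * s) (G-0 W n N)) (e (c 0 * W (suc N)) n)
        where
        e : ∀ a n → a + n * 0ℚ ≡ a
        e = RS.solve-∀ ringℚ
      compare : ∀ i → spread c′ i + head i ≡ spread c (suc i)
      compare zero = e (c 1) (c 0)
        where
        e : ∀ a b → a + ι (+ 2) * 0ℚ + 0ℚ + ι (+ 2) * b ≡ a + ι (+ 2) * b + 0ℚ
        e = RS.solve-∀ ringℚ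
      compare (suc zero) = e (c 2) (c 1) (c 0)
        where
        e : ∀ a b c → a + ι (+ 2) * b + 0ℚ + c ≡ a + ι (+ 2) * b + c
        e = RS.solve-∀ ringℚ
      compare (suc (suc i)) = ℚₚ.+-identityʳ (spread c′ (suc (suc i)))
      e₁ : ∀ x c w n s → x * (c * w + n * s) ≡ c * (x * w) + n * (x * s)
      e₁ = RS.solve-∀ ringℚ
      e₂ : ∀ c w₂ w₁ w₀ n s → c * (w₂ + ι (+ 2) * n * w₁ + n * n * w₀) + n * s
        ≡ (c + ι (+ 2) * 0ℚ + 0ℚ) * w₂ + n * (s + (ι (+ 2) * c * w₁ + n * (c * w₀)))
      e₂ = RS.solve-∀ ringℚ

    -- Passing from row 2κ + 1 to row 2κ + 3 of the ballot numbers is a `spread`, so by `G-W` it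
    -- multiplies the sum by 4x. The initial value is W(0) = 2.
    G-W-ballot : ∀ κ → G W n κ (ballot (suc (double κ))) ≡ ι (+ 2) * (ι (+ 4) * x) ^ κ
    G-W-ballot zero = refl
    G-W-ballot (suc κ) = begin
      G W n (suc κ) (ballot (suc (suc (suc (double κ)))))    ≡⟨ G-cong W n (suc κ) (λ i _ → ballot-suc-suc (suc (double κ)) i) ⟩
      G W n (suc κ) (spread (ballot (suc (double κ))))       ≡⟨ G-W κ (ballot (suc (double κ))) (ballot-middle κ) ⟨
      ι (+ 4) * x * G W n κ (ballot (suc (double κ)))        ≡⟨ cong (ι (+ 4) * x *_) (G-W-ballot κ) ⟩
      ι (+ 4) * x * (ι (+ 2) * (ι (+ 4) * x) ^ κ)            ≡⟨ e (ι (+ 4) * x) ((ι (+ 4) * x) ^ κ) ⟩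
      ι (+ 2) * (ι (+ 4) * x * (ι (+ 4) * x) ^ κ)            ∎
      where
      e : ∀ a b → a * (ι (+ 2) * b) ≡ ι (+ 2) * (a * b)
      e = RS.solve-∀ ringℚ

-- Binomial coefficients at half-integers and the coefficients of the bracket

module BracketCoefficients where

  open import Data.Integer.Base as ℤ using (ℤ; +_; 0ℤ; 1ℤ; -1ℤ)
  import Data.Integer.Properties as ℤₚ
  open import Data.Nat.Base as ℕ using (ℕ; zero; suc; z≤n; s≤s)
  open import Data.Nat.Combinatorics using (_C_; nC1≡n)
  import Data.Nat.Properties as ℕₚ
  open import Data.Rational.Base using (ℚ; 0ℚ; 1ℚ; ½; _+_; _*_; _-_; -_; _/_)
  import Data.Rational.Properties as ℚₚ
  open import Relation.Binary.PropositionalEquality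
  import Tactic.RingSolver as RS
  open BinomialCoefficients
  open BracketPolynomials
  open FiniteSums
  open Rationals
  open ≡-Reasoning

  ι-suc : ∀ n → ι (+ suc n) ≡ 1ℚ + ι (+ n)
  ι-suc n = trans (cong ι (ℤₚ.pos-+ 1 n)) (ι-+ 1ℤ (+ n))

  ι-double : ∀ n → ι (+ double n) ≡ ι (+ 2) * ι (+ n)
  ι-double zero    = refl
  ι-double (suc n) = trans (ι-suc (suc (double n))) (trans (cong (λ z → 1ℚ + z) (trans (ι-suc (double n)) (cong (λ z → 1ℚ + z) (ι-double n))))
    (trans (e (ι (+ n))) (cong (ι (+ 2) *_) (sym (ι-suc n)))))
    where
    e : ∀ x → 1ℚ + (1ℚ + ι (+ 2) * x) ≡ ι (+ 2) * (1ℚ + x)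
    e = RS.solve-∀ ringℚ

  suc*1/suc : ∀ n → ι (+ suc n) * (+ 1 / suc n) ≡ 1ℚ
  suc*1/suc n = ι*/ (+ 1) (suc n)

  -- Absorption for a rational upper argument; it carries the induction on ν in `binomial-half`.
  binomial-absorption : ∀ α k → ι (+ suc k) * binomial (α + 1ℚ) (suc k) ≡ (α + 1ℚ) * binomial α k
  binomial-absorption α zero = e α
    where
    e : ∀ a → 1ℚ * (1ℚ * ((a + 1ℚ - 0ℚ) * 1ℚ)) ≡ (a + 1ℚ) * 1ℚ
    e = RS.solve-∀ ringℚ
  binomial-absorption α (suc k) = begin
    ι (+ suc (suc k)) * (β * ((α + 1ℚ - ι (+ suc k)) * (+ 1 / suc (suc k))))
      ≡⟨ e₁ (ι (+ suc (suc k))) β (α + 1ℚ - ι (+ suc k)) (+ 1 / suc (suc k)) ⟩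
    ι (+ suc (suc k)) * (+ 1 / suc (suc k)) * (β * (α + 1ℚ - ι (+ suc k)))
      ≡⟨ cong₂ (λ a b → a * (β * (α + 1ℚ - b))) (suc*1/suc (suc k)) (ι-suc k) ⟩
    1ℚ * (β * (α + 1ℚ - (1ℚ + ι (+ k))))
      ≡⟨ cong (λ a → a * (β * (α + 1ℚ - (1ℚ + ι (+ k))))) (sym (suc*1/suc k)) ⟩
    ι (+ suc k) * (+ 1 / suc k) * (β * (α + 1ℚ - (1ℚ + ι (+ k))))
      ≡⟨ e₂ (ι (+ suc k)) (+ 1 / suc k) β α (ι (+ k)) ⟩
    ι (+ suc k) * β * ((α - ι (+ k)) * (+ 1 / suc k))
      ≡⟨ cong (_* ((α - ι (+ k)) * (+ 1 / suc k))) (binomial-absorption α k) ⟩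
    (α + 1ℚ) * binomial α k * ((α - ι (+ k)) * (+ 1 / suc k))
      ≡⟨ ℚₚ.*-assoc (α + 1ℚ) (binomial α k) _ ⟩
    (α + 1ℚ) * (binomial α k * ((α - ι (+ k)) * (+ 1 / suc k)))
      ∎
    where
    β = binomial (α + 1ℚ) (suc k)
    e₁ : ∀ s b x r → s * (b * (x * r)) ≡ s * r * (b * x)
    e₁ = RS.solve-∀ ringℚ
    e₂ : ∀ u r b a k → u * r * (b * (a + 1ℚ - (1ℚ + k))) ≡ u * b * ((a - k) * r)
    e₂ = RS.solve-∀ ringℚ

  C′-step : ∀ n k → ι (+ suc k) * C′ n (suc k) ≡ (ι (+ n) - ι (+ k)) * C′ n k
  C′-step n k = trans (sym (ι-* (+ suc k) (+ (n C suc k)))) (trans (cong ι (nCk-step n k))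
    (trans (ι-* (+ n ℤ.- + k) (+ (n C k))) (cong (_* C′ n k) (ι-- (+ n) (+ k)))))

  C′-absorption : ∀ n k → ι (+ suc k) * C′ (suc n) (suc k) ≡ ι (+ suc n) * C′ n k
  C′-absorption n k = trans (sym (ι-* (+ suc k) (+ (suc n C suc k)))) (trans (cong ι (absorption n k)) (ι-* (+ suc n) (+ (n C k))))

  C′-raise : ∀ n k → (ι (+ suc n) - ι (+ k)) * C′ (suc n) k ≡ ι (+ suc n) * C′ n k
  C′-raise n k = trans (sym (C′-step (suc n) k)) (C′-absorption n k)

  half : ℕ → ℚ
  half ν = ½ + ι (+ ν)

  -- The common factor of all coefficients of the bracket relative to those of `W`. Its binomial
  -- part is the central coefficient that is divided out in `α`.
  scalar : ℕ → ℚ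
  scalar ν = ½ ^ suc (double ν) * C′ (suc (double ν)) ν

  2ν+1 : ∀ ν → ι (+ suc (double ν)) ≡ 1ℚ + ι (+ 2) * ι (+ ν)
  2ν+1 ν = trans (ι-suc (double ν)) (cong (λ z → 1ℚ + z) (ι-double ν))

  scalar-suc : ∀ ν → ι (+ suc ν) * (scalar (suc ν) * ι (+ double (suc (suc ν)))) ≡ half (suc ν) * (scalar ν * ι (+ double (suc ν)))
  scalar-suc ν = begin
    ι (+ suc ν) * (½ * (½ * P) * C₃ * ι (+ double (suc (suc ν))))
      ≡⟨ cong (λ d → ι (+ suc ν) * (½ * (½ * P) * C₃ * d)) (trans (ι-double (suc (suc ν))) (cong (ι (+ 2) *_) (trans (ι-suc (suc ν)) (cong (λ z → 1ℚ + z) (ι-suc ν))))) ⟩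
    ι (+ suc ν) * (½ * (½ * P) * C₃ * (ι (+ 2) * (1ℚ + (1ℚ + N))))
      ≡⟨ e₁ (ι (+ suc ν)) P C₃ N ⟩
    ½ * P * (1ℚ + (1ℚ + N)) * (ι (+ suc ν) * C₃)
      ≡⟨ cong (½ * P * (1ℚ + (1ℚ + N)) *_) (trans (C′-absorption (suc (suc (double ν))) ν) (cong (_* C₂) (trans (2ν+1 (suc ν)) (cong (λ z → 1ℚ + ι (+ 2) * z) (ι-suc ν))))) ⟩
    ½ * P * (1ℚ + (1ℚ + N)) * ((1ℚ + ι (+ 2) * (1ℚ + N)) * C₂)
      ≡⟨ e₂ P N C₂ ⟩
    ½ * P * (1ℚ + ι (+ 2) * (1ℚ + N)) * ((1ℚ + (1ℚ + ι (+ 2) * N) - N) * C₂)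
      ≡⟨ cong (λ z → ½ * P * (1ℚ + ι (+ 2) * (1ℚ + N)) * ((z - N) * C₂)) (sym 2ν+2) ⟩
    ½ * P * (1ℚ + ι (+ 2) * (1ℚ + N)) * ((ι (+ suc (suc (double ν))) - N) * C₂)
      ≡⟨ cong (½ * P * (1ℚ + ι (+ 2) * (1ℚ + N)) *_) (C′-raise (suc (double ν)) ν) ⟩
    ½ * P * (1ℚ + ι (+ 2) * (1ℚ + N)) * (ι (+ suc (suc (double ν))) * C₁)
      ≡⟨ e₃ P N (ι (+ suc (suc (double ν)))) C₁ ⟩
    (½ + (1ℚ + N)) * (P * C₁ * ι (+ suc (suc (double ν))))
      ≡⟨ cong (λ z → (½ + z) * (P * C₁ * ι (+ suc (suc (double ν))))) (sym (ι-suc ν)) ⟩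
    half (suc ν) * (scalar ν * ι (+ double (suc ν)))
      ∎
    where
    P = ½ ^ suc (double ν)
    N = ι (+ ν)
    C₃ = C′ (suc (double (suc ν))) (suc ν)
    C₂ = C′ (suc (suc (double ν))) ν
    C₁ = C′ (suc (double ν)) ν
    2ν+2 : ι (+ suc (suc (double ν))) ≡ 1ℚ + (1ℚ + ι (+ 2) * N)
    2ν+2 = trans (ι-suc (suc (double ν))) (cong (λ z → 1ℚ + z) (2ν+1 ν))
    e₁ : ∀ u p c n → u * (½ * (½ * p) * c * (ι (+ 2) * (1ℚ + (1ℚ + n)))) ≡ ½ * p * (1ℚ + (1ℚ + n)) * (u * c)
    e₁ = RS.solve-∀ ringℚ
    e₂ : ∀ p n c → ½ * p * (1ℚ + (1ℚ + n)) * ((1ℚ + ι (+ 2) * (1ℚ + n)) * c) ≡ ½ * p * (1ℚ + ι (+ 2) * (1ℚ + n)) * ((1ℚ + (1ℚ + ι (+ 2) * n) - n) * c)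
    e₂ = RS.solve-∀ ringℚ
    e₃ : ∀ p n d c → ½ * p * (1ℚ + ι (+ 2) * (1ℚ + n)) * (d * c) ≡ (½ + (1ℚ + n)) * (p * c * d)
    e₃ = RS.solve-∀ ringℚ

  binomial-half : ∀ ν → binomial (half ν) ν ≡ scalar ν * ι (+ double (suc ν))
  binomial-half zero = refl
  binomial-half (suc ν) = *-cancelˡ (ι-suc≢0 ν) (begin
    ι (+ suc ν) * binomial (half (suc ν)) (suc ν)     ≡⟨ cong (λ α → ι (+ suc ν) * binomial α (suc ν)) half-suc ⟩
    ι (+ suc ν) * binomial (half ν + 1ℚ) (suc ν)      ≡⟨ binomial-absorption (half ν) ν ⟩
    (half ν + 1ℚ) * binomial (half ν) ν               ≡⟨ cong₂ _*_ (sym half-suc) (binomial-half ν) ⟩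
    half (suc ν) * (scalar ν * ι (+ double (suc ν)))  ≡⟨ scalar-suc ν ⟨
    ι (+ suc ν) * (scalar (suc ν) * ι (+ double (suc (suc ν)))) ∎)
    where
    e : ∀ a → ½ + (1ℚ + a) ≡ ½ + a + 1ℚ
    e = RS.solve-∀ ringℚ
    half-suc : half (suc ν) ≡ half ν + 1ℚ
    half-suc = trans (cong (λ z → ½ + z) (ι-suc ν)) (e (ι (+ ν)))

  -- Induction on i. With u = i + 1 and q = m + 1, passing from (i, m + 1) to (i + 1, m) multiplies
  -- both sides by q(2q + 1) / (u(2u + 1)): on the right these are two steps along row 2ν + 2. The
  -- factor `M` clears the denominator, and i = 0 is `binomial-half`.
  bracket-coefficient : ∀ i m ν → i ℕ.+ m ≡ ν → binomial (half ν) m * binomial (half ν) i ≡ scalar ν * C′ (double (suc ν)) (suc (double i))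
  bracket-coefficient zero m ν refl = trans (ℚₚ.*-identityʳ (binomial (half m) m)) (trans (binomial-half m)
    (cong (λ c → scalar m * ι (+ c)) (sym (nC1≡n (double (suc m))))))
  bracket-coefficient (suc i) m ν i+m≡ν = *-cancelˡ multiplier≢0 (begin
    M * (bm * (bi * ((half ν - ι (+ i)) * r)))
      ≡⟨ cong₂ (λ a b → a * (bm * (bi * ((½ + b - ι (+ i)) * r)))) M≡ ν≡ ⟩
    u * (1ℚ + ι (+ 2) * u) * (bm * (bi * ((½ + (ι (+ i) + q) - ι (+ i)) * r)))
      ≡⟨ e₁ u bm bi (ι (+ i)) q r ⟩
    (u * r) * (1ℚ + ι (+ 2) * u) * (½ + q) * (bm * bi)
      ≡⟨ cong (λ z → z * (1ℚ + ι (+ 2) * u) * (½ + q) * (bm * bi)) (trans (suc*1/suc i) (sym (suc*1/suc m))) ⟩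
    (q * s) * (1ℚ + ι (+ 2) * u) * (½ + q) * (bm * bi)
      ≡⟨ e₂ u bm bi (ι (+ m)) q s ⟩
    q * (1ℚ + ι (+ 2) * q) * (bm * ((½ + (u + ι (+ m)) - ι (+ m)) * s) * bi)
      ≡⟨ cong (λ z → q * (1ℚ + ι (+ 2) * q) * (bm * ((½ + z - ι (+ m)) * s) * bi)) (sym ν≡′) ⟩
    q * (1ℚ + ι (+ 2) * q) * (binomial (half ν) (suc m) * bi)
      ≡⟨ cong (q * (1ℚ + ι (+ 2) * q) *_) (bracket-coefficient i (suc m) ν (trans (ℕₚ.+-suc i m) i+m≡ν)) ⟩
    q * (1ℚ + ι (+ 2) * q) * (scalar ν * C₁)
      ≡⟨ e₃ q (scalar ν) C₁ ⟩
    scalar ν * (½ * (ι (+ 2) * q) * ((1ℚ + ι (+ 2) * q) * C₁))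
      ≡⟨ cong (λ z → scalar ν * (½ * (ι (+ 2) * q) * z)) step₁ ⟨
    scalar ν * (½ * (ι (+ 2) * q) * (ι (+ 2) * u * C₂))
      ≡⟨ e₄ (scalar ν) q u C₂ ⟩
    scalar ν * (u * (ι (+ 2) * q * C₂))
      ≡⟨ cong (λ z → scalar ν * (u * z)) step₂ ⟨
    scalar ν * (u * ((1ℚ + ι (+ 2) * u) * C₃))
      ≡⟨ e₅ (scalar ν) u C₃ ⟩
    u * (1ℚ + ι (+ 2) * u) * (scalar ν * C₃)
      ≡⟨ cong (_* (scalar ν * C₃)) M≡ ⟨
    M * (scalar ν * C₃)
      ∎)
    where
    u = ι (+ suc i)
    q = ι (+ suc m)
    r = + 1 / suc i
    s = + 1 / suc m
    bm = binomial (half ν) m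
    bi = binomial (half ν) i
    n = double (suc ν)
    C₁ = C′ n (suc (double i))
    C₂ = C′ n (double (suc i))
    C₃ = C′ n (suc (double (suc i)))
    M = u * ι (+ suc (double (suc i)))
    M≡ : M ≡ u * (1ℚ + ι (+ 2) * u)
    M≡ = cong (u *_) (2ν+1 (suc i))
    multiplier≢0 : M ≢ 0ℚ
    multiplier≢0 M≡0 = ι-suc≢0 (double (suc i)) (*-cancelˡ (ι-suc≢0 i) (trans M≡0 (sym (ℚₚ.*-zeroʳ u))))
    ν≡ : ι (+ ν) ≡ ι (+ i) + q
    ν≡ = trans (cong (λ z → ι (+ z)) (sym (trans (ℕₚ.+-suc i m) i+m≡ν))) (trans (cong ι (ℤₚ.pos-+ i (suc m))) (ι-+ (+ i) (+ suc m)))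
    ν≡′ : ι (+ ν) ≡ u + ι (+ m)
    ν≡′ = trans (cong (λ z → ι (+ z)) (sym i+m≡ν)) (trans (cong ι (ℤₚ.pos-+ (suc i) m)) (ι-+ (+ suc i) (+ m)))
    n≡ : ι (+ n) ≡ ι (+ 2) * (1ℚ + (u + ι (+ m)))
    n≡ = trans (ι-double (suc ν)) (cong (ι (+ 2) *_) (trans (ι-suc ν) (cong (λ z → 1ℚ + z) ν≡′)))
    step₁ : ι (+ 2) * u * C₂ ≡ (1ℚ + ι (+ 2) * q) * C₁
    step₁ = trans (cong (_* C₂) (sym (ι-double (suc i)))) (trans (C′-step n (suc (double i))) (cong (_* C₁)
      (trans (cong₂ _-_ n≡ (2ν+1 i)) (trans (cong (λ z → ι (+ 2) * (1ℚ + (z + ι (+ m))) - (1ℚ + ι (+ 2) * ι (+ i))) (ι-suc i))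
        (trans (e (ι (+ i)) (ι (+ m))) (cong (λ z → 1ℚ + ι (+ 2) * z) (sym (ι-suc m))))))))
      where
      e : ∀ i m → ι (+ 2) * (1ℚ + (1ℚ + i + m)) - (1ℚ + ι (+ 2) * i) ≡ 1ℚ + ι (+ 2) * (1ℚ + m)
      e = RS.solve-∀ ringℚ
    step₂ : (1ℚ + ι (+ 2) * u) * C₃ ≡ ι (+ 2) * q * C₂
    step₂ = trans (cong (_* C₃) (sym (2ν+1 (suc i)))) (trans (C′-step n (double (suc i))) (cong (_* C₂)
      (trans (cong₂ _-_ n≡ (ι-double (suc i))) (trans (e u (ι (+ m))) (cong (ι (+ 2) *_) (sym (ι-suc m)))))))
      where
      e : ∀ u m → ι (+ 2) * (1ℚ + (u + m)) - ι (+ 2) * u ≡ ι (+ 2) * (1ℚ + m)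
      e = RS.solve-∀ ringℚ
    e₁ : ∀ u bm bi i q r → u * (1ℚ + ι (+ 2) * u) * (bm * (bi * ((½ + (i + q) - i) * r))) ≡ (u * r) * (1ℚ + ι (+ 2) * u) * (½ + q) * (bm * bi)
    e₁ = RS.solve-∀ ringℚ
    e₂ : ∀ u bm bi m q s → (q * s) * (1ℚ + ι (+ 2) * u) * (½ + q) * (bm * bi) ≡ q * (1ℚ + ι (+ 2) * q) * (bm * ((½ + (u + m) - m) * s) * bi)
    e₂ = RS.solve-∀ ringℚ
    e₃ : ∀ q k c → q * (1ℚ + ι (+ 2) * q) * (k * c) ≡ k * (½ * (ι (+ 2) * q) * ((1ℚ + ι (+ 2) * q) * c))
    e₃ = RS.solve-∀ ringℚ
    e₄ : ∀ k q u c → k * (½ * (ι (+ 2) * q) * (ι (+ 2) * u * c)) ≡ k * (u * (ι (+ 2) * q * c))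
    e₄ = RS.solve-∀ ringℚ
    e₅ : ∀ k u c → k * (u * ((1ℚ + ι (+ 2) * u) * c)) ≡ u * (1ℚ + ι (+ 2) * u) * (k * c)
    e₅ = RS.solve-∀ ringℚ

  -- k - 2μ + 1 = (k - μ + 1) - μ, and μ C(k, μ) = (k - μ + 1) C(k, μ - 1).
  T≡ballot : ∀ k μ → μ ℕ.≤ k → T k μ ≡ ballot k μ
  T≡ballot k zero _ = trans (cong (λ z → z * 1ℚ) (*-cancelˡ (ι-suc≢0 k) (trans (ι*/ (+ k ℤ.- 0ℤ ℤ.+ 1ℤ) (suc k)) (trans (cong ι (e k)) (sym (ℚₚ.*-identityʳ (ι (+ suc k)))))))) refl
    where
    e : ∀ k → + k ℤ.- 0ℤ ℤ.+ 1ℤ ≡ + suc k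
    e k = trans (cong (ℤ._+ 1ℤ) (ℤₚ.+-identityʳ (+ k))) (trans (sym (ℤₚ.pos-+ k 1)) (cong +_ (ℕₚ.+-comm k 1)))
  T≡ballot k (suc m) m<k = *-cancelˡ (ι-suc≢0 (k ℕ.∸ suc m)) (begin
    ι (+ d) * ((I / d) * C₂)                      ≡⟨ ℚₚ.*-assoc (ι (+ d)) (I / d) C₂ ⟨
    ι (+ d) * (I / d) * C₂                        ≡⟨ cong (_* C₂) (ι*/ I d) ⟩
    ι I * C₂                                      ≡⟨ cong (_* C₂) I≡ ⟩
    (K - ι (+ 2) * (1ℚ + N) + 1ℚ) * C₂            ≡⟨ e₁ K N C₂ ⟩
    (K - N) * C₂ - (1ℚ + N) * C₂                  ≡⟨ cong (λ z → (K - N) * C₂ - z * C₂) (ι-suc m) ⟨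
    (K - N) * C₂ - ι (+ suc m) * C₂               ≡⟨ cong (λ z → (K - N) * C₂ - z) (C′-step k m) ⟩
    (K - N) * C₂ - (K - N) * C₁                   ≡⟨ e₂ (K - N) C₂ C₁ ⟩
    (K - N) * (C₂ - C₁)                           ≡⟨ cong (_* (C₂ - C₁)) d≡ ⟨
    ι (+ d) * (C₂ - C₁)                           ∎)
    where
    d = suc (k ℕ.∸ suc m)
    I = + k ℤ.- + (2 ℕ.* suc m) ℤ.+ 1ℤ
    K = ι (+ k)
    N = ι (+ m)
    C₂ = C′ k (suc m)
    C₁ = C′ k m
    d≡ : ι (+ d) ≡ K - N
    d≡ = trans (cong (λ z → ι (+ z)) (sym (ℕₚ.+-∸-assoc 1 m<k))) (trans (cong ι (sym (trans (ℤₚ.m-n≡m⊖n k m) (ℤₚ.⊖-≥ (ℕₚ.<⇒≤ m<k))))) (ι-- (+ k) (+ m)))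
    I≡ : ι I ≡ K - ι (+ 2) * (1ℚ + N) + 1ℚ
    I≡ = trans (ι-+ (+ k ℤ.- + (2 ℕ.* suc m)) 1ℤ) (cong (_+ 1ℚ) (trans (ι-- (+ k) (+ (2 ℕ.* suc m)))
      (cong (λ z → K - z) (trans (cong ι (ℤₚ.pos-* 2 (suc m))) (trans (ι-* (+ 2) (+ suc m)) (cong (ι (+ 2) *_) (ι-suc m)))))))
    e₁ : ∀ k n c → (k - ι (+ 2) * (1ℚ + n) + 1ℚ) * c ≡ (k - n) * c - (1ℚ + n) * c
    e₁ = RS.solve-∀ ringℚ
    e₂ : ∀ x a b → x * a - x * b ≡ x * (a - b)
    e₂ = RS.solve-∀ ringℚ

  Σ≡G : ∀ v y N c → Σ[0⋯ N ] (λ i → c i * (y ^ i * v (N ℕ.∸ i))) ≡ G v y N c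
  Σ≡G v y zero c = e (c 0) (v 0)
    where
    e : ∀ c v → c * (1ℚ * v) + 0ℚ ≡ c * v
    e = RS.solve-∀ ringℚ
  Σ≡G v y (suc N) c = cong₂ _+_ (cong (c 0 *_) (ℚₚ.*-identityˡ (v (suc N)))) (trans (factor N (λ i → c (suc i))) (cong (y *_) (Σ≡G v y N (λ i → c (suc i)))))
    where
    e : ∀ c y p v → c * (y * p * v) ≡ y * (c * (p * v))
    e = RS.solve-∀ ringℚ
    factor : ∀ N c → Σ[0⋯ N ] (λ i → c i * (y * y ^ i * v (N ℕ.∸ i))) ≡ y * Σ[0⋯ N ] (λ i → c i * (y ^ i * v (N ℕ.∸ i)))
    factor N c = trans (Σ-cong N λ {i} _ → e (c i) y (y ^ i) (v (N ℕ.∸ i))) (Σ-*ˡ y N (λ i → c i * (y ^ i * v (N ℕ.∸ i))))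

  -1^*^ : ∀ y i → ι (-1ℤ ℤ.^ i) * y ^ i ≡ (- y) ^ i
  -1^*^ y zero    = refl
  -1^*^ y (suc i) = trans (cong (_* (y * y ^ i)) (ι-* -1ℤ (-1ℤ ℤ.^ i))) (trans (e (ι (-1ℤ ℤ.^ i)) y (y ^ i)) (cong (- y *_) (-1^*^ y i)))
    where
    e : ∀ a y p → - 1ℚ * a * (y * p) ≡ - y * (a * p)
    e = RS.solve-∀ ringℚ

  -- The alternating signs are absorbed into the second argument - y. With x = t² and y = n - t²
  -- this argument is t² - n.
  bracket-sum : ∀ x y ν →
    Σ[0⋯ ν ] (λ i → ι (-1ℤ ℤ.^ i) * binomial (half ν) (ν ℕ.∸ i) * binomial (half ν) i * (y ^ i * x ^ (ν ℕ.∸ i))) ≡ scalar ν * W x (- y) ν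
  bracket-sum x y ν = trans (Σ-cong ν λ {i} i≤ν → term i≤ν) (trans (Σ-*ˡ (scalar ν) ν (λ i → c i * ((- y) ^ i * x ^ (ν ℕ.∸ i))))
    (cong (scalar ν *_) (Σ≡G (x ^_) (- y) ν c)))
    where
    c : ℕ → ℚ
    c i = C′ (double (suc ν)) (suc (double i))
    e₁ : ∀ s a b p q → s * a * b * (p * q) ≡ a * b * (s * p * q)
    e₁ = RS.solve-∀ ringℚ
    term : ∀ {i} → i ℕ.≤ ν → ι (-1ℤ ℤ.^ i) * binomial (half ν) (ν ℕ.∸ i) * binomial (half ν) i * (y ^ i * x ^ (ν ℕ.∸ i))
      ≡ scalar ν * (c i * ((- y) ^ i * x ^ (ν ℕ.∸ i)))
    term {i} i≤ν = trans (e₁ (ι (-1ℤ ℤ.^ i)) (binomial (half ν) (ν ℕ.∸ i)) (binomial (half ν) i) (y ^ i) (x ^ (ν ℕ.∸ i)))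
      (trans (cong₂ (λ a b → a * (b * x ^ (ν ℕ.∸ i))) (bracket-coefficient i (ν ℕ.∸ i) ν (ℕₚ.m+[n∸m]≡n i≤ν)) (-1^*^ y i))
        (ℚₚ.*-assoc (scalar ν) (c i) ((- y) ^ i * x ^ (ν ℕ.∸ i))))

  ½-split : ∀ {κ μ} → μ ℕ.≤ κ → ½ ^ (2 ℕ.* μ) * ½ ^ suc (double (κ ℕ.∸ μ)) ≡ ½ ^ suc (double κ)
  ½-split {κ} {zero} _ = ℚₚ.*-identityˡ (½ ^ suc (double κ))
  ½-split {suc κ} {suc μ} (s≤s μ≤κ) = trans (cong (λ n → ½ ^ n * h) (ℕₚ.*-suc 2 μ)) (trans (e (½ ^ (2 ℕ.* μ)) h) (cong (λ z → ½ * (½ * z)) (½-split μ≤κ)))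
    where
    h = ½ ^ suc (double (κ ℕ.∸ μ))
    e : ∀ p h → ½ * (½ * p) * h ≡ ½ * (½ * (p * h))
    e = RS.solve-∀ ringℚ

  double≥ : ∀ κ → κ ℕ.≤ double κ
  double≥ zero    = z≤n
  double≥ (suc κ) = s≤s (ℕₚ.m≤n⇒m≤1+n (double≥ κ))

  -- For z = -(n - x) one has x - z = n, so `G-W-ballot` is an expansion in powers of n. The powers
  -- of 1/2 in each term combine to 2^(-2κ-1), which cancels the constant in 2(4x)^κ.
  power-expansion : ∀ κ x n →
    Σ[0⋯ κ ] (λ μ → ½ ^ (2 ℕ.* μ) * T (suc (double κ)) μ * (½ ^ suc (double (κ ℕ.∸ μ)) * W x (- (n - x)) (κ ℕ.∸ μ)) * n ^ μ) ≡ x ^ κ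
  power-expansion κ x n = begin
    Σ[0⋯ κ ] (λ μ → ½ ^ (2 ℕ.* μ) * T k μ * (½ ^ suc (double (κ ℕ.∸ μ)) * w (κ ℕ.∸ μ)) * n ^ μ)
      ≡⟨ Σ-cong κ (λ {μ} μ≤κ → term μ≤κ) ⟩
    Σ[0⋯ κ ] (λ μ → ½ ^ k * (ballot k μ * ((x - - (n - x)) ^ μ * w (κ ℕ.∸ μ))))
      ≡⟨ Σ-*ˡ (½ ^ k) κ (λ μ → ballot k μ * ((x - - (n - x)) ^ μ * w (κ ℕ.∸ μ))) ⟩
    ½ ^ k * Σ[0⋯ κ ] (λ μ → ballot k μ * ((x - - (n - x)) ^ μ * w (κ ℕ.∸ μ)))
      ≡⟨ cong (½ ^ k *_) (trans (Σ≡G w (x - - (n - x)) κ (ballot k)) (G-W-ballot x (- (n - x)) κ)) ⟩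
    ½ ^ k * (ι (+ 2) * (ι (+ 4) * x) ^ κ)
      ≡⟨ cancel κ ⟩
    x ^ κ
      ∎
    where
    k = suc (double κ)
    w : ℕ → ℚ
    w = W x (- (n - x))
    n≡ : ∀ x n → n ≡ x - - (n - x)
    n≡ = RS.solve-∀ ringℚ
    e : ∀ a t b c d → a * t * (b * c) * d ≡ a * b * (t * (d * c))
    e = RS.solve-∀ ringℚ
    term : ∀ {μ} → μ ℕ.≤ κ → ½ ^ (2 ℕ.* μ) * T k μ * (½ ^ suc (double (κ ℕ.∸ μ)) * w (κ ℕ.∸ μ)) * n ^ μ
      ≡ ½ ^ k * (ballot k μ * ((x - - (n - x)) ^ μ * w (κ ℕ.∸ μ)))
    term {μ} μ≤κ = trans (e (½ ^ (2 ℕ.* μ)) (T k μ) (½ ^ suc (double (κ ℕ.∸ μ))) (w (κ ℕ.∸ μ)) (n ^ μ))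
      (cong₂ _*_ (½-split μ≤κ) (cong₂ (λ t m → t * (m ^ μ * w (κ ℕ.∸ μ)))
        (T≡ballot k μ (ℕₚ.≤-trans μ≤κ (ℕₚ.m≤n⇒m≤1+n (double≥ κ)))) (n≡ x n)))
    cancel : ∀ κ → ½ ^ suc (double κ) * (ι (+ 2) * (ι (+ 4) * x) ^ κ) ≡ x ^ κ
    cancel zero    = refl
    cancel (suc κ) = trans (e₁ (½ ^ suc (double κ)) x ((ι (+ 4) * x) ^ κ)) (cong (x *_) (cancel κ))
      where
      e₁ : ∀ h x p → ½ * (½ * h) * (ι (+ 2) * (ι (+ 4) * x * p)) ≡ x * (h * (ι (+ 2) * p))
      e₁ = RS.solve-∀ ringℚ

-- The bracket part of α as a sum over t

module ClassNumberSums where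

  open import Data.Integer.Base as ℤ using (ℤ; +_; -[1+_]; 0ℤ; -1ℤ; ∣_∣)
  import Data.Integer.Properties as ℤₚ
  open import Data.List.Base using (upTo)
  open import Data.List.Membership.Propositional using (_∈_)
  import Data.List.Relation.Unary.Unique.Propositional.Properties as Uniqueₚ
  open import Data.Nat.Base as ℕ using (ℕ; zero; suc; NonZero; z≤n; ⌊_/2⌋)
  import Data.Nat.Divisibility as ℕ∣
  import Data.Nat.DivMod as ℕ÷
  import Data.Nat.Properties as ℕₚ
  open import Data.Product.Base using (_×_; _,_)
  open import Data.Rational.Base using (ℚ; 0ℚ; 1ℚ; ½; _+_; _*_; _-_; -_; _/_)
  import Data.Rational.Properties as ℚₚ
  open import Data.Sum.Base using (_⊎_; inj₁; inj₂)
  open import Relation.Binary.PropositionalEquality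
  open import Relation.Nullary using (Dec; yes; no)
  import Tactic.RingSolver as RS
  open BracketCoefficients
  open BracketPolynomials
  open FiniteSums
  open Rationals
  open ≡-Reasoning

  ∂^≡ : ∀ i F n → ∂^ i F n ≡ ι (+ n) ^ i * F n
  ∂^≡ zero    F n = sym (ℚₚ.*-identityˡ (F n))
  ∂^≡ (suc i) F n = trans (cong (ι (+ n) *_) (∂^≡ i F n)) (sym (ℚₚ.*-assoc (ι (+ n)) (ι (+ n) ^ i) (F n)))

  -- H vanishes at rationals that are not integers, so the indicator in `V` is already contained in
  -- the value at n / b.
  V≡H : ∀ b .{{_ : NonZero b}} n → V b 𝓗-series n ≡ H (+ n / b)
  V≡H b n = go (b ℕ∣.∣? n)
    where
    go : (d : Dec (b ℕ∣.∣ n)) → δ d * H (ι (+ (n ℕ./ b))) ≡ H (+ n / b)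
    go (yes b∣n) = trans (ℚₚ.*-identityˡ (H (ι (+ (n ℕ./ b))))) (cong H (trans (sym (*d/d b (n ℕ./ b)))
      (cong (λ m → + m / b) (trans (ℕₚ.*-comm b (n ℕ./ b)) (ℕ÷.m/n*n≡m b∣n)))))
    go (no b∤n) = trans (ℚₚ.*-zeroˡ (H (ι (+ (n ℕ./ b))))) (sym (H-cases (+ n) b λ q n≡ → b∤n
      (ℕ∣.divides q (trans (ℤₚ.+-injective n≡) (ℕₚ.*-comm b q)))))

  H-negative : ∀ b .{{_ : NonZero b}} {z} → z ℤ.< 0ℤ → H (z / b) ≡ 0ℚ
  H-negative b {z} z<0 = H-cases z b λ n z≡ → ℤₚ.<⇒≱ z<0 (subst (0ℤ ℤ.≤_) (sym z≡) (ℤ.+≤+ z≤n))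

  square-abs : ∀ t → t ℤ.* t ≡ + (∣ t ∣ ℕ.* ∣ t ∣)
  square-abs (+ n)    = sym (ℤₚ.pos-* n n)
  square-abs -[1+ n ] = refl

  m≤m*m : ∀ m → m ℕ.≤ m ℕ.* m
  m≤m*m zero    = z≤n
  m≤m*m (suc m) = ℕₚ.m≤m*n (suc m) (suc m)

  square≡⇒≤ : ∀ {t n} → t ℤ.* t ≡ + n → ∣ t ∣ ℕ.≤ n
  square≡⇒≤ {t} eq = subst (∣ t ∣ ℕ.≤_) (ℤₚ.+-injective (trans (sym (square-abs t)) eq)) (m≤m*m ∣ t ∣)

  module _ (m : ℤ) (M : ℕ) where

    -- t² = N forces ∣t∣ ≤ N. In this way all coefficients of θ up to n become sums over one and the
    -- same range, and the sums can be interchanged.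
    θ-extend : ∀ {N n} → N ℕ.≤ n → θ 1 m M N ≡ ∑ [± n ] (λ t → δ (t ≡? m [mod M ]) * δ (t ℤ.* t ℤₚ.≟ + N) * ι t)
    θ-extend {N} {n} N≤n = trans (Σ±≡∑ N f) (∑-support ℤₚ._≟_ ([±]-unique N) ([±]-unique n)
      (λ {t} t∈ → inj₂ (∈-[±]⁺ n (ℕₚ.≤-trans (∈-[±]⁻ N t∈) N≤n) , same t))
      (λ {t} _ → outside t (∣ t ∣ ℕₚ.≤? N)))
      where
      f g : ℤ → ℚ
      f t = δ (t ≡? m [mod M ]) * δ (t ℤ.* t ℤₚ.≟ + N) * ι (t ℤ.^ 1)
      g t = δ (t ≡? m [mod M ]) * δ (t ℤ.* t ℤₚ.≟ + N) * ι t
      same : ∀ t → f t ≡ g t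
      same t = cong (λ s → δ (t ≡? m [mod M ]) * δ (t ℤ.* t ℤₚ.≟ + N) * ι s) (ℤₚ.*-identityʳ t)
      outside : ∀ t → Dec (∣ t ∣ ℕ.≤ N) → g t ≡ 0ℚ ⊎ (t ∈ [± N ] × f t ≡ g t)
      outside t (yes t≤N) = inj₂ (∈-[±]⁺ N t≤N , same t)
      outside t (no t≰N)  = inj₁ (trans (ℚₚ.*-assoc (δ (t ≡? m [mod M ])) _ (ι t)) (δ*-zero (t ≡? m [mod M ]) λ _ →
        δ-no-* (t ℤ.* t ℤₚ.≟ + N) (ι t) λ eq → t≰N (square≡⇒≤ {t} eq)))

    module _ (b : ℕ) .{{_ : NonZero b}} (n : ℕ) where

      h : ℤ → ℚ
      h t = H ((+ n ℤ.- t ℤ.* t) / b)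

      sq co : ℤ → ℚ
      sq t = ι (t ℤ.* t)
      co t = ι (+ n) - sq t

      -- For fixed t only a = n - t² contributes to the convolution. If t² > n there is no such a,
      -- and the right-hand side vanishes because H does at negative arguments.
      collapse : ∀ i j t → ∑ (upTo (suc n)) (λ a → δ (t ℤ.* t ℤₚ.≟ + (n ℕ.∸ a)) * (ι (+ a) ^ i * V b 𝓗-series a * ι (+ (n ℕ.∸ a)) ^ j))
        ≡ h t * (co t ^ i * sq t ^ j)
      collapse i j t = go (s ℕₚ.≤? n)
        where
        s = ∣ t ∣ ℕ.* ∣ t ∣
        F : ℕ → ℚ
        F a = ι (+ a) ^ i * V b 𝓗-series a * ι (+ (n ℕ.∸ a)) ^ j
        D : ∀ a → Dec (t ℤ.* t ≡ + (n ℕ.∸ a))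
        D a = t ℤ.* t ℤₚ.≟ + (n ℕ.∸ a)
        s≡ : ∀ {a} → t ℤ.* t ≡ + (n ℕ.∸ a) → s ≡ n ℕ.∸ a
        s≡ eq = ℤₚ.+-injective (trans (sym (square-abs t)) eq)
        go : Dec (s ℕ.≤ n) → ∑ (upTo (suc n)) (λ a → δ (D a) * F a) ≡ h t * (co t ^ i * sq t ^ j)
        go (no s≰n) = trans (∑-zero (upTo (suc n)) λ {a} _ → δ-no-* (D a) (F a) λ eq → s≰n (subst (ℕ._≤ n) (sym (s≡ {a} eq)) (ℕₚ.m∸n≤m n a)))
          (sym (trans (cong (_* (co t ^ i * sq t ^ j)) (H-negative b negative)) (ℚₚ.*-zeroˡ (co t ^ i * sq t ^ j))))
          where
          negative : + n ℤ.- t ℤ.* t ℤ.< 0ℤ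
          negative = subst (λ z → + n ℤ.- z ℤ.< 0ℤ) (sym (square-abs t))
            (subst (+ n ℤ.- + s ℤ.<_) (ℤₚ.+-inverseʳ (+ s)) (ℤₚ.+-monoˡ-< (ℤ.- + s) (ℤ.+<+ (ℕₚ.≰⇒> s≰n))))
        go (yes s≤n) = begin
          ∑ (upTo (suc n)) (λ a → δ (D a) * F a)
            ≡⟨ ∑-cong (upTo (suc n)) (λ {a} a∈ → cong (_* F a) (δ-cong (D a) (a ℕₚ.≟ a₀) (unique {a} (∈-upTo⁻′ a∈)) λ { refl → sym s≡t² })) ⟩
          ∑ (upTo (suc n)) (λ a → δ (a ℕₚ.≟ a₀) * F a)
            ≡⟨ ∑-δ F (ℕₚ._≟ a₀) (Uniqueₚ.upTo⁺ (suc n)) (∈-upTo⁺′ (ℕₚ.m∸n≤m n s)) ⟩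
          ι (+ a₀) ^ i * V b 𝓗-series a₀ * ι (+ (n ℕ.∸ a₀)) ^ j
            ≡⟨ cong₂ (λ x y → x ^ i * V b 𝓗-series a₀ * y ^ j) (trans (cong ι a₀≡) (ι-- (+ n) (t ℤ.* t))) (cong ι s≡t²) ⟩
          co t ^ i * V b 𝓗-series a₀ * sq t ^ j
            ≡⟨ cong (λ v → co t ^ i * v * sq t ^ j) (trans (V≡H b a₀) (cong (λ z → H (z / b)) a₀≡)) ⟩
          co t ^ i * h t * sq t ^ j
            ≡⟨ e (co t ^ i) (h t) (sq t ^ j) ⟩
          h t * (co t ^ i * sq t ^ j)
            ∎
          where
          a₀ = n ℕ.∸ s
          s≡t² : + (n ℕ.∸ a₀) ≡ t ℤ.* t
          s≡t² = trans (cong +_ (ℕₚ.m∸[m∸n]≡n s≤n)) (sym (square-abs t))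
          a₀≡ : + a₀ ≡ + n ℤ.- t ℤ.* t
          a₀≡ = trans (sym (trans (ℤₚ.m-n≡m⊖n n s) (ℤₚ.⊖-≥ s≤n))) (cong (λ z → + n ℤ.- z) (sym (square-abs t)))
          unique : ∀ {a} → a ℕ.≤ n → t ℤ.* t ≡ + (n ℕ.∸ a) → a ≡ a₀
          unique {a} a≤n eq = trans (sym (ℕₚ.m∸[m∸n]≡n a≤n)) (cong (n ℕ.∸_) (sym (s≡ {a} eq)))
          e : ∀ x y z → x * y * z ≡ y * (x * z)
          e = RS.solve-∀ ringℚ

      convolution : ∀ i j → (∂^ i (V b 𝓗-series) ⊛ ∂^ j (θ 1 m M)) n ≡ ∑ [± n ] (λ t → δ (t ≡? m [mod M ]) * (h t * ι t * (co t ^ i * sq t ^ j)))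
      convolution i j = begin
        (∂^ i F ⊛ ∂^ j (θ 1 m M)) n
          ≡⟨ Σ≡∑ n (λ a → ∂^ i F a * ∂^ j (θ 1 m M) (n ℕ.∸ a)) ⟩
        ∑ (upTo (suc n)) (λ a → ∂^ i F a * ∂^ j (θ 1 m M) (n ℕ.∸ a))
          ≡⟨ ∑-cong (upTo (suc n)) (λ {a} _ → trans (cong₂ _*_ (∂^≡ i F a) (trans (∂^≡ j (θ 1 m M) (n ℕ.∸ a)) (cong (ι (+ (n ℕ.∸ a)) ^ j *_) (θ-extend {n ℕ.∸ a} {n} (ℕₚ.m∸n≤m n a)))))
               (trans (e₁ (ι (+ a) ^ i * F a) (ι (+ (n ℕ.∸ a)) ^ j) (∑ [± n ] (g a))) (sym (∑-*ˡ (K a) [± n ] (g a))))) ⟩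
        ∑ (upTo (suc n)) (λ a → ∑ [± n ] λ t → K a * g a t)
          ≡⟨ ∑-swap (upTo (suc n)) [± n ] (λ a t → K a * g a t) ⟩
        ∑ [± n ] (λ t → ∑ (upTo (suc n)) λ a → K a * g a t)
          ≡⟨ ∑-cong [± n ] (λ {t} _ → trans (∑-cong (upTo (suc n)) λ {a} _ → e₂ (K a) (δ (t ≡? m [mod M ])) (δ (t ℤ.* t ℤₚ.≟ + (n ℕ.∸ a))) (ι t))
               (trans (∑-*ˡ (δ (t ≡? m [mod M ]) * ι t) (upTo (suc n)) (λ a → δ (t ℤ.* t ℤₚ.≟ + (n ℕ.∸ a)) * K a))
               (trans (cong (δ (t ≡? m [mod M ]) * ι t *_) (collapse i j t)) (e₃ (δ (t ≡? m [mod M ])) (ι t) (h t) (co t ^ i * sq t ^ j))))) ⟩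
        ∑ [± n ] (λ t → δ (t ≡? m [mod M ]) * (h t * ι t * (co t ^ i * sq t ^ j)))
          ∎
        where
        F = V b 𝓗-series
        K : ℕ → ℚ
        K a = ι (+ a) ^ i * F a * ι (+ (n ℕ.∸ a)) ^ j
        g : ℕ → ℤ → ℚ
        g a t = δ (t ≡? m [mod M ]) * δ (t ℤ.* t ℤₚ.≟ + (n ℕ.∸ a)) * ι t
        e₁ : ∀ x y z → x * (y * z) ≡ x * y * z
        e₁ = RS.solve-∀ ringℚ
        e₂ : ∀ k d d′ t → k * (d * d′ * t) ≡ d * t * (d′ * k)
        e₂ = RS.solve-∀ ringℚ
        e₃ : ∀ d t h x → d * t * (h * x) ≡ d * (h * t * x)
        e₃ = RS.solve-∀ ringℚ

      -- The part of α coming from the Rankin–Cohen bracket.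
      main : ℕ → ℚ
      main ν = ∑ [± n ] (λ t → δ (t ≡? m [mod M ]) * (h t * (ι t * (½ ^ suc (double ν) * W (sq t) (- co t) ν))))

      -- For the weights 3/2 and 1/2 + 1 both binomials have upper argument ν + 1/2. After
      -- interchange of sums, `bracket-sum` applies to each t, with the two powers of q d/dq turned
      -- into powers of n - t² and t².
      rankinCohen≡ : ∀ ν → rankinCohen (+ 3 / 2) (½ + ι (+ 1)) ν (V b 𝓗-series) (θ 1 m M) n ≡ C′ (suc (double ν)) ν * main ν
      rankinCohen≡ ν = begin
        rankinCohen (+ 3 / 2) (½ + ι (+ 1)) ν F (θ 1 m M) n
          ≡⟨ Σ-cong ν (λ {i} _ → trans (cong₂ (λ κ₁ κ₂ → ι (-1ℤ ℤ.^ i) * binomial κ₁ (ν ℕ.∸ i) * binomial κ₂ i * (∂^ i F ⊛ ∂^ (ν ℕ.∸ i) (θ 1 m M)) n)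
               (κ₁≡ (ι (+ ν))) (κ₂≡ (ι (+ ν)))) (cong (B i *_) (convolution i (ν ℕ.∸ i)))) ⟩
        Σ[0⋯ ν ] (λ i → B i * ∑ [± n ] λ t → δ (t ≡? m [mod M ]) * (h t * ι t * (co t ^ i * sq t ^ (ν ℕ.∸ i))))
          ≡⟨ trans (Σ≡∑ ν (λ i → B i * ∑ [± n ] λ t → δ (t ≡? m [mod M ]) * (h t * ι t * P i t))) (∑-cong (upTo (suc ν)) λ {i} _ → sym (∑-*ˡ (B i) [± n ] (λ t → δ (t ≡? m [mod M ]) * (h t * ι t * P i t)))) ⟩
        ∑ (upTo (suc ν)) (λ i → ∑ [± n ] λ t → B i * (δ (t ≡? m [mod M ]) * (h t * ι t * P i t)))
          ≡⟨ ∑-swap (upTo (suc ν)) [± n ] (λ i t → B i * (δ (t ≡? m [mod M ]) * (h t * ι t * P i t))) ⟩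
        ∑ [± n ] (λ t → ∑ (upTo (suc ν)) λ i → B i * (δ (t ≡? m [mod M ]) * (h t * ι t * P i t)))
          ≡⟨ ∑-cong [± n ] (λ {t} _ → per-t t) ⟩
        ∑ [± n ] (λ t → C′ (suc (double ν)) ν * (δ (t ≡? m [mod M ]) * (h t * (ι t * (½ ^ suc (double ν) * W (sq t) (- co t) ν)))))
          ≡⟨ ∑-*ˡ (C′ (suc (double ν)) ν) [± n ] (λ t → δ (t ≡? m [mod M ]) * (h t * (ι t * (½ ^ suc (double ν) * W (sq t) (- co t) ν)))) ⟩
        C′ (suc (double ν)) ν * main ν
          ∎
        where
        F = V b 𝓗-series
        B : ℕ → ℚ
        B i = ι (-1ℤ ℤ.^ i) * binomial (half ν) (ν ℕ.∸ i) * binomial (half ν) i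
        P : ℕ → ℤ → ℚ
        P i t = co t ^ i * sq t ^ (ν ℕ.∸ i)
        κ₁≡ : ∀ x → + 3 / 2 + x - 1ℚ ≡ ½ + x
        κ₁≡ = RS.solve-∀ ringℚ
        κ₂≡ : ∀ x → ½ + ι (+ 1) + x - 1ℚ ≡ ½ + x
        κ₂≡ = RS.solve-∀ ringℚ
        e₁ : ∀ b d k p → b * (d * (k * p)) ≡ d * k * (b * p)
        e₁ = RS.solve-∀ ringℚ
        e₂ : ∀ d h t p c w → d * (h * t) * (p * c * w) ≡ c * (d * (h * (t * (p * w))))
        e₂ = RS.solve-∀ ringℚ
        per-t : ∀ t → ∑ (upTo (suc ν)) (λ i → B i * (δ (t ≡? m [mod M ]) * (h t * ι t * P i t)))
          ≡ C′ (suc (double ν)) ν * (δ (t ≡? m [mod M ]) * (h t * (ι t * (½ ^ suc (double ν) * W (sq t) (- co t) ν))))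
        per-t t = begin
          ∑ (upTo (suc ν)) (λ i → B i * (d * (h t * ι t * P i t)))     ≡⟨ ∑-cong (upTo (suc ν)) (λ {i} _ → e₁ (B i) d (h t * ι t) (P i t)) ⟩
          ∑ (upTo (suc ν)) (λ i → d * (h t * ι t) * (B i * P i t))     ≡⟨ ∑-*ˡ (d * (h t * ι t)) (upTo (suc ν)) (λ i → B i * P i t) ⟩
          d * (h t * ι t) * ∑ (upTo (suc ν)) (λ i → B i * P i t)       ≡⟨ cong (d * (h t * ι t) *_) (trans (sym (Σ≡∑ ν (λ i → B i * P i t))) (bracket-sum (sq t) (co t) ν)) ⟩
          d * (h t * ι t) * (scalar ν * W (sq t) (- co t) ν)           ≡⟨ e₂ d (h t) (ι t) (½ ^ suc (double ν)) (C′ (suc (double ν)) ν) (W (sq t) (- co t) ν) ⟩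
          C′ (suc (double ν)) ν * (d * (h t * (ι t * (½ ^ suc (double ν) * W (sq t) (- co t) ν)))) ∎
          where
          d = δ (t ≡? m [mod M ])

      -- Both summands of γ contain the central binomial coefficient: the bracket through `scalar`,
      -- Λ by definition. It cancels against the normalisation of α.
      α≡ : ∀ ν → α (suc (double ν)) m M b n ≡ main ν + (b ^-½) * ½ ^ (1 ℕ.+ suc (double ν)) * Λ (suc (double ν)) m M b n
      α≡ ν = begin
        1/c * γ ℓ m M b n
          ≡⟨ cong (λ z → 1/c * (z + (b ^-½) * ½ ^ (1 ℕ.+ ℓ) * ι (+ central ℓ) * Λ ℓ m M b n))
               (trans (cong₂ (λ j f → rankinCohen (+ 3 / 2) (½ + ι (+ j)) f (V b 𝓗-series) (θ j m M) n) (odd% ν) (floor ν)) (rankinCohen≡ ν)) ⟩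
        1/c * (C′ ℓ ν * main ν + (b ^-½) * ½ ^ (1 ℕ.+ ℓ) * ι (+ central ℓ) * Λ ℓ m M b n)
          ≡⟨ cong (λ c → 1/c * (C′ ℓ c * main ν + (b ^-½) * ½ ^ (1 ℕ.+ ℓ) * ι (+ central ℓ) * Λ ℓ m M b n)) (sym (floor ν)) ⟩
        1/c * (ι (+ central ℓ) * main ν + (b ^-½) * ½ ^ (1 ℕ.+ ℓ) * ι (+ central ℓ) * Λ ℓ m M b n)
          ≡⟨ e 1/c (ι (+ central ℓ)) (main ν) ((b ^-½) * ½ ^ (1 ℕ.+ ℓ)) (Λ ℓ m M b n) ⟩
        ι (+ central ℓ) * 1/c * (main ν + (b ^-½) * ½ ^ (1 ℕ.+ ℓ) * Λ ℓ m M b n)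
          ≡⟨ cong (_* (main ν + (b ^-½) * ½ ^ (1 ℕ.+ ℓ) * Λ ℓ m M b n)) (ι*/ (+ 1) (central ℓ) {{central≢0 ℓ}}) ⟩
        1ℚ * (main ν + (b ^-½) * ½ ^ (1 ℕ.+ ℓ) * Λ ℓ m M b n)
          ≡⟨ ℚₚ.*-identityˡ _ ⟩
        main ν + (b ^-½) * ½ ^ (1 ℕ.+ ℓ) * Λ ℓ m M b n
          ∎
        where
        ℓ = suc (double ν)
        1/c = _/_ (+ 1) (central ℓ) {{central≢0 ℓ}}
        odd% : ∀ ν → suc (double ν) ℕ.% 2 ≡ 1
        odd% zero    = refl
        odd% (suc ν) = odd% ν
        floor : ∀ ν → ⌊ suc (double ν) /2⌋ ≡ ν
        floor zero    = refl
        floor (suc ν) = cong suc (floor ν)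
        e : ∀ i c x d y → i * (c * x + d * c * y) ≡ c * i * (x + d * y)
        e = RS.solve-∀ ringℚ

      -- For each t the sum over μ is `power-expansion` with x = t², and the remaining factor t
      -- makes the power odd.
      main-sum : ∀ κ → Σ[0⋯ κ ] (λ μ → ½ ^ (2 ℕ.* μ) * T (suc (double κ)) μ * main (κ ℕ.∸ μ) * ι (+ n) ^ μ)
        ≡ ∑ [± n ] (λ t → δ (t ≡? m [mod M ]) * (h t * ι (t ℤ.^ suc (double κ))))
      main-sum κ = begin
        Σ[0⋯ κ ] (λ μ → c μ * main (κ ℕ.∸ μ) * ι (+ n) ^ μ)
          ≡⟨ trans (Σ≡∑ κ (λ μ → c μ * main (κ ℕ.∸ μ) * ι (+ n) ^ μ)) (∑-cong (upTo (suc κ)) λ {μ} _ → trans (e₁ (c μ) (main (κ ℕ.∸ μ)) (ι (+ n) ^ μ)) (sym (∑-*ˡ (c μ * ι (+ n) ^ μ) [± n ] (g μ)))) ⟩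
        ∑ (upTo (suc κ)) (λ μ → ∑ [± n ] λ t → c μ * ι (+ n) ^ μ * g μ t)
          ≡⟨ ∑-swap (upTo (suc κ)) [± n ] (λ μ t → c μ * ι (+ n) ^ μ * g μ t) ⟩
        ∑ [± n ] (λ t → ∑ (upTo (suc κ)) λ μ → c μ * ι (+ n) ^ μ * g μ t)
          ≡⟨ ∑-cong [± n ] (λ {t} _ → per-t t) ⟩
        ∑ [± n ] (λ t → δ (t ≡? m [mod M ]) * (h t * ι (t ℤ.^ suc (double κ))))
          ∎
        where
        c : ℕ → ℚ
        c μ = ½ ^ (2 ℕ.* μ) * T (suc (double κ)) μ
        w : ℕ → ℤ → ℚ
        w μ t = ½ ^ suc (double (κ ℕ.∸ μ)) * W (sq t) (- co t) (κ ℕ.∸ μ)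
        g : ℕ → ℤ → ℚ
        g μ t = δ (t ≡? m [mod M ]) * (h t * (ι t * w μ t))
        e₁ : ∀ x y z → x * y * z ≡ x * z * y
        e₁ = RS.solve-∀ ringℚ
        e₂ : ∀ c n d h t w → c * n * (d * (h * (t * w))) ≡ d * (h * t) * (c * w * n)
        e₂ = RS.solve-∀ ringℚ
        e₃ : ∀ d h t x → d * (h * t) * x ≡ d * (h * (t * x))
        e₃ = RS.solve-∀ ringℚ
        power : ∀ t κ → ι t * sq t ^ κ ≡ ι (t ℤ.^ suc (double κ))
        power t zero    = trans (ℚₚ.*-identityʳ (ι t)) (cong ι (sym (ℤₚ.*-identityʳ t)))
        power t (suc κ) = trans (e₄ (ι t) (sq t) (sq t ^ κ)) (trans (cong₂ _*_ (ι-* t t) (power t κ))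
          (trans (ℚₚ.*-assoc (ι t) (ι t) (ι (t ℤ.^ suc (double κ)))) (trans (cong (ι t *_) (sym (ι-* t (t ℤ.^ suc (double κ))))) (sym (ι-* t (t ℤ.^ suc (suc (double κ))))))))
          where
          e₄ : ∀ t s p → t * (s * p) ≡ s * (t * p)
          e₄ = RS.solve-∀ ringℚ
        per-t : ∀ t → ∑ (upTo (suc κ)) (λ μ → c μ * ι (+ n) ^ μ * g μ t) ≡ δ (t ≡? m [mod M ]) * (h t * ι (t ℤ.^ suc (double κ)))
        per-t t = begin
          ∑ (upTo (suc κ)) (λ μ → c μ * ι (+ n) ^ μ * g μ t)
            ≡⟨ ∑-cong (upTo (suc κ)) (λ {μ} _ → e₂ (c μ) (ι (+ n) ^ μ) d (h t) (ι t) (w μ t)) ⟩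
          ∑ (upTo (suc κ)) (λ μ → d * (h t * ι t) * (c μ * w μ t * ι (+ n) ^ μ))
            ≡⟨ ∑-*ˡ (d * (h t * ι t)) (upTo (suc κ)) (λ μ → c μ * w μ t * ι (+ n) ^ μ) ⟩
          d * (h t * ι t) * ∑ (upTo (suc κ)) (λ μ → c μ * w μ t * ι (+ n) ^ μ)
            ≡⟨ cong (d * (h t * ι t) *_) (trans (sym (Σ≡∑ κ (λ μ → c μ * w μ t * ι (+ n) ^ μ))) (power-expansion κ (sq t) (ι (+ n)))) ⟩
          d * (h t * ι t) * sq t ^ κ
            ≡⟨ e₃ d (h t) (ι t) (sq t ^ κ) ⟩
          d * (h t * (ι t * sq t ^ κ))
            ≡⟨ cong (λ z → d * (h t * z)) (power t κ) ⟩
          d * (h t * ι (t ℤ.^ suc (double κ)))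
            ∎
          where
          d = δ (t ≡? m [mod M ])

-- Solutions of t² - bs² = n for b = c²

module UnitSums where

  open import Data.Integer.Base as ℤ using (ℤ; +_; -[1+_]; 1ℤ; -1ℤ)
  import Data.Integer.Properties as ℤₚ
  open import Data.Integer.Divisibility.Signed
  import Data.Integer.Tactic.RingSolver as ℤRing
  open import Data.List.Base using (List; []; _∷_; _++_; map; upTo; cartesianProduct)
  open import Data.List.Membership.Propositional using (_∈_)
  open import Data.List.Membership.Propositional.Properties using (∈-cartesianProduct⁺; ∈-cartesianProduct⁻)
  open import Data.List.Relation.Unary.Unique.Propositional using (Unique)
  import Data.List.Relation.Unary.Unique.Propositional.Properties as Uniqueₚ
  open import Data.Nat.Base as ℕ using (ℕ; zero; suc; NonZero; z≤n; s≤s)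
  import Data.Nat.Divisibility as ℕ∣
  import Data.Nat.DivMod as ℕ÷
  import Data.Nat.Properties as ℕₚ
  open import Data.Nat.Primality using (Prime; prime⇒nonZero)
  open import Data.Product.Base using (∃-syntax; _×_; _,_; proj₁; proj₂)
  open import Data.Product.Properties using (≡-dec)
  open import Data.Rational.Base using (ℚ; 0ℚ; 1ℚ; ½; _+_; _*_; _-_; -_)
  import Data.Rational.Properties as ℚₚ
  open import Data.Sum.Base as Sum using (_⊎_; inj₁; inj₂)
  open import Relation.Binary.PropositionalEquality
  open import Relation.Nullary using (¬_; Dec; yes; no; contradiction)
  open import Relation.Nullary.Decidable using (_×-dec_)
  import Tactic.RingSolver as RS
  open FiniteSums
  open PrimeModulus
  open Rationals

  ∑-++ : ∀ {A : Set} (xs ys : List A) f → ∑ (xs ++ ys) f ≡ ∑ xs f + ∑ ys f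
  ∑-++ []       ys f = sym (ℚₚ.+-identityˡ (∑ ys f))
  ∑-++ (x ∷ xs) ys f = trans (cong (λ z → f x + z) (∑-++ xs ys f)) (sym (ℚₚ.+-assoc (f x) (∑ xs f) (∑ ys f)))

  ∑-cartesianProduct : ∀ {A B : Set} (xs : List A) (ys : List B) (f : A × B → ℚ) →
    ∑ (cartesianProduct xs ys) f ≡ ∑ xs (λ x → ∑ ys (λ y → f (x , y)))
  ∑-cartesianProduct []       ys f = refl
  ∑-cartesianProduct (x ∷ xs) ys f = trans (∑-++ (map (x ,_) ys) (cartesianProduct xs ys) f)
    (cong₂ _+_ (∑-map (x ,_) ys f) (∑-cartesianProduct xs ys f))

  square : ℕ → List (ℕ × ℕ)
  square n = cartesianProduct (upTo (suc n)) (upTo (suc n))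

  square-unique : ∀ n → Unique (square n)
  square-unique n = Uniqueₚ.cartesianProduct⁺ (Uniqueₚ.upTo⁺ (suc n)) (Uniqueₚ.upTo⁺ (suc n))

  ∈-square⁺ : ∀ {n t s} → t ℕ.≤ n → s ℕ.≤ n → (t , s) ∈ square n
  ∈-square⁺ t≤n s≤n = ∈-cartesianProduct⁺ (∈-upTo⁺′ t≤n) (∈-upTo⁺′ s≤n)

  ∈-square⁻ : ∀ {n t s} → (t , s) ∈ square n → t ℕ.≤ n × s ℕ.≤ n
  ∈-square⁻ {n} ts∈ = let (t∈ , s∈) = ∈-cartesianProduct⁻ (upTo (suc n)) (upTo (suc n)) ts∈ in ∈-upTo⁻′ t∈ , ∈-upTo⁻′ s∈

  _≟²_ : (x y : ℕ × ℕ) → Dec (x ≡ y)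
  _≟²_ = ≡-dec ℕₚ._≟_ ℕₚ._≟_

  weight : ℕ → ℚ
  weight zero    = ½
  weight (suc _) = 1ℚ

  -- If p ∤ u, each factor p of p^r has to be taken from w, until u w = 1 remains.
  factor-of-power : ∀ {p} → Prime p → ∀ r u w → u ℕ.* w ≡ p ℕ.^ r → ¬ p ℕ∣.∣ u → u ≡ 1
  factor-of-power pp zero u w uw≡ p∤u = ℕₚ.m*n≡1⇒m≡1 u w uw≡
  factor-of-power {p} pp (suc r) u w uw≡ p∤u = go (Sum.[ (λ p∣u → contradiction p∣u p∤u) , (λ p∣w → p∣w) ]
      (euclidsLemma u w pp (ℕ∣.divides (p ℕ.^ r) (trans uw≡ (ℕₚ.*-comm p (p ℕ.^ r))))))
    where
    open import Data.Nat.Primality using (euclidsLemma)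
    go : p ℕ∣.∣ w → u ≡ 1
    go (ℕ∣.divides q refl) = factor-of-power pp r u q (ℕₚ.*-cancelʳ-≡ (u ℕ.* q) (p ℕ.^ r) p {{prime⇒nonZero pp}}
      (trans (ℕₚ.*-assoc u q p) (trans uw≡ (ℕₚ.*-comm p (p ℕ.^ r))))) p∤u

  module _ (c : ℕ) .{{c≢0 : NonZero c}} (ℓ : ℕ) where

    private
      b : ℕ
      b = c ℕ.* c

    Solution : ℕ → ℕ × ℕ → Set
    Solution n (t , s) = 1 ℕ.≤ t × + t ℤ.* + t ℤ.- + b ℤ.* (+ s ℤ.* + s) ≡ + n

    solution? : ∀ n x → Dec (Solution n x)
    solution? n (t , s) = 1 ℕₚ.≤? t ×-dec (+ t ℤ.* + t ℤ.- + b ℤ.* (+ s ℤ.* + s) ℤₚ.≟ + n)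

    -- Since b = c², this is an integral factor of t² - bs² = (t - cs)(t + cs).
    value : ℕ × ℕ → ℤ
    value (t , s) = + t ℤ.- + c ℤ.* + s

    term : ℤ → ℕ → ℕ × ℕ → ℚ
    term e n x@(t , s) = δ (solution? n x) * (δ (+ t ≡? e [mod 4 ]) * (weight s * ι (value x ℤ.^ suc ℓ)))

    total : ℤ → ℕ → ℚ
    total e n = ∑ (square n) (term e n)

    Λ≡total : ∀ m n .{{_ : NonZero n}} → Λ ℓ m 4 b n ≡ ι (1ℤ ℤ.^ ℓ) * total (1ℤ ℤ.* m) n + ι (-1ℤ ℤ.^ ℓ) * total (-1ℤ ℤ.* m) n
    -- Unfolding a sum over s once makes weight disappear, so the two weights need not be compared.
    Λ≡total m n@(suc _) = cong₂ (λ x y → ι (1ℤ ℤ.^ ℓ) * x + ι (-1ℤ ℤ.^ ℓ) * y) (collect (1ℤ ℤ.* m)) (collect (-1ℤ ℤ.* m))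
      where
      defsTerm : ℤ → ℕ → ℕ → ℚ
      defsTerm e t s = δ (1 ℕₚ.≤? t) * δ (+ t ℤ.* + t ℤ.- + b ℤ.* (+ s ℤ.* + s) ℤₚ.≟ + n) * δ (+ t ≡? e [mod 4 ])
        * (weight s * ι ((+ t ℤ.- + (√ b) ℤ.* + s) ℤ.^ suc ℓ))
      term≡ : ∀ e t s → defsTerm e t s ≡ term e n (t , s)
      term≡ e t s = trans (cong (λ r → δ (1 ℕₚ.≤? t) * δ (+ t ℤ.* + t ℤ.- + b ℤ.* (+ s ℤ.* + s) ℤₚ.≟ + n) * δ (+ t ≡? e [mod 4 ])
            * (weight s * ι ((+ t ℤ.- + r ℤ.* + s) ℤ.^ suc ℓ))) (√-square c))
        (trans (ℚₚ.*-assoc (δ (1 ℕₚ.≤? t) * δ (+ t ℤ.* + t ℤ.- + b ℤ.* (+ s ℤ.* + s) ℤₚ.≟ + n)) (δ (+ t ≡? e [mod 4 ])) _)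
          (cong (_* (δ (+ t ≡? e [mod 4 ]) * (weight s * ι (value (t , s) ℤ.^ suc ℓ))))
            (δ-× (1 ℕₚ.≤? t) (+ t ℤ.* + t ℤ.- + b ℤ.* (+ s ℤ.* + s) ℤₚ.≟ + n))))
        where
        δ-× : ∀ {P R : Set} (P? : Dec P) (R? : Dec R) → δ P? * δ R? ≡ δ (P? ×-dec R?)
        δ-× (yes p) R? = trans (ℚₚ.*-identityˡ (δ R?)) (δ-cong R? (yes p ×-dec R?) (p ,_) proj₂)
        δ-× (no ¬p) R? = trans (ℚₚ.*-zeroˡ (δ R?)) (sym (δ-no (no ¬p ×-dec R?) λ (p , _) → ¬p p))
      collect : ∀ e → Σ[0⋯ n ] (λ t → Σ[0⋯ n ] (λ s → defsTerm e t s)) ≡ total e n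
      collect e = trans (Σ≡∑ n (λ t → Σ[0⋯ n ] (defsTerm e t))) (trans (∑-cong (upTo (suc n)) λ {t} _ → trans (Σ≡∑ n (defsTerm e t)) (∑-cong (upTo (suc n)) λ {s} _ → term≡ e t s))
        (sym (∑-cartesianProduct (upTo (suc n)) (upTo (suc n)) (term e n))))

    module _ {p : ℕ} (pp : Prime p) (odd : ¬ + p ∣ + 2) (p∤c : ¬ + p ∣ + c) where

      private instance
        p≢0 : NonZero p
        p≢0 = prime⇒nonZero pp

      nat∣ : ∀ {m} → p ℕ∣.∣ m → + p ∣ + m
      nat∣ {m} = ∣ᵤ⇒∣ {+ p} {+ m}

      Divisible : ℕ × ℕ → Set
      Divisible (t , s) = p ℕ∣.∣ t × p ℕ∣.∣ s

      divisible? : ∀ x → Dec (Divisible x)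
      divisible? (t , s) = p ℕ∣.∣? t ×-dec p ℕ∣.∣? s

      conjugate : ℕ × ℕ → ℕ
      conjugate (t , s) = t ℕ.+ c ℕ.* s

      conjugate≡ : ∀ t s → + conjugate (t , s) ≡ + t ℤ.+ + c ℤ.* + s
      conjugate≡ t s = trans (ℤₚ.pos-+ t (c ℕ.* s)) (cong (λ z → + t ℤ.+ z) (ℤₚ.pos-* c s))

      norm : ∀ t s → value (t , s) ℤ.* + conjugate (t , s) ≡ + t ℤ.* + t ℤ.- + b ℤ.* (+ s ℤ.* + s)
      norm t s = trans (cong (value (t , s) ℤ.*_) (conjugate≡ t s)) (trans (e (+ t) (+ c) (+ s)) (cong (λ z → + t ℤ.* + t ℤ.- z ℤ.* (+ s ℤ.* + s)) (sym (ℤₚ.pos-* c c))))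
        where
        e : ∀ t c s → (t ℤ.- c ℤ.* s) ℤ.* (t ℤ.+ c ℤ.* s) ≡ t ℤ.* t ℤ.- c ℤ.* c ℤ.* (s ℤ.* s)
        e = ℤRing.solve-∀

      -- A solution is either divisible by p or the trivial one with t - cs = 1.
      value-nat : ∀ {n x} → Solution (suc n) x → ∃[ u ] (value x ≡ + u × u ℕ.* conjugate x ≡ suc n)
      value-nat {n} {t , s} (1≤t , eq) = go (value (t , s)) refl
        where
        go : ∀ v → v ≡ value (t , s) → ∃[ u ] (value (t , s) ≡ + u × u ℕ.* conjugate (t , s) ≡ suc n)
        go (+ u) v≡ = u , sym v≡ , ℤₚ.+-injective (trans (ℤₚ.pos-* u (conjugate (t , s))) (trans (cong (ℤ._* + conjugate (t , s)) v≡) (trans (norm t s) eq)))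
        go -[1+ u ] v≡ = contradiction (trans (cong (ℤ._* + conjugate (t , s)) v≡) (trans (norm t s) eq)) (negative t 1≤t)
          where
          negative : ∀ t → 1 ℕ.≤ t → -[1+ u ] ℤ.* + conjugate (t , s) ≢ + suc n
          negative (suc t) _ ()

      -- Write p^r = uw with u = t - cs ≤ w = t + cs. If p ∤ u, then u = 1. If p divides u but not
      -- w, then w = 1 and u ≤ w gives u = 1, a contradiction. If p divides both, it divides u + w =
      -- 2t and w - u = 2cs, hence t and s.
      trivial-or-divisible : ∀ {n r x} → suc n ≡ p ℕ.^ r → suc n ≢ 1 → Solution (suc n) x → (value x ≡ 1ℤ × ¬ Divisible x) ⊎ Divisible x
      trivial-or-divisible {n} {r} {x@(t , s)} n≡ n≢1 sol@(1≤t , _) = go (p ℕ∣.∣? u) (p ℕ∣.∣? w)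
        where
        u = proj₁ (value-nat {n} {x} sol)
        v≡ = proj₁ (proj₂ (value-nat {n} {x} sol))
        uw≡ = trans (proj₂ (proj₂ (value-nat {n} {x} sol))) n≡
        w = conjugate x
        divides-difference : Divisible x → p ℕ∣.∣ u
        divides-difference (p∣t , p∣s) = ∣⇒∣ᵤ (subst (+ p ∣_) v≡ (∣m∣n⇒∣m-n (nat∣ p∣t) (∣n⇒∣m*n (+ c) (nat∣ p∣s))))
        double-t : value x ℤ.+ + w ≡ + 2 ℤ.* + t
        double-t = trans (cong (λ z → value x ℤ.+ z) (conjugate≡ t s)) (e (+ t) (+ c ℤ.* + s))
          where
          e : ∀ t y → (t ℤ.- y) ℤ.+ (t ℤ.+ y) ≡ + 2 ℤ.* t
          e = ℤRing.solve-∀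
        double-s : + w ℤ.- value x ≡ + 2 ℤ.* + c ℤ.* + s
        double-s = trans (cong (ℤ._- value x) (conjugate≡ t s)) (e (+ t) (+ c) (+ s))
          where
          e : ∀ t c s → (t ℤ.+ c ℤ.* s) ℤ.- (t ℤ.- c ℤ.* s) ≡ + 2 ℤ.* c ℤ.* s
          e = ℤRing.solve-∀
        u∣v : p ℕ∣.∣ u → + p ∣ value x
        u∣v p∣u = subst (+ p ∣_) (sym v≡) (nat∣ p∣u)
        u≤w : u ℕ.≤ w
        u≤w = ℤₚ.drop‿+≤+ (subst₂ ℤ._≤_ v≡ (sym (conjugate≡ t s)) (ℤₚ.≤-trans (ℤₚ.i-j≤i (+ t) (+ c ℤ.* + s) {{cs≥0}}) (ℤₚ.i≤i+j (+ t) (+ c ℤ.* + s) {{cs≥0}})))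
          where
          cs≥0 : ℤ.NonNegative (+ c ℤ.* + s)
          cs≥0 = subst ℤ.NonNegative (ℤₚ.pos-* c s) _
        go : Dec (p ℕ∣.∣ u) → Dec (p ℕ∣.∣ w) → (value x ≡ 1ℤ × ¬ Divisible x) ⊎ Divisible x
        go (no p∤u) _ = inj₁ (trans v≡ (cong +_ (factor-of-power pp r u w uw≡ p∤u)) , λ d → p∤u (divides-difference d))
        go (yes p∣u) (no p∤w) = contradiction (ℕₚ.≤-antisym (subst (u ℕ.≤_) w≡1 u≤w) (0<u u uw≡)) u≢1
          where
          w≡1 : w ≡ 1
          w≡1 = factor-of-power pp r w u (trans (ℕₚ.*-comm w u) uw≡) p∤w
          0<u : ∀ u → u ℕ.* w ≡ p ℕ.^ r → 1 ℕ.≤ u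
          0<u zero 0≡ = contradiction (sym 0≡) (ℕ.≢-nonZero⁻¹ (p ℕ.^ r) {{ℕₚ.m^n≢0 p r}})
          0<u (suc u) _ = s≤s z≤n
          u≢1 : u ≢ 1
          u≢1 u≡1 = p∤1 pp (nat∣ (subst (p ℕ∣.∣_) u≡1 p∣u))
        go (yes p∣u) (yes p∣w) = inj₂
          ( ∣⇒∣ᵤ (cancel-∣ pp {+ 2} (+ t) odd (∣-≡ double-t (∣m∣n⇒∣m+n (u∣v p∣u) (nat∣ p∣w))))
          , ∣⇒∣ᵤ (cancel-∣ pp {+ 2 ℤ.* + c} (+ s) (euclid-contra pp {+ 2} {+ c} odd p∤c) (∣-≡ double-s (∣m∣n⇒∣m-n (nat∣ p∣w) (u∣v p∣u)))) )

      module _ {n r : ℕ} (n≡ : suc n ≡ p ℕ.^ r) (n≢1 : suc n ≢ 1) {t₀ s₀ : ℕ}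
               (t₀≡ : + 2 ℤ.* + t₀ ≡ + suc n ℤ.+ 1ℤ) (s₀≡ : + 2 ℤ.* + c ℤ.* + s₀ ≡ + suc n ℤ.- 1ℤ) where

        private
          x₀ : ℕ × ℕ
          x₀ = t₀ , s₀

          trivial-value : value x₀ ≡ 1ℤ
          trivial-value = ℤₚ.*-cancelˡ-≡ (+ 2) (value x₀) 1ℤ (trans (e₁ (+ t₀) (+ c) (+ s₀)) (trans (cong₂ ℤ._-_ t₀≡ s₀≡) (e₂ (+ suc n))))
            where
            e₁ : ∀ t c s → + 2 ℤ.* (t ℤ.- c ℤ.* s) ≡ + 2 ℤ.* t ℤ.- + 2 ℤ.* c ℤ.* s
            e₁ = ℤRing.solve-∀
            e₂ : ∀ n → (n ℤ.+ 1ℤ) ℤ.- (n ℤ.- 1ℤ) ≡ + 2 ℤ.* 1ℤ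
            e₂ = ℤRing.solve-∀

          trivial-conjugate : + conjugate x₀ ≡ + suc n
          trivial-conjugate = ℤₚ.*-cancelˡ-≡ (+ 2) (+ conjugate x₀) (+ suc n) (trans (cong (+ 2 ℤ.*_) (conjugate≡ t₀ s₀))
            (trans (e₁ (+ t₀) (+ c) (+ s₀)) (trans (cong₂ ℤ._+_ t₀≡ s₀≡) (e₂ (+ suc n)))))
            where
            e₁ : ∀ t c s → + 2 ℤ.* (t ℤ.+ c ℤ.* s) ≡ + 2 ℤ.* t ℤ.+ + 2 ℤ.* c ℤ.* s
            e₁ = ℤRing.solve-∀
            e₂ : ∀ n → (n ℤ.+ 1ℤ) ℤ.+ (n ℤ.- 1ℤ) ≡ + 2 ℤ.* n
            e₂ = ℤRing.solve-∀

          1≤t₀ : 1 ℕ.≤ t₀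
          1≤t₀ = positive t₀ t₀≡
            where
            positive : ∀ t → + 2 ℤ.* + t ≡ + suc n ℤ.+ 1ℤ → 1 ℕ.≤ t
            positive zero ()
            positive (suc t) _ = s≤s z≤n

          trivial-solution : Solution (suc n) x₀
          trivial-solution = 1≤t₀ , trans (sym (norm t₀ s₀)) (trans (cong₂ ℤ._*_ trivial-value trivial-conjugate) (ℤₚ.*-identityˡ (+ suc n)))

          trivial-indivisible : ¬ Divisible x₀
          trivial-indivisible (p∣t , p∣s) = p∤1 pp (subst (+ p ∣_) trivial-value (∣m∣n⇒∣m-n (nat∣ p∣t) (∣n⇒∣m*n (+ c) (nat∣ p∣s))))

          trivial-weight : weight s₀ ≡ 1ℚ
          trivial-weight = positive s₀ s₀≡
            where
            positive : ∀ s → + 2 ℤ.* + c ℤ.* + s ≡ + suc n ℤ.- 1ℤ → weight s ≡ 1ℚ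
            positive zero eq = contradiction (cong suc (ℤₚ.+-injective (trans (sym eq) (ℤₚ.*-zeroʳ (+ 2 ℤ.* + c))))) n≢1
            positive (suc s) _ = refl

          trivial-unique : ∀ {x} → Solution (suc n) x → value x ≡ 1ℤ → x ≡ x₀
          trivial-unique {x@(t , s)} sol v≡1 = cong₂ _,_
              (ℤₚ.+-injective (ℤₚ.*-cancelˡ-≡ (+ 2) (+ t) (+ t₀) (trans (e₁ (+ t) (+ c) (+ s)) (trans (cong₂ ℤ._+_ v≡1 w≡) (trans (ℤₚ.+-comm 1ℤ (+ suc n)) (sym t₀≡))))))
              (ℤₚ.+-injective (ℤₚ.*-cancelˡ-≡ (+ 2 ℤ.* + c) (+ s) (+ s₀) {{ℤₚ.i*j≢0 (+ 2) (+ c)}}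
                (trans (e₂ (+ t) (+ c) (+ s)) (trans (cong₂ ℤ._-_ w≡ v≡1) (sym s₀≡)))))
            where
            e₁ : ∀ t c s → + 2 ℤ.* t ≡ (t ℤ.- c ℤ.* s) ℤ.+ (t ℤ.+ c ℤ.* s)
            e₁ = ℤRing.solve-∀
            e₂ : ∀ t c s → + 2 ℤ.* c ℤ.* s ≡ (t ℤ.+ c ℤ.* s) ℤ.- (t ℤ.- c ℤ.* s)
            e₂ = ℤRing.solve-∀
            w≡ : + t ℤ.+ + c ℤ.* + s ≡ + suc n
            w≡ = trans (sym (conjugate≡ t s)) (trans (sym (ℤₚ.*-identityˡ (+ conjugate x))) (trans (cong (ℤ._* + conjugate x) (sym v≡1)) (trans (norm t s) (proj₂ sol))))

          x₀∈ : x₀ ∈ square (suc n)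
          x₀∈ = ∈-square⁺ (ℕₚ.≤-trans (ℕₚ.m≤m+n t₀ (c ℕ.* s₀)) w≤) (ℕₚ.≤-trans (ℕₚ.m≤n*m s₀ c) (ℕₚ.≤-trans (ℕₚ.m≤n+m (c ℕ.* s₀) t₀) w≤))
            where
            w≤ : conjugate x₀ ℕ.≤ suc n
            w≤ = ℕₚ.≤-reflexive (ℤₚ.+-injective trivial-conjugate)

        term-split : ∀ e x → term e (suc n) x ≡ δ (x ≟² x₀) * δ (+ t₀ ≡? e [mod 4 ]) + δ (divisible? x) * term e (suc n) x
        term-split e x@(t , s) = go (solution? (suc n) x) refl
          where
          body = δ (+ t ≡? e [mod 4 ]) * (weight s * ι (value x ℤ.^ suc ℓ))
          e₀ : ∀ k d → 0ℚ ≡ 0ℚ * k + d * 0ℚ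
          e₀ = RS.solve-∀ ringℚ
          e₁ : ∀ k y → k ≡ 1ℚ * k + 0ℚ * y
          e₁ = RS.solve-∀ ringℚ
          e₂ : ∀ k y → y ≡ 0ℚ * k + 1ℚ * y
          e₂ = RS.solve-∀ ringℚ
          K = δ (+ t₀ ≡? e [mod 4 ])
          go : (S : Dec (Solution (suc n) x)) → δ S * body ≡ term e (suc n) x → term e (suc n) x ≡ δ (x ≟² x₀) * K + δ (divisible? x) * term e (suc n) x
          go (no ¬S) eq = trans term≡0 (trans (e₀ K (δ (divisible? x))) (cong₂ (λ a y → a * K + δ (divisible? x) * y)
              (sym (δ-no (x ≟² x₀) λ x≡ → ¬S (subst (Solution (suc n)) (sym x≡) trivial-solution))) (sym term≡0)))
            where
            term≡0 : term e (suc n) x ≡ 0ℚ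
            term≡0 = δ-no-* (solution? (suc n) x) body ¬S
          go (yes S) _ with trivial-or-divisible {n} {r} {x} n≡ n≢1 S
          ... | inj₂ d = trans (e₂ K (term e (suc n) x)) (cong₂ (λ a a′ → a * K + a′ * term e (suc n) x)
                  (sym (δ-no (x ≟² x₀) λ x≡ → trivial-indivisible (subst Divisible x≡ d))) (sym (δ-yes (divisible? x) d)))
          ... | inj₁ (v≡1 , ¬d) = trans (trivial-term (trivial-unique S v≡1)) (trans (e₁ K (term e (suc n) x)) (cong₂ (λ a a′ → a * K + a′ * term e (suc n) x)
                  (sym (δ-yes (x ≟² x₀) (trivial-unique S v≡1))) (sym (δ-no (divisible? x) ¬d))))
            where
            trivial-term : x ≡ x₀ → term e (suc n) x ≡ K
            trivial-term refl = trans (δ-yes-* (solution? (suc n) x₀) _ trivial-solution)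
              (trans (cong (λ z → K * z) (cong₂ _*_ trivial-weight (cong ι (trans (cong (ℤ._^ suc ℓ) trivial-value) (ℤₚ.^-zeroˡ (suc ℓ)))))) (ℚₚ.*-identityʳ K))

        -- The trivial solution has s₀ > 0, as `suc n` is not 1, so its weight is 1. Its value is 1
        -- too, and only the residue condition on t₀ is left of its term.
        total-split : ∀ e → total e (suc n) ≡ δ (+ t₀ ≡? e [mod 4 ]) + ∑ (square (suc n)) (λ x → δ (divisible? x) * term e (suc n) x)
        total-split e = trans (∑-cong (square (suc n)) λ {x} _ → term-split e x)
          (trans (∑-+ (square (suc n)) (λ x → δ (x ≟² x₀) * K) (λ x → δ (divisible? x) * term e (suc n) x))
            (cong (_+ ∑ (square (suc n)) (λ x → δ (divisible? x) * term e (suc n) x)) (∑-δ (λ _ → K) (_≟² x₀) (square-unique (suc n)) x₀∈)))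
          where
          K = δ (+ t₀ ≡? e [mod 4 ])

      solution-bounded : ∀ {n x} → Solution (suc n) x → x ∈ square (suc n)
      solution-bounded {n} {x@(t , s)} sol = ∈-square⁺ (ℕₚ.≤-trans (ℕₚ.m≤m+n t (c ℕ.* s)) w≤)
          (ℕₚ.≤-trans (ℕₚ.m≤n*m s c) (ℕₚ.≤-trans (ℕₚ.m≤n+m (c ℕ.* s) t) w≤))
        where
        bound : ∀ u → u ℕ.* conjugate x ≡ suc n → conjugate x ℕ.≤ suc n
        bound (suc u) eq = subst (conjugate x ℕ.≤_) eq (ℕₚ.m≤m+n (conjugate x) (u ℕ.* conjugate x))
        w≤ : conjugate x ℕ.≤ suc n
        w≤ = let (u , _ , uw≡) = value-nat {n} {x} sol in bound u uw≡

      scaleUp scaleDown : ℕ × ℕ → ℕ × ℕ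
      scaleUp   (t , s) = t ℕ.* p , s ℕ.* p
      scaleDown (t , s) = t ℕ./ p , s ℕ./ p

      scaleDown-scaleUp : ∀ x → scaleDown (scaleUp x) ≡ x
      scaleDown-scaleUp (t , s) = cong₂ _,_ (ℕ÷.m*n/n≡m t p) (ℕ÷.m*n/n≡m s p)

      scaleUp-divisible : ∀ x → Divisible (scaleUp x)
      scaleUp-divisible (t , s) = ℕ∣.divides t refl , ℕ∣.divides s refl

      divisible-scaleUp : ∀ {x} → Divisible x → ∃[ y ] (x ≡ scaleUp y)
      divisible-scaleUp (ℕ∣.divides t refl , ℕ∣.divides s refl) = (t , s) , refl

      value-scaleUp : ∀ x → value (scaleUp x) ≡ value x ℤ.* + p
      value-scaleUp (t , s) = trans (cong₂ (λ a b → a ℤ.- + c ℤ.* b) (ℤₚ.pos-* t p) (ℤₚ.pos-* s p)) (e (+ t) (+ s) (+ c) (+ p))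
        where
        e : ∀ t s c p → t ℤ.* p ℤ.- c ℤ.* (s ℤ.* p) ≡ (t ℤ.- c ℤ.* s) ℤ.* p
        e = ℤRing.solve-∀

      norm-scaleUp : ∀ t s → + (t ℕ.* p) ℤ.* + (t ℕ.* p) ℤ.- + b ℤ.* (+ (s ℕ.* p) ℤ.* + (s ℕ.* p)) ≡ + p ℤ.* + p ℤ.* (+ t ℤ.* + t ℤ.- + b ℤ.* (+ s ℤ.* + s))
      norm-scaleUp t s = trans (cong₂ (λ x y → x ℤ.* x ℤ.- + b ℤ.* (y ℤ.* y)) (ℤₚ.pos-* t p) (ℤₚ.pos-* s p)) (e (+ t) (+ s) (+ b) (+ p))
        where
        e : ∀ t s b p → t ℤ.* p ℤ.* (t ℤ.* p) ℤ.- b ℤ.* (s ℤ.* p ℤ.* (s ℤ.* p)) ≡ p ℤ.* p ℤ.* (t ℤ.* t ℤ.- b ℤ.* (s ℤ.* s))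
        e = ℤRing.solve-∀

      -- If p divides t and s, then p² divides t² - bs², which is p.
      divisible-total-p : ∀ e → ∑ (square p) (λ x → δ (divisible? x) * term e p x) ≡ 0ℚ
      divisible-total-p e = ∑-zero (square p) λ {x} _ → δ*-zero (divisible? x) λ d → δ-no-* (solution? p x) _ (impossible x d)
        where
        impossible : ∀ x → Divisible x → ¬ Solution p x
        impossible x d (_ , eq) with divisible-scaleUp {x} d
        ... | (t , s) , refl = p∤1 pp (*-cancelˡ-∣ (+ p) {{prime-nonZero pp}} (divides (+ t ℤ.* + t ℤ.- + b ℤ.* (+ s ℤ.* + s))
                (trans (ℤₚ.*-identityʳ (+ p)) (trans (sym eq) (trans (norm-scaleUp t s) (ℤₚ.*-comm (+ p ℤ.* + p) (+ t ℤ.* + t ℤ.- + b ℤ.* (+ s ℤ.* + s))))))))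

      module _ {e e′ : ℤ} (⇒ : ∀ t → + 4 ∣ + p ℤ.* t ℤ.- e → + 4 ∣ t ℤ.- e′) (⇐ : ∀ t → + 4 ∣ t ℤ.- e′ → + 4 ∣ + p ℤ.* t ℤ.- e) where

        -- Multiplication of t and s by p is a bijection from the solutions at `suc n` to the
        -- divisible ones at p² `suc n`. It multiplies (t - cs)^(ℓ+1) by p^(ℓ+1), keeps the weight,
        -- and turns the class `e′` into `e`, as the two hypotheses express.
        divisible-total : ∀ n → ∑ (square (p ℕ.* (p ℕ.* suc n))) (λ x → δ (divisible? x) * term e (p ℕ.* (p ℕ.* suc n)) x)
          ≡ ι ((+ p) ℤ.^ suc ℓ) * total e′ (suc n)
        divisible-total n = trans (∑-reindex _≟²_ _≟²_ scaleDown scaleUp (square-unique N) (square-unique (suc n)) to from)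
            (∑-*ˡ (ι ((+ p) ℤ.^ suc ℓ)) (square (suc n)) (term e′ (suc n)))
          where
          N = p ℕ.* (p ℕ.* suc n)
          f g : ℕ × ℕ → ℚ
          f x = δ (divisible? x) * term e N x
          g x = ι ((+ p) ℤ.^ suc ℓ) * term e′ (suc n) x
          N≡ : + N ≡ + p ℤ.* + p ℤ.* + suc n
          N≡ = trans (ℤₚ.pos-* p (p ℕ.* suc n)) (trans (cong (+ p ℤ.*_) (ℤₚ.pos-* p (suc n))) (sym (ℤₚ.*-assoc (+ p) (+ p) (+ suc n))))
          solution⁺ : ∀ x → Solution (suc n) x → Solution N (scaleUp x)
          solution⁺ (t , s) (1≤t , eq) = ℕₚ.*-mono-≤ 1≤t (ℕ.>-nonZero⁻¹ p) , trans (norm-scaleUp t s) (trans (cong (+ p ℤ.* + p ℤ.*_) eq) (sym N≡))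
          solution⁻ : ∀ x → Solution N (scaleUp x) → Solution (suc n) x
          solution⁻ (t , s) (1≤tp , eq) = positive t 1≤tp , ℤₚ.*-cancelˡ-≡ (+ p ℤ.* + p) (+ t ℤ.* + t ℤ.- + b ℤ.* (+ s ℤ.* + s)) (+ suc n)
              {{ℤₚ.i*j≢0 (+ p) (+ p) {{prime-nonZero pp}} {{prime-nonZero pp}}}} (trans (sym (norm-scaleUp t s)) (trans eq N≡))
            where
            positive : ∀ t → 1 ℕ.≤ t ℕ.* p → 1 ℕ.≤ t
            positive (suc t) _ = s≤s z≤n
          weight-scaleUp : ∀ s → weight (s ℕ.* p) ≡ weight s
          weight-scaleUp zero    = refl
          weight-scaleUp (suc s) = nonZero (suc s ℕ.* p) {{ℕₚ.m*n≢0 (suc s) p}}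
            where
            nonZero : ∀ k .{{_ : NonZero k}} → weight k ≡ 1ℚ
            nonZero (suc k) = refl
          pow-* : ∀ x y n → (x ℤ.* y) ℤ.^ n ≡ x ℤ.^ n ℤ.* y ℤ.^ n
          pow-* x y zero    = refl
          pow-* x y (suc n) = trans (cong (x ℤ.* y ℤ.*_) (pow-* x y n)) (e₀ x y (x ℤ.^ n) (y ℤ.^ n))
            where
            e₀ : ∀ x y a b → x ℤ.* y ℤ.* (a ℤ.* b) ≡ x ℤ.* a ℤ.* (y ℤ.* b)
            e₀ = ℤRing.solve-∀
          f-scaleUp : ∀ x → f (scaleUp x) ≡ g x
          f-scaleUp x@(t , s) = begin
            f (scaleUp x)
              ≡⟨ δ-yes-* (divisible? (scaleUp x)) (term e N (scaleUp x)) (scaleUp-divisible x) ⟩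
            term e N (scaleUp x)
              ≡⟨ cong₂ _*_ (δ-cong (solution? N (scaleUp x)) (solution? (suc n) x) (solution⁻ x) (solution⁺ x))
                   (cong₂ _*_ (δ-cong (+ (t ℕ.* p) ≡? e [mod 4 ]) (+ t ≡? e′ [mod 4 ])
                       (λ d → ⇒ (+ t) (∣-≡ (cong (ℤ._- e) tp≡) d)) (λ d → ∣-≡ (cong (ℤ._- e) (sym tp≡)) (⇐ (+ t) d)))
                     (cong₂ _*_ (weight-scaleUp s) (trans (cong ι (trans (cong (ℤ._^ suc ℓ) (value-scaleUp x)) (pow-* (value x) (+ p) (suc ℓ)))) (ι-* (value x ℤ.^ suc ℓ) ((+ p) ℤ.^ suc ℓ))))) ⟩
            δ (solution? (suc n) x) * (δ (+ t ≡? e′ [mod 4 ]) * (weight s * (ι (value x ℤ.^ suc ℓ) * ι ((+ p) ℤ.^ suc ℓ))))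
              ≡⟨ e₀ (δ (solution? (suc n) x)) (δ (+ t ≡? e′ [mod 4 ])) (weight s) (ι (value x ℤ.^ suc ℓ)) (ι ((+ p) ℤ.^ suc ℓ)) ⟩
            g x
              ∎
            where
            open ≡-Reasoning
            tp≡ : + (t ℕ.* p) ≡ + p ℤ.* + t
            tp≡ = trans (ℤₚ.pos-* t p) (ℤₚ.*-comm (+ t) (+ p))
            e₀ : ∀ a b w v q → a * (b * (w * (v * q))) ≡ q * (a * (b * (w * v)))
            e₀ = RS.solve-∀ ringℚ
          from : ∀ {y} → y ∈ square (suc n) → g y ≡ 0ℚ ⊎ (scaleUp y ∈ square N × scaleDown (scaleUp y) ≡ y × f (scaleUp y) ≡ g y)
          from {y@(t , s)} y∈ = inj₂ (∈-square⁺ (bound t (proj₁ (∈-square⁻ {suc n} y∈))) (bound s (proj₂ (∈-square⁻ {suc n} y∈))) , scaleDown-scaleUp y , f-scaleUp y)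
            where
            bound : ∀ k → k ℕ.≤ suc n → k ℕ.* p ℕ.≤ N
            bound k k≤ = ℕₚ.≤-trans (ℕₚ.*-monoˡ-≤ p k≤) (ℕₚ.≤-trans (ℕₚ.≤-reflexive (ℕₚ.*-comm (suc n) p)) (ℕₚ.m≤n*m (p ℕ.* suc n) p))
          to : ∀ {x} → x ∈ square N → f x ≡ 0ℚ ⊎ (scaleDown x ∈ square (suc n) × scaleUp (scaleDown x) ≡ x × f x ≡ g (scaleDown x))
          to {x} _ = go (divisible? x) refl
            where
            go : (d : Dec (Divisible x)) → δ d ≡ δ (divisible? x) → f x ≡ 0ℚ ⊎ (scaleDown x ∈ square (suc n) × scaleUp (scaleDown x) ≡ x × f x ≡ g (scaleDown x))
            go (no ¬d) _ = inj₁ (δ-no-* (divisible? x) (term e N x) ¬d)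
            go (yes d) _ with divisible-scaleUp {x} d
            ... | y , refl with solution? (suc n) y
            ...   | yes sol = inj₂ (subst (_∈ square (suc n)) (sym (scaleDown-scaleUp y)) (solution-bounded {n} {y} sol) ,
                                    cong scaleUp (scaleDown-scaleUp y) , trans (f-scaleUp y) (cong g (sym (scaleDown-scaleUp y))))
            -- Outside the smaller square there are no solutions, so a quotient that is not a
            -- solution has a zero term and needs no place there.
            ...   | no ¬sol = inj₁ (trans (f-scaleUp y) (trans (cong (ι ((+ p) ℤ.^ suc ℓ) *_) (δ-no-* (solution? (suc n) y) _ ¬sol)) (ℚₚ.*-zeroʳ (ι ((+ p) ℤ.^ suc ℓ)))))

-- Signs and residue classes modulo 4

module Signs where

  open import Data.Integer.Base as ℤ using (ℤ; +_; 1ℤ; -1ℤ)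
  import Data.Integer.Properties as ℤₚ
  open import Data.Integer.Divisibility.Signed
  import Data.Integer.Tactic.RingSolver as ℤRing
  open import Data.Nat.Base as ℕ using (ℕ; zero; suc; NonZero; z≤n; s≤s)
  import Data.Nat.Properties as ℕₚ
  open import Data.Nat.Primality using (Prime; prime⇒nonZero; prime?)
  open import Data.Product.Base using (∃-syntax; _×_; _,_)
  open import Data.Rational.Base using (_+_; _*_; _-_; -_)
  open import Data.Sum.Base using (_⊎_; inj₁; inj₂)
  open import Relation.Binary.PropositionalEquality
  open import Relation.Nullary using (¬_; contradiction)
  open import Relation.Nullary.Decidable using (from-yes)
  open FiniteSums
  open JacobiSymbols
  open PrimeModulus
  open QuadraticResidues using (pow-cong)

  IsSign : ℤ → Set
  IsSign x = x ≡ 1ℤ ⊎ x ≡ -1ℤ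

  sign-* : ∀ {x y} → IsSign x → IsSign y → IsSign (x ℤ.* y)
  sign-* (inj₁ refl) (inj₁ refl) = inj₁ refl
  sign-* (inj₁ refl) (inj₂ refl) = inj₂ refl
  sign-* (inj₂ refl) (inj₁ refl) = inj₂ refl
  sign-* (inj₂ refl) (inj₂ refl) = inj₁ refl

  sign-^ : ∀ {x} n → IsSign x → IsSign (x ℤ.^ n)
  sign-^ zero    s = inj₁ refl
  sign-^ (suc n) s = sign-* s (sign-^ n s)

  sign-square : ∀ {x} → IsSign x → x ℤ.* x ≡ 1ℤ
  sign-square (inj₁ refl) = refl
  sign-square (inj₂ refl) = refl

  sign-double : ∀ {x} n → IsSign x → x ℤ.^ (n ℕ.+ n) ≡ 1ℤ
  sign-double {x} n s = trans (ℤₚ.^-distribˡ-+-* x n n) (sign-square (sign-^ n s))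

  sign-odd : ∀ {x} n → IsSign x → x ℤ.^ suc (n ℕ.+ n) ≡ x
  sign-odd {x} n s = trans (cong (x ℤ.*_) (sign-double n s)) (ℤₚ.*-identityʳ x)

  sign-mod4 : ∀ {x y} → IsSign x → IsSign y → + 4 ∣ x ℤ.- y → x ≡ y
  sign-mod4 (inj₁ refl) (inj₁ refl) _ = refl
  sign-mod4 (inj₂ refl) (inj₂ refl) _ = refl
  sign-mod4 (inj₁ refl) (inj₂ refl) d = contradiction d 4∤2
  sign-mod4 (inj₂ refl) (inj₁ refl) d = contradiction (∣m⇒∣-m d) 4∤2

  pos-^ : ∀ p e → + (p ℕ.^ e) ≡ (+ p) ℤ.^ e
  pos-^ p zero    = refl
  pos-^ p (suc e) = trans (ℤₚ.pos-* p (p ℕ.^ e)) (cong (+ p ℤ.*_) (pos-^ p e))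

  ≥3⇒odd : ∀ {p} → 3 ℕ.≤ p → ¬ + p ∣ + 2
  ≥3⇒odd 3≤p d with ∣-small 3≤p d
  ... | ()

  module _ {p : ℕ} (pp : Prime p) (3≤p : 3 ℕ.≤ p) where

    private
      odd = ≥3⇒odd 3≤p
      mod8 = oddMod8 pp 3≤p
      instance
        p≢0 : NonZero p
        p≢0 = prime⇒nonZero pp

    4⇐8 : ∀ {x} → + 8 ∣ x → + 4 ∣ x
    4⇐8 = ∣-trans (divides (+ 2) refl)

    p²≡1[8] : + 8 ∣ + p ℤ.* + p ℤ.- 1ℤ
    p²≡1[8] = square≡1-mod8 pp odd mod8

    jacobi[-1]-sign : ∀ e → IsSign (jacobi -1ℤ (p ℕ.^ e))
    jacobi[-1]-sign e = subst IsSign (sym (jacobi-pow pp -1ℤ e)) (sign-^ e (legendre-±1 {a = -1ℤ} {p} (p∤-1 pp odd)))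

    jacobi[-1]-mod4 : ∀ e → + 4 ∣ + (p ℕ.^ e) ℤ.- jacobi -1ℤ (p ℕ.^ e)
    jacobi[-1]-mod4 e = subst₂ (λ x y → + 4 ∣ x ℤ.- y) (sym (pos-^ p e)) (sym (jacobi-pow pp -1ℤ e))
      (pow-cong {x = + p} {legendre -1ℤ p} e (legendre[-1]-mod4 pp odd mod8))

    private
      L = legendre (+ 2) p
      L-sign : IsSign L
      L-sign = legendre-±1 {a = + 2} {p} odd

      even-power : ∀ e → + 8 ∣ (+ p) ℤ.^ (e ℕ.+ e) ℤ.- 1ℤ
      even-power e = subst₂ (λ x y → + 8 ∣ x ℤ.- y) (sym (trans (ℤₚ.^-distribˡ-+-* (+ p) e e) (sym (pow-* e)))) (ℤₚ.^-zeroˡ e) (pow-cong {x = + p ℤ.* + p} {1ℤ} e p²≡1[8])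
        where
        e₀ : ∀ x a → x ℤ.* x ℤ.* (a ℤ.* a) ≡ x ℤ.* a ℤ.* (x ℤ.* a)
        e₀ = ℤRing.solve-∀
        pow-* : ∀ n → (+ p ℤ.* + p) ℤ.^ n ≡ (+ p) ℤ.^ n ℤ.* (+ p) ℤ.^ n
        pow-* zero    = refl
        pow-* (suc n) = trans (cong (+ p ℤ.* + p ℤ.*_) (pow-* n)) (e₀ (+ p) ((+ p) ℤ.^ n))

    parity : ∀ r → ∃[ e ] (r ≡ e ℕ.+ e ⊎ r ≡ suc (e ℕ.+ e))
    parity zero = 0 , inj₁ refl
    parity (suc r) with parity r
    ... | e , inj₁ refl = e , inj₂ refl
    ... | e , inj₂ refl = suc e , inj₁ (cong suc (sym (ℕₚ.+-suc e e)))

    jacobi[2]-sign : ∀ r → IsSign (jacobi (+ 2) (p ℕ.^ r))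
    jacobi[2]-sign r = subst IsSign (sym (jacobi-pow pp (+ 2) r)) (sign-^ r L-sign)

    -- If r is even, p^r ≡ 1 modulo 8 and the symbol is 1. If r is odd, p^r ≡ p modulo 8 and the
    -- symbol is (2/p); then p ≡ 1 modulo 4, and the law for p applies.
    jacobi[2]-mod8 : ∀ r → + 4 ∣ + (p ℕ.^ r) ℤ.- 1ℤ → + 8 ∣ + (p ℕ.^ r) ℤ.+ 1ℤ ℤ.- + 2 ℤ.* jacobi (+ 2) (p ℕ.^ r)
    jacobi[2]-mod8 r d = subst₂ (λ x y → + 8 ∣ x ℤ.+ 1ℤ ℤ.- + 2 ℤ.* y) (sym (pos-^ p r)) (sym (jacobi-pow pp (+ 2) r)) (go r (parity r) (∣-≡ (cong (ℤ._- 1ℤ) (pos-^ p r)) d))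
      where
      go : ∀ r → ∃[ e ] (r ≡ e ℕ.+ e ⊎ r ≡ suc (e ℕ.+ e)) → + 4 ∣ (+ p) ℤ.^ r ℤ.- 1ℤ → + 8 ∣ (+ p) ℤ.^ r ℤ.+ 1ℤ ℤ.- + 2 ℤ.* L ℤ.^ r
      go r (e , inj₁ refl) d = ∣-≡ (trans (e₁ ((+ p) ℤ.^ (e ℕ.+ e))) (cong (λ z → (+ p) ℤ.^ (e ℕ.+ e) ℤ.+ 1ℤ ℤ.- + 2 ℤ.* z) (sym (sign-double e L-sign)))) (even-power e)
        where
        e₁ : ∀ x → x ℤ.- 1ℤ ≡ x ℤ.+ 1ℤ ℤ.- + 2 ℤ.* 1ℤ
        e₁ = ℤRing.solve-∀
      go r (e , inj₂ refl) d = ∣-≡ (trans (e₁ (+ p) P L) (cong (λ z → + p ℤ.* P ℤ.+ 1ℤ ℤ.- + 2 ℤ.* z) (sym (sign-odd e L-sign))))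
          (∣m∣n⇒∣m+n (∣n⇒∣m*n (+ p) (even-power e)) (legendre[2]-mod8 pp odd mod8 (∣-≡ (e₂ (+ p) P) (∣m∣n⇒∣m-n d (∣n⇒∣m*n (+ p) (4⇐8 (even-power e)))))))
        where
        P = (+ p) ℤ.^ (e ℕ.+ e)
        e₁ : ∀ p P L → p ℤ.* (P ℤ.- 1ℤ) ℤ.+ (p ℤ.+ 1ℤ ℤ.- + 2 ℤ.* L) ≡ p ℤ.* P ℤ.+ 1ℤ ℤ.- + 2 ℤ.* L
        e₁ = ℤRing.solve-∀
        e₂ : ∀ p P → p ℤ.* P ℤ.- 1ℤ ℤ.- p ℤ.* (P ℤ.- 1ℤ) ≡ p ℤ.- 1ℤ
        e₂ = ℤRing.solve-∀

  prime[3] : Prime 3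
  prime[3] = from-yes (prime? 3)

  -- 1 and 3 are treated as powers of the prime 3, so that the facts about prime powers apply.
  -- Modulo 4 the class m is the sign (-1/m).
  m-sign : ∀ {m} → m ≡ 1 ⊎ m ≡ 3 → IsSign (jacobi -1ℤ m) × + 4 ∣ + m ℤ.- jacobi -1ℤ m
  m-sign (inj₁ refl) = jacobi[-1]-sign prime[3] (s≤s (s≤s (s≤s z≤n))) 0 , jacobi[-1]-mod4 prime[3] (s≤s (s≤s (s≤s z≤n))) 0
  m-sign (inj₂ refl) = jacobi[-1]-sign prime[3] (s≤s (s≤s (s≤s z≤n))) 1 , jacobi[-1]-mod4 prime[3] (s≤s (s≤s (s≤s z≤n))) 1

  -- Of the two residue classes ±m the number t ≡ J lies in exactly one, and the sign in front tells which.
  signed-indicator : ∀ {t m χ J : ℤ} n → IsSign χ → IsSign J → + 4 ∣ m ℤ.- χ → + 4 ∣ t ℤ.- J →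
    ι (1ℤ ℤ.^ suc (n ℕ.+ n)) * δ (t ≡? 1ℤ ℤ.* m [mod 4 ]) + ι (-1ℤ ℤ.^ suc (n ℕ.+ n)) * δ (t ≡? -1ℤ ℤ.* m [mod 4 ]) ≡ ι (χ ℤ.* J)
  signed-indicator {t} {m} {χ} {J} n sχ sJ dm dt = trans (cong₂ (λ x y → ι x * δ₊ + ι y * δ₋) (sign-odd n (inj₁ refl)) (sign-odd n (inj₂ refl))) (go sχ sJ (same sχ sJ))
    where
    δ₊ = δ (t ≡? 1ℤ ℤ.* m [mod 4 ])
    δ₋ = δ (t ≡? -1ℤ ℤ.* m [mod 4 ])
    e₁ : ∀ s t m χ J → (t ℤ.- J) ℤ.- s ℤ.* (m ℤ.- χ) ℤ.+ (J ℤ.- s ℤ.* χ) ≡ t ℤ.- s ℤ.* m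
    e₁ = ℤRing.solve-∀
    e₂ : ∀ s t m χ J → (t ℤ.- s ℤ.* m) ℤ.- (t ℤ.- J) ℤ.+ s ℤ.* (m ℤ.- χ) ≡ J ℤ.- s ℤ.* χ
    e₂ = ℤRing.solve-∀
    in-class : ∀ s → J ≡ s ℤ.* χ → + 4 ∣ t ℤ.- s ℤ.* m
    in-class s J≡ = ∣-≡ (e₁ s t m χ J) (∣m∣n⇒∣m+n (∣m∣n⇒∣m-n dt (∣n⇒∣m*n s dm)) (∣-≡ (sym (ℤₚ.i≡j⇒i-j≡0 J≡)) ∣-0))
    class⇒ : ∀ s → IsSign s → + 4 ∣ t ℤ.- s ℤ.* m → J ≡ s ℤ.* χ
    class⇒ s ss d = sign-mod4 sJ (sign-* ss sχ) (∣-≡ (e₂ s t m χ J) (∣m∣n⇒∣m+n (∣m∣n⇒∣m-n d dt) (∣n⇒∣m*n s dm)))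
    same : IsSign χ → IsSign J → J ≡ χ ⊎ J ≡ ℤ.- χ
    same (inj₁ refl) (inj₁ refl) = inj₁ refl
    same (inj₁ refl) (inj₂ refl) = inj₂ refl
    same (inj₂ refl) (inj₁ refl) = inj₂ refl
    same (inj₂ refl) (inj₂ refl) = inj₁ refl
    not-both : IsSign χ → χ ≢ ℤ.- χ
    not-both (inj₁ refl) ()
    not-both (inj₂ refl) ()
    1*χ : 1ℤ ℤ.* χ ≡ χ
    1*χ = ℤₚ.*-identityˡ χ
    -1*χ : -1ℤ ℤ.* χ ≡ ℤ.- χ
    -1*χ = ℤₚ.-1*i≡-i χ
    go : IsSign χ → IsSign J → J ≡ χ ⊎ J ≡ ℤ.- χ → ι 1ℤ * δ₊ + ι -1ℤ * δ₋ ≡ ι (χ ℤ.* J)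
    go sχ _ (inj₁ J≡χ) = trans (cong₂ (λ x y → ι 1ℤ * x + ι -1ℤ * y) (δ-yes (t ≡? 1ℤ ℤ.* m [mod 4 ]) (in-class 1ℤ (trans J≡χ (sym 1*χ))))
        (δ-no (t ≡? -1ℤ ℤ.* m [mod 4 ]) λ d → not-both sχ (trans (sym J≡χ) (trans (class⇒ -1ℤ (inj₂ refl) d) -1*χ))))
      (cong ι (sym (trans (cong (χ ℤ.*_) J≡χ) (sign-square sχ))))
    go sχ _ (inj₂ J≡-χ) = trans (cong₂ (λ x y → ι 1ℤ * x + ι -1ℤ * y) (δ-no (t ≡? 1ℤ ℤ.* m [mod 4 ]) λ d → not-both sχ (trans (sym (trans (class⇒ 1ℤ (inj₁ refl) d) 1*χ)) J≡-χ))
        (δ-yes (t ≡? -1ℤ ℤ.* m [mod 4 ]) (in-class -1ℤ (trans J≡-χ (sym -1*χ)))))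
      (cong ι (sym (trans (cong (χ ℤ.*_) J≡-χ) (trans (sym (ℤₚ.neg-distribʳ-* χ χ)) (cong (λ z → ℤ.- z) (sign-square sχ))))))

-- The combination of α at pʳ and at p^(r-2)

module Assembly where

  open import Data.Integer.Base as ℤ using (ℤ; +_; 1ℤ; -1ℤ; ∣_∣)
  import Data.Integer.Properties as ℤₚ
  open import Data.Integer.Divisibility.Signed
  import Data.Integer.Tactic.RingSolver as ℤRing
  open import Data.Nat.Base as ℕ using (ℕ; zero; suc; NonZero; s≤s; _∸_)
  import Data.Nat.Properties as ℕₚ
  open import Data.Nat.Primality using (Prime; prime⇒nonZero)
  import Data.Nat.Tactic.RingSolver as ℕRing
  open import Data.Product.Base using (_,_; proj₁; proj₂)
  open import Data.Rational.Base using (ℚ; 0ℚ; 1ℚ; ½; _+_; _*_; _-_; -_)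
  import Data.Rational.Properties as ℚₚ
  open import Data.Sum.Base as Sum using (_⊎_; inj₁; inj₂)
  open import Relation.Binary.PropositionalEquality hiding (J)
  open import Relation.Nullary using (¬_; Dec; yes; no; contradiction)
  open import Relation.Nullary.Decidable using (¬?)
  import Tactic.RingSolver as RS
  open BracketPolynomials using (double)
  open BracketCoefficients using (½-split)
  open ClassNumberSums
  open FiniteSums
  open HurwitzValues using (natural-quotient)
  open PrimeModulus
  open Rationals
  open Signs
  open UnitSums
  open ≡-Reasoning

  double≡ : ∀ n → double n ≡ n ℕ.+ n
  double≡ zero    = refl
  double≡ (suc n) = cong suc (trans (cong suc (double≡ n)) (sym (ℕₚ.+-suc n n)))

  δ-¬ : ∀ {P : Set} (P? : Dec P) → δ (¬? P?) ≡ 1ℚ - δ P?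
  δ-¬ (yes _) = refl
  δ-¬ (no _)  = refl

  module _ {p : ℕ} {p̄ : ℤ} (inv : + 4 ∣ + p ℤ.* p̄ ℤ.- 1ℤ) where

    divide-class : ∀ e t → + 4 ∣ + p ℤ.* t ℤ.- e → + 4 ∣ t ℤ.- e ℤ.* p̄
    divide-class e t d = ∣-lin p̄ (ℤ.- t) d inv (e₁ (+ p) p̄ e t)
      where
      e₁ : ∀ p p̄ e t → p̄ ℤ.* (p ℤ.* t ℤ.- e) ℤ.+ ℤ.- t ℤ.* (p ℤ.* p̄ ℤ.- 1ℤ) ≡ t ℤ.- e ℤ.* p̄
      e₁ = ℤRing.solve-∀

    multiply-class : ∀ e t → + 4 ∣ t ℤ.- e ℤ.* p̄ → + 4 ∣ + p ℤ.* t ℤ.- e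
    multiply-class e t d = ∣-lin (+ p) e d inv (e₁ (+ p) p̄ e t)
      where
      e₁ : ∀ p p̄ e t → p ℤ.* (t ℤ.- e ℤ.* p̄) ℤ.+ e ℤ.* (p ℤ.* p̄ ℤ.- 1ℤ) ≡ p ℤ.* t ℤ.- e
      e₁ = ℤRing.solve-∀

  Λ[p^r-2] : (ℓ : ℕ) (m : ℤ) (M b : ℕ) → (p r : ℕ) → ℚ
  Λ[p^r-2] ℓ m M b p (suc (suc r)) = Λ ℓ m M b (p ℕ.^ r)
  Λ[p^r-2] ℓ m M b p _             = 0ℚ

  main[p^r-2] : (m : ℤ) (M b : ℕ) .{{_ : NonZero b}} → (p r ν : ℕ) → ℚ
  main[p^r-2] m M b p (suc (suc r)) ν = main m M b (p ℕ.^ r) ν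
  main[p^r-2] m M b p _             ν = 0ℚ

  module _ {p : ℕ} (pp : Prime p) (3≤p : 3 ℕ.≤ p) (c : ℕ) {{c≢0 : NonZero c}} (c≤2 : c ≡ 1 ⊎ c ≡ 2)
           {m : ℕ} (m-odd : m ≡ 1 ⊎ m ≡ 3) {p̄ : ℤ} (inv : + 4 ∣ + p ℤ.* p̄ ℤ.- 1ℤ) where

    private
      b : ℕ
      b = c ℕ.* c
      odd : ¬ + p ∣ + 2
      odd = ≥3⇒odd 3≤p
      χ : ℤ
      χ = jacobi -1ℤ m
      χ-sign : IsSign χ
      χ-sign = proj₁ (m-sign m-odd)
      χ-mod4 : + 4 ∣ + m ℤ.- χ
      χ-mod4 = proj₂ (m-sign m-odd)
      instance
        p≢0 : NonZero p
        p≢0 = prime⇒nonZero pp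
        b≢0 : NonZero b
        b≢0 = ℕₚ.m*n≢0 c c

      p∤c : ¬ + p ∣ + c
      p∤c = small c≤2
        where
        small : c ≡ 1 ⊎ c ≡ 2 → ¬ + p ∣ + c
        small (inj₁ refl) = p∤1 pp
        small (inj₂ refl) = odd

    -- Dividing t and s by p takes out p^(ℓ+1) and moves the classes ±m to ±m p̄, which gives the
    -- second term; for r = 1 there are no divisible solutions, in agreement with the value 0. The
    -- first term is the trivial solution, seen by both classes ±m with opposite signs because ℓ is
    -- odd.
    Λ-telescope : ∀ ν r → 1 ℕ.≤ r → + 4 ∣ + (p ℕ.^ r) ℤ.- 1ℤ → Λ (suc (double ν)) (+ m) 4 b (p ℕ.^ r)
      ≡ ι (χ ℤ.* jacobi (+ 2) (p ℕ.^ r)) + ι ((+ p) ℤ.^ suc (suc (double ν))) * Λ[p^r-2] (suc (double ν)) (+ m ℤ.* p̄) 4 b p r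
    Λ-telescope ν r 1≤r n≡1 = go (p ℕ.^ r) refl n≡1
      where
      ℓ = suc (double ν)
      J = jacobi (+ 2) (p ℕ.^ r)
      Q = ι ((+ p) ℤ.^ suc ℓ)
      rest : ℤ → ℕ → ℚ
      rest e N = ∑ (square N) (λ x → δ (divisible? c ℓ pp odd p∤c x) * term c ℓ e N x)
      low : ℤ → ℚ
      low s = ι (s ℤ.^ ℓ)
      s₁ : ℚ
      s₁ = low 1ℤ
      s₋ : ℚ
      s₋ = low -1ℤ
      rest-sum : ∀ r → 1 ℕ.≤ r → s₁ * rest (1ℤ ℤ.* + m) (p ℕ.^ r) + s₋ * rest (-1ℤ ℤ.* + m) (p ℕ.^ r) ≡ Q * Λ[p^r-2] ℓ (+ m ℤ.* p̄) 4 b p r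
      rest-sum (suc zero) _ = trans (cong₂ (λ x y → s₁ * x + s₋ * y) (vanish (1ℤ ℤ.* + m)) (vanish (-1ℤ ℤ.* + m))) (e s₁ s₋ Q)
        where
        vanish : ∀ e → rest e (p ℕ.* 1) ≡ 0ℚ
        vanish e = trans (cong (rest e) (ℕₚ.*-identityʳ p)) (divisible-total-p c ℓ pp odd p∤c e)
        e : ∀ a b q → a * 0ℚ + b * 0ℚ ≡ q * 0ℚ
        e = RS.solve-∀ ringℚ
      rest-sum (suc (suc s)) _ = descend (p ℕ.^ s) {{ℕₚ.m^n≢0 p s}}
        where
        descend : ∀ n .{{_ : NonZero n}} → s₁ * rest (1ℤ ℤ.* + m) (p ℕ.* (p ℕ.* n)) + s₋ * rest (-1ℤ ℤ.* + m) (p ℕ.* (p ℕ.* n)) ≡ Q * Λ ℓ (+ m ℤ.* p̄) 4 b n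
        descend n@(suc n-1) = begin
          s₁ * rest (1ℤ ℤ.* + m) (p ℕ.* (p ℕ.* n)) + s₋ * rest (-1ℤ ℤ.* + m) (p ℕ.* (p ℕ.* n))
            ≡⟨ cong₂ (λ x y → s₁ * x + s₋ * y) (step 1ℤ) (step -1ℤ) ⟩
          s₁ * (Q * total c ℓ (1ℤ ℤ.* (+ m ℤ.* p̄)) n) + s₋ * (Q * total c ℓ (-1ℤ ℤ.* (+ m ℤ.* p̄)) n)
            ≡⟨ e₁ s₁ s₋ Q (total c ℓ (1ℤ ℤ.* (+ m ℤ.* p̄)) n) (total c ℓ (-1ℤ ℤ.* (+ m ℤ.* p̄)) n) ⟩
          Q * (s₁ * total c ℓ (1ℤ ℤ.* (+ m ℤ.* p̄)) n + s₋ * total c ℓ (-1ℤ ℤ.* (+ m ℤ.* p̄)) n)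
            ≡⟨ cong (Q *_) (Λ≡total c ℓ (+ m ℤ.* p̄) n) ⟨
          Q * Λ ℓ (+ m ℤ.* p̄) 4 b n
            ∎
          where
          e₁ : ∀ a b q x y → a * (q * x) + b * (q * y) ≡ q * (a * x + b * y)
          e₁ = RS.solve-∀ ringℚ
          step : ∀ s → rest (s ℤ.* + m) (p ℕ.* (p ℕ.* n)) ≡ Q * total c ℓ (s ℤ.* (+ m ℤ.* p̄)) n
          step s = divisible-total c ℓ pp odd p∤c {s ℤ.* + m} {s ℤ.* (+ m ℤ.* p̄)}
            (λ t d → ∣-≡ (cong (λ z → t ℤ.- z) (ℤₚ.*-assoc s (+ m) p̄)) (divide-class {p} {p̄} inv (s ℤ.* + m) t d))
            (λ t d → multiply-class {p} {p̄} inv (s ℤ.* + m) t (∣-≡ (cong (λ z → t ℤ.- z) (sym (ℤₚ.*-assoc s (+ m) p̄))) d)) n-1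
      go : ∀ n → n ≡ p ℕ.^ r → + 4 ∣ + (p ℕ.^ r) ℤ.- 1ℤ → Λ ℓ (+ m) 4 b (p ℕ.^ r) ≡ ι (χ ℤ.* J) + Q * Λ[p^r-2] ℓ (+ m ℤ.* p̄) 4 b p r
      go zero 0≡ _ = contradiction (sym 0≡) (ℕ.≢-nonZero⁻¹ (p ℕ.^ r) {{ℕₚ.m^n≢0 p r}})
      go (suc n) n≡ d = begin
        Λ ℓ (+ m) 4 b (p ℕ.^ r)
          ≡⟨ cong (Λ ℓ (+ m) 4 b) n≡ ⟨
        Λ ℓ (+ m) 4 b (suc n)
          ≡⟨ Λ≡total c ℓ (+ m) (suc n) ⟩
        s₁ * total c ℓ (1ℤ ℤ.* + m) (suc n) + s₋ * total c ℓ (-1ℤ ℤ.* + m) (suc n)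
          ≡⟨ cong₂ (λ x y → s₁ * x + s₋ * y) (split (1ℤ ℤ.* + m)) (split (-1ℤ ℤ.* + m)) ⟩
        s₁ * (δ (+ t₀ ≡? 1ℤ ℤ.* + m [mod 4 ]) + rest (1ℤ ℤ.* + m) (suc n)) + s₋ * (δ (+ t₀ ≡? -1ℤ ℤ.* + m [mod 4 ]) + rest (-1ℤ ℤ.* + m) (suc n))
          ≡⟨ e₁ s₁ s₋ (δ (+ t₀ ≡? 1ℤ ℤ.* + m [mod 4 ])) (δ (+ t₀ ≡? -1ℤ ℤ.* + m [mod 4 ])) (rest (1ℤ ℤ.* + m) (suc n)) (rest (-1ℤ ℤ.* + m) (suc n)) ⟩
        (s₁ * δ (+ t₀ ≡? 1ℤ ℤ.* + m [mod 4 ]) + s₋ * δ (+ t₀ ≡? -1ℤ ℤ.* + m [mod 4 ])) + (s₁ * rest (1ℤ ℤ.* + m) (suc n) + s₋ * rest (-1ℤ ℤ.* + m) (suc n))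
          ≡⟨ cong₂ _+_ (trans (cong (λ k → ι (1ℤ ℤ.^ suc k) * δ (+ t₀ ≡? 1ℤ ℤ.* + m [mod 4 ]) + ι (-1ℤ ℤ.^ suc k) * δ (+ t₀ ≡? -1ℤ ℤ.* + m [mod 4 ])) (double≡ ν))
                 (signed-indicator {+ t₀} {+ m} {χ} {J} ν χ-sign (jacobi[2]-sign pp 3≤p r) χ-mod4 t₀-mod4))
               (trans (cong (λ N → s₁ * rest (1ℤ ℤ.* + m) N + s₋ * rest (-1ℤ ℤ.* + m) N) n≡) (rest-sum r 1≤r)) ⟩
        ι (χ ℤ.* J) + Q * Λ[p^r-2] ℓ (+ m ℤ.* p̄) 4 b p r
          ∎
        where
        q = proj₁ (natural-quotient {4} {n} (subst (λ N → + 4 ∣ + N ℤ.- 1ℤ) (sym n≡) d))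
        n≡4q : n ≡ 4 ℕ.* q
        n≡4q = proj₂ (natural-quotient {4} {n} (subst (λ N → + 4 ∣ + N ℤ.- 1ℤ) (sym n≡) d))
        -- From t₀ - c s₀ = 1 and t₀ + c s₀ = pʳ = 4q + 1 one gets t₀ = 2q + 1 and c s₀ = 2q. For c
        -- = 2 it is pʳ ≡ 1 modulo 4 that makes s₀ integral.
        t₀ = suc (2 ℕ.* q)
        s₀ : ℕ
        s₀ = Sum.[ (λ _ → 2 ℕ.* q) , (λ _ → q) ] c≤2
        1+n≡ : + suc n ≡ 1ℤ ℤ.+ + 4 ℤ.* + q
        1+n≡ = trans (ℤₚ.pos-+ 1 n) (cong (λ z → 1ℤ ℤ.+ z) (trans (cong +_ n≡4q) (ℤₚ.pos-* 4 q)))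
        t₀≡ : + 2 ℤ.* + t₀ ≡ + suc n ℤ.+ 1ℤ
        t₀≡ = trans (cong (+ 2 ℤ.*_) (trans (ℤₚ.pos-+ 1 (2 ℕ.* q)) (cong (λ z → 1ℤ ℤ.+ z) (ℤₚ.pos-* 2 q)))) (trans (e (+ q)) (cong (ℤ._+ 1ℤ) (sym 1+n≡)))
          where
          e : ∀ q → + 2 ℤ.* (1ℤ ℤ.+ + 2 ℤ.* q) ≡ 1ℤ ℤ.+ + 4 ℤ.* q ℤ.+ 1ℤ
          e = ℤRing.solve-∀
        s₀≡ : + 2 ℤ.* + c ℤ.* + s₀ ≡ + suc n ℤ.- 1ℤ
        s₀≡ = trans (cases c≤2) (cong (ℤ._- 1ℤ) (sym 1+n≡))
          where
          e₂ : ∀ q → + 2 ℤ.* 1ℤ ℤ.* (+ 2 ℤ.* q) ≡ 1ℤ ℤ.+ + 4 ℤ.* q ℤ.- 1ℤ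
          e₂ = ℤRing.solve-∀
          e₃ : ∀ q → + 2 ℤ.* + 2 ℤ.* q ≡ 1ℤ ℤ.+ + 4 ℤ.* q ℤ.- 1ℤ
          e₃ = ℤRing.solve-∀
          cases : (h : c ≡ 1 ⊎ c ≡ 2) → + 2 ℤ.* + c ℤ.* + (Sum.[ (λ _ → 2 ℕ.* q) , (λ _ → q) ] h) ≡ 1ℤ ℤ.+ + 4 ℤ.* + q ℤ.- 1ℤ
          cases (inj₁ refl) = trans (cong (+ 2 ℤ.* 1ℤ ℤ.*_) (ℤₚ.pos-* 2 q)) (e₂ (+ q))
          cases (inj₂ refl) = e₃ (+ q)
        t₀-mod4 : + 4 ∣ + t₀ ℤ.- J
        t₀-mod4 = *-cancelˡ-∣ (+ 2) (∣-≡ (trans (cong (λ N → + N ℤ.+ 1ℤ ℤ.- + 2 ℤ.* J) (sym n≡)) (trans (cong (ℤ._- + 2 ℤ.* J) (sym t₀≡)) (e (+ t₀) J))) (jacobi[2]-mod8 pp 3≤p r d))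
          where
          e : ∀ t J → + 2 ℤ.* t ℤ.- + 2 ℤ.* J ≡ + 2 ℤ.* (t ℤ.- J)
          e = ℤRing.solve-∀
        n≢1 : suc n ≢ 1
        n≢1 1+n≡1 = p≢1 r 1≤r (trans (sym n≡) 1+n≡1)
          where
          p≢1 : ∀ r → 1 ℕ.≤ r → p ℕ.^ r ≢ 1
          p≢1 (suc r) _ eq = contradiction (subst (3 ℕ.≤_) (ℕₚ.m*n≡1⇒m≡1 p (p ℕ.^ r) eq) 3≤p) λ { (s≤s ()) }
        split : ∀ e → total c ℓ e (suc n) ≡ δ (+ t₀ ≡? e [mod 4 ]) + rest e (suc n)
        split e = total-split c ℓ pp odd p∤c {n} {r} n≡ n≢1 {t₀} {s₀} t₀≡ s₀≡ e
        e₁ : ∀ a b x y u v → a * (x + u) + b * (y + v) ≡ (a * x + b * y) + (a * u + b * v)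
        e₁ = RS.solve-∀ ringℚ

    private
      B : ℚ
      B = b ^-½

    -- Λ at p^(r-2) enters both α with the same constant and, after `Λ-telescope`, with the same
    -- factor p^(ℓ+1); it cancels in the difference, and of the unit sums only the trivial solution
    -- survives.
    α-difference : ∀ ν r → 1 ℕ.≤ r → + 4 ∣ + (p ℕ.^ r) ℤ.- 1ℤ →
      α (suc (double ν)) (+ m) 4 b (p ℕ.^ r) - ι (+ (p ℕ.^ (suc (double ν) ℕ.+ 1))) * α[p^r-2] (suc (double ν)) (+ m ℤ.* p̄) 4 b p r
      ≡ main (+ m) 4 b (p ℕ.^ r) ν - ι ((+ p) ℤ.^ suc (suc (double ν))) * main[p^r-2] (+ m ℤ.* p̄) 4 b p r ν
        + B * ½ ^ (1 ℕ.+ suc (double ν)) * ι (χ ℤ.* jacobi (+ 2) (p ℕ.^ r))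
    α-difference ν r 1≤r n≡1 = begin
      α ℓ (+ m) 4 b (p ℕ.^ r) - ι (+ (p ℕ.^ (ℓ ℕ.+ 1))) * α[p^r-2] ℓ (+ m ℤ.* p̄) 4 b p r
        ≡⟨ cong₂ (λ x y → x - y) (trans (α≡ (+ m) 4 b (p ℕ.^ r) ν) (cong (λ z → M + K * z) (Λ-telescope ν r 1≤r n≡1)))
             (cong₂ _*_ (cong ι (trans (cong (λ e → + (p ℕ.^ e)) (ℕₚ.+-comm ℓ 1)) (pos-^ p (suc ℓ)))) (low r)) ⟩
      (M + K * (X + Q * L)) - Q * (M′ + K * L)
        ≡⟨ e M K X Q L M′ ⟩
      M - Q * M′ + K * X
        ∎
      where
      ℓ = suc (double ν)
      M = main (+ m) 4 b (p ℕ.^ r) ν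
      M′ = main[p^r-2] (+ m ℤ.* p̄) 4 b p r ν
      L = Λ[p^r-2] ℓ (+ m ℤ.* p̄) 4 b p r
      K = B * ½ ^ (1 ℕ.+ ℓ)
      X = ι (χ ℤ.* jacobi (+ 2) (p ℕ.^ r))
      Q = ι ((+ p) ℤ.^ suc ℓ)
      low : ∀ r → α[p^r-2] ℓ (+ m ℤ.* p̄) 4 b p r ≡ main[p^r-2] (+ m ℤ.* p̄) 4 b p r ν + K * Λ[p^r-2] ℓ (+ m ℤ.* p̄) 4 b p r
      low zero          = sym (trans (ℚₚ.+-identityˡ (K * 0ℚ)) (ℚₚ.*-zeroʳ K))
      low (suc zero)    = sym (trans (ℚₚ.+-identityˡ (K * 0ℚ)) (ℚₚ.*-zeroʳ K))
      low (suc (suc s)) = α≡ (+ m ℤ.* p̄) 4 b (p ℕ.^ s) ν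
      e : ∀ M K X Q L M′ → (M + K * (X + Q * L)) - Q * (M′ + K * L) ≡ M - Q * M′ + K * X
      e = RS.solve-∀ ringℚ

    moment : ℤ → ℕ → ℕ → ℚ
    moment m′ κ n = ∑ [± n ] (λ t → δ (t ≡? m′ [mod 4 ]) * (h m′ 4 b n t * ι (t ℤ.^ suc (double κ))))

    moment[p^r-2] : ℕ → ℕ → ℚ
    moment[p^r-2] κ (suc (suc s)) = moment (+ m ℤ.* p̄) κ (p ℕ.^ s)
    moment[p^r-2] κ _             = 0ℚ

    main-low-sum : ∀ κ r → Σ[0⋯ κ ] (λ μ → ½ ^ (2 ℕ.* μ) * T (suc (double κ)) μ * main[p^r-2] (+ m ℤ.* p̄) 4 b p r (κ ∸ μ) * ι (+ (p ℕ.^ (r ∸ 2))) ^ μ)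
      ≡ moment[p^r-2] κ r
    main-low-sum κ (suc (suc s)) = main-sum (+ m ℤ.* p̄) 4 b (p ℕ.^ s) κ
    main-low-sum κ zero = trans (Σ-cong κ λ {μ} _ → e (½ ^ (2 ℕ.* μ) * T (suc (double κ)) μ) (ι (+ (p ℕ.^ 0)) ^ μ)) (trans (Σ-*ˡ 0ℚ κ (λ _ → 1ℚ)) (ℚₚ.*-zeroˡ (Σ[0⋯ κ ] (λ _ → 1ℚ))))
      where
      e : ∀ x y → x * 0ℚ * y ≡ 0ℚ * 1ℚ
      e = RS.solve-∀ ringℚ
    main-low-sum κ (suc zero) = trans (Σ-cong κ λ {μ} _ → e (½ ^ (2 ℕ.* μ) * T (suc (double κ)) μ) (ι (+ (p ℕ.^ 0)) ^ μ)) (trans (Σ-*ˡ 0ℚ κ (λ _ → 1ℚ)) (ℚₚ.*-zeroˡ (Σ[0⋯ κ ] (λ _ → 1ℚ))))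
      where
      e : ∀ x y → x * 0ℚ * y ≡ 0ℚ * 1ℚ
      e = RS.solve-∀ ringℚ

    index : ∀ {κ μ} → μ ℕ.≤ κ → suc (double κ) ∸ 2 ℕ.* μ ≡ suc (double (κ ∸ μ))
    index {κ} {zero} _ = refl
    index {suc κ} {suc μ} (s≤s μ≤κ) = trans (cong (suc (double (suc κ)) ∸_) (ℕₚ.*-suc 2 μ)) (index μ≤κ)

    index+ : ∀ {κ μ} → μ ℕ.≤ κ → double (κ ∸ μ) ℕ.+ 2 ℕ.* μ ≡ double κ
    index+ {κ} {zero} _ = ℕₚ.+-identityʳ (double κ)
    index+ {suc κ} {suc μ} (s≤s μ≤κ) = trans (cong (double (κ ∸ μ) ℕ.+_) (ℕₚ.*-suc 2 μ))
      (trans (ℕₚ.+-suc (double (κ ∸ μ)) (suc (2 ℕ.* μ))) (cong suc (trans (ℕₚ.+-suc (double (κ ∸ μ)) (2 ℕ.* μ)) (cong suc (index+ μ≤κ)))))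

    ι-pow : ∀ r μ → ι (+ (p ℕ.^ (r ℕ.* μ))) ≡ ι (+ (p ℕ.^ r)) ^ μ
    ι-pow r μ = trans (cong (λ z → ι (+ z)) (sym (ℕₚ.^-*-assoc p r μ))) (trans (cong ι (pos-^ (p ℕ.^ r) μ)) (ι-^ (+ (p ℕ.^ r)) μ))

    -- p^(k-2μ+1) p^(rμ) = p^(k+1) (p^(r-2))^μ. The first factor does not depend on μ, and the
    -- second is the power of n that `main-sum` needs at n = p^(r-2).
    collect-powers : ∀ {κ μ} → μ ℕ.≤ κ → ∀ r ν → ι ((+ p) ℤ.^ suc (suc (double (κ ∸ μ)))) * main[p^r-2] (+ m ℤ.* p̄) 4 b p r ν * ι (+ (p ℕ.^ (r ℕ.* μ)))
      ≡ ι ((+ p) ℤ.^ suc (suc (double κ))) * (main[p^r-2] (+ m ℤ.* p̄) 4 b p r ν * ι (+ (p ℕ.^ (r ∸ 2))) ^ μ)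
    collect-powers {κ} {μ} μ≤κ zero ν = e (ι ((+ p) ℤ.^ suc (suc (double (κ ∸ μ))))) (ι ((+ p) ℤ.^ suc (suc (double κ)))) (ι (+ (p ℕ.^ (0 ℕ.* μ)))) (ι (+ (p ℕ.^ 0)) ^ μ)
      where
      e : ∀ x q y z → x * 0ℚ * y ≡ q * (0ℚ * z)
      e = RS.solve-∀ ringℚ
    collect-powers {κ} {μ} μ≤κ (suc zero) ν = e (ι ((+ p) ℤ.^ suc (suc (double (κ ∸ μ))))) (ι ((+ p) ℤ.^ suc (suc (double κ)))) (ι (+ (p ℕ.^ (1 ℕ.* μ)))) (ι (+ (p ℕ.^ 0)) ^ μ)
      where
      e : ∀ x q y z → x * 0ℚ * y ≡ q * (0ℚ * z)
      e = RS.solve-∀ ringℚ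
    collect-powers {κ} {μ} μ≤κ (suc (suc s)) ν = begin
      ι (P ℤ.^ ℓ+1) * M * ι (+ (p ℕ.^ (suc (suc s) ℕ.* μ)))
        ≡⟨ e (ι (P ℤ.^ ℓ+1)) M (ι (+ (p ℕ.^ (suc (suc s) ℕ.* μ)))) ⟩
      ι (P ℤ.^ ℓ+1) * ι (+ (p ℕ.^ (suc (suc s) ℕ.* μ))) * M
        ≡⟨ cong (_* M) powers ⟩
      ι (P ℤ.^ suc (suc (double κ))) * ι (+ (p ℕ.^ s)) ^ μ * M
        ≡⟨ e₁ (ι (P ℤ.^ suc (suc (double κ)))) (ι (+ (p ℕ.^ s)) ^ μ) M ⟩
      ι (P ℤ.^ suc (suc (double κ))) * (M * ι (+ (p ℕ.^ s)) ^ μ)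
        ∎
      where
      P = + p
      ℓ+1 = suc (suc (double (κ ∸ μ)))
      M = main (+ m ℤ.* p̄) 4 b (p ℕ.^ s) ν
      e : ∀ x y z → x * y * z ≡ x * z * y
      e = RS.solve-∀ ringℚ
      e₁ : ∀ x y z → x * y * z ≡ x * (z * y)
      e₁ = RS.solve-∀ ringℚ
      expand : ∀ s μ → suc (suc s) ℕ.* μ ≡ 2 ℕ.* μ ℕ.+ s ℕ.* μ
      expand = ℕRing.solve-∀
      powers : ι (P ℤ.^ ℓ+1) * ι (+ (p ℕ.^ (suc (suc s) ℕ.* μ))) ≡ ι (P ℤ.^ suc (suc (double κ))) * ι (+ (p ℕ.^ s)) ^ μ
      powers = begin
        ι (P ℤ.^ ℓ+1) * ι (+ (p ℕ.^ (suc (suc s) ℕ.* μ)))                 ≡⟨ ι-* (P ℤ.^ ℓ+1) (+ (p ℕ.^ (suc (suc s) ℕ.* μ))) ⟨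
        ι (P ℤ.^ ℓ+1 ℤ.* + (p ℕ.^ (suc (suc s) ℕ.* μ)))                   ≡⟨ cong (λ z → ι (P ℤ.^ ℓ+1 ℤ.* z)) (trans (pos-^ p (suc (suc s) ℕ.* μ)) (trans (cong (P ℤ.^_) (expand s μ)) (ℤₚ.^-distribˡ-+-* P (2 ℕ.* μ) (s ℕ.* μ)))) ⟩
        ι (P ℤ.^ ℓ+1 ℤ.* (P ℤ.^ (2 ℕ.* μ) ℤ.* P ℤ.^ (s ℕ.* μ)))           ≡⟨ cong ι (trans (sym (ℤₚ.*-assoc (P ℤ.^ ℓ+1) (P ℤ.^ (2 ℕ.* μ)) (P ℤ.^ (s ℕ.* μ)))) (cong (ℤ._* P ℤ.^ (s ℕ.* μ)) (trans (sym (ℤₚ.^-distribˡ-+-* P ℓ+1 (2 ℕ.* μ))) (cong (λ k → P ℤ.^ suc (suc k)) (index+ μ≤κ))))) ⟩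
        ι (P ℤ.^ suc (suc (double κ)) ℤ.* P ℤ.^ (s ℕ.* μ))                ≡⟨ ι-* (P ℤ.^ suc (suc (double κ))) (P ℤ.^ (s ℕ.* μ)) ⟩
        ι (P ℤ.^ suc (suc (double κ))) * ι (P ℤ.^ (s ℕ.* μ))              ≡⟨ cong (ι (P ℤ.^ suc (suc (double κ))) *_) (trans (cong ι (sym (pos-^ p (s ℕ.* μ)))) (ι-pow s μ)) ⟩
        ι (P ℤ.^ suc (suc (double κ))) * ι (+ (p ℕ.^ s)) ^ μ              ∎

    α-sum : ∀ κ r → 1 ℕ.≤ r → + 4 ∣ + (p ℕ.^ r) ℤ.- 1ℤ → let k = suc (double κ) in
      Σ[0⋯ κ ] (λ μ → ½ ^ (2 ℕ.* μ) * T k μ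
        * (α (k ∸ 2 ℕ.* μ) (+ m) 4 b (p ℕ.^ r) - ι (+ (p ℕ.^ (k ∸ 2 ℕ.* μ ℕ.+ 1))) * α[p^r-2] (k ∸ 2 ℕ.* μ) (+ m ℤ.* p̄) 4 b p r)
        * ι (+ (p ℕ.^ (r ℕ.* μ))))
      ≡ moment (+ m) κ (p ℕ.^ r) - ι ((+ p) ℤ.^ suc k) * moment[p^r-2] κ r
        + B * ι (χ ℤ.* jacobi (+ 2) (p ℕ.^ r)) * ½ ^ (k ℕ.+ 1) * Σ[0⋯ κ ] (λ μ → T k μ * ι (+ (p ℕ.^ (r ℕ.* μ))))
    α-sum κ r 1≤r n≡1 = begin
      Σ[0⋯ κ ] (λ μ → ½ ^ (2 ℕ.* μ) * T k μ * A (k ∸ 2 ℕ.* μ) * N μ)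
        ≡⟨ Σ-cong κ (λ {μ} μ≤κ → term≡ μ≤κ) ⟩
      Σ[0⋯ κ ] (λ μ → f μ + (ℚ⁻ Q * g μ + Z * t μ))
        ≡⟨ Σ-+ κ f (λ μ → ℚ⁻ Q * g μ + Z * t μ) ⟩
      Σ[0⋯ κ ] f + Σ[0⋯ κ ] (λ μ → ℚ⁻ Q * g μ + Z * t μ)
        ≡⟨ cong (λ z → Σ[0⋯ κ ] f + z) (trans (Σ-+ κ (λ μ → ℚ⁻ Q * g μ) (λ μ → Z * t μ)) (cong₂ _+_ (Σ-*ˡ (ℚ⁻ Q) κ g) (Σ-*ˡ Z κ t))) ⟩
      Σ[0⋯ κ ] f + (ℚ⁻ Q * Σ[0⋯ κ ] g + Z * Σ[0⋯ κ ] t)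
        ≡⟨ cong₂ (λ x y → x + (ℚ⁻ Q * y + Z * Σ[0⋯ κ ] t)) (main-sum (+ m) 4 b (p ℕ.^ r) κ) (main-low-sum κ r) ⟩
      moment (+ m) κ (p ℕ.^ r) + (ℚ⁻ Q * moment[p^r-2] κ r + Z * Σ[0⋯ κ ] t)
        ≡⟨ e₁ (moment (+ m) κ (p ℕ.^ r)) Q (moment[p^r-2] κ r) (Z * Σ[0⋯ κ ] t) ⟩
      moment (+ m) κ (p ℕ.^ r) - Q * moment[p^r-2] κ r + Z * Σ[0⋯ κ ] t
        ∎
      where
      k = suc (double κ)
      Q = ι ((+ p) ℤ.^ suc k)
      X = ι (χ ℤ.* jacobi (+ 2) (p ℕ.^ r))
      Z = B * X * ½ ^ (k ℕ.+ 1)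
      A : ℕ → ℚ
      A ℓ = α ℓ (+ m) 4 b (p ℕ.^ r) - ι (+ (p ℕ.^ (ℓ ℕ.+ 1))) * α[p^r-2] ℓ (+ m ℤ.* p̄) 4 b p r
      N f g t : ℕ → ℚ
      N μ = ι (+ (p ℕ.^ (r ℕ.* μ)))
      f μ = ½ ^ (2 ℕ.* μ) * T k μ * main (+ m) 4 b (p ℕ.^ r) (κ ∸ μ) * ι (+ (p ℕ.^ r)) ^ μ
      g μ = ½ ^ (2 ℕ.* μ) * T k μ * main[p^r-2] (+ m ℤ.* p̄) 4 b p r (κ ∸ μ) * ι (+ (p ℕ.^ (r ∸ 2))) ^ μ
      t μ = T k μ * N μ
      ℚ⁻ : ℚ → ℚ
      ℚ⁻ x = - x
      e₁ : ∀ x q y z → x + (- q * y + z) ≡ x - q * y + z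
      e₁ = RS.solve-∀ ringℚ
      e₂ : ∀ c T x q y B h X n → c * T * (x - q * y + B * h * X) * n ≡ c * T * x * n + (- (c * T) * (q * y * n) + B * X * (c * h) * (T * n))
      e₂ = RS.solve-∀ ringℚ
      e₃ : ∀ c q y n → - c * (q * (y * n)) ≡ - q * (c * y * n)
      e₃ = RS.solve-∀ ringℚ
      -- 2^(-2μ) from the formula and 2^(-1-ℓ) from Λ combine to 2^(-k-1), independent of μ; this is
      -- the constant in front of the second sum.
      halves : ∀ {μ} → μ ℕ.≤ κ → ½ ^ (2 ℕ.* μ) * ½ ^ (1 ℕ.+ suc (double (κ ∸ μ))) ≡ ½ ^ (k ℕ.+ 1)
      halves {μ} μ≤κ = trans (e₄ (½ ^ (2 ℕ.* μ)) (½ ^ suc (double (κ ∸ μ)))) (trans (cong (½ *_) (½-split μ≤κ)) (cong (½ ^_) (ℕₚ.+-comm 1 k)))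
        where
        e₄ : ∀ a b → a * (½ * b) ≡ ½ * (a * b)
        e₄ = RS.solve-∀ ringℚ
      term≡ : ∀ {μ} → μ ℕ.≤ κ → ½ ^ (2 ℕ.* μ) * T k μ * A (k ∸ 2 ℕ.* μ) * N μ ≡ f μ + (ℚ⁻ Q * g μ + Z * t μ)
      term≡ {μ} μ≤κ = begin
        c₀ * T k μ * A (k ∸ 2 ℕ.* μ) * N μ
          ≡⟨ cong (λ z → c₀ * T k μ * z * N μ) (trans (cong A (index μ≤κ)) (α-difference (κ ∸ μ) r 1≤r n≡1)) ⟩
        c₀ * T k μ * (M - q * M′ + B * ½ ^ (1 ℕ.+ suc (double (κ ∸ μ))) * X) * N μ
          ≡⟨ e₂ c₀ (T k μ) M q M′ B (½ ^ (1 ℕ.+ suc (double (κ ∸ μ)))) X (N μ) ⟩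
        c₀ * T k μ * M * N μ + (- (c₀ * T k μ) * (q * M′ * N μ) + B * X * (c₀ * ½ ^ (1 ℕ.+ suc (double (κ ∸ μ)))) * t μ)
          ≡⟨ cong₂ _+_ (cong (c₀ * T k μ * M *_) (ι-pow r μ)) (cong₂ _+_ (trans (cong (- (c₀ * T k μ) *_) (collect-powers μ≤κ r (κ ∸ μ))) (e₃ (c₀ * T k μ) Q M′ (ι (+ (p ℕ.^ (r ∸ 2))) ^ μ)))
               (cong (λ z → B * X * z * t μ) (halves μ≤κ))) ⟩
        f μ + (ℚ⁻ Q * g μ + Z * t μ)
          ∎
        where
        c₀ = ½ ^ (2 ℕ.* μ)
        M = main (+ m) 4 b (p ℕ.^ r) (κ ∸ μ)
        M′ = main[p^r-2] (+ m ℤ.* p̄) 4 b p r (κ ∸ μ)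
        q = ι ((+ p) ℤ.^ suc (suc (double (κ ∸ μ))))

-- The terms of the moment with p ∣ t

module DivisibleTerms where

  open import Data.Integer.Base as ℤ using (ℤ; +_; 0ℤ; 1ℤ; -1ℤ; ∣_∣)
  import Data.Integer.Properties as ℤₚ
  open import Data.Integer.Divisibility.Signed
  import Data.Integer.Tactic.RingSolver as ℤRing
  open import Data.List.Membership.Propositional using (_∈_)
  open import Data.Nat.Base as ℕ using (ℕ; zero; suc; NonZero; z≤n; s≤s)
  import Data.Nat.Divisibility as ℕ∣
  import Data.Nat.DivMod as ℕ÷
  import Data.Nat.Properties as ℕₚ
  open import Data.Nat.Primality using (Prime; prime⇒nonZero)
  import Data.Nat.Tactic.RingSolver as ℕRing
  open import Data.Product.Base using (_×_; _,_; proj₁; proj₂)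
  open import Data.Rational.Base using (ℚ; 0ℚ; 1ℚ; _+_; _*_; _-_; -_; _/_)
  import Data.Rational.Properties as ℚₚ
  open import Data.Sum.Base as Sum using (_⊎_; inj₁; inj₂)
  open import Relation.Binary.PropositionalEquality hiding (J)
  open import Relation.Nullary using (¬_; Dec; yes; no; contradiction)
  open import Relation.Nullary.Decidable using (¬?)
  import Tactic.RingSolver as RS
  open Assembly
  open BinaryQuadraticForms using (0<sq; 0<⇒1≤)
  open BracketPolynomials using (double)
  open ClassNumberSums
  open FiniteSums
  open HurwitzValues using (H-p²)
  open PrimeModulus
  open Rationals
  open Signs
  open ≡-Reasoning

  quotient′ : ∀ {p : ℕ} {t} → Dec (+ p ∣ t) → ℤ
  quotient′ (yes (divides q _)) = q
  quotient′ (no _)              = 0ℤ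

  module _ {p : ℕ} (pp : Prime p) where

    private instance
      p≢0 : ℤ.NonZero (+ p)
      p≢0 = prime-nonZero pp

    quotient-* : ∀ q → quotient′ {p} (+ p ∣? q ℤ.* + p) ≡ q
    quotient-* q = go (+ p ∣? q ℤ.* + p)
      where
      go : (d : Dec (+ p ∣ q ℤ.* + p)) → quotient′ {p} d ≡ q
      go (yes (divides q′ eq)) = sym (ℤₚ.*-cancelʳ-≡ q q′ (+ p) eq)
      go (no ¬d) = contradiction (divides q refl) ¬d

    -- Substitute t = qp. The range of t may contain multiples of p beyond p times the range of q;
    -- at these `F` is assumed to vanish.
    ∑-multiples : ∀ {N n} (F : ℤ → ℚ) → (∀ q → ¬ ∣ q ∣ ℕ.≤ n → F (q ℤ.* + p) ≡ 0ℚ) → p ℕ.* n ℕ.≤ N →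
      ∑ [± N ] (λ t → δ (+ p ∣? t) * F t) ≡ ∑ [± n ] (λ q → F (q ℤ.* + p))
    ∑-multiples {N} {n} F outside pn≤N = ∑-reindex ℤₚ._≟_ ℤₚ._≟_ (λ t → quotient′ {p} (+ p ∣? t)) (ℤ._* + p) ([±]-unique N) ([±]-unique n) to from
      where
      f : ℤ → ℚ
      f t = δ (+ p ∣? t) * F t
      f-* : ∀ q → f (q ℤ.* + p) ≡ F (q ℤ.* + p)
      f-* q = δ-yes-* (+ p ∣? q ℤ.* + p) (F (q ℤ.* + p)) (divides q refl)
      from : ∀ {q} → q ∈ [± n ] → F (q ℤ.* + p) ≡ 0ℚ ⊎ (q ℤ.* + p ∈ [± N ] × quotient′ {p} (+ p ∣? q ℤ.* + p) ≡ q × f (q ℤ.* + p) ≡ F (q ℤ.* + p))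
      from {q} q∈ = inj₂ (∈-[±]⁺ N (subst (ℕ._≤ N) (sym (ℤₚ.abs-* q (+ p)))
        (ℕₚ.≤-trans (ℕₚ.≤-trans (ℕₚ.≤-reflexive (ℕₚ.*-comm ∣ q ∣ p)) (ℕₚ.*-monoʳ-≤ p (∈-[±]⁻ n q∈))) pn≤N)) , quotient-* q , f-* q)
      to : ∀ {t} → t ∈ [± N ] → f t ≡ 0ℚ ⊎ (quotient′ {p} (+ p ∣? t) ∈ [± n ] × quotient′ {p} (+ p ∣? t) ℤ.* + p ≡ t × f t ≡ F (quotient′ {p} (+ p ∣? t) ℤ.* + p))
      to {t} _ = go (+ p ∣? t)
        where
        go : Dec (+ p ∣ t) → f t ≡ 0ℚ ⊎ (quotient′ {p} (+ p ∣? t) ∈ [± n ] × quotient′ {p} (+ p ∣? t) ℤ.* + p ≡ t × f t ≡ F (quotient′ {p} (+ p ∣? t) ℤ.* + p))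
        go (no ¬d) = inj₁ (δ-no-* (+ p ∣? t) (F t) ¬d)
        go (yes (divides q refl)) with ∣ q ∣ ℕₚ.≤? n
        ... | yes q≤n = inj₂ (subst (_∈ [± n ]) (sym (quotient-* q)) (∈-[±]⁺ n q≤n) , cong (ℤ._* + p) (quotient-* q) ,
                              trans (f-* q) (cong (λ z → F (z ℤ.* + p)) (sym (quotient-* q))))
        ... | no q≰n  = inj₁ (trans (f-* q) (outside q q≰n))

    square-grows : ∀ {n q} → + n ℤ.< q ℤ.* q → + (p ℕ.* (p ℕ.* n)) ℤ.< q ℤ.* + p ℤ.* (q ℤ.* + p)
    square-grows {n} {q} n<q² = subst₂ ℤ._<_ (sym (trans (ℤₚ.pos-* p (p ℕ.* n)) (trans (cong (+ p ℤ.*_) (ℤₚ.pos-* p n)) (sym (ℤₚ.*-assoc (+ p) (+ p) (+ n)))))) (e (+ p) q)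
        (ℤₚ.*-monoˡ-<-pos (+ p ℤ.* + p) {{ℤ.positive (BinaryQuadraticForms.0<* 0<p 0<p)}} n<q²)
      where
      0<p : 0ℤ ℤ.< + p
      0<p = ℤ.+<+ (ℕₚ.n≢0⇒n>0 (ℕ.≢-nonZero⁻¹ p {{prime⇒nonZero pp}}))
      e : ∀ p q → p ℤ.* p ℤ.* (q ℤ.* q) ≡ q ℤ.* p ℤ.* (q ℤ.* p)
      e = ℤRing.solve-∀

    -- Descent: p divides t, and division by p² lowers the odd exponent by 2 until a square
    -- divisible by p would have to equal p itself.
    ¬square : ∀ e t → t ℤ.* t ≢ + (p ℕ.^ suc (e ℕ.+ e))
    ¬square e t eq with euclid-sq pp t (divides (+ (p ℕ.^ (e ℕ.+ e))) (trans eq (trans (ℤₚ.pos-* p (p ℕ.^ (e ℕ.+ e))) (ℤₚ.*-comm (+ p) (+ (p ℕ.^ (e ℕ.+ e)))))))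
    ... | divides q refl = descend e (ℤₚ.*-cancelˡ-≡ (+ p) (+ p ℤ.* (q ℤ.* q)) (+ (p ℕ.^ (e ℕ.+ e))) (trans (f (+ p) q) (trans eq (ℤₚ.pos-* p (p ℕ.^ (e ℕ.+ e))))))
      where
      f : ∀ p q → p ℤ.* (p ℤ.* (q ℤ.* q)) ≡ q ℤ.* p ℤ.* (q ℤ.* p)
      f = ℤRing.solve-∀
      descend : ∀ e → + p ℤ.* (q ℤ.* q) ≢ + (p ℕ.^ (e ℕ.+ e))
      descend zero eq′ = p∤1 pp (divides (q ℤ.* q) (trans (sym eq′) (ℤₚ.*-comm (+ p) (q ℤ.* q))))
      descend (suc e) eq′ = ¬square e q (ℤₚ.*-cancelˡ-≡ (+ p) (q ℤ.* q) (+ (p ℕ.^ suc (e ℕ.+ e)))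
        (trans eq′ (trans (cong (λ k → + (p ℕ.^ suc k)) (ℕₚ.+-suc e e)) (ℤₚ.pos-* p (p ℕ.^ suc (e ℕ.+ e))))))

  odd-class≢0 : ∀ {m} → m ≡ 1 ⊎ m ≡ 3 → ∀ {t} → + 4 ∣ t ℤ.- + m → t ≢ 0ℤ
  odd-class≢0 (inj₁ refl) d refl with ∣-small {4} (s≤s (s≤s z≤n)) d
  ... | ()
  odd-class≢0 (inj₂ refl) d refl with ∣-small {4} (s≤s (s≤s (s≤s (s≤s z≤n)))) d
  ... | ()

  odd-class-square : ∀ {m} → m ≡ 1 ⊎ m ≡ 3 → ∀ {t} → + 4 ∣ t ℤ.- + m → + 4 ∣ t ℤ.* t ℤ.- 1ℤ
  odd-class-square (inj₁ refl) {t} d = ∣-lin₁ (t ℤ.+ 1ℤ) d (e t)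
    where
    e : ∀ t → (t ℤ.+ 1ℤ) ℤ.* (t ℤ.- 1ℤ) ≡ t ℤ.* t ℤ.- 1ℤ
    e = ℤRing.solve-∀
  odd-class-square (inj₂ refl) {t} d = ∣-≡ (e t) (∣m∣n⇒∣m+n (∣n⇒∣m*n (t ℤ.+ + 3) d) (divides (+ 2) refl))
    where
    e : ∀ t → (t ℤ.+ + 3) ℤ.* (t ℤ.- + 3) ℤ.+ + 8 ≡ t ℤ.* t ℤ.- 1ℤ
    e = ℤRing.solve-∀

  module _ {p : ℕ} (pp : Prime p) (3≤p : 3 ℕ.≤ p) (c : ℕ) {{c≢0 : NonZero c}} (c≤2 : c ≡ 1 ⊎ c ≡ 2)
           {m : ℕ} (m-odd : m ≡ 1 ⊎ m ≡ 3) {p̄ : ℤ} (inv : + 4 ∣ + p ℤ.* p̄ ℤ.- 1ℤ) where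

    private
      b : ℕ
      b = c ℕ.* c
      odd : ¬ + p ∣ + 2
      odd = ≥3⇒odd 3≤p
      χ : ℤ
      χ = jacobi -1ℤ m
      χ-sign : IsSign χ
      χ-sign = proj₁ (m-sign m-odd)
      χ-mod4 : + 4 ∣ + m ℤ.- χ
      χ-mod4 = proj₂ (m-sign m-odd)
      instance
        p≢0 : NonZero p
        p≢0 = prime⇒nonZero pp
        b≢0 : NonZero b
        b≢0 = ℕₚ.m*n≢0 c c
      b∣p²-1 : + b ∣ + p ℤ.* + p ℤ.- 1ℤ
      b∣p²-1 = ∣-trans (divisor c≤2) (p²≡1[8] pp 3≤p)
        where
        divisor : c ≡ 1 ⊎ c ≡ 2 → + b ∣ + 8
        divisor (inj₁ refl) = divides (+ 8) refl
        divisor (inj₂ refl) = divides (+ 2) refl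

    F : ℕ → ℕ → ℤ → ℚ
    F κ r t = δ (t ≡? + m [mod 4 ]) * (h (+ m) 4 b (p ℕ.^ r) t * ι (t ℤ.^ suc (double κ)))

    𝓗-split : ∀ κ r → 𝓗 (suc (double κ)) (+ m) 4 b p r ≡ moment pp 3≤p c c≤2 m-odd inv (+ m) κ (p ℕ.^ r) - ∑ [± p ℕ.^ r ] (λ t → δ (+ p ∣? t) * F κ r t)
    𝓗-split κ r = begin
      𝓗 k (+ m) 4 b p r
        ≡⟨ Σ±≡∑ (p ℕ.^ r) g ⟩
      ∑ [± p ℕ.^ r ] g
        ≡⟨ ∑-cong [± p ℕ.^ r ] (λ {t} _ → trans (cong (λ z → z * δ (t ≡? + m [mod 4 ]) * (h (+ m) 4 b (p ℕ.^ r) t * ι (t ℤ.^ k))) (δ-¬ (+ p ∣? t)))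
             (e (δ (+ p ∣? t)) (δ (t ≡? + m [mod 4 ])) (h (+ m) 4 b (p ℕ.^ r) t * ι (t ℤ.^ k)))) ⟩
      ∑ [± p ℕ.^ r ] (λ t → F κ r t - δ (+ p ∣? t) * F κ r t)
        ≡⟨ ∑-- [± p ℕ.^ r ] (F κ r) (λ t → δ (+ p ∣? t) * F κ r t) ⟩
      moment pp 3≤p c c≤2 m-odd inv (+ m) κ (p ℕ.^ r) - ∑ [± p ℕ.^ r ] (λ t → δ (+ p ∣? t) * F κ r t)
        ∎
      where
      k = suc (double κ)
      g : ℤ → ℚ
      g t = δ (¬? (+ p ∣? t)) * δ (t ≡? + m [mod 4 ]) * (h (+ m) 4 b (p ℕ.^ r) t * ι (t ℤ.^ k))
      e : ∀ d d′ x → (1ℚ - d) * d′ * x ≡ d′ * x - d * (d′ * x)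
      e = RS.solve-∀ ringℚ

    square-excess : ∀ {κ r t} → + (p ℕ.^ r) ℤ.< t ℤ.* t → F κ r t ≡ 0ℚ
    square-excess {κ} {r} {t} N<t² = trans (cong (λ z → δ (t ≡? + m [mod 4 ]) * (z * ι (t ℤ.^ suc (double κ)))) (H-negative b negative))
        (e (δ (t ≡? + m [mod 4 ])) (ι (t ℤ.^ suc (double κ))))
      where
      negative : + (p ℕ.^ r) ℤ.- t ℤ.* t ℤ.< 0ℤ
      negative = subst (+ (p ℕ.^ r) ℤ.- t ℤ.* t ℤ.<_) (ℤₚ.+-inverseʳ (t ℤ.* t)) (ℤₚ.+-monoˡ-< (ℤ.- (t ℤ.* t)) N<t²)
      e : ∀ x y → x * (0ℚ * y) ≡ 0ℚ
      e = RS.solve-∀ ringℚ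

    -- The term subtracted last in the formula. It is the contribution of H(0), from t² = pʳ.
    boundary : ℕ → ℕ → ℚ
    boundary κ r = δ (2 ℕ∣.∣? r) * (+ 1 / 12) * ι (+ (p ℕ.^ (r ℕ.* suc (double κ) ℕ./ 2))) * ι (+ p ℤ.- 1ℤ) * ι χ * ι (ε p r)

    -- The terms with t² = pʳ, where t = pq.
    boundary-sum : ∀ κ s → ∑ [± p ℕ.^ s ] (λ q → δ (q ≡? + m ℤ.* p̄ [mod 4 ]) * (δ (q ℤ.* q ℤₚ.≟ + (p ℕ.^ s)) * (+ 1 / 12 * ι (+ p ℤ.- 1ℤ) * ι ((q ℤ.* + p) ℤ.^ suc (double κ)))))
      ≡ boundary κ (suc (suc s))
    boundary-sum κ s with parity pp 3≤p s
    ... | e , inj₂ refl = trans (∑-zero [± p ℕ.^ s ] λ {q} _ → δ*-zero (q ≡? + m ℤ.* p̄ [mod 4 ]) λ _ → δ-no-* (q ℤ.* q ℤₚ.≟ + (p ℕ.^ s)) _ (¬square pp e q))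
        (sym (trans (cong (λ z → z * (+ 1 / 12) * ι (+ (p ℕ.^ (r ℕ.* suc (double κ) ℕ./ 2))) * ι (+ p ℤ.- 1ℤ) * ι χ * ι (ε p r)) (δ-no (2 ℕ∣.∣? r) odd-index))
          (zero-* (+ 1 / 12) (ι (+ (p ℕ.^ (r ℕ.* suc (double κ) ℕ./ 2)))) (ι (+ p ℤ.- 1ℤ)) (ι χ) (ι (ε p r)))))
      where
      r = suc (suc s)
      zero-* : ∀ a b c d f → 0ℚ * a * b * c * d * f ≡ 0ℚ
      zero-* = RS.solve-∀ ringℚ
      odd-index : ¬ 2 ℕ∣.∣ r
      odd-index 2∣r with ℕ∣.∣m+n∣m⇒∣n {2} {suc e ℕ.+ suc e} {1} (subst (2 ℕ∣.∣_) (r≡ e) 2∣r) (ℕ∣.divides (suc e) (double-comm (suc e)))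
        where
        r≡ : ∀ e → suc (suc (suc (e ℕ.+ e))) ≡ suc e ℕ.+ suc e ℕ.+ 1
        r≡ = ℕRing.solve-∀
        double-comm : ∀ e → e ℕ.+ e ≡ e ℕ.* 2
        double-comm = ℕRing.solve-∀
      ... | 2∣1 = contradiction (ℕ∣.∣⇒≤ 2∣1) λ { (s≤s ()) }
    ... | e , inj₁ refl = begin
      ∑ [± p ℕ.^ s ] (λ q → δ (q ≡? + m ℤ.* p̄ [mod 4 ]) * (δ (q ℤ.* q ℤₚ.≟ + (p ℕ.^ s)) * G q))
        ≡⟨ ∑-cong [± p ℕ.^ s ] (λ {q} _ → trans (sym (ℚₚ.*-assoc (δ (q ≡? + m ℤ.* p̄ [mod 4 ])) (δ (q ℤ.* q ℤₚ.≟ + (p ℕ.^ s))) (G q))) (cong (_* G q) (only q))) ⟩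
      ∑ [± p ℕ.^ s ] (λ q → δ (q ℤₚ.≟ q₀) * G q)
        ≡⟨ ∑-δ G (ℤₚ._≟ q₀) ([±]-unique (p ℕ.^ s)) (∈-[±]⁺ (p ℕ.^ s) (square≡⇒≤ {q₀} q₀²)) ⟩
      + 1 / 12 * ι (+ p ℤ.- 1ℤ) * ι ((q₀ ℤ.* + p) ℤ.^ k)
        ≡⟨ cong (+ 1 / 12 * ι (+ p ℤ.- 1ℤ) *_) (trans (cong ι q₀p^k) (trans (ι-* (χ ℤ.* ε′) (+ (p ℕ.^ (suc e ℕ.* k)))) (cong (_* ι (+ (p ℕ.^ (suc e ℕ.* k)))) (ι-* χ ε′)))) ⟩
      + 1 / 12 * ι (+ p ℤ.- 1ℤ) * (ι χ * ι ε′ * ι (+ (p ℕ.^ (suc e ℕ.* k))))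
        ≡⟨ rearrange (+ 1 / 12) (ι (+ p ℤ.- 1ℤ)) (ι χ) (ι ε′) (ι (+ (p ℕ.^ (suc e ℕ.* k)))) ⟩
      1ℚ * (+ 1 / 12) * ι (+ (p ℕ.^ (suc e ℕ.* k))) * ι (+ p ℤ.- 1ℤ) * ι χ * ι ε′
        ≡⟨ cong₂ (λ x y → x * (+ 1 / 12) * ι (+ (p ℕ.^ y)) * ι (+ p ℤ.- 1ℤ) * ι χ * ι ε′) (sym (δ-yes (2 ℕ∣.∣? r) (ℕ∣.divides (suc e) (r≡ e))))
             (sym (trans (cong (ℕ._/ 2) (trans (cong (ℕ._* k) (r≡ e)) (swap₂ (suc e) k))) (ℕ÷.m*n/n≡m (suc e ℕ.* k) 2))) ⟩
      δ (2 ℕ∣.∣? r) * (+ 1 / 12) * ι (+ (p ℕ.^ (r ℕ.* k ℕ./ 2))) * ι (+ p ℤ.- 1ℤ) * ι χ * ι ε′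
        ≡⟨ cong (λ y → δ (2 ℕ∣.∣? r) * (+ 1 / 12) * ι (+ (p ℕ.^ (r ℕ.* k ℕ./ 2))) * ι (+ p ℤ.- 1ℤ) * ι χ * ι (jacobi -1ℤ (p ℕ.^ y)))
             (sym (trans (cong (ℕ._/ 2) (r≡ e)) (ℕ÷.m*n/n≡m (suc e) 2))) ⟩
      boundary κ r
        ∎
      where
      k = suc (double κ)
      r = suc (suc s)
      G : ℤ → ℚ
      G q = + 1 / 12 * ι (+ p ℤ.- 1ℤ) * ι ((q ℤ.* + p) ℤ.^ k)
      ε′ = jacobi -1ℤ (p ℕ.^ suc e)
      ε-sign : IsSign ε′
      ε-sign = jacobi[-1]-sign pp 3≤p (suc e)
      ε-mod4 : + 4 ∣ + (p ℕ.^ suc e) ℤ.- ε′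
      ε-mod4 = jacobi[-1]-mod4 pp 3≤p (suc e)
      P = + (p ℕ.^ e)
      -- Of the two roots ±p^e exactly one lies in the class m p̄. Its sign is χ ε′, because then q₀
      -- p = χ ε′ p^(e+1), and p^(e+1) ≡ ε′ and χ ≡ m modulo 4 give q₀ p ≡ m.
      q₀ = χ ℤ.* ε′ ℤ.* P
      sign² : χ ℤ.* ε′ ℤ.* (χ ℤ.* ε′) ≡ 1ℤ
      sign² = sign-square (sign-* χ-sign ε-sign)
      r≡ : ∀ e → suc (suc (e ℕ.+ e)) ≡ suc e ℕ.* 2
      r≡ = ℕRing.solve-∀
      swap₂ : ∀ e k → e ℕ.* 2 ℕ.* k ≡ e ℕ.* k ℕ.* 2
      swap₂ = ℕRing.solve-∀
      rearrange : ∀ a b c d f → a * b * (c * d * f) ≡ 1ℚ * a * f * b * c * d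
      rearrange = RS.solve-∀ ringℚ
      q₀² : q₀ ℤ.* q₀ ≡ + (p ℕ.^ s)
      q₀² = trans (e₁ (χ ℤ.* ε′) P) (trans (cong (ℤ._* (P ℤ.* P)) sign²) (trans (ℤₚ.*-identityˡ (P ℤ.* P))
        (trans (sym (ℤₚ.pos-* (p ℕ.^ e) (p ℕ.^ e))) (cong +_ (sym (ℕₚ.^-distribˡ-+-* p e e))))))
        where
        e₁ : ∀ x P → x ℤ.* P ℤ.* (x ℤ.* P) ≡ x ℤ.* x ℤ.* (P ℤ.* P)
        e₁ = ℤRing.solve-∀
      q₀p : q₀ ℤ.* + p ≡ χ ℤ.* ε′ ℤ.* + (p ℕ.^ suc e)
      q₀p = trans (ℤₚ.*-assoc (χ ℤ.* ε′) P (+ p)) (cong (χ ℤ.* ε′ ℤ.*_) (trans (ℤₚ.*-comm P (+ p)) (sym (ℤₚ.pos-* p (p ℕ.^ e)))))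
      q₀p≡m : + 4 ∣ + p ℤ.* q₀ ℤ.- + m
      q₀p≡m = ∣-≡ (trans (e₁ χ ε′ (+ (p ℕ.^ suc e)) (+ m)) (trans (cong (λ z → χ ℤ.* ε′ ℤ.* + (p ℕ.^ suc e) ℤ.- χ ℤ.* z ℤ.+ (χ ℤ.- + m)) (sign-square ε-sign))
          (trans (e₂ (χ ℤ.* ε′ ℤ.* + (p ℕ.^ suc e)) χ (+ m)) (cong (ℤ._- + m) (trans (sym q₀p) (ℤₚ.*-comm q₀ (+ p)))))))
        (∣m∣n⇒∣m-n (∣n⇒∣m*n (χ ℤ.* ε′) ε-mod4) χ-mod4)
        where
        e₁ : ∀ χ ε P m → χ ℤ.* ε ℤ.* (P ℤ.- ε) ℤ.- (m ℤ.- χ) ≡ χ ℤ.* ε ℤ.* P ℤ.- χ ℤ.* (ε ℤ.* ε) ℤ.+ (χ ℤ.- m)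
        e₁ = ℤRing.solve-∀
        e₂ : ∀ x χ m → x ℤ.- χ ℤ.* 1ℤ ℤ.+ (χ ℤ.- m) ≡ x ℤ.- m
        e₂ = ℤRing.solve-∀
      -- The exponent k is odd, so the sign χ ε′ survives in the k-th power; it accounts for the two
      -- symbols in the last term.
      sign-k : ∀ {x} → IsSign x → ∀ κ → x ℤ.^ suc (double κ) ≡ x
      sign-k {x} sx κ = trans (cong (λ j → x ℤ.^ suc j) (double≡ κ)) (sign-odd κ sx)
      pow-* : ∀ x y n → (x ℤ.* y) ℤ.^ n ≡ x ℤ.^ n ℤ.* y ℤ.^ n
      pow-* x y zero    = refl
      pow-* x y (suc n) = trans (cong (x ℤ.* y ℤ.*_) (pow-* x y n)) (e₀ x y (x ℤ.^ n) (y ℤ.^ n))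
        where
        e₀ : ∀ x y a b → x ℤ.* y ℤ.* (a ℤ.* b) ≡ x ℤ.* a ℤ.* (y ℤ.* b)
        e₀ = ℤRing.solve-∀
      q₀p^k : (q₀ ℤ.* + p) ℤ.^ k ≡ χ ℤ.* ε′ ℤ.* + (p ℕ.^ (suc e ℕ.* k))
      q₀p^k = trans (cong (ℤ._^ k) q₀p) (trans (pow-* (χ ℤ.* ε′) (+ (p ℕ.^ suc e)) k)
        (cong₂ ℤ._*_ (sign-k (sign-* χ-sign ε-sign) κ) (trans (sym (pos-^ (p ℕ.^ suc e) k)) (cong +_ (ℕₚ.^-*-assoc p (suc e) k)))))
      -- The classes m and -m differ modulo 4 because m is odd, which rules out the root -q₀.
      2m≢0 : ¬ + 4 ∣ + m ℤ.- (ℤ.- + m)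
      2m≢0 d = different χ-sign (sign-mod4 χ-sign (sign-neg χ-sign) (∣-≡ (e₁ (+ m) χ) (∣m∣n⇒∣m-n d (∣m∣n⇒∣m+n χ-mod4 χ-mod4))))
        where
        e₁ : ∀ m χ → m ℤ.- (ℤ.- m) ℤ.- (m ℤ.- χ ℤ.+ (m ℤ.- χ)) ≡ χ ℤ.- (ℤ.- χ)
        e₁ = ℤRing.solve-∀
        sign-neg : ∀ {x} → IsSign x → IsSign (ℤ.- x)
        sign-neg (inj₁ refl) = inj₂ refl
        sign-neg (inj₂ refl) = inj₁ refl
        different : ∀ {x} → IsSign x → x ≢ ℤ.- x
        different (inj₁ refl) ()
        different (inj₂ refl) ()
      roots : ∀ q → q ℤ.* q ≡ + (p ℕ.^ s) → q ≡ q₀ ⊎ q ≡ ℤ.- q₀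
      roots q eq = Sum.map (ℤₚ.i-j≡0⇒i≡j q q₀) (λ z → ℤₚ.i-j≡0⇒i≡j q (ℤ.- q₀) (trans (cong (λ w → q ℤ.+ w) (ℤₚ.neg-involutive q₀)) z))
        (ℤₚ.i*j≡0⇒i≡0∨j≡0 (q ℤ.- q₀) (trans (e₁ q q₀) (trans (cong₂ ℤ._-_ eq q₀²) (ℤₚ.+-inverseʳ (+ (p ℕ.^ s))))))
        where
        e₁ : ∀ q r → (q ℤ.- r) ℤ.* (q ℤ.+ r) ≡ q ℤ.* q ℤ.- r ℤ.* r
        e₁ = ℤRing.solve-∀
      only : ∀ q → δ (q ≡? + m ℤ.* p̄ [mod 4 ]) * δ (q ℤ.* q ℤₚ.≟ + (p ℕ.^ s)) ≡ δ (q ℤₚ.≟ q₀)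
      only q = go (q ≡? + m ℤ.* p̄ [mod 4 ]) (q ℤ.* q ℤₚ.≟ + (p ℕ.^ s))
        where
        go : (C : Dec (q ≡ + m ℤ.* p̄ [mod 4 ])) (S : Dec (q ℤ.* q ≡ + (p ℕ.^ s))) → δ C * δ S ≡ δ (q ℤₚ.≟ q₀)
        go (no ¬C) S = trans (ℚₚ.*-zeroˡ (δ S)) (sym (δ-no (q ℤₚ.≟ q₀) λ { refl → ¬C (divide-class {p} {p̄} inv (+ m) q₀ q₀p≡m) }))
        go (yes C) (no ¬S) = sym (δ-no (q ℤₚ.≟ q₀) λ { refl → ¬S q₀² })
        go (yes C) (yes S) = in-class C (roots q S)
          where
          in-class : q ≡ + m ℤ.* p̄ [mod 4 ] → q ≡ q₀ ⊎ q ≡ ℤ.- q₀ → 1ℚ ≡ δ (q ℤₚ.≟ q₀)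
          in-class _ (inj₁ q≡) = sym (δ-yes (q ℤₚ.≟ q₀) q≡)
          in-class C (inj₂ q≡) = contradiction (∣-≡ (trans (cong (λ z → ℤ.- ((+ p ℤ.* q₀ ℤ.- + m) ℤ.+ (+ p ℤ.* z ℤ.- + m))) q≡) (e₁ (+ p) q₀ (+ m)))
                  (∣m⇒∣-m (∣m∣n⇒∣m+n q₀p≡m (multiply-class {p} {p̄} inv (+ m) q C)))) 2m≢0
            where
            e₁ : ∀ p q m → ℤ.- ((p ℤ.* q ℤ.- m) ℤ.+ (p ℤ.* ℤ.- q ℤ.- m)) ≡ m ℤ.- (ℤ.- m)
            e₁ = ℤRing.solve-∀

    -- With t = pq, `H-p²` contributes a factor p and t^k a factor p^k, so the moment at p^(r-2) in
    -- the class m p̄ appears with p^(k+1); its defect at q² = p^(r-2) adds up to `boundary`. For r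
    -- = 1 a multiple of p in the class of m is nonzero, hence t² ≥ p² > p and H vanishes.
    divisible-terms : ∀ κ r → 1 ℕ.≤ r → ∑ [± p ℕ.^ r ] (λ t → δ (+ p ∣? t) * F κ r t)
      ≡ ι ((+ p) ℤ.^ suc (suc (double κ))) * moment[p^r-2] pp 3≤p c c≤2 m-odd inv κ r + boundary κ r
    divisible-terms κ (suc zero) _ = trans (∑-zero [± p ℕ.^ 1 ] λ {t} _ → δ*-zero (+ p ∣? t) (vanish t))
        (sym (trans (cong (λ z → Q * 0ℚ + z * (+ 1 / 12) * R * ι (+ p ℤ.- 1ℤ) * ι χ * ι (ε p 1)) (δ-no (2 ℕ∣.∣? 1) λ 2∣1 → contradiction (ℕ∣.∣⇒≤ 2∣1) λ { (s≤s ()) }))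
          (zero-* Q (+ 1 / 12) R (ι (+ p ℤ.- 1ℤ)) (ι χ) (ι (ε p 1)))))
      where
      Q = ι ((+ p) ℤ.^ suc (suc (double κ)))
      R = ι (+ (p ℕ.^ (1 ℕ.* suc (double κ) ℕ./ 2)))
      zero-* : ∀ q a b c d f → q * 0ℚ + 0ℚ * a * b * c * d * f ≡ 0ℚ
      zero-* = RS.solve-∀ ringℚ
      vanish : ∀ t → + p ∣ t → F κ 1 t ≡ 0ℚ
      vanish t (divides q refl) = δ*-zero (q ℤ.* + p ≡? + m [mod 4 ]) λ t≡m → excess (λ q≡0 → odd-class≢0 m-odd t≡m (cong (ℤ._* + p) q≡0))
        where
        large : q ≢ 0ℤ → + (p ℕ.^ 1) ℤ.< q ℤ.* + p ℤ.* (q ℤ.* + p)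
        large q≢0 = ℤₚ.<-≤-trans (ℤ.+<+ p<p²) (bound (0<⇒1≤ (0<sq q≢0)))
          where
          p<p² : p ℕ.* 1 ℕ.< p ℕ.* p
          p<p² = ℕₚ.*-monoʳ-< p (ℕₚ.<-≤-trans (s≤s (s≤s z≤n)) 3≤p)
          e : ∀ p q → p ℤ.* p ℤ.* (q ℤ.* q) ≡ q ℤ.* p ℤ.* (q ℤ.* p)
          e = ℤRing.solve-∀
          bound : 1ℤ ℤ.≤ q ℤ.* q → + (p ℕ.* p) ℤ.≤ q ℤ.* + p ℤ.* (q ℤ.* + p)
          bound 1≤q² = subst₂ ℤ._≤_ (trans (ℤₚ.*-identityʳ (+ (p ℕ.* p))) refl) (trans (cong (ℤ._* (q ℤ.* q)) (ℤₚ.pos-* p p)) (e (+ p) q))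
            (ℤₚ.*-monoˡ-≤-nonNeg (+ (p ℕ.* p)) 1≤q²)
        excess : q ≢ 0ℤ → h (+ m) 4 b (p ℕ.^ 1) (q ℤ.* + p) * ι ((q ℤ.* + p) ℤ.^ suc (double κ)) ≡ 0ℚ
        excess q≢0 = trans (cong (_* ι ((q ℤ.* + p) ℤ.^ suc (double κ))) (H-negative b (subst (+ (p ℕ.^ 1) ℤ.- t² ℤ.<_) (ℤₚ.+-inverseʳ t²) (ℤₚ.+-monoˡ-< (ℤ.- t²) (large q≢0)))))
            (ℚₚ.*-zeroˡ (ι ((q ℤ.* + p) ℤ.^ suc (double κ))))
          where
          t² = q ℤ.* + p ℤ.* (q ℤ.* + p)
    divisible-terms κ r@(suc (suc s)) _ = begin
      ∑ [± p ℕ.^ r ] (λ t → δ (+ p ∣? t) * F κ r t)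
        ≡⟨ ∑-multiples pp {p ℕ.^ r} {p ℕ.^ s} (F κ r) outside (ℕₚ.m≤n*m (p ℕ.* p ℕ.^ s) p) ⟩
      ∑ [± p ℕ.^ s ] (λ q → F κ r (q ℤ.* + p))
        ≡⟨ ∑-cong [± p ℕ.^ s ] (λ {q} _ → per-q q) ⟩
      ∑ [± p ℕ.^ s ] (λ q → Q * M q + E q)
        ≡⟨ ∑-+ [± p ℕ.^ s ] (λ q → Q * M q) E ⟩
      ∑ [± p ℕ.^ s ] (λ q → Q * M q) + ∑ [± p ℕ.^ s ] E
        ≡⟨ cong₂ _+_ (∑-*ˡ Q [± p ℕ.^ s ] M) (boundary-sum κ s) ⟩
      Q * moment[p^r-2] pp 3≤p c c≤2 m-odd inv κ r + boundary κ r
        ∎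
      where
      k = suc (double κ)
      Q = ι ((+ p) ℤ.^ suc k)
      M E : ℤ → ℚ
      M q = δ (q ≡? + m ℤ.* p̄ [mod 4 ]) * (h (+ m ℤ.* p̄) 4 b (p ℕ.^ s) q * ι (q ℤ.^ k))
      E q = δ (q ≡? + m ℤ.* p̄ [mod 4 ]) * (δ (q ℤ.* q ℤₚ.≟ + (p ℕ.^ s)) * (+ 1 / 12 * ι (+ p ℤ.- 1ℤ) * ι ((q ℤ.* + p) ℤ.^ k)))
      outside : ∀ q → ¬ ∣ q ∣ ℕ.≤ p ℕ.^ s → F κ r (q ℤ.* + p) ≡ 0ℚ
      outside q q≰ = square-excess {κ} {r} {q ℤ.* + p} (square-grows pp {p ℕ.^ s} {q} (subst (+ (p ℕ.^ s) ℤ.<_) (sym (square-abs q))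
        (ℤ.+<+ (ℕₚ.<-≤-trans (ℕₚ.≰⇒> q≰) (m≤m*m ∣ q ∣)))))
      pow-* : ∀ x y n → (x ℤ.* y) ℤ.^ n ≡ x ℤ.^ n ℤ.* y ℤ.^ n
      pow-* x y zero    = refl
      pow-* x y (suc n) = trans (cong (x ℤ.* y ℤ.*_) (pow-* x y n)) (e₀ x y (x ℤ.^ n) (y ℤ.^ n))
        where
        e₀ : ∀ x y a b → x ℤ.* y ℤ.* (a ℤ.* b) ≡ x ℤ.* a ℤ.* (y ℤ.* b)
        e₀ = ℤRing.solve-∀
      per-q : ∀ q → F κ r (q ℤ.* + p) ≡ Q * M q + E q
      per-q q = trans (cong (_* (h (+ m) 4 b (p ℕ.^ r) (q ℤ.* + p) * ι ((q ℤ.* + p) ℤ.^ k)))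
            (δ-cong (q ℤ.* + p ≡? + m [mod 4 ]) C? (λ d → divide-class {p} {p̄} inv (+ m) q (∣-≡ (cong (ℤ._- + m) (ℤₚ.*-comm q (+ p))) d))
              λ d → ∣-≡ (cong (ℤ._- + m) (ℤₚ.*-comm (+ p) q)) (multiply-class {p} {p̄} inv (+ m) q d)))
          (trans (δ*-cong C? value) (trans (e₁ (δ C?) (ι (+ p)) (h (+ m ℤ.* p̄) 4 b (p ℕ.^ s) q) (ι (q ℤ.^ k)) (ι ((+ p) ℤ.^ k)) D (+ 1 / 12 * ι (+ p ℤ.- 1ℤ)) (ι ((q ℤ.* + p) ℤ.^ k)))
            (cong (λ z → z * M q + E q) (sym (ι-* (+ p) ((+ p) ℤ.^ k))))))
        where
        C? = q ≡? + m ℤ.* p̄ [mod 4 ]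
        D = δ (q ℤ.* q ℤₚ.≟ + (p ℕ.^ s))
        value : q ≡ + m ℤ.* p̄ [mod 4 ] → h (+ m) 4 b (p ℕ.^ r) (q ℤ.* + p) * ι ((q ℤ.* + p) ℤ.^ k)
          ≡ (ι (+ p) * h (+ m ℤ.* p̄) 4 b (p ℕ.^ s) q) * (ι (q ℤ.^ k) * ι ((+ p) ℤ.^ k)) + D * (+ 1 / 12 * ι (+ p ℤ.- 1ℤ)) * ι ((q ℤ.* + p) ℤ.^ k)
        value C = trans (cong (_* ι ((q ℤ.* + p) ℤ.^ k)) (H-p² pp odd c b∣p²-1 s q q≢0))
            (trans (ℚₚ.*-distribʳ-+ (ι ((q ℤ.* + p) ℤ.^ k)) (ι (+ p) * h (+ m ℤ.* p̄) 4 b (p ℕ.^ s) q) (D * (+ 1 / 12 * ι (+ p ℤ.- 1ℤ))))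
              (cong (λ z → (ι (+ p) * h (+ m ℤ.* p̄) 4 b (p ℕ.^ s) q) * z + D * (+ 1 / 12 * ι (+ p ℤ.- 1ℤ)) * ι ((q ℤ.* + p) ℤ.^ k))
                (trans (cong ι (pow-* q (+ p) k)) (ι-* (q ℤ.^ k) ((+ p) ℤ.^ k)))))
          where
          q≢0 : q ≢ 0ℤ
          q≢0 refl = odd-class≢0 m-odd (multiply-class {p} {p̄} inv (+ m) 0ℤ C) (ℤₚ.*-zeroʳ (+ p))
        e₁ : ∀ d p h x y D K z → d * ((p * h) * (x * y) + D * K * z) ≡ p * y * (d * (h * x)) + d * (D * (K * z))
        e₁ = RS.solve-∀ ringℚ

open import Data.Integer.Base as ℤ using (ℤ; +_; 1ℤ; -1ℤ)
open import Data.Nat.Base as ℕ using (ℕ; NonZero; _∸_)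
open import Data.Nat.Divisibility using (_∣?_)
open import Data.Nat.Primality using (Prime)
open import Data.Product.Base using (_×_)
open import Data.Rational.Base using (ℚ; 0ℚ; ½; _+_; _*_; _-_; _/_)
open import Data.Sum.Base using (_⊎_)
open import Relation.Binary.PropositionalEquality using (_≡_)

-- The two cases of the formula

module Conclusion where

  open import Data.Integer.Divisibility.Signed using (∣m∣n⇒∣m-n) renaming (_∣?_ to _∣?ℤ_)
  import Data.Integer.Tactic.RingSolver as ℤRing
  open import Data.Nat.Base using (zero; suc)
  import Data.Nat.DivMod as ℕ÷
  open import Data.Product.Base using (∃-syntax; _,_)
  import Data.Rational.Properties as ℚₚ
  open import Data.Sum.Base using (inj₁; inj₂)
  open import Relation.Binary.PropositionalEquality hiding (J)
  import Tactic.RingSolver as RS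
  open Assembly
  open BracketPolynomials using (double)
  open DivisibleTerms
  open FiniteSums
  open HurwitzValues using (H-vanishes)
  open PrimeModulus using (∣-≡)
  open Rationals
  open ≡-Reasoning

  odd-number : ∀ k → k ℕ.% 2 ≡ 1 → ∃[ κ ] (k ≡ suc (double κ))
  odd-number (suc zero)    _  = 0 , refl
  odd-number (suc (suc k)) eq = let (κ , k≡) = odd-number k eq in suc κ , cong (λ j → suc (suc j)) k≡

  double/2 : ∀ κ → double κ ℕ./ 2 ≡ κ
  double/2 κ = trans (cong (ℕ._/ 2) (double≡2* κ)) (ℕ÷.m*n/n≡m κ 2)
    where
    double≡2* : ∀ κ → double κ ≡ κ ℕ.* 2
    double≡2* zero    = refl
    double≡2* (suc κ) = cong (λ j → suc (suc j)) (double≡2* κ)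

  square-factor : ∀ {b} → b ≡ 1 ⊎ b ≡ 4 → ∃[ c ] (b ≡ c ℕ.* c × (c ≡ 1 ⊎ c ≡ 2))
  square-factor (inj₁ refl) = 1 , refl , inj₁ refl
  square-factor (inj₂ refl) = 2 , refl , inj₂ refl

  module _ {p : ℕ} (pp : Prime p) (3≤p : 3 ℕ.≤ p) {m : ℕ} (m-odd : m ≡ 1 ⊎ m ≡ 3) {p̄ : ℤ} (inv : + p ℤ.* p̄ ≡ 1ℤ [mod 4 ]) where

    -- 𝓗 is the full moment minus the terms with p ∣ t, that is, minus p^(k+1) times the lower
    -- moment and minus `boundary`. `α-sum` expresses the same difference of moments by the α, up to
    -- the contribution of the trivial solutions, which is subtracted again.
    case-1 : ∀ κ c {{c≢0 : NonZero c}} .{{b≢0 : NonZero (c ℕ.* c)}} (c≤2 : c ≡ 1 ⊎ c ≡ 2) r → 1 ℕ.≤ r → + (p ℕ.^ r) ≡ 1ℤ [mod 4 ] →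
      let k = suc (double κ) ; b = c ℕ.* c in
      𝓗 k (+ m) 4 b p r ≡
        (Σ[0⋯ double κ ℕ./ 2 ] λ μ →
          ½ ^ (2 ℕ.* μ) * T k μ
            * (α (k ∸ 2 ℕ.* μ) (+ m) 4 b (p ℕ.^ r)
                - ι (+ (p ℕ.^ (k ∸ 2 ℕ.* μ ℕ.+ 1))) * α[p^r-2] (k ∸ 2 ℕ.* μ) (+ m ℤ.* p̄) 4 b p r)
            * ι (+ (p ℕ.^ (r ℕ.* μ))))
        - (b ^-½) * ι (jacobi -1ℤ m) * ι (jacobi (+ 2) (p ℕ.^ r)) * ½ ^ (k ℕ.+ 1)
            * (Σ[0⋯ double κ ℕ./ 2 ] λ μ → T k μ * ι (+ (p ℕ.^ (r ℕ.* μ))))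
        - δ (2 ∣? r) * (+ 1 / 12) * ι (+ (p ℕ.^ (r ℕ.* k ℕ./ 2))) * ι (+ p ℤ.- 1ℤ)
            * ι (jacobi -1ℤ m) * ι (ε p r)
    case-1 κ c c≤2 r 1≤r n≡1 = begin
      𝓗 k (+ m) 4 b p r
        ≡⟨ 𝓗-split pp 3≤p c c≤2 m-odd inv κ r ⟩
      S - ∑ [± p ℕ.^ r ] (λ t → δ (+ p ∣?ℤ t) * F pp 3≤p c c≤2 m-odd inv κ r t)
        ≡⟨ cong (λ z → S - z) (divisible-terms pp 3≤p c c≤2 m-odd inv κ r 1≤r) ⟩
      S - (Q * S′ + E)
        ≡⟨ e S Q S′ E (B * ι (χ ℤ.* J) * h) (B * ι χ * ι J * h) t (cong (_* h) (trans (cong (B *_) (ι-* χ J)) (sym (ℚₚ.*-assoc B (ι χ) (ι J))))) ⟩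
      (S - Q * S′ + B * ι (χ ℤ.* J) * h * t) - B * ι χ * ι J * h * t - E
        ≡⟨ cong (λ z → z - B * ι χ * ι J * h * t - E) (α-sum pp 3≤p c c≤2 m-odd inv κ r 1≤r n≡1) ⟨
      Σ[0⋯ κ ] f - B * ι χ * ι J * h * Σ[0⋯ κ ] g - E
        ≡⟨ cong (λ N → Σ[0⋯ N ] f - B * ι χ * ι J * h * Σ[0⋯ N ] g - E) (sym (double/2 κ)) ⟩
      Σ[0⋯ double κ ℕ./ 2 ] f - B * ι χ * ι J * h * Σ[0⋯ double κ ℕ./ 2 ] g - E
        ∎
      where
      k = suc (double κ)
      b = c ℕ.* c
      χ = jacobi -1ℤ m
      J = jacobi (+ 2) (p ℕ.^ r)
      B = b ^-½
      h = ½ ^ (k ℕ.+ 1)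
      Q = ι ((+ p) ℤ.^ suc k)
      S = moment pp 3≤p c c≤2 m-odd inv (+ m) κ (p ℕ.^ r)
      S′ = moment[p^r-2] pp 3≤p c c≤2 m-odd inv κ r
      E = boundary pp 3≤p c c≤2 m-odd inv κ r
      f g : ℕ → ℚ
      f μ = ½ ^ (2 ℕ.* μ) * T k μ
        * (α (k ∸ 2 ℕ.* μ) (+ m) 4 b (p ℕ.^ r) - ι (+ (p ℕ.^ (k ∸ 2 ℕ.* μ ℕ.+ 1))) * α[p^r-2] (k ∸ 2 ℕ.* μ) (+ m ℤ.* p̄) 4 b p r)
        * ι (+ (p ℕ.^ (r ℕ.* μ)))
      g μ = T k μ * ι (+ (p ℕ.^ (r ℕ.* μ)))
      t = Σ[0⋯ κ ] g
      e : ∀ S Q S′ E X Y t → X ≡ Y → S - (Q * S′ + E) ≡ (S - Q * S′ + X * t) - Y * t - E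
      e S Q S′ E X _ t refl = e′ S Q S′ E X t
        where
        e′ : ∀ S Q S′ E X t → S - (Q * S′ + E) ≡ (S - Q * S′ + X * t) - X * t - E
        e′ = RS.solve-∀ ringℚ

    case-3 : ∀ k b .{{_ : NonZero b}} → b ≡ 1 ⊎ b ≡ 4 → ∀ r → + (p ℕ.^ r) ≡ + 3 [mod 4 ] → 𝓗 k (+ m) 4 b p r ≡ 0ℚ
    case-3 k b b14 r n≡3 = trans (Σ±≡∑ (p ℕ.^ r) f) (∑-zero [± p ℕ.^ r ] λ {t} _ → trans (ℚₚ.*-assoc (δ (¬? (+ p ∣?ℤ t))) (δ (t ≡? + m [mod 4 ])) (H′ t * ι (t ℤ.^ k)))
        (trans (cong (δ (¬? (+ p ∣?ℤ t)) *_) (δ*-zero (t ≡? + m [mod 4 ]) λ t≡m → trans (cong (_* ι (t ℤ.^ k)) (H-vanishes b b14 (+ (p ℕ.^ r) ℤ.- t ℤ.* t)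
          (∣-≡ (e (+ (p ℕ.^ r)) (t ℤ.* t)) (∣m∣n⇒∣m-n n≡3 (odd-class-square m-odd {t} t≡m))))) (ℚₚ.*-zeroˡ (ι (t ℤ.^ k)))))
          (ℚₚ.*-zeroʳ (δ (¬? (+ p ∣?ℤ t))))))
      where
      open import Relation.Nullary.Decidable using (¬?)
      H′ : ℤ → ℚ
      H′ t = H ((+ (p ℕ.^ r) ℤ.- t ℤ.* t) / b)
      f : ℤ → ℚ
      f t = δ (¬? (+ p ∣?ℤ t)) * δ (t ≡? + m [mod 4 ]) * (H′ t * ι (t ℤ.^ k))
      e : ∀ N t → N ℤ.- + 3 ℤ.- (t ℤ.- 1ℤ) ≡ N ℤ.- t ℤ.- + 2
      e = ℤRing.solve-∀

  conclusion : ∀ {k b p m p̄} .{{_ : NonZero b}} → ∃[ κ ] (k ≡ suc (double κ)) → ∃[ c ] (b ≡ c ℕ.* c × (c ≡ 1 ⊎ c ≡ 2)) → b ≡ 1 ⊎ b ≡ 4 → Prime p → 3 ℕ.≤ p → m ≡ 1 ⊎ m ≡ 3 →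
    + p ℤ.* p̄ ≡ 1ℤ [mod 4 ] → ∀ r → 1 ℕ.≤ r →
    ( + (p ℕ.^ r) ≡ 1ℤ [mod 4 ] →
    𝓗 k (+ m) 4 b p r ≡
    (Σ[0⋯ (k ∸ 1) ℕ./ 2 ] λ μ →
    ½ ^ (2 ℕ.* μ) * T k μ
    * (α (k ∸ 2 ℕ.* μ) (+ m) 4 b (p ℕ.^ r)
    - ι (+ (p ℕ.^ (k ∸ 2 ℕ.* μ ℕ.+ 1))) * α[p^r-2] (k ∸ 2 ℕ.* μ) (+ m ℤ.* p̄) 4 b p r)
    * ι (+ (p ℕ.^ (r ℕ.* μ))))
    - (b ^-½) * ι (jacobi -1ℤ m) * ι (jacobi (+ 2) (p ℕ.^ r)) * ½ ^ (k ℕ.+ 1)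
    * (Σ[0⋯ (k ∸ 1) ℕ./ 2 ] λ μ → T k μ * ι (+ (p ℕ.^ (r ℕ.* μ))))
    - δ (2 ∣? r) * (+ 1 / 12) * ι (+ (p ℕ.^ (r ℕ.* k ℕ./ 2))) * ι (+ p ℤ.- 1ℤ)
    * ι (jacobi -1ℤ m) * ι (ε p r) )
    × ( + (p ℕ.^ r) ≡ + 3 [mod 4 ] → 𝓗 k (+ m) 4 b p r ≡ 0ℚ )
  conclusion (κ , refl) (c , refl , c≤2) b14 pp 3≤p m-odd inv r 1≤r =
    case-1 pp 3≤p m-odd inv κ c {{c≢0 c≤2}} c≤2 r 1≤r , case-3 pp 3≤p m-odd inv (suc (double κ)) (c ℕ.* c) b14 r
    where
    c≢0 : ∀ {c} → c ≡ 1 ⊎ c ≡ 2 → NonZero c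
    c≢0 (inj₁ refl) = _
    c≢0 (inj₂ refl) = _

open Conclusion

theorem5p8 : (k m b p r : ℕ) (p̄ : ℤ) .{{_ : NonZero b}} →
    1 ℕ.≤ k → k ℕ.% 2 ≡ 1 →
    m ≡ 1 ⊎ m ≡ 3 →
    b ≡ 1 ⊎ b ≡ 4 →
    Prime p → 3 ℕ.≤ p →
    1 ℕ.≤ r →
    + p ℤ.* p̄ ≡ 1ℤ [mod 4 ] →
    ( + (p ℕ.^ r) ≡ 1ℤ [mod 4 ] →
    𝓗 k (+ m) 4 b p r ≡
    (Σ[0⋯ (k ∸ 1) ℕ./ 2 ] λ μ →
    ½ ^ (2 ℕ.* μ) * T k μ
    * (α (k ∸ 2 ℕ.* μ) (+ m) 4 b (p ℕ.^ r)
    - ι (+ (p ℕ.^ (k ∸ 2 ℕ.* μ ℕ.+ 1))) * α[p^r-2] (k ∸ 2 ℕ.* μ) (+ m ℤ.* p̄) 4 b p r)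
    * ι (+ (p ℕ.^ (r ℕ.* μ))))
    - (b ^-½) * ι (jacobi -1ℤ m) * ι (jacobi (+ 2) (p ℕ.^ r)) * ½ ^ (k ℕ.+ 1)
    * (Σ[0⋯ (k ∸ 1) ℕ./ 2 ] λ μ → T k μ * ι (+ (p ℕ.^ (r ℕ.* μ))))
    - δ (2 ∣? r) * (+ 1 / 12) * ι (+ (p ℕ.^ (r ℕ.* k ℕ./ 2))) * ι (+ p ℤ.- 1ℤ)
    * ι (jacobi -1ℤ m) * ι (ε p r) )
    × ( + (p ℕ.^ r) ≡ + 3 [mod 4 ] → 𝓗 k (+ m) 4 b p r ≡ 0ℚ )
theorem5p8 k m b p r p̄ 1≤k k-odd m-odd b14 pp 3≤p 1≤r inv = conclusion (odd-number k k-odd) (square-factor b14) b14 pp 3≤p m-odd inv r 1≤r
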